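{- Let $\ell$ be an odd prime with $\ell\equiv\pm1\pmod5$ and put $D=\mathbb Z[1/\ell]$. Let $t=2+20\nu^2$, where $\nu$ is an integer with $\nu\equiv4\pmod{27}$ all of whose prime factors are congruent to $\pm1\pmod{20}$. Let $$A=\begin{pmatrix}t-5&\tfrac23(5\nu-2)\\ 6(5\nu+2)&5\end{pmatrix}\in\operatorname{SL}_2(D).$$ Then the image of $A$ is a commutator in every finite quotient of $\operatorname{SL}_2(D)$, but $A$ is not a commutator in $\operatorname{SL}_2(D)$. Consequently, there are infinitely many groups $\operatorname{SL}_2(\mathbb Z[1/\ell])$ ($\ell$ prime) each containing infinitely many elements that are commutators in every finite quotient but not commutators in the group.
   Context: An element $Z$ of a group is a commutator if $Z=XYX^{ -1}Y^{ -1}$ for some $X,Y$ in the group. -}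

module Defs where

open import Data.Nat as ℕ using (ℕ; _^_; _%_)
open import Data.Nat.Divisibility using (_∣_)
open import Data.Integer as ℤ using (ℤ; +_)
open import Data.Rational using (ℚ; ↧ₙ_; _+_; _*_; _-_; -_; 0ℚ; 1ℚ; _/_)
open import Data.Product using (Σ; ∃; ∃-syntax; _×_; _,_)
open import Data.List using (List)
open import Data.List.Membership.Propositional using (_∈_)
open import Relation.Binary.PropositionalEquality using (_≡_)

-- The ring D = ℤ[1/ℓ], realised as the subring of ℚ of rationals whose
-- (reduced) denominator divides some power of ℓ.

InD : ℕ → ℚ → Set
InD ℓ q = ∃[ k ] (↧ₙ q) ∣ (ℓ ^ k)

record Mat : Set where
  constructor mat
  field
    a b c d : ℚ
open Mat public

_·_ : Mat → Mat → Mat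
mat a₁ b₁ c₁ d₁ · mat a₂ b₂ c₂ d₂ =
  mat (a₁ * a₂ + b₁ * c₂) (a₁ * b₂ + b₁ * d₂)
      (c₁ * a₂ + d₁ * c₂) (c₁ * b₂ + d₁ * d₂)

I₂ : Mat
I₂ = mat 1ℚ 0ℚ 0ℚ 1ℚ

det : Mat → ℚ
det (mat a b c d) = a * d - b * c

-- inverse of a determinant-one matrix (adjugate)
inv : Mat → Mat
inv (mat a b c d) = mat d (- b) (- c) a

InSL2 : ℕ → Mat → Set
InSL2 ℓ M = InD ℓ (a M) × InD ℓ (b M) × InD ℓ (c M) × InD ℓ (d M) × det M ≡ 1ℚ

comm : Mat → Mat → Mat
comm X Y = ((X · Y) · inv X) · inv Y

IsCommutator : ℕ → Mat → Set
IsCommutator ℓ Z = ∃[ X ] ∃[ Y ] (InSL2 ℓ X × InSL2 ℓ Y × Z ≡ comm X Y)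

record IsFiniteIndexNormal (ℓ : ℕ) (N : Mat → Set) : Set₁ where
  field
    ⊆G      : ∀ M → N M → InSL2 ℓ M
    has-I   : N I₂
    ·-closed : ∀ M M′ → N M → N M′ → N (M · M′)
    inv-closed : ∀ M → N M → N (inv M)
    normal  : ∀ g M → InSL2 ℓ g → N M → N ((g · M) · inv g)
    reps    : List Mat
    reps⊆G  : ∀ g → g ∈ reps → InSL2 ℓ g
    covers  : ∀ x → InSL2 ℓ x → ∃[ g ] (g ∈ reps × N (inv g · x))

IsCommutatorMod : ℕ → (Mat → Set) → Mat → Set
IsCommutatorMod ℓ N Z =
  ∃[ X ] ∃[ Y ] (InSL2 ℓ X × InSL2 ℓ Y × N (inv (comm X Y) · Z))

CommutatorInEveryFiniteQuotient : ℕ → Mat → Set₁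
CommutatorInEveryFiniteQuotient ℓ Z =
  ∀ (N : Mat → Set) → IsFiniteIndexNormal ℓ N → IsCommutatorMod ℓ N Z

ℤ→ℚ : ℤ → ℚ
ℤ→ℚ z = z / 1

matA : ℤ → Mat
matA ν = mat (ℤ→ℚ (t ℤ.- + 5)) ((+ 2 / 3) * ℤ→ℚ (+ 5 ℤ.* ν ℤ.- + 2))
             (ℤ→ℚ (+ 6 ℤ.* (+ 5 ℤ.* ν ℤ.+ + 2))) 5ℚ
  where
  t : ℤ
  t = + 2 ℤ.+ + 20 ℤ.* (ν ℤ.* ν)
  5ℚ : ℚ
  5ℚ = + 5 / 1

{-# OPTIONS --safe #-}
-- For finite quotients: let N be normal of finite index. The elementary matrices over D of some level M lie in N,
-- where ℓ^a = 1 + M. Units u of D with u ≡ 1 mod M make g e₁₂(x) g⁻¹ congruent to e₂₁(-xc²) e₁₂(xr²) modulo N whenever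
-- u = 1 - xrc for the first column (r, c) of g. Choosing x with 1 - xrc a power of ℓ yields, modulo N, that e₁₂(a) and
-- e₂₁(b) commute if q ∣ ab for q a suitable power of M, so that the quotient splits over the primes dividing q, and that
-- small integers prime to p have Weyl elements acting as they should on the p-component. Since the units modulo p^k are
-- generated by such small integers, each component satisfies the relations of SL₂(ℤ/p^k); hence N contains every product
-- of integral elementary matrices that is ≡ 1 mod q. It remains to solve A = [X, Y] modulo powers of 2, of 3, and modulo
-- integers prime to 6, which is done by explicit matrices and Hensel's lemma.
--
-- For the group itself: the traces x, y, z of X, Y, XY satisfy x² + y² + z² - xyz = 4 + 20ν², so
-- (x² - 4)(y² - 4) = (2z - xy)² - 80ν². Thus 5 is a square modulo the odd primes dividing x² - 4 (apart from ℓ and those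
-- dividing ν), and all of them are 0 or ±1 modulo 5. Together with congruences modulo 8 this forces x, y, z ≡ ±2 mod 5,
-- and then 25 ∣ 20ν², a contradiction.
module Submission where

module GroupWords where
  open import Algebra.Bundles using (Group)
  open import Data.List using (List; []; _∷_; _++_)
  open import Level using (0ℓ)
  import Algebra.Properties.Group

  module Rewriting (𝔾 : Group 0ℓ 0ℓ) where
    open Group 𝔾 public using (Carrier; _≈_; _∙_; ε; _⁻¹; refl; sym; trans; assoc; identityˡ; identityʳ; inverseˡ; inverseʳ; ∙-congˡ; ∙-congʳ; ∙-cong; ⁻¹-cong; setoid; reflexive)
    open Algebra.Properties.Group 𝔾 public using (∙-cancelˡ; ∙-cancelʳ; ⁻¹-involutive)
    open import Relation.Binary.Reasoning.Setoid setoid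

    ⟦_⟧ : List Carrier → Carrier
    ⟦ [] ⟧ = ε
    ⟦ g ∷ gs ⟧ = g ∙ ⟦ gs ⟧

    ⟦⟧-++ : ∀ ks ls → ⟦ ks ++ ls ⟧ ≈ ⟦ ks ⟧ ∙ ⟦ ls ⟧
    ⟦⟧-++ [] ls = sym (identityˡ _)
    ⟦⟧-++ (k ∷ ks) ls = trans (∙-congˡ (⟦⟧-++ ks ls)) (sym (assoc _ _ _))

    -- A record, so that the two lists can be inferred from a proof.
    infix 4 _≋_
    record _≋_ (ks ls : List Carrier) : Set where
      constructor eq
      field value : ⟦ ks ⟧ ≈ ⟦ ls ⟧
    open _≋_ public

    rfl : ∀ {ks} → ks ≋ ks
    rfl = eq refl

    flip : ∀ {ks ls} → ks ≋ ls → ls ≋ ks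
    flip (eq p) = eq (sym p)

    infixl 3 _⟫_
    _⟫_ : ∀ {ks ls ms} → ks ≋ ls → ls ≋ ms → ks ≋ ms
    eq p ⟫ eq r = eq (trans p r)

    at : ∀ ks {ls ms} → ls ≋ ms → ∀ {ns} → ks ++ (ls ++ ns) ≋ ks ++ (ms ++ ns)
    at [] {ls} {ms} (eq p) {ns} = eq (begin
      ⟦ ls ++ ns ⟧   ≈⟨ ⟦⟧-++ ls ns ⟩
      ⟦ ls ⟧ ∙ ⟦ ns ⟧ ≈⟨ ∙-congʳ p ⟩
      ⟦ ms ⟧ ∙ ⟦ ns ⟧ ≈⟨ ⟦⟧-++ ms ns ⟨
      ⟦ ms ++ ns ⟧ ∎)
    at (k ∷ ks) p = eq (∙-congˡ (value (at ks p)))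

    letter : ∀ {g h} → g ≈ h → g ∷ [] ≋ h ∷ []
    letter p = eq (∙-congʳ p)

    unletter : ∀ {g h} → g ∷ [] ≋ h ∷ [] → g ≈ h
    unletter (eq p) = trans (sym (identityʳ _)) (trans p (identityʳ _))

    pack : ∀ ks → ks ≋ ⟦ ks ⟧ ∷ []
    pack ks = eq (sym (identityʳ _))

    invʳ : ∀ {g} → g ∷ g ⁻¹ ∷ [] ≋ []
    invʳ = eq (trans (∙-congˡ (identityʳ _)) (inverseʳ _))

    invˡ : ∀ {g} → g ⁻¹ ∷ g ∷ [] ≋ []
    invˡ = eq (trans (∙-congˡ (identityʳ _)) (inverseˡ _))

    cancelˡ : ∀ g {ks ls} → g ∷ ks ≋ g ∷ ls → ks ≋ ls
    cancelˡ g (eq p) = eq (∙-cancelˡ g _ _ p)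

    cancelʳ : ∀ ks ls ms → ks ++ ms ≋ ls ++ ms → ks ≋ ls
    cancelʳ ks ls ms (eq p) = eq (∙-cancelʳ ⟦ ms ⟧ _ _ (trans (sym (⟦⟧-++ ks ms)) (trans p (⟦⟧-++ ls ms))))

    -- Moving a letter to the other side of a relation.
    moveˡ : ∀ g {ks ls} → g ∷ ks ≋ ls → ks ≋ g ⁻¹ ∷ ls
    moveˡ g {ks} {ls} (eq p) = eq (begin
      ⟦ ks ⟧                ≈⟨ identityˡ _ ⟨
      ε ∙ ⟦ ks ⟧            ≈⟨ ∙-congʳ (inverseˡ g) ⟨
      g ⁻¹ ∙ g ∙ ⟦ ks ⟧     ≈⟨ assoc _ _ _ ⟩
      g ⁻¹ ∙ (g ∙ ⟦ ks ⟧)   ≈⟨ ∙-congˡ p ⟩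
      g ⁻¹ ∙ ⟦ ls ⟧ ∎)

    inv-letter : ∀ {g h} → g ∷ [] ≋ h ∷ [] → g ⁻¹ ∷ [] ≋ h ⁻¹ ∷ []
    inv-letter p = letter (⁻¹-cong (unletter p))

module ElementaryRelations where
  open GroupWords
  open import Algebra.Bundles using (Group)
  open import Data.List using ([]; _∷_)
  open import Data.Integer using (ℤ; +_; _+_; _*_; _-_; -_; 0ℤ; 1ℤ)
  open import Data.Integer.Divisibility.Signed using (_∣_; divides; ∣m∣n⇒∣m+n; ∣n⇒∣m*n)
  open import Data.Integer.Tactic.RingSolver using (solve)
  open import Data.Product using (_×_; _,_; proj₁)
  open import Level using (0ℓ)
  open import Relation.Binary.PropositionalEquality as ≡ using (_≡_)

  infixl 6 _⊕_
  infixr 7 _⊛_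

  _⊛_ : ∀ {Q h} c → Q ∣ h → Q ∣ c * h
  c ⊛ d = ∣n⇒∣m*n c d

  _⊕_ : ∀ {Q h k} → Q ∣ h → Q ∣ k → Q ∣ h + k
  _⊕_ = ∣m∣n⇒∣m+n

  by : ∀ {Q e h} → Q ∣ h → e ≡ h → Q ∣ e
  by {Q} d p = ≡.subst (Q ∣_) (≡.sym p) d

  -- Two one-parameter families x, y of a group that behave like the elementary matrices
  -- e₁₂(a), e₂₁(a) over ℤ/Q, the Weyl element x(1) y(-1) x(1) included.
  module Weyl (𝔾 : Group 0ℓ 0ℓ) (x y : ℤ → Group.Carrier 𝔾) where
    open Rewriting 𝔾

    W : ℤ → ℤ → Carrier
    W u u' = ⟦ x u ∷ y (- u') ∷ x u ∷ [] ⟧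

    record Good (u u' : ℤ) : Set where
      field
        good-x : ∀ a → W u u' ∷ x a ∷ [] ≋ y (- (u' * u' * a)) ∷ W u u' ∷ []
        good-y : ∀ a → W u u' ∷ y a ∷ [] ≋ x (- (u * u * a)) ∷ W u u' ∷ []
    open Good public

  record Elementary (Q : ℤ) (𝔾 : Group 0ℓ 0ℓ) (x y : ℤ → Group.Carrier 𝔾) : Set where
    open Group 𝔾 using (_≈_; _∙_)
    open Weyl 𝔾 x y
    field
      x-cong : ∀ {a b} → Q ∣ a - b → x a ≈ x b
      y-cong : ∀ {a b} → Q ∣ a - b → y a ≈ y b
      x-homo : ∀ a b → x (a + b) ≈ x a ∙ x b
      y-homo : ∀ a b → y (a + b) ≈ y a ∙ y b
      good₁  : Good 1ℤ 1ℤ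

  module Local {Q : ℤ} {𝔾 : Group 0ℓ 0ℓ} {x y : ℤ → Group.Carrier 𝔾} (el : Elementary Q 𝔾 x y) where
    open Rewriting 𝔾 public
    open Weyl 𝔾 x y public
    open Elementary el public

    Unit : ℤ → ℤ → Set
    Unit u u' = Q ∣ u * u' - 1ℤ

    xs : ∀ b {a} → Q ∣ a - b → x a ∷ [] ≋ x b ∷ []
    xs b d = letter (x-cong d)

    ys : ∀ b {a} → Q ∣ a - b → y a ∷ [] ≋ y b ∷ []
    ys b d = letter (y-cong d)

    self : ∀ {a b} → a ≡ b → Q ∣ a - b
    self {a} ≡.refl = divides 0ℤ (solve (a ∷ Q ∷ []))

    same : ∀ a → Q ∣ a - a
    same a = self (≡.refl {x = a})

    self₀ : ∀ {a} → a ≡ 0ℤ → Q ∣ a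
    self₀ ≡.refl = divides 0ℤ (solve (Q ∷ []))

    xx : ∀ {a b} → x a ∷ x b ∷ [] ≋ x (a + b) ∷ []
    xx = eq (trans (∙-congˡ (identityʳ _)) (trans (sym (x-homo _ _)) (sym (identityʳ _))))

    yy : ∀ {a b} → y a ∷ y b ∷ [] ≋ y (a + b) ∷ []
    yy = eq (trans (∙-congˡ (identityʳ _)) (trans (sym (y-homo _ _)) (sym (identityʳ _))))

    x-sum : ∀ a b c → Q ∣ a + b - c → x a ∷ x b ∷ [] ≋ x c ∷ []
    x-sum a b c d = xx ⟫ xs c d

    y-sum : ∀ a b c → Q ∣ a + b - c → y a ∷ y b ∷ [] ≋ y c ∷ []
    y-sum a b c d = yy ⟫ ys c d

    x-zero : ∀ {a} → Q ∣ a → x a ∷ [] ≋ []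
    x-zero {a} d = cancelˡ (x a) (x-sum a a a (by (1ℤ ⊛ d) (solve (a ∷ []))))

    y-zero : ∀ {a} → Q ∣ a → y a ∷ [] ≋ []
    y-zero {a} d = cancelˡ (y a) (y-sum a a a (by (1ℤ ⊛ d) (solve (a ∷ []))))

    x-cancel : ∀ {a b} → Q ∣ a + b → x a ∷ x b ∷ [] ≋ []
    x-cancel d = xx ⟫ x-zero d

    y-cancel : ∀ {a b} → Q ∣ a + b → y a ∷ y b ∷ [] ≋ []
    y-cancel d = yy ⟫ y-zero d

    opp : ∀ a → Q ∣ a + - a
    opp a = divides 0ℤ (solve (a ∷ Q ∷ []))

    opp′ : ∀ a → Q ∣ - a + a
    opp′ a = divides 0ℤ (solve (a ∷ Q ∷ []))

    W-def : ∀ u u' → W u u' ∷ [] ≋ x u ∷ y (- u') ∷ x u ∷ []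
    W-def u u' = flip (pack _)

    W-cong : ∀ u u' v v' → Q ∣ u - v → Q ∣ u' - v' → W u u' ∷ [] ≋ W v v' ∷ []
    W-cong u u' v v' d d' = W-def u u' ⟫ at [] (xs v d)
      ⟫ at (_ ∷ []) (ys (- v') { - u'} (by ((- 1ℤ) ⊛ d') (solve (u' ∷ v' ∷ [])))) ⟫ at (_ ∷ _ ∷ []) (xs v d) ⟫ pack _

    W⁻¹ : ∀ u u' → W u u' ⁻¹ ∷ [] ≋ x (- u) ∷ y u' ∷ x (- u) ∷ []
    W⁻¹ u u' = flip (moveˡ (W u u') (at [] (W-def u u') ⟫ at (_ ∷ _ ∷ []) (x-cancel (opp u))
       ⟫ at (_ ∷ []) (y-cancel (opp′ u')) ⟫ x-cancel (opp u)))

    W-neg : ∀ u u' → W (- u) (- u') ∷ [] ≋ W u u' ⁻¹ ∷ []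
    W-neg u u' = W-def _ _ ⟫ at (_ ∷ []) (ys u' { - - u'} (self₀ (solve (u' ∷ [])))) ⟫ flip (W⁻¹ u u')

    module _ {u u'} (U : Unit u u') (G : Good u u') where
      private w = W u u'

      Wx : ∀ a b → Q ∣ b + u' * u' * a → w ∷ x a ∷ [] ≋ y b ∷ w ∷ []
      Wx a b d = good-x G a ⟫ at [] (ys b { - (u' * u' * a)} (by ((- 1ℤ) ⊛ d) (solve (u' ∷ a ∷ b ∷ []))))

      Wy : ∀ a b → Q ∣ b + u * u * a → w ∷ y a ∷ [] ≋ x b ∷ w ∷ []
      Wy a b d = good-y G a ⟫ at [] (xs b { - (u * u * a)} (by ((- 1ℤ) ⊛ d) (solve (u ∷ a ∷ b ∷ []))))

      private
        turn : ∀ a b → Q ∣ b + u' * u' * a → Q ∣ a + u * u * b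
        turn a b d = by ((u * u) ⊛ d ⊕ (- a * (u * u' + 1ℤ)) ⊛ U) (solve (a ∷ b ∷ u ∷ u' ∷ []))

        turn′ : ∀ a b → Q ∣ b + u * u * a → Q ∣ a + u' * u' * b
        turn′ a b d = by ((u' * u') ⊛ d ⊕ (- a * (u * u' + 1ℤ)) ⊛ U) (solve (a ∷ b ∷ u ∷ u' ∷ []))

      xW : ∀ a b → Q ∣ b + u' * u' * a → x a ∷ w ∷ [] ≋ w ∷ y b ∷ []
      xW a b d = flip (Wy b a (turn a b d))

      yW : ∀ a b → Q ∣ b + u * u * a → y a ∷ w ∷ [] ≋ w ∷ x b ∷ []
      yW a b d = flip (Wx b a (turn′ a b d))

      W⁻¹x : ∀ a b → Q ∣ b + u' * u' * a → w ⁻¹ ∷ x a ∷ [] ≋ y b ∷ w ⁻¹ ∷ []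
      W⁻¹x a b d = flip (moveˡ w (at [] (flip (xW a b d)) ⟫ at (_ ∷ []) invʳ))

      W⁻¹y : ∀ a b → Q ∣ b + u * u * a → w ⁻¹ ∷ y a ∷ [] ≋ x b ∷ w ⁻¹ ∷ []
      W⁻¹y a b d = flip (moveˡ w (at [] (flip (yW a b d)) ⟫ at (_ ∷ []) invʳ))

      xW⁻¹ : ∀ a b → Q ∣ b + u' * u' * a → x a ∷ w ⁻¹ ∷ [] ≋ w ⁻¹ ∷ y b ∷ []
      xW⁻¹ a b d = moveˡ w (at [] (Wx a b d) ⟫ at (_ ∷ []) invʳ)

      yW⁻¹ : ∀ a b → Q ∣ b + u * u * a → y a ∷ w ⁻¹ ∷ [] ≋ w ⁻¹ ∷ x b ∷ []
      yW⁻¹ a b d = moveˡ w (at [] (Wy a b d) ⟫ at (_ ∷ []) invʳ)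

      -- Conjugating w by itself exchanges the roles of x and y in its definition.
      W-dual : w ∷ [] ≋ y (- u') ∷ x u ∷ y (- u') ∷ []
      W-dual = flip (at (_ ∷ []) invʳ) ⟫ at (_ ∷ []) (W-def u u') ⟫ at [] (Wx u (- u') (by (u' ⊛ U) (solve (u ∷ u' ∷ []))))
        ⟫ at (_ ∷ []) (Wy (- u') u (by ((- u) ⊛ U) (solve (u ∷ u' ∷ []))))
        ⟫ at (_ ∷ _ ∷ []) (Wx u (- u') (by (u' ⊛ U) (solve (u ∷ u' ∷ [])))) ⟫ at (_ ∷ _ ∷ _ ∷ []) invʳ

      x-split : x u ∷ [] ≋ y u' ∷ w ∷ y u' ∷ []
      x-split = flip (at (_ ∷ []) W-dual ⟫ at [] (y-cancel (opp u')) ⟫ at (_ ∷ []) (y-cancel (opp′ u')))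

    y-split : ∀ u u' → y u' ∷ [] ≋ x u ∷ W u u' ⁻¹ ∷ x u ∷ []
    y-split u u' = flip (at (_ ∷ []) (W⁻¹ u u') ⟫ at [] (x-cancel (opp u)) ⟫ at (_ ∷ []) (x-cancel (opp′ u)))

    -- If w = y(-u') x(u) y(-u') acts on x, y as a Weyl element should, then w is W u u'.
    weyl-recognition : ∀ {u u' w} → Unit u u' → w ∷ [] ≋ y (- u') ∷ x u ∷ y (- u') ∷ [] →
      (∀ a b → Q ∣ b + u' * u' * a → w ∷ x a ∷ [] ≋ y b ∷ w ∷ []) →
      (∀ a b → Q ∣ b + u * u * a → w ∷ y a ∷ [] ≋ x b ∷ w ∷ []) →
      w ∷ [] ≋ W u u' ∷ [] × Good u u'
    weyl-recognition {u} {u'} {w} U def wx wy = w≋W , record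
      { good-x = λ a → at [] (flip w≋W) ⟫ wx a (- (u' * u' * a)) (opp′ (u' * u' * a)) ⟫ at (_ ∷ []) w≋W
      ; good-y = λ a → at [] (flip w≋W) ⟫ wy a (- (u * u * a)) (opp′ (u * u * a)) ⟫ at (_ ∷ []) w≋W }
      where
      w≋W : w ∷ [] ≋ W u u' ∷ []
      w≋W = flip (at (_ ∷ []) invʳ) ⟫ at (_ ∷ []) def ⟫ at [] (wy (- u') u (by ((- u) ⊛ U) (solve (u ∷ u' ∷ []))))
        ⟫ at (_ ∷ []) (wx u (- u') (by (u' ⊛ U) (solve (u ∷ u' ∷ []))))
        ⟫ at (_ ∷ _ ∷ []) (wy (- u') u (by ((- u) ⊛ U) (solve (u ∷ u' ∷ [])))) ⟫ at (_ ∷ _ ∷ _ ∷ []) invʳ ⟫ pack _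

    record Acts (h : Carrier) (λ₁ λ₂ : ℤ) : Set where
      field
        unit : Unit λ₁ λ₂
        on-x : ∀ a b → Q ∣ b - λ₁ * a → h ∷ x a ∷ [] ≋ x b ∷ h ∷ []
        on-y : ∀ a b → Q ∣ b - λ₂ * a → h ∷ y a ∷ [] ≋ y b ∷ h ∷ []
    open Acts public

    ratio-acts : ∀ {u u' v v'} → Unit u u' → Good u u' → Unit v v' → Good v v' →
      Acts ⟦ W v v' ∷ W u u' ⁻¹ ∷ [] ⟧ (v * u' * (v * u')) (v' * u * (v' * u))
    ratio-acts {u} {u'} {v} {v'} U Gu V Gv = record
      { unit = by (((u * u' * v * v' + 1ℤ) * (u * u')) ⊛ V ⊕ (u * u' * v * v' + 1ℤ) ⊛ U) (solve (u ∷ u' ∷ v ∷ v' ∷ []))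
      ; on-x = λ a b d → at [] (flip (pack (W v v' ∷ W u u' ⁻¹ ∷ []))) ⟫ at (_ ∷ []) (W⁻¹x U Gu a (- (u' * u' * a)) (opp′ (u' * u' * a)))
          ⟫ at [] (Wy V Gv (- (u' * u' * a)) b (by (1ℤ ⊛ d) (solve (a ∷ b ∷ u' ∷ v ∷ [])))) ⟫ at (_ ∷ []) (pack _)
      ; on-y = λ a b d → at [] (flip (pack (W v v' ∷ W u u' ⁻¹ ∷ []))) ⟫ at (_ ∷ []) (W⁻¹y U Gu a (- (u * u * a)) (opp′ (u * u * a)))
          ⟫ at [] (Wx V Gv (- (u * u * a)) b (by (1ℤ ⊛ d) (solve (a ∷ b ∷ u ∷ v' ∷ [])))) ⟫ at (_ ∷ []) (pack _) }

    acts-⁻¹ : ∀ {h λ₁ λ₂} → Acts h λ₁ λ₂ → Acts (h ⁻¹) λ₂ λ₁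
    acts-⁻¹ {h} {l} {l'} A = record
      { unit = by (1ℤ ⊛ (unit A)) (solve (l ∷ l' ∷ []))
      ; on-x = λ a b d → flip (moveˡ h (at [] (on-x A b a (by ((- l) ⊛ d ⊕ (- a) ⊛ (unit A)) (solve (a ∷ b ∷ l ∷ l' ∷ [])))) ⟫ at (_ ∷ []) invʳ))
      ; on-y = λ a b d → flip (moveˡ h (at [] (on-y A b a (by ((- l') ⊛ d ⊕ (- a) ⊛ (unit A)) (solve (a ∷ b ∷ l ∷ l' ∷ [])))) ⟫ at (_ ∷ []) invʳ)) }

    acts-weyl : ∀ {h λ₁ λ₂ u u'} → Acts h λ₁ λ₂ → Good u u' →
      h ∷ W u u' ∷ [] ≋ W (λ₁ * u) (λ₂ * u') ∷ h ∷ [] × Good (λ₁ * u) (λ₂ * u')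
    acts-weyl {h} {l} {l'} {u} {u'} A G = conj , record
      { good-x = λ a → at [] (flip conj′) ⟫ at (_ ∷ _ ∷ []) (on-x (acts-⁻¹ A) a (l' * a) (same (l' * a)))
          ⟫ at (_ ∷ []) (good-x G (l' * a)) ⟫ at [] (on-y A (- (u' * u' * (l' * a))) (- (l' * u' * (l' * u') * a)) (self₀ (solve (l' ∷ u' ∷ a ∷ []))))
          ⟫ at (_ ∷ []) conj′
      ; good-y = λ a → at [] (flip conj′) ⟫ at (_ ∷ _ ∷ []) (on-y (acts-⁻¹ A) a (l * a) (same (l * a)))
          ⟫ at (_ ∷ []) (good-y G (l * a)) ⟫ at [] (on-x A (- (u * u * (l * a))) (- (l * u * (l * u) * a)) (self₀ (solve (l ∷ u ∷ a ∷ []))))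
          ⟫ at (_ ∷ []) conj′ }
      where
      conj : h ∷ W u u' ∷ [] ≋ W (l * u) (l' * u') ∷ h ∷ []
      conj = at (_ ∷ []) (W-def u u') ⟫ at [] (on-x A u (l * u) (same (l * u))) ⟫ at (_ ∷ []) (on-y A (- u') (- (l' * u')) (self₀ (solve (l' ∷ u' ∷ []))))
        ⟫ at (_ ∷ _ ∷ []) (on-x A u (l * u) (same (l * u))) ⟫ at [] (flip (W-def (l * u) (l' * u')))
      conj′ : h ∷ W u u' ∷ h ⁻¹ ∷ [] ≋ W (l * u) (l' * u') ∷ []
      conj′ = at [] conj ⟫ at (_ ∷ []) invʳ

    good-resp : ∀ u u' v v' → Q ∣ u - v → Q ∣ u' - v' → Good u u' → Good v v'
    good-resp u u' v v' d d' G = record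
      { good-x = λ a → at [] (flip e) ⟫ good-x G a ⟫ at [] (ys (- (v' * v' * a)) { - (u' * u' * a)} (by ((- a * (u' + v')) ⊛ d') (solve (u' ∷ v' ∷ a ∷ []))))
          ⟫ at (_ ∷ []) e
      ; good-y = λ a → at [] (flip e) ⟫ good-y G a ⟫ at [] (xs (- (v * v * a)) { - (u * u * a)} (by ((- a * (u + v)) ⊛ d) (solve (u ∷ v ∷ a ∷ []))))
          ⟫ at (_ ∷ []) e }
      where
      e : W u u' ∷ [] ≋ W v v' ∷ []
      e = W-cong u u' v v' d d'

    inverse-unique : ∀ {u u' v v'} → Unit u u' → Unit v v' → Q ∣ u - v → Q ∣ u' - v'
    inverse-unique {u} {u'} {v} {v'} U V d = by (v' ⊛ U ⊕ (- u') ⊛ V ⊕ (- (u' * v')) ⊛ d) (solve (u ∷ u' ∷ v ∷ v' ∷ []))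

    -- The relation w(a + b) = w(a) w(ab/(a+b))⁻¹ w(b), from x(a + b) = x(a) x(b).
    weyl-sum : ∀ {a a' b b' c c' e e'} → Unit a a' → Unit b b' → Unit c c' → Unit e e' → Good a a' → Good b b' → Good e e' →
      Q ∣ a + b - c → Q ∣ a' + b' - e' → W a a' ∷ W e e' ⁻¹ ∷ W b b' ∷ [] ≋ W c c' ∷ []
    weyl-sum {a} {a'} {b} {b'} {c} {c'} {e} {e'} A B C E Ga Gb Ge dc de =
      pack ws ⟫ proj₁ (weyl-recognition C def wx wy)
      where
      sum′ : Q ∣ a' * b' * c - e'
      sum′ = by (de ⊕ b' ⊛ A ⊕ a' ⊛ B ⊕ (- (a' * b')) ⊛ dc) (solve (a ∷ a' ∷ b ∷ b' ∷ c ∷ e' ∷ []))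
      sum : Q ∣ a * b * e' - c
      sum = by (dc ⊕ b ⊛ A ⊕ a ⊛ B ⊕ (- (a * b)) ⊛ de) (solve (a ∷ a' ∷ b ∷ b' ∷ c ∷ e' ∷ []))
      key : Q ∣ a' * b' * e - c'
      key = by (c' ⊛ E ⊕ (- (a' * b' * e)) ⊛ C ⊕ (e * c') ⊛ sum′) (solve (a' ∷ b' ∷ c ∷ c' ∷ e ∷ e' ∷ []))
      main : x c ∷ [] ≋ y c' ∷ W a a' ∷ W e e' ⁻¹ ∷ W b b' ∷ y c' ∷ []
      main = flip (x-sum a b c dc) ⟫ at [] (x-split A Ga) ⟫ at (_ ∷ _ ∷ _ ∷ []) (x-split B Gb) ⟫ at (_ ∷ _ ∷ []) (y-sum a' b' e' de)
        ⟫ at (_ ∷ _ ∷ []) (y-split e e') ⟫ at (_ ∷ []) (Wx A Ga e (- (a' * a' * e)) (opp′ (a' * a' * e)))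
        ⟫ at (_ ∷ _ ∷ _ ∷ _ ∷ []) (xW B Gb e (- (b' * b' * e)) (opp′ (b' * b' * e)))
        ⟫ at [] (y-sum a' (- (a' * a' * e)) c' (by (key ⊕ (- (a' * e)) ⊛ de ⊕ (- a') ⊛ E) (solve (a' ∷ b' ∷ c' ∷ e ∷ e' ∷ [])))) ⟫ at (_ ∷ _ ∷ _ ∷ _ ∷ []) (y-sum (- (b' * b' * e)) b' c' (by (key ⊕ (- (b' * e)) ⊛ de ⊕ (- b') ⊛ E) (solve (a' ∷ b' ∷ c' ∷ e ∷ e' ∷ []))))
      ws = W a a' ∷ W e e' ⁻¹ ∷ W b b' ∷ []
      w = ⟦ ws ⟧
      def : w ∷ [] ≋ y (- c') ∷ x c ∷ y (- c') ∷ []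
      def = flip (at (_ ∷ []) main ⟫ at [] (y-cancel (opp′ c')) ⟫ at (_ ∷ _ ∷ _ ∷ []) (y-cancel (opp c')) ⟫ pack _)
      wx : ∀ s r → Q ∣ r + c' * c' * s → w ∷ x s ∷ [] ≋ y r ∷ w ∷ []
      wx s r d = at [] (flip (pack ws)) ⟫ at (_ ∷ _ ∷ []) (Wx B Gb s (- (b' * b' * s)) (opp′ (b' * b' * s)))
        ⟫ at (_ ∷ []) (W⁻¹y E Ge (- (b' * b' * s)) (e * e * (b' * b' * s)) (self₀ (solve (e ∷ b' ∷ s ∷ []))))
        ⟫ at [] (Wx A Ga (e * e * (b' * b' * s)) r (by (d ⊕ (s * (a' * b' * e + c')) ⊛ key) (solve (a' ∷ b' ∷ c' ∷ e ∷ s ∷ r ∷ [])))) ⟫ at (_ ∷ []) (pack _)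
      wy : ∀ s r → Q ∣ r + c * c * s → w ∷ y s ∷ [] ≋ x r ∷ w ∷ []
      wy s r d = at [] (flip (pack ws)) ⟫ at (_ ∷ _ ∷ []) (Wy B Gb s (- (b * b * s)) (opp′ (b * b * s)))
        ⟫ at (_ ∷ []) (W⁻¹x E Ge (- (b * b * s)) (e' * e' * (b * b * s)) (self₀ (solve (e' ∷ b ∷ s ∷ []))))
        ⟫ at [] (Wy A Ga (e' * e' * (b * b * s)) r (by (d ⊕ (s * (a * b * e' + c)) ⊛ sum) (solve (a ∷ b ∷ c ∷ e' ∷ s ∷ r ∷ [])))) ⟫ at (_ ∷ []) (pack _)

    good-neg : ∀ {u u'} → Unit u u' → Good u u' → Good (- u) (- u')
    good-neg {u} {u'} U G = record
      { good-x = λ a → at [] (W-neg u u') ⟫ W⁻¹x U G a (- (- u' * - u' * a)) (self₀ (solve (u' ∷ a ∷ []))) ⟫ at (_ ∷ []) (flip (W-neg u u'))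
      ; good-y = λ a → at [] (W-neg u u') ⟫ W⁻¹y U G a (- (- u * - u * a)) (self₀ (solve (u ∷ a ∷ []))) ⟫ at (_ ∷ []) (flip (W-neg u u')) }

    -- x(s) y(r) = y(r/v) h(v) x(s/v) with v = 1 + s r, for a unit s.
    swap : ∀ s s' r v v' → Unit s s' → Unit v v' → Q ∣ 1ℤ + s * r - v → Good s s' →
      x s ∷ y r ∷ [] ≋ y (r * v') ∷ W s s' ∷ W (s * v') (s' * v) ⁻¹ ∷ x (s * v') ∷ []
    swap s s' r v v' S V d G = at [] (x-split S G)
      ⟫ at (_ ∷ _ ∷ []) (y-sum s' r (s' * v) (by (s' ⊛ d ⊕ (- r) ⊛ S) (solve (s ∷ s' ∷ r ∷ v ∷ []))))
      ⟫ at (_ ∷ _ ∷ []) (y-split (s * v') (s' * v))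
      ⟫ at (_ ∷ []) (Wx S G (s * v') (- (s' * s' * (s * v'))) (opp′ (s' * s' * (s * v'))))
      ⟫ at [] (y-sum s' (- (s' * s' * (s * v'))) (r * v')
          (by ((- s') ⊛ V ⊕ (r * v' - s' * v') ⊛ S ⊕ (- (s' * v')) ⊛ d) (solve (s ∷ s' ∷ r ∷ v ∷ v' ∷ []))))

    W-transpose : ∀ {u u'} → Unit u' u → Good u' u → W 1ℤ 1ℤ ∷ W u u' ∷ [] ≋ W u' u ∷ W 1ℤ 1ℤ ∷ []
    W-transpose {u} {u'} U G = at (_ ∷ []) (W-def u u') ⟫ at [] (Wx U₁ good₁ u (- u) (self₀ (solve (u ∷ []))))
      ⟫ at (_ ∷ []) (Wy U₁ good₁ (- u') u' (self₀ (solve (u' ∷ [])))) ⟫ at (_ ∷ _ ∷ []) (Wx U₁ good₁ u (- u) (self₀ (solve (u ∷ []))))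
      ⟫ at [] (flip (W-dual U G))
      where
      U₁ : Unit 1ℤ 1ℤ
      U₁ = self₀ ≡.refl

module WeylPowers where
  open GroupWords
  open ElementaryRelations
  open import Algebra.Bundles using (Group)
  open import Data.List using ([]; _∷_)
  open import Data.Nat as ℕ using (ℕ; zero; suc)
  open import Data.Integer using (ℤ; +_; _+_; _*_; _-_; -_; _^_; 0ℤ; 1ℤ)
  open import Data.Integer.Divisibility.Signed using (_∣_)
  open import Data.Integer.Tactic.RingSolver using (solve)
  open import Data.Product using (_×_; _,_; proj₁; proj₂)
  open import Level using (0ℓ)
  open import Relation.Binary.PropositionalEquality as ≡ using (_≡_)

  double : ℕ → ℕ
  double zero = zero
  double (suc i) = suc (suc (double i))

  -- Weyl elements at the powers of a unit g. Up to the central element σ with w₁² = σ w₀²,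
  -- multiplication by t = w₁ w₀⁻¹ raises the index by one.
  module Powers {Q : ℤ} {𝔾 : Group 0ℓ 0ℓ} {x y : ℤ → Group.Carrier 𝔾} (el : Elementary Q 𝔾 x y)
      (g g' : ℤ) (U : Q ∣ g * g' - 1ℤ) (good : ∀ i → Weyl.Good 𝔾 x y (g ^ i) (g' ^ i)) where
    open Local el

    units : ∀ i → Unit (g ^ i) (g' ^ i)
    units zero = self₀ ≡.refl
    units (suc i) = by ((g ^ i * g' ^ i) ⊛ U ⊕ units i) (lemma (g ^ i) (g' ^ i))
      where
      lemma : ∀ a b → g * a * (g' * b) - 1ℤ ≡ a * b * (g * g' - 1ℤ) + (a * b - 1ℤ)
      lemma a b = solve (g ∷ g' ∷ a ∷ b ∷ [])

    w : ℕ → Carrier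
    w i = W (g ^ i) (g' ^ i)

    t : Carrier
    t = ⟦ w 1 ∷ w 0 ⁻¹ ∷ [] ⟧

    t-acts : Acts t (g ^ 1 * g' ^ 0 * (g ^ 1 * g' ^ 0)) (g' ^ 1 * g ^ 0 * (g' ^ 1 * g ^ 0))
    t-acts = ratio-acts (units 0) (good 0) (units 1) (good 1)

    tw : ∀ i → t ∷ w i ∷ [] ≋ w (2 ℕ.+ i) ∷ t ∷ []
    tw i = proj₁ (acts-weyl t-acts (good i)) ⟫ at [] (W-cong _ _ _ _ (self₀ (lemma g (g ^ i))) (self₀ (lemma g' (g' ^ i))))
      where
      lemma : ∀ h k → h * 1ℤ * 1ℤ * (h * 1ℤ * 1ℤ) * k - h * (h * k) ≡ 0ℤ
      lemma h k = solve (h ∷ k ∷ [])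

    tw₀ : t ∷ w 0 ∷ [] ≋ w 1 ∷ []
    tw₀ = at [] (flip (pack (w 1 ∷ w 0 ⁻¹ ∷ []))) ⟫ at (_ ∷ []) invˡ

    Central : Carrier → Set
    Central c = (∀ a → c ∷ x a ∷ [] ≋ x a ∷ c ∷ []) × (∀ a → c ∷ y a ∷ [] ≋ y a ∷ c ∷ [])

    central-W : ∀ {c} → Central c → ∀ u u' → c ∷ W u u' ∷ [] ≋ W u u' ∷ c ∷ []
    central-W (cx , cy) u u' = at (_ ∷ []) (W-def u u') ⟫ at [] (cx u) ⟫ at (_ ∷ []) (cy (- u')) ⟫ at (_ ∷ _ ∷ []) (cx u)
      ⟫ at [] (flip (W-def u u'))

    central-⁻¹ : ∀ {c h} → c ∷ h ∷ [] ≋ h ∷ c ∷ [] → c ∷ h ⁻¹ ∷ [] ≋ h ⁻¹ ∷ c ∷ []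
    central-⁻¹ {c} {h} p = moveˡ h (at [] (flip p) ⟫ at (_ ∷ []) invʳ)

    central-t : ∀ {c} → Central c → c ∷ t ∷ [] ≋ t ∷ c ∷ []
    central-t C = at (_ ∷ []) (flip (pack (w 1 ∷ w 0 ⁻¹ ∷ []))) ⟫ at [] (central-W C _ _) ⟫ at (_ ∷ []) (central-⁻¹ (central-W C _ _))
      ⟫ at [] (pack (w 1 ∷ w 0 ⁻¹ ∷ []))

    s : Carrier
    s = ⟦ w 0 ∷ w 0 ∷ [] ⟧

    s-central : Central s
    s-central = (λ a → at [] (flip (pack (w 0 ∷ w 0 ∷ []))) ⟫ at (_ ∷ []) (Wx (units 0) (good 0) a (- a) (self₀ (solve (a ∷ []))))
        ⟫ at [] (Wy (units 0) (good 0) (- a) a (self₀ (solve (a ∷ [])))) ⟫ at (_ ∷ []) (pack (w 0 ∷ w 0 ∷ [])))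
      , (λ a → at [] (flip (pack (w 0 ∷ w 0 ∷ []))) ⟫ at (_ ∷ []) (Wy (units 0) (good 0) a (- a) (self₀ (solve (a ∷ []))))
        ⟫ at [] (Wx (units 0) (good 0) (- a) a (self₀ (solve (a ∷ [])))) ⟫ at (_ ∷ []) (pack (w 0 ∷ w 0 ∷ [])))

    σ : Carrier
    σ = ⟦ w 1 ∷ w 1 ∷ s ⁻¹ ∷ [] ⟧

    σ-def : σ ∷ [] ≋ w 1 ∷ w 1 ∷ s ⁻¹ ∷ []
    σ-def = flip (pack (w 1 ∷ w 1 ∷ s ⁻¹ ∷ []))

    σ-central : Central σ
    σ-central = (λ a → at [] σ-def ⟫ at (_ ∷ _ ∷ []) (flip (central-⁻¹ (flip (proj₁ s-central a))))
        ⟫ at (_ ∷ []) (Wx (units 1) (good 1) a (- (g' ^ 1 * g' ^ 1 * a)) (opp′ (g' ^ 1 * g' ^ 1 * a)))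
        ⟫ at [] (Wy (units 1) (good 1) (- (g' ^ 1 * g' ^ 1 * a)) a (by ((- a * (g ^ 1 * g' ^ 1 + 1ℤ)) ⊛ units 1) (lemma a (g ^ 1) (g' ^ 1))))
        ⟫ at (_ ∷ []) (flip σ-def))
      , (λ a → at [] σ-def ⟫ at (_ ∷ _ ∷ []) (flip (central-⁻¹ (flip (proj₂ s-central a))))
        ⟫ at (_ ∷ []) (Wy (units 1) (good 1) a (- (g ^ 1 * g ^ 1 * a)) (opp′ (g ^ 1 * g ^ 1 * a)))
        ⟫ at [] (Wx (units 1) (good 1) (- (g ^ 1 * g ^ 1 * a)) a (by ((- a * (g ^ 1 * g' ^ 1 + 1ℤ)) ⊛ units 1) (lemma′ a (g ^ 1) (g' ^ 1))))
        ⟫ at (_ ∷ []) (flip σ-def))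
      where
      lemma : ∀ a h h' → a + h * h * - (h' * h' * a) ≡ - a * (h * h' + 1ℤ) * (h * h' - 1ℤ)
      lemma a h h' = solve (a ∷ h ∷ h' ∷ [])
      lemma′ : ∀ a h h' → a + h' * h' * - (h * h * a) ≡ - a * (h * h' + 1ℤ) * (h * h' - 1ℤ)
      lemma′ a h h' = solve (a ∷ h ∷ h' ∷ [])

    σt : σ ∷ t ∷ [] ≋ t ∷ σ ∷ []
    σt = central-t σ-central

    w₁w₁ : w 1 ∷ w 1 ∷ [] ≋ σ ∷ w 0 ∷ w 0 ∷ []
    w₁w₁ = flip (at [] σ-def ⟫ at (_ ∷ _ ∷ _ ∷ []) (pack (w 0 ∷ w 0 ∷ [])) ⟫ at (_ ∷ _ ∷ []) invˡ)

    te : ∀ i → t ∷ w (double i) ∷ [] ≋ w (suc (double i)) ∷ []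
    te zero = tw₀
    te (suc i) = cancelʳ _ _ (t ∷ []) (at (_ ∷ []) (flip (tw (double i))) ⟫ at (_ ∷ []) (te i) ⟫ tw (suc (double i)))

    to : ∀ i → t ∷ w (suc (double i)) ∷ [] ≋ σ ∷ w (suc (suc (double i))) ∷ []
    to zero = cancelʳ (t ∷ w 1 ∷ []) (σ ∷ w 2 ∷ []) (t ∷ [])
      (at (_ ∷ _ ∷ []) (flip (pack (w 1 ∷ w 0 ⁻¹ ∷ []))) ⟫ at (_ ∷ []) w₁w₁ ⟫ at (_ ∷ _ ∷ _ ∷ []) invʳ ⟫ at [] (flip σt) ⟫ at (_ ∷ []) (tw 0))
    to (suc i) = cancelʳ _ (σ ∷ w (4 ℕ.+ double i) ∷ []) (t ∷ [])
      (at (_ ∷ []) (flip (tw (suc (double i)))) ⟫ at (_ ∷ []) (to i) ⟫ at [] (flip σt) ⟫ at (_ ∷ []) (tw (suc (suc (double i)))))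

    -- w_{2a} w_{2a+2b+1}⁻¹ w_{2b+2} = w₁ is the sum relation for a decomposition g = g^2a + g^(2b+2).
    σ-trivial : ∀ a b → w (double a) ∷ w (suc (double (b ℕ.+ a))) ⁻¹ ∷ w (suc (suc (double b))) ∷ [] ≋ w 1 ∷ [] → σ ∷ [] ≋ []
    σ-trivial a b sum = cancelʳ (σ ∷ []) [] (w (suc (suc (double b))) ∷ []) (flip (shift b) ⟫ at (_ ∷ _ ∷ []) (flip sum)
        ⟫ at [] (flip (drop b)) ⟫ at (_ ∷ []) invˡ ⟫ at [] invʳ)
      where
      up : ∀ i → w (suc (suc (double i))) ∷ [] ≋ σ ⁻¹ ∷ t ∷ w (suc (double i)) ∷ []
      up i = moveˡ σ (flip (to i))
      shift : ∀ b → w (suc (double b)) ∷ w 0 ⁻¹ ∷ w 1 ∷ [] ≋ σ ∷ w (suc (suc (double b))) ∷ []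
      shift zero = at [] (pack (w 1 ∷ w 0 ⁻¹ ∷ [])) ⟫ to zero
      shift (suc b) = at [] (flip (te (suc b)) ⟫ at (_ ∷ []) (up b)) ⟫ at (_ ∷ _ ∷ _ ∷ []) (shift b)
        ⟫ at (_ ∷ _ ∷ []) (flip σt) ⟫ at (_ ∷ []) invˡ ⟫ at (_ ∷ []) (te (suc b)) ⟫ to (suc b)
      drop : ∀ b → w (suc (double (b ℕ.+ a))) ∷ w (double a) ⁻¹ ∷ [] ≋ w (suc (double b)) ∷ w 0 ⁻¹ ∷ []
      drop zero = at [] (flip (te a)) ⟫ at (_ ∷ []) invʳ ⟫ pack′
        where
        pack′ : t ∷ [] ≋ w 1 ∷ w 0 ⁻¹ ∷ []
        pack′ = flip (pack (w 1 ∷ w 0 ⁻¹ ∷ []))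
      drop (suc b) = at [] (flip (te (suc (b ℕ.+ a))) ⟫ at (_ ∷ []) (up (b ℕ.+ a))) ⟫ at (_ ∷ _ ∷ _ ∷ []) (drop b)
        ⟫ at (_ ∷ []) (flip (up b)) ⟫ at [] (te (suc b))

    module _ (σ≋ε : σ ∷ [] ≋ []) where
      t-step : ∀ i → t ∷ w i ∷ [] ≋ w (suc i) ∷ []
      t-step zero = tw₀
      t-step (suc zero) = to zero ⟫ at [] σ≋ε
      t-step (suc (suc i)) = cancelʳ _ (w (3 ℕ.+ i) ∷ []) (t ∷ []) (at (_ ∷ []) (flip (tw i)) ⟫ at (_ ∷ []) (t-step i) ⟫ tw (suc i))

      w-mult : ∀ i j → w i ∷ w 0 ⁻¹ ∷ w j ∷ [] ≋ w (i ℕ.+ j) ∷ []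
      w-mult zero j = at [] invʳ
      w-mult (suc i) j = at [] (flip (t-step i)) ⟫ at (_ ∷ []) (w-mult i j) ⟫ t-step (i ℕ.+ j)

    tt : ∀ i → t ∷ w (double i) ∷ t ∷ [] ≋ σ ∷ w (double i) ∷ []
    tt i = cancelˡ t (at (_ ∷ []) (te i) ⟫ at [] (to i) ⟫ at (_ ∷ []) (flip (tw (double i))) ⟫ at [] σt)

    even-square : ∀ i → w (double i) ∷ w (double i) ∷ [] ≋ s ∷ []
    even-square zero = pack (w 0 ∷ w 0 ∷ [])
    even-square (suc i) = cancelʳ (w (double (suc i)) ∷ w (double (suc i)) ∷ []) (s ∷ []) (t ∷ [])
      (at (_ ∷ []) (flip (tw (double i))) ⟫ at [] (flip (tw (double i))) ⟫ at (_ ∷ []) (even-square i) ⟫ flip (central-t s-central))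

    central-inv : ∀ {c h} → c ∷ h ∷ [] ≋ h ∷ c ∷ [] → c ⁻¹ ∷ h ∷ [] ≋ h ∷ c ⁻¹ ∷ []
    central-inv p = flip (central-⁻¹ (flip p))

    -- The relation in the hypothesis comes from the two decompositions 2 = 1 + 1 = 3 - 1.
    σ-trivial₂ : ∀ i → w 0 ∷ w 0 ∷ w 0 ∷ w 0 ∷ [] ≋ [] →
      w 0 ∷ w (double i) ∷ w 0 ∷ w 0 ∷ w 1 ⁻¹ ∷ w 0 ∷ w (double i) ∷ [] ≋ w 1 ∷ [] → σ ∷ [] ≋ []
    σ-trivial₂ i s⁴ rel = cancelʳ (σ ∷ []) [] (w 0 ∷ [])
        (flip (at (_ ∷ []) (flip (pack (w 1 ∷ w 0 ⁻¹ ∷ []))) ⟫ at [] w₁w₁ ⟫ at (_ ∷ _ ∷ []) invʳ)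
        ⟫ at [] (flip rel ⟫ at (_ ∷ _ ∷ _ ∷ _ ∷ []) w₁⁻w₀ ⟫ at (_ ∷ _ ∷ []) (pack (w 0 ∷ w 0 ∷ []))
          ⟫ at (_ ∷ _ ∷ _ ∷ _ ∷ []) (central-inv (central-W σ-central _ _)) ⟫ at (_ ∷ []) (flip (central-W s-central _ _))
          ⟫ at (_ ∷ _ ∷ []) (moveˡ t (tt i)) ⟫ at (_ ∷ _ ∷ _ ∷ _ ∷ []) (even-square i)
          ⟫ at (_ ∷ _ ∷ _ ∷ []) σs ⟫ at (_ ∷ _ ∷ _ ∷ _ ∷ []) invʳ
          ⟫ at (_ ∷ []) (central-⁻¹ (central-t s-central)) ⟫ at (_ ∷ _ ∷ []) ss)
        ⟫ at (_ ∷ []) invˡ)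
      where
      σs : σ ∷ s ∷ [] ≋ s ∷ σ ∷ []
      σs = at (_ ∷ []) (flip (pack (w 0 ∷ w 0 ∷ []))) ⟫ at [] (central-W σ-central _ _) ⟫ at (_ ∷ []) (central-W σ-central _ _) ⟫ at [] (pack (w 0 ∷ w 0 ∷ []))
      ss : s ∷ s ∷ [] ≋ []
      ss = at [] (flip (pack (w 0 ∷ w 0 ∷ []))) ⟫ at (_ ∷ _ ∷ []) (flip (pack (w 0 ∷ w 0 ∷ []))) ⟫ s⁴
      w₁⁻w₀ : w 1 ⁻¹ ∷ w 0 ∷ [] ≋ t ∷ σ ⁻¹ ∷ []
      w₁⁻w₀ = flip (moveˡ (w 1) (at [] (flip tw₀) ⟫ at [] (tt zero) ⟫ at [] (central-W σ-central _ _) ⟫ at (_ ∷ []) invʳ))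

module NormalForms where
  open GroupWords
  open ElementaryRelations
  open import Algebra.Bundles using (Group)
  open import Data.List using (List; []; _∷_)
  open import Data.Integer using (ℤ; +_; _+_; _*_; _-_; -_; 0ℤ; 1ℤ)
  open import Data.Integer.Divisibility.Signed using (_∣_)
  open import Data.Integer.Tactic.RingSolver using (solve)
  open import Data.Product using (_×_; _,_; ∃-syntax)
  open import Data.Sum using (_⊎_; inj₁; inj₂)
  open import Level using (0ℓ)
  open import Relation.Nullary using (¬_)
  open import Data.Empty using (⊥-elim)
  open import Relation.Binary.PropositionalEquality as ≡ using (_≡_)

  data Matℤ : Set where
    matℤ : (a b c d : ℤ) → Matℤ

  infixl 7 _⊡_
  _⊡_ : Matℤ → Matℤ → Matℤ
  matℤ a b c d ⊡ matℤ a' b' c' d' = matℤ (a * a' + b * c') (a * b' + b * d') (c * a' + d * c') (c * b' + d * d')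

  Congruent : ℤ → Matℤ → Matℤ → Set
  Congruent Q (matℤ a b c d) (matℤ a' b' c' d') = (Q ∣ a - a') × (Q ∣ b - b') × (Q ∣ c - c') × (Q ∣ d - d')

  data Letter : Set where
    𝕩 𝕪 : ℤ → Letter

  Word : Set
  Word = List Letter

  act : Letter → Matℤ → Matℤ
  act (𝕩 s) (matℤ a b c d) = matℤ (a + s * c) (b + s * d) c d
  act (𝕪 s) (matℤ a b c d) = matℤ a b (c + s * a) (d + s * b)

  matrix : Word → Matℤ
  matrix [] = matℤ 1ℤ 0ℤ 0ℤ 1ℤ
  matrix (l ∷ ls) = act l (matrix ls)

  module Evaluate (𝔾 : Group 0ℓ 0ℓ) (x y : ℤ → Group.Carrier 𝔾) where
    open Group 𝔾 using (Carrier; _∙_; ε)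

    ⟪_⟫ : Letter → Carrier
    ⟪ 𝕩 s ⟫ = x s
    ⟪ 𝕪 s ⟫ = y s

    eval : Word → Carrier
    eval [] = ε
    eval (l ∷ ls) = ⟪ l ⟫ ∙ eval ls

  record Torus {Q : ℤ} {𝔾 : Group 0ℓ 0ℓ} {x y : ℤ → Group.Carrier 𝔾} (el : Elementary Q 𝔾 x y) : Set where
    open Local el
    field
      all-good : ∀ u u' → Unit u u' → Good u u'
      W-mult   : ∀ u u' v v' → Unit u u' → Unit v v' → W u u' ∷ W 1ℤ 1ℤ ⁻¹ ∷ W v v' ∷ [] ≋ W (u * v) (u' * v') ∷ []

  record LocalRing (Q : ℤ) : Set where
    Invertible : ℤ → Set
    Invertible a = ∃[ a' ] Q ∣ a * a' - 1ℤ
    field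
      decide     : ∀ a → Invertible a ⊎ ¬ Invertible a
      nonunit    : ∀ a b → ¬ Invertible a → ¬ Invertible b → ∀ r s → ¬ Invertible (r * a + s * b)
      nontrivial : ¬ Q ∣ 1ℤ

  -- Over a local ring every word has the normal form y(c/a) h(a) x(b/a) determined by its matrix,
  -- or the matrix acquires an invertible corner after multiplication by the Weyl element.
  module NormalForm {Q : ℤ} {𝔾 : Group 0ℓ 0ℓ} {x y : ℤ → Group.Carrier 𝔾} {el : Elementary Q 𝔾 x y}
      (torus : Torus el) (local : LocalRing Q) where
    open Local el
    open Torus torus
    open LocalRing local
    open Evaluate 𝔾 x y

    private
      w₀ = W 1ℤ 1ℤ
      U₁ : Unit 1ℤ 1ℤ
      U₁ = self₀ ≡.refl

    Det : Matℤ → Set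
    Det (matℤ a b c d) = Q ∣ a * d - b * c - 1ℤ

    proj-a : Matℤ → ℤ
    proj-a (matℤ a b c d) = a

    Corner : Carrier → Matℤ → Set
    Corner g (matℤ a b c d) = ∀ a' → Unit a a' → g ∷ [] ≋ y (c * a') ∷ W a a' ∷ w₀ ⁻¹ ∷ x (b * a') ∷ []

    rot : Matℤ → Matℤ
    rot (matℤ a b c d) = matℤ c d (- a) (- b)

    Normal : Carrier → Matℤ → Set
    Normal g m = Corner g m × Corner (w₀ ∙ g) (rot m) × Det m

    y-corner : ∀ s g m → Corner g m → Corner (y s ∙ g) (act (𝕪 s) m)
    y-corner s g (matℤ a b c d) N a' U = eq (assoc _ _ _) ⟫ at (_ ∷ []) (N a' U)
      ⟫ at [] (y-sum s (c * a') ((c + s * a) * a') (by ((- s) ⊛ U) (solve (s ∷ c ∷ a ∷ a' ∷ []))))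

    -- The element w(u) w₀⁻¹ acts on x by u².
    h-x : ∀ u u' → Unit u u' → ∀ a b → Q ∣ a - u * u * b → x a ∷ W u u' ∷ w₀ ⁻¹ ∷ [] ≋ W u u' ∷ w₀ ⁻¹ ∷ x b ∷ []
    h-x u u' U a b d = at [] (xW U (all-good u u' U) a (- b) (by ((u' * u') ⊛ d ⊕ (b * (u * u' + 1ℤ)) ⊛ U) (solve (a ∷ b ∷ u ∷ u' ∷ []))))
      ⟫ at (_ ∷ []) (yW⁻¹ U₁ good₁ (- b) b (self₀ (solve (b ∷ []))))

    x-corner-c : ∀ s g a b c d c' → Unit c c' → Det (matℤ a b c d) → Corner (w₀ ∙ g) (matℤ c d (- a) (- b)) →
      Corner (x s ∙ g) (act (𝕩 s) (matℤ a b c d))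
    x-corner-c s g a b c d c' V Δ N f' F = eq (assoc _ _ _) ⟫ at (_ ∷ []) g-form
        ⟫ at [] (x-sum s (a * c') ((a + s * c) * c') (by ((- s) ⊛ V) (solve (s ∷ a ∷ c ∷ c' ∷ []))))
        ⟫ at [] (x-split E (all-good ((a + s * c) * c') (f' * c) E)) ⟫ at (_ ∷ _ ∷ []) (yW⁻¹ U₁ good₁ (f' * c) (- (f' * c)) (self₀ (solve (f' ∷ c ∷ []))))
        ⟫ at (_ ∷ _ ∷ _ ∷ []) (h-x c c' V (- (f' * c)) (- (f' * c')) (by ((f' * c) ⊛ V) (solve (f' ∷ c ∷ c' ∷ []))))
        ⟫ at (_ ∷ []) (W-mult ((a + s * c) * c') (f' * c) c c' E V)
        ⟫ at (_ ∷ []) (W-cong ((a + s * c) * c' * c) (f' * c * c') (a + s * c) f' (by ((a + s * c) ⊛ V) (solve (a ∷ s ∷ c ∷ c' ∷ [])))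
            (by (f' ⊛ V) (solve (f' ∷ c ∷ c' ∷ []))))
        ⟫ at (_ ∷ _ ∷ _ ∷ []) (x-sum (- (f' * c')) (d * c') ((b + s * d) * f') bottom)
        ⟫ at [] (ys (c * f') {f' * c} (self₀ (solve (c ∷ f' ∷ []))))
      where
      E : Unit ((a + s * c) * c') (f' * c)
      E = by ((c * c') ⊛ F ⊕ V) (solve (a ∷ s ∷ c ∷ c' ∷ f' ∷ []))
      bottom : Q ∣ - (f' * c') + d * c' - (b + s * d) * f'
      bottom = by ((f' * c') ⊛ Δ ⊕ (- (d * c')) ⊛ F ⊕ (f' * (b + s * d)) ⊛ V) (solve (a ∷ b ∷ c ∷ c' ∷ d ∷ s ∷ f' ∷ []))
      g-form : g ∷ [] ≋ x (a * c') ∷ w₀ ⁻¹ ∷ W c c' ∷ w₀ ⁻¹ ∷ x (d * c') ∷ []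
      g-form = moveˡ w₀ (eq (trans (∙-congˡ (identityʳ g)) (sym (identityʳ _))) ⟫ N c' V)
        ⟫ at [] (W⁻¹y U₁ good₁ (- a * c') (a * c') (self₀ (solve (a ∷ c' ∷ []))))

    x-corner-s : ∀ s s' g a b c d → Unit s s' → Det (matℤ a b c d) → ∃[ a' ] Unit a a' → Corner g (matℤ a b c d) →
      Corner (x s ∙ g) (act (𝕩 s) (matℤ a b c d))
    x-corner-s s s' g a b c d S Δ (a' , A) N f' F = eq (assoc _ _ _) ⟫ at (_ ∷ []) (N a' A)
        ⟫ at [] (x-split S (all-good s s' S)) ⟫ at (_ ∷ _ ∷ []) (y-sum s' (c * a') (s' * a' * (a + s * c)) (by ((- s') ⊛ A ⊕ (- (c * a')) ⊛ S) (solve (s ∷ s' ∷ c ∷ a ∷ a' ∷ []))))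
        ⟫ at (_ ∷ _ ∷ []) (y-split (s * a * f') (s' * a' * (a + s * c))) ⟫ at (_ ∷ []) (Wx S (all-good s s' S) (s * a * f') (- (s' * s' * (s * a * f'))) (opp′ (s' * s' * (s * a * f'))))
        ⟫ at [] (y-sum s' (- (s' * s' * (s * a * f'))) (c * f') (by ((c * f' - s' * a * f') ⊛ S ⊕ (- s') ⊛ F) (solve (s ∷ s' ∷ a ∷ c ∷ f' ∷ []))))
        ⟫ at (_ ∷ _ ∷ _ ∷ []) (h-x a a' A (s * a * f') (a' * s * f') (by ((- (a * s * f')) ⊛ A) (solve (a ∷ a' ∷ s ∷ f' ∷ []))))
        ⟫ at (_ ∷ []) ratio ⟫ at (_ ∷ []) (W-mult ((a + s * c) * a') (f' * a) a a' P A)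
        ⟫ at (_ ∷ []) (W-cong ((a + s * c) * a' * a) (f' * a * a') (a + s * c) f' (by ((a + s * c) ⊛ A) (solve (a ∷ a' ∷ s ∷ c ∷ []))) (by (f' ⊛ A) (solve (a ∷ a' ∷ f' ∷ []))))
        ⟫ at (_ ∷ _ ∷ _ ∷ []) (x-sum (a' * s * f') (b * a') ((b + s * d) * f') bottom)
      where
      E : Unit (s * a * f') (s' * a' * (a + s * c))
      E = by ((a * a' * (f' * (a + s * c))) ⊛ S ⊕ (f' * (a + s * c)) ⊛ A ⊕ F) (solve (a ∷ a' ∷ s ∷ s' ∷ c ∷ f' ∷ []))
      P : Unit ((a + s * c) * a') (f' * a)
      P = by ((a * a') ⊛ F ⊕ A) (solve (a ∷ a' ∷ s ∷ c ∷ f' ∷ []))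
      ratio : W s s' ∷ W (s * a * f') (s' * a' * (a + s * c)) ⁻¹ ∷ [] ≋ W ((a + s * c) * a') (f' * a) ∷ w₀ ⁻¹ ∷ []
      ratio = at [] (flip (W-mult ((a + s * c) * a') (f' * a) (s * a * f') (s' * a' * (a + s * c)) P E ⟫ W-cong ((a + s * c) * a' * (s * a * f')) (f' * a * (s' * a' * (a + s * c))) s s'
          (by ((s * (a + s * c) * f') ⊛ A ⊕ s ⊛ F) (solve (a ∷ a' ∷ s ∷ c ∷ f' ∷ [])))
          (by ((s' * (a + s * c) * f') ⊛ A ⊕ s' ⊛ F) (solve (a ∷ a' ∷ s ∷ s' ∷ c ∷ f' ∷ []))))) ⟫ at (_ ∷ _ ∷ []) invʳ
      bottom : Q ∣ a' * s * f' + b * a' - (b + s * d) * f'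
      bottom = by ((- (b * a')) ⊛ F ⊕ (f' * (s * d + b)) ⊛ A ⊕ (- (a' * f' * s)) ⊛ Δ) (solve (a ∷ a' ∷ b ∷ c ∷ d ∷ s ∷ f' ∷ []))

    corner-resp : ∀ {g h m n} → g ≈ h → m ≡ n → Corner g m → Corner h n
    corner-resp {m = matℤ a b c d} p ≡.refl N a' U = letter (sym p) ⟫ N a' U

    det-x : ∀ s m → Det m → Det (act (𝕩 s) m)
    det-x s (matℤ a b c d) Δ = by Δ (solve (a ∷ b ∷ c ∷ d ∷ s ∷ []))

    det-y : ∀ s m → Det m → Det (act (𝕪 s) m)
    det-y s (matℤ a b c d) Δ = by Δ (solve (a ∷ b ∷ c ∷ d ∷ s ∷ []))

    private
      unimodular : ∀ a b c d → Q ∣ a * d - b * c - 1ℤ → Q ∣ (d * a + - b * c) * 1ℤ - 1ℤ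
      unimodular a b c d Δ = by Δ (solve (a ∷ b ∷ c ∷ d ∷ []))

      unit-1 : Invertible 1ℤ
      unit-1 = 1ℤ , U₁

      unit-sum : ∀ a c → Invertible a → ¬ Invertible c → Invertible (a + 1ℤ * c)
      unit-sum a c A ¬C with decide (a + 1ℤ * c)
      ... | inj₁ I = I
      ... | inj₂ ¬I = ⊥-elim (nonunit (a + 1ℤ * c) c ¬I ¬C 1ℤ (- 1ℤ) (≡.subst Invertible {a} {1ℤ * (a + 1ℤ * c) + - 1ℤ * c} (solve (a ∷ c ∷ [])) A))

    x-corner : ∀ s g m → Corner g m → Corner (w₀ ∙ g) (rot m) → Det m → Corner (x s ∙ g) (act (𝕩 s) m)
    x-corner s g (matℤ a b c d) N N' Δ with decide c | decide a | decide s
    ... | inj₁ (c' , V) | _ | _ = x-corner-c s g a b c d c' V Δ N'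
    ... | inj₂ ¬C | inj₂ ¬A | _ = ⊥-elim (nonunit a c ¬A ¬C d (- b) (1ℤ , unimodular a b c d Δ))
    ... | inj₂ ¬C | inj₁ A | inj₁ (s' , S) = x-corner-s s s' g a b c d S Δ A N
    ... | inj₂ ¬C | inj₁ A | inj₂ ¬S with decide (s - 1ℤ)
    ...   | inj₂ ¬S₁ = ⊥-elim (nonunit s (s - 1ℤ) ¬S ¬S₁ 1ℤ (- 1ℤ) (≡.subst Invertible {1ℤ} {1ℤ * s + - 1ℤ * (s - 1ℤ)} (solve (s ∷ [])) unit-1))
    ...   | inj₁ (r , R) = corner-resp
              (trans (sym (assoc _ _ _)) (∙-congʳ (trans (sym (x-homo (s - 1ℤ) 1ℤ)) (x-cong {s - 1ℤ + 1ℤ} {s} (self₀ (solve (s ∷ [])))))))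
              (lemma a b)
              (x-corner-s (s - 1ℤ) r (x 1ℤ ∙ g) (a + 1ℤ * c) (b + 1ℤ * d) c d R (det-x 1ℤ (matℤ a b c d) Δ) (unit-sum a c A ¬C)
                (x-corner-s 1ℤ 1ℤ g a b c d U₁ Δ A N))
      where
      lemma : ∀ a b → matℤ (a + 1ℤ * c + (s - 1ℤ) * c) (b + 1ℤ * d + (s - 1ℤ) * d) c d ≡ matℤ (a + s * c) (b + s * d) c d
      lemma a b = ≡.cong₂ (λ p q → matℤ p q c d) (solve (a ∷ s ∷ c ∷ [])) (solve (b ∷ s ∷ d ∷ []))

    w₀⁴ : w₀ ∷ w₀ ∷ w₀ ∷ w₀ ∷ [] ≋ []
    w₀⁴ = at (_ ∷ _ ∷ _ ∷ []) (flip (W-mult (- 1ℤ) (- 1ℤ) (- 1ℤ) (- 1ℤ) U₁ U₁)) ⟫ at (_ ∷ _ ∷ _ ∷ []) (W-neg 1ℤ 1ℤ)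
      ⟫ at (_ ∷ _ ∷ []) invʳ ⟫ at (_ ∷ []) invʳ ⟫ at (_ ∷ []) (W-neg 1ℤ 1ℤ) ⟫ invʳ

    W-opposite : ∀ a a' → Unit a a' → w₀ ∷ w₀ ∷ W a a' ∷ [] ≋ W (- a) (- a') ∷ []
    W-opposite a a' U = at (_ ∷ _ ∷ []) (W-cong a a' (- 1ℤ * - a) (- 1ℤ * - a') (self₀ (solve (a ∷ []))) (self₀ (solve (a' ∷ [])))
        ⟫ flip (W-mult (- 1ℤ) (- 1ℤ) (- a) (- a') U₁ (by U (solve (a ∷ a' ∷ [])))))
      ⟫ at (_ ∷ _ ∷ []) (W-neg 1ℤ 1ℤ) ⟫ at (_ ∷ []) invʳ ⟫ at [] invʳ

    rot-rot : ∀ g m → Corner g m → Corner (w₀ ∙ (w₀ ∙ g)) (rot (rot m))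
    rot-rot g (matℤ a b c d) N a' U = eq (trans (assoc _ _ _) (∙-congˡ (assoc _ _ _))) ⟫ at (_ ∷ _ ∷ []) (N (- a') V)
        ⟫ at (_ ∷ []) (Wy U₁ good₁ (c * - a') (c * a') (self₀ (solve (c ∷ a' ∷ []))))
        ⟫ at [] (Wx U₁ good₁ (c * a') (- c * a') (self₀ (solve (c ∷ a' ∷ []))))
        ⟫ at (_ ∷ []) (W-opposite a (- a') V ⟫ W-cong (- a) (- - a') (- a) a' (same (- a)) (self₀ (solve (a' ∷ []))))
        ⟫ at (_ ∷ _ ∷ _ ∷ []) (xs (- b * a') {b * - a'} (self₀ (solve (b ∷ a' ∷ []))))
      where
      V : Unit a (- a')
      V = by U (solve (a ∷ a' ∷ []))

    private
      pair : ∀ {g h k l} → g ∷ h ∷ [] ≋ k ∷ l ∷ [] → g ∙ h ≈ k ∙ l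
      pair (eq p) = trans (∙-congˡ (sym (identityʳ _))) (trans p (∙-congˡ (identityʳ _)))

    w₀x : ∀ s g → w₀ ∙ (x s ∙ g) ≈ y (- s) ∙ (w₀ ∙ g)
    w₀x s g = trans (sym (assoc _ _ _)) (trans (∙-congʳ (pair (Wx U₁ good₁ s (- s) (self₀ (solve (s ∷ [])))))) (assoc _ _ _))

    w₀y : ∀ s g → w₀ ∙ (y s ∙ g) ≈ x (- s) ∙ (w₀ ∙ g)
    w₀y s g = trans (sym (assoc _ _ _)) (trans (∙-congʳ (pair (Wy U₁ good₁ s (- s) (self₀ (solve (s ∷ [])))))) (assoc _ _ _))

    normal-x : ∀ s g m → Normal g m → Normal (x s ∙ g) (act (𝕩 s) m)
    normal-x s g (matℤ a b c d) (N , N' , Δ) = x-corner s g (matℤ a b c d) N N' Δ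
      , corner-resp {m = matℤ c d (- a + - s * c) (- b + - s * d)} {n = matℤ c d (- (a + s * c)) (- (b + s * d))} (sym (w₀x s g)) (≡.cong₂ (matℤ c d) (solve (a ∷ s ∷ c ∷ [])) (solve (b ∷ s ∷ d ∷ [])))
          (y-corner (- s) (w₀ ∙ g) (rot (matℤ a b c d)) N')
      , det-x s (matℤ a b c d) Δ

    normal-y : ∀ s g m → Normal g m → Normal (y s ∙ g) (act (𝕪 s) m)
    normal-y s g (matℤ a b c d) (N , N' , Δ) = y-corner s g (matℤ a b c d) N
      , corner-resp {m = matℤ (c + - s * - a) (d + - s * - b) (- a) (- b)} {n = matℤ (c + s * a) (d + s * b) (- a) (- b)} (sym (w₀y s g)) (≡.cong₂ (λ p q → matℤ p q (- a) (- b)) (solve (a ∷ s ∷ c ∷ [])) (solve (b ∷ s ∷ d ∷ [])))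
          (x-corner (- s) (w₀ ∙ g) (rot (matℤ a b c d)) N' (rot-rot g (matℤ a b c d) N) (by Δ (solve (a ∷ b ∷ c ∷ d ∷ []))))
      , det-y s (matℤ a b c d) Δ

    normal : ∀ ω → Normal (eval ω) (matrix ω)
    normal [] = (λ a' U → flip (at [] (y-zero (self₀ (solve (a' ∷ []))))
          ⟫ at [] (W-cong 1ℤ a' 1ℤ 1ℤ (same 1ℤ) (by U (solve (a' ∷ [])))) ⟫ at [] invʳ ⟫ x-zero (self₀ (solve (a' ∷ []))) ⟫ eq (sym (identityʳ ε))))
      , (λ a' U → ⊥-elim (nontrivial (by (- 1ℤ ⊛ U) (solve (a' ∷ []))))) , self₀ ≡.refl
    normal (𝕩 s ∷ ω) = normal-x s (eval ω) (matrix ω) (normal ω)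
    normal (𝕪 s ∷ ω) = normal-y s (eval ω) (matrix ω) (normal ω)

    corner-unique : ∀ {g h} m n → Congruent Q m n → Corner g m → Corner h n → ∀ u → Unit (proj-a m) u → g ≈ h
    corner-unique (matℤ a b c d) (matℤ a₁ b₁ c₁ d₁) (da , db , dc , _) N N₁ u U =
      unletter (N u U ⟫ at [] (ys (c₁ * u) {c * u} (by (u ⊛ dc) (solve (c ∷ c₁ ∷ u ∷ [])))) ⟫ at (_ ∷ []) (W-cong a u a₁ u da (same u))
        ⟫ at (_ ∷ _ ∷ _ ∷ []) (xs (b₁ * u) {b * u} (by (u ⊛ db) (solve (b ∷ b₁ ∷ u ∷ [])))) ⟫ flip (N₁ u U₁′))
      where
      U₀ : Unit a u
      U₀ = U
      U₁′ : Unit a₁ u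
      U₁′ = by (U₀ ⊕ (- u) ⊛ da) (solve (a ∷ a₁ ∷ u ∷ []))

    eval-unique : ∀ ω₁ ω₂ → Congruent Q (matrix ω₁) (matrix ω₂) → eval ω₁ ≈ eval ω₂
    eval-unique ω₁ ω₂ = go (matrix ω₁) (matrix ω₂) (normal ω₁) (normal ω₂)
      where
      go : ∀ {g h} m n → Normal g m → Normal h n → Congruent Q m n → g ≈ h
      go (matℤ a b c d) (matℤ a₁ b₁ c₁ d₁) (N , N' , Δ) (N₁ , N₁' , _) (da , db , dc , dd) with decide a | decide c
      ... | inj₁ (u , U) | _ = corner-unique (matℤ a b c d) (matℤ a₁ b₁ c₁ d₁) (da , db , dc , dd) N N₁ u U
      ... | inj₂ _ | inj₁ (u , U) = ∙-cancelˡ w₀ _ _ (corner-unique (matℤ c d (- a) (- b)) (matℤ c₁ d₁ (- a₁) (- b₁))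
              (dc , dd , by (- 1ℤ ⊛ da) (solve (a ∷ a₁ ∷ [])) , by (- 1ℤ ⊛ db) (solve (b ∷ b₁ ∷ []))) N' N₁' u U)
      ... | inj₂ ¬A | inj₂ ¬C = ⊥-elim (nonunit a c ¬A ¬C d (- b) (1ℤ , unimodular a b c d Δ))

module Tori where
  open GroupWords
  open ElementaryRelations
  open WeylPowers
  open NormalForms
  open import Algebra.Bundles using (Group)
  open import Data.List using ([]; _∷_)
  open import Data.Nat as ℕ using (ℕ; zero; suc)
  open import Data.Integer using (ℤ; +_; _+_; _*_; _-_; -_; _^_; 0ℤ; 1ℤ)
  open import Data.Integer.Properties using (^-distribˡ-+-*)
  open import Data.Integer.Divisibility.Signed using (_∣_)
  open import Data.Integer.Tactic.RingSolver using (solve)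
  open import Data.Product using (_×_; _,_; proj₁; proj₂; ∃-syntax)
  open import Data.Sum using (_⊎_; inj₁; inj₂)
  open import Level using (0ℓ)
  open import Relation.Binary.PropositionalEquality as ≡ using (_≡_)

  module Units {Q : ℤ} {𝔾 : Group 0ℓ 0ℓ} {x y : ℤ → Group.Carrier 𝔾} (el : Elementary Q 𝔾 x y) where
    open Local el

    good-scaled : ∀ {h h'} → Unit h h' → Good h h' → ∀ i {r r'} → Good r r' → Good ((h * h) ^ i * r) ((h' * h') ^ i * r')
    good-scaled U H zero {r} {r'} G = good-resp r r' (1ℤ * r) (1ℤ * r') (self₀ (solve (r ∷ []))) (self₀ (solve (r' ∷ []))) G
    good-scaled {h} {h'} U H (suc i) {r} {r'} G = good-resp (h * 1ℤ * (h * 1ℤ) * ((h * h) ^ i * r)) (h' * 1ℤ * (h' * 1ℤ) * ((h' * h') ^ i * r')) (h * h * (h * h) ^ i * r) (h' * h' * (h' * h') ^ i * r')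
        (self₀ (lemma h ((h * h) ^ i) r)) (self₀ (lemma h' ((h' * h') ^ i) r'))
        (proj₂ (acts-weyl (ratio-acts (self₀ ≡.refl) good₁ U H) (good-scaled U H i G)))
      where
      lemma : ∀ h p r → h * 1ℤ * (h * 1ℤ) * (p * r) - h * h * p * r ≡ 0ℤ
      lemma h p r = solve (h ∷ p ∷ r ∷ [])

    pow-unit : ∀ g g' → Unit g g' → ∀ i → Unit (g ^ i) (g' ^ i)
    pow-unit g g' U zero = self₀ ≡.refl
    pow-unit g g' U (suc i) = by ((g ^ i * g' ^ i) ⊛ U ⊕ pow-unit g g' U i) (lemma g g' (g ^ i) (g' ^ i))
      where
      lemma : ∀ g g' a b → g * a * (g' * b) - 1ℤ ≡ a * b * (g * g' - 1ℤ) + (a * b - 1ℤ)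
      lemma g g' a b = solve (g ∷ g' ∷ a ∷ b ∷ [])

    cyclic-torus :
      ∀ h h' → Unit h h' → Good h h' →
      (∀ u u' → Unit u u' → ∃[ i ] ∃[ r ] ∃[ r' ] Unit r r' × Good r r' × Q ∣ (h * h) ^ i * r - u) →
      ∀ g g' → Unit g g' → (∀ u u' → Unit u u' → ∃[ i ] Q ∣ g ^ i - u) →
      ∀ a b → Q ∣ g ^ double a + g ^ suc (suc (double b)) - g →
      Torus el
    cyclic-torus h h' H GH cover g g' U gen a b split = record { all-good = all-good ; W-mult = W-mult }
      where
      all-good : ∀ u u' → Unit u u' → Good u u'
      all-good u u' V = from-cover (cover u u' V)
        where
        HH : Unit (h * h) (h' * h')
        HH = by ((h * h' + 1ℤ) ⊛ H) (solve (h ∷ h' ∷ []))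
        lemma : ∀ p p' r r' → p * r * (p' * r') - 1ℤ ≡ r * r' * (p * p' - 1ℤ) + (r * r' - 1ℤ)
        lemma p p' r r' = solve (p ∷ p' ∷ r ∷ r' ∷ [])
        from-cover : ∃[ i ] ∃[ r ] ∃[ r' ] Unit r r' × Good r r' × Q ∣ (h * h) ^ i * r - u → Good u u'
        from-cover (i , r , r' , R , G , d) = good-resp ((h * h) ^ i * r) ((h' * h') ^ i * r') u u' d (inverse-unique {(h * h) ^ i * r} {(h' * h') ^ i * r'} {u} {u'}
              (by ((r * r') ⊛ pow-unit (h * h) (h' * h') HH i ⊕ R) (lemma ((h * h) ^ i) ((h' * h') ^ i) r r')) V d) (good-scaled H GH i G)

      open Powers el g g' U (λ i → all-good (g ^ i) (g' ^ i) (pow-unit g g' U i)) hiding (units)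

      e : ℕ
      e = suc (double (b ℕ.+ a))

      double-+ : ∀ b a → double (b ℕ.+ a) ≡ double b ℕ.+ double a
      double-+ zero a = ≡.refl
      double-+ (suc b) a = ≡.cong (λ n → suc (suc n)) (double-+ b a)

      split′ : Q ∣ g' ^ double a + g' ^ suc (suc (double b)) - g' ^ e
      split′ = by ((g' * g' ^ suc (double b) * g' ^ double a) ⊛ split ⊕ (- (g' ^ double a)) ⊛ pow-unit g g' U (suc (suc (double b)))
          ⊕ (- (g' * g' ^ suc (double b))) ⊛ pow-unit g g' U (double a) ⊕ (g' ^ double a * g' ^ suc (double b)) ⊛ U)
          (≡.trans (≡.cong (λ n → g' ^ double a + g' ^ suc (suc (double b)) - g' * n) power) (lemma g g' (g ^ double a) (g' ^ double a) (g ^ suc (suc (double b))) (g' ^ suc (double b)) (g' ^ double b)))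
        where
        power : g' ^ double (b ℕ.+ a) ≡ g' ^ double b * g' ^ double a
        power = ≡.trans (≡.cong (g' ^_) (double-+ b a)) (^-distribˡ-+-* g' (double b) (double a))
        lemma : ∀ g g' A A' B B' C → A' + g' * (g' * C) - g' * (C * A') ≡
          g' * (g' * C) * A' * (A + B - g) + - A' * (B * (g' * (g' * C)) - 1ℤ) + - (g' * (g' * C)) * (A * A' - 1ℤ) + A' * (g' * C) * (g * g' - 1ℤ)
        lemma g g' A A' B B' C = solve (g ∷ g' ∷ A ∷ A' ∷ B ∷ B' ∷ C ∷ [])

      sum : w (double a) ∷ w e ⁻¹ ∷ w (suc (suc (double b))) ∷ [] ≋ w 1 ∷ []
      sum = weyl-sum (pow-unit g g' U (double a)) (pow-unit g g' U (suc (suc (double b)))) (pow-unit g g' U 1) (pow-unit g g' U e)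
        (all-good (g ^ (double a)) (g' ^ (double a)) (pow-unit g g' U (double a))) (all-good (g ^ (suc (suc (double b)))) (g' ^ (suc (suc (double b)))) (pow-unit g g' U (suc (suc (double b))))) (all-good (g ^ e) (g' ^ e) (pow-unit g g' U e))
        (by split (lemma (g ^ double a) (g ^ suc (suc (double b))) g)) split′
        where
        lemma : ∀ A B g → A + B - g * 1ℤ ≡ A + B - g
        lemma A B g = solve (A ∷ B ∷ g ∷ [])

      W-mult : ∀ u u' v v' → Unit u u' → Unit v v' → W u u' ∷ W 1ℤ 1ℤ ⁻¹ ∷ W v v' ∷ [] ≋ W (u * v) (u' * v') ∷ []
      W-mult u u' v v' S T = from-gen (gen u u' S) (gen v v' T)
        where
        lemma : ∀ p r u v → p * r - u * v ≡ r * (p - u) + u * (r - v)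
        lemma p r u v = solve (p ∷ r ∷ u ∷ v ∷ [])
        from-gen : ∃[ i ] Q ∣ g ^ i - u → ∃[ j ] Q ∣ g ^ j - v → W u u' ∷ W 1ℤ 1ℤ ⁻¹ ∷ W v v' ∷ [] ≋ W (u * v) (u' * v') ∷ []
        from-gen (i , d) (j , f) = at [] (flip (W-cong (g ^ i) (g' ^ i) u u' d (inverse-unique {g ^ i} {g' ^ i} {u} {u'} (pow-unit g g' U i) S d)))
            ⟫ at (_ ∷ _ ∷ []) (flip (W-cong (g ^ j) (g' ^ j) v v' f (inverse-unique {g ^ j} {g' ^ j} {v} {v'} (pow-unit g g' U j) T f)))
            ⟫ w-mult (σ-trivial a b sum) i j
            ⟫ W-cong (g ^ (i ℕ.+ j)) (g' ^ (i ℕ.+ j)) (u * v) (u' * v') c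
                (inverse-unique {g ^ (i ℕ.+ j)} {g' ^ (i ℕ.+ j)} {u * v} {u' * v'} (pow-unit g g' U (i ℕ.+ j)) (by ((u * u') ⊛ T ⊕ S) (solve (u ∷ u' ∷ v ∷ v' ∷ []))) c)
          where
          c : Q ∣ g ^ (i ℕ.+ j) - u * v
          c = by (g ^ j ⊛ d ⊕ u ⊛ f) (≡.trans (≡.cong (_- u * v) (^-distribˡ-+-* g i j)) (lemma (g ^ i) (g ^ j) u v))

    -- Here f records that -3/5 is a power of 9.
    dyadic-torus :
      ∀ i₃ → Unit (+ 3) i₃ → Good (+ 3) i₃ →
      (∀ u u' → Unit u u' → ∃[ i ] (Q ∣ (+ 3) ^ i - u ⊎ Q ∣ (+ 3) ^ i + u)) →
      ∀ i₅ → Unit (+ 5) i₅ → ∀ f → Q ∣ (+ 3) ^ double f + + 3 * i₅ →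
      W 1ℤ 1ℤ ∷ W 1ℤ 1ℤ ∷ W 1ℤ 1ℤ ∷ W 1ℤ 1ℤ ∷ [] ≋ [] →
      Torus el
    dyadic-torus i₃ U₃ G₃ gen i₅ U₅ f F s⁴ = record { all-good = all-good ; W-mult = W-mult }
      where
      pow = pow-unit (+ 3) i₃ U₃

      U₁ : Unit 1ℤ 1ℤ
      U₁ = self₀ ≡.refl

      3-good : ∀ i → Good ((+ 3) ^ i) (i₃ ^ i)
      3-good zero = good₁
      3-good (suc zero) = good-resp (+ 3) i₃ (+ 3 * 1ℤ) (i₃ * 1ℤ) (self₀ ≡.refl) (self₀ (solve (i₃ ∷ []))) G₃
      3-good (suc (suc i)) = good-resp (+ 3 * 1ℤ * (+ 3 * 1ℤ) * (+ 3) ^ i) (i₃ * 1ℤ * (i₃ * 1ℤ) * i₃ ^ i) ((+ 3) ^ suc (suc i)) (i₃ ^ suc (suc i))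
          (self₀ (lemma (+ 3) ((+ 3) ^ i))) (self₀ (lemma i₃ (i₃ ^ i)))
          (proj₂ (acts-weyl (ratio-acts U₁ good₁ U₃ G₃) (3-good i)))
        where
        lemma : ∀ h k → h * 1ℤ * (h * 1ℤ) * k - h * (h * k) ≡ 0ℤ
        lemma h k = solve (h ∷ k ∷ [])

      opposite : ∀ u u' → Unit u u' → ∀ i → Q ∣ (+ 3) ^ i + u → Q ∣ - (+ 3) ^ i - u × Q ∣ - i₃ ^ i - u'
      opposite u u' V i d = c , inverse-unique { - (+ 3) ^ i} { - i₃ ^ i} {u} {u'} (by (pow i) (lemma ((+ 3) ^ i) (i₃ ^ i))) V c
        where
        lemma : ∀ a b → - a * - b - 1ℤ ≡ a * b - 1ℤ
        lemma a b = solve (a ∷ b ∷ [])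
        lemma′ : ∀ a u → - a - u ≡ - 1ℤ * (a + u)
        lemma′ a u = solve (a ∷ u ∷ [])
        c : Q ∣ - (+ 3) ^ i - u
        c = by (- 1ℤ ⊛ d) (lemma′ ((+ 3) ^ i) u)

      all-good : ∀ u u' → Unit u u' → Good u u'
      all-good u u' V = from-gen (gen u u' V)
        where
        from-gen : ∃[ i ] (Q ∣ (+ 3) ^ i - u ⊎ Q ∣ (+ 3) ^ i + u) → Good u u'
        from-gen (i , inj₁ d) = good-resp ((+ 3) ^ i) (i₃ ^ i) u u' d (inverse-unique {(+ 3) ^ i} {i₃ ^ i} {u} {u'} (pow i) V d) (3-good i)
        from-gen (i , inj₂ d) = good-resp (- (+ 3) ^ i) (- i₃ ^ i) u u' (proj₁ (opposite u u' V i d)) (proj₂ (opposite u u' V i d)) (good-neg (pow i) (3-good i))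

      open Powers el (+ 3) i₃ U₃ 3-good hiding (units)

      W-pos : ∀ u u' → Unit u u' → ∀ i → Q ∣ (+ 3) ^ i - u → W u u' ∷ [] ≋ w i ∷ []
      W-pos u u' V i d = flip (W-cong ((+ 3) ^ i) (i₃ ^ i) u u' d (inverse-unique {(+ 3) ^ i} {i₃ ^ i} {u} {u'} (pow i) V d))

      W-opp : ∀ u u' → Unit u u' → ∀ i → Q ∣ (+ 3) ^ i + u → W u u' ∷ [] ≋ w i ⁻¹ ∷ []
      W-opp u u' V i d = flip (W-cong (- (+ 3) ^ i) (- i₃ ^ i) u u' (proj₁ (opposite u u' V i d)) (proj₂ (opposite u u' V i d))) ⟫ W-neg ((+ 3) ^ i) (i₃ ^ i)

      U₃′ : Unit i₃ (+ 3)
      U₃′ = by U₃ (solve (i₃ ∷ []))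

      Y = W (+ 3 * i₅) (+ 5 * i₃)

      UY : Unit (+ 3 * i₅) (+ 5 * i₃)
      UY = by ((+ 5 * i₅) ⊛ U₃ ⊕ U₅) (solve (i₃ ∷ i₅ ∷ []))

      Y-power : Y ∷ [] ≋ w (double f) ⁻¹ ∷ []
      Y-power = W-opp (+ 3 * i₅) (+ 5 * i₃) UY (double f) F

      -- Both sides are x(2) y(2).
      two-ways : y (+ 2 * i₃ * (+ 3 * i₅)) ∷ w 0 ∷ W (1ℤ * (+ 3 * i₅)) (1ℤ * (+ 5 * i₃)) ⁻¹ ∷ x (1ℤ * (+ 3 * i₅)) ∷ w 0 ∷ W (1ℤ * i₃) (1ℤ * + 3) ⁻¹ ∷ x (1ℤ * i₃) ∷ []
        ≋ y (- + 2 * - i₅) ∷ W (+ 3) i₃ ∷ W (+ 3 * - i₅) (i₃ * - + 5) ⁻¹ ∷ x (+ 3 * - i₅) ∷ W (- 1ℤ) (- 1ℤ) ∷ w 0 ⁻¹ ∷ x 1ℤ ∷ []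
      two-ways = flip (at (_ ∷ []) (swap 1ℤ 1ℤ (+ 2) (+ 3) i₃ U₁ U₃ (self₀ ≡.refl) good₁)
          ⟫ at [] (swap 1ℤ 1ℤ (+ 2 * i₃) (+ 5 * i₃) (+ 3 * i₅) U₁ (by UY (solve (i₃ ∷ i₅ ∷ []))) (by ((- 1ℤ) ⊛ U₃) (solve (i₃ ∷ []))) good₁))
        ⟫ at [] (x-sum 1ℤ 1ℤ (+ 2) (self₀ ≡.refl)) ⟫ at [] (flip (x-sum (+ 3) (- 1ℤ) (+ 2) (self₀ ≡.refl)))
        ⟫ at (_ ∷ []) (swap (- 1ℤ) (- 1ℤ) (+ 2) (- 1ℤ) (- 1ℤ) U₁ U₁ (self₀ ≡.refl) (good-neg U₁ good₁))
        ⟫ at [] (swap (+ 3) i₃ (- + 2) (- + 5) (- i₅) U₃ (by U₅ (solve (i₅ ∷ []))) (self₀ ≡.refl) G₃)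

      star : w 0 ∷ Y ⁻¹ ∷ w 0 ∷ W i₃ (+ 3) ⁻¹ ∷ [] ≋ w 1 ∷ Y ∷ w 0 ⁻¹ ∷ w 0 ⁻¹ ∷ []
      star = cancelʳ _ _ (x (+ 2 * i₅) ∷ []) (cancelˡ (y (+ 2 * i₅))
        (flip left ⟫ two-ways ⟫ right))
        where
        left : y (+ 2 * i₃ * (+ 3 * i₅)) ∷ w 0 ∷ W (1ℤ * (+ 3 * i₅)) (1ℤ * (+ 5 * i₃)) ⁻¹ ∷ x (1ℤ * (+ 3 * i₅)) ∷ w 0 ∷ W (1ℤ * i₃) (1ℤ * + 3) ⁻¹ ∷ x (1ℤ * i₃) ∷ []
          ≋ y (+ 2 * i₅) ∷ w 0 ∷ Y ⁻¹ ∷ w 0 ∷ W i₃ (+ 3) ⁻¹ ∷ x (+ 2 * i₅) ∷ []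
        left = at [] (ys (+ 2 * i₅) {+ 2 * i₃ * (+ 3 * i₅)} (by ((+ 2 * i₅) ⊛ U₃) (solve (i₃ ∷ i₅ ∷ []))))
          ⟫ at (_ ∷ _ ∷ []) (inv-letter (W-cong (1ℤ * (+ 3 * i₅)) (1ℤ * (+ 5 * i₃)) (+ 3 * i₅) (+ 5 * i₃) (self₀ (solve (i₅ ∷ []))) (self₀ (solve (i₃ ∷ [])))))
          ⟫ at (_ ∷ _ ∷ _ ∷ []) (xW U₁ good₁ (1ℤ * (+ 3 * i₅)) (- (+ 3 * i₅)) (self₀ (solve (i₅ ∷ []))))
          ⟫ at (_ ∷ _ ∷ _ ∷ _ ∷ _ ∷ []) (inv-letter (W-cong (1ℤ * i₃) (1ℤ * + 3) i₃ (+ 3) (self₀ (solve (i₃ ∷ []))) (self₀ ≡.refl)))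
          ⟫ at (_ ∷ _ ∷ _ ∷ _ ∷ []) (yW⁻¹ U₃′ (all-good i₃ (+ 3) U₃′) (- (+ 3 * i₅)) (i₃ * i₅) (by ((- (i₃ * i₅)) ⊛ U₃) (solve (i₃ ∷ i₅ ∷ []))))
          ⟫ at (_ ∷ _ ∷ _ ∷ _ ∷ _ ∷ []) (x-sum (i₃ * i₅) (1ℤ * i₃) (+ 2 * i₅) (by ((+ 2 * i₅) ⊛ U₃ ⊕ (- i₃) ⊛ U₅) (solve (i₃ ∷ i₅ ∷ []))))
        right : y (- + 2 * - i₅) ∷ W (+ 3) i₃ ∷ W (+ 3 * - i₅) (i₃ * - + 5) ⁻¹ ∷ x (+ 3 * - i₅) ∷ W (- 1ℤ) (- 1ℤ) ∷ w 0 ⁻¹ ∷ x 1ℤ ∷ []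
          ≋ y (+ 2 * i₅) ∷ w 1 ∷ Y ∷ w 0 ⁻¹ ∷ w 0 ⁻¹ ∷ x (+ 2 * i₅) ∷ []
        right = at [] (ys (+ 2 * i₅) { - + 2 * - i₅} (self₀ (solve (i₅ ∷ []))))
          ⟫ at (_ ∷ []) (W-cong (+ 3) i₃ (+ 3 * 1ℤ) (i₃ * 1ℤ) (self₀ ≡.refl) (self₀ (solve (i₃ ∷ []))))
          ⟫ at (_ ∷ _ ∷ []) (flip (W-neg (+ 3 * - i₅) (i₃ * - + 5)) ⟫ W-cong (- (+ 3 * - i₅)) (- (i₃ * - + 5)) (+ 3 * i₅) (+ 5 * i₃) (self₀ (solve (i₅ ∷ []))) (self₀ (solve (i₃ ∷ []))))
          ⟫ at (_ ∷ _ ∷ _ ∷ _ ∷ []) (W-neg 1ℤ 1ℤ)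
          ⟫ at (_ ∷ _ ∷ _ ∷ []) (xW⁻¹ U₁ good₁ (+ 3 * - i₅) (+ 3 * i₅) (self₀ (solve (i₅ ∷ []))))
          ⟫ at (_ ∷ _ ∷ _ ∷ _ ∷ []) (yW⁻¹ U₁ good₁ (+ 3 * i₅) (- (+ 3 * i₅)) (self₀ (solve (i₅ ∷ []))))
          ⟫ at (_ ∷ _ ∷ _ ∷ _ ∷ _ ∷ []) (x-sum (- (+ 3 * i₅)) 1ℤ (+ 2 * i₅) (by ((- 1ℤ) ⊛ U₅) (solve (i₅ ∷ []))))

      W₃⁻¹ : W i₃ (+ 3) ⁻¹ ∷ [] ≋ w 0 ∷ w 1 ⁻¹ ∷ w 0 ⁻¹ ∷ []
      W₃⁻¹ = flip (moveˡ (W i₃ (+ 3)) (at [] (flip (W-transpose {+ 3} {i₃} U₃′ (all-good i₃ (+ 3) U₃′)))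
        ⟫ at (_ ∷ []) (W-cong (+ 3) i₃ (+ 3 * 1ℤ) (i₃ * 1ℤ) (self₀ ≡.refl) (self₀ (solve (i₃ ∷ [])))) ⟫ at (_ ∷ []) invʳ ⟫ invʳ))

      relation : w 0 ∷ w (double f) ∷ w 0 ∷ w 0 ∷ w 1 ⁻¹ ∷ w 0 ∷ w (double f) ∷ [] ≋ w 1 ∷ []
      relation = cancelʳ _ (w 1 ∷ []) (w (double f) ⁻¹ ∷ w 0 ⁻¹ ∷ w 0 ⁻¹ ∷ [])
        (at (_ ∷ _ ∷ _ ∷ _ ∷ _ ∷ _ ∷ []) invʳ ⟫ at (_ ∷ _ ∷ _ ∷ _ ∷ _ ∷ []) invʳ
        ⟫ at (_ ∷ _ ∷ _ ∷ []) (flip W₃⁻¹)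
        ⟫ at (_ ∷ []) (letter (sym (⁻¹-involutive _)) ⟫ inv-letter (flip Y-power)) ⟫ star ⟫ at (_ ∷ []) Y-power)

      σ≋ε : σ ∷ [] ≋ []
      σ≋ε = σ-trivial₂ f s⁴ relation

      ss : s ∷ s ∷ [] ≋ []
      ss = at [] (flip (pack (w 0 ∷ w 0 ∷ []))) ⟫ at (_ ∷ _ ∷ []) (flip (pack (w 0 ∷ w 0 ∷ []))) ⟫ s⁴

      s-w : ∀ i → s ∷ w i ∷ [] ≋ w i ∷ s ∷ []
      s-w i = central-W s-central _ _

      s-w₀⁻¹ : s ∷ w 0 ⁻¹ ∷ [] ≋ w 0 ⁻¹ ∷ s ∷ []
      s-w₀⁻¹ = central-⁻¹ (s-w 0)

      square : ∀ i → w i ∷ w i ∷ [] ≋ s ∷ []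
      square zero = pack (w 0 ∷ w 0 ∷ [])
      square (suc i) = cancelʳ (w (suc i) ∷ w (suc i) ∷ []) (s ∷ []) (t ∷ [])
        (at (_ ∷ []) step ⟫ at [] (flip (t-step σ≋ε i)) ⟫ at (_ ∷ []) (square i) ⟫ flip (central-t s-central))
        where
        step : w (suc i) ∷ t ∷ [] ≋ w i ∷ []
        step = cancelˡ t (at [] (t-step σ≋ε (suc i)) ⟫ flip (tw i) ⟫ rfl)

      w⁻¹ : ∀ i → w i ⁻¹ ∷ [] ≋ s ∷ w i ∷ []
      w⁻¹ i = flip (moveˡ (w i) (at [] (flip (s-w i)) ⟫ at (_ ∷ []) (square i) ⟫ ss))

      W-mult : ∀ u u' v v' → Unit u u' → Unit v v' → W u u' ∷ W 1ℤ 1ℤ ⁻¹ ∷ W v v' ∷ [] ≋ W (u * v) (u' * v') ∷ []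
      W-mult u u' v v' S T = from-gen (gen u u' S) (gen v v' T)
        where
        UV : Unit (u * v) (u' * v')
        UV = by ((u * u') ⊛ T ⊕ S) (solve (u ∷ u' ∷ v ∷ v' ∷ []))
        3^+ : ∀ i j → (+ 3) ^ (i ℕ.+ j) ≡ (+ 3) ^ i * (+ 3) ^ j
        3^+ = ^-distribˡ-+-* (+ 3)
        pp : ∀ p r → p * r - u * v ≡ r * (p - u) + u * (r - v)
        pp p r = solve (p ∷ r ∷ u ∷ v ∷ [])
        np : ∀ p r → p * r + u * v ≡ r * (p + u) + (- u) * (r - v)
        np p r = solve (p ∷ r ∷ u ∷ v ∷ [])
        pn : ∀ p r → p * r + u * v ≡ r * (p - u) + u * (r + v)
        pn p r = solve (p ∷ r ∷ u ∷ v ∷ [])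
        nn : ∀ p r → p * r - u * v ≡ r * (p + u) + (- u) * (r + v)
        nn p r = solve (p ∷ r ∷ u ∷ v ∷ [])
        from-gen : ∃[ i ] (Q ∣ (+ 3) ^ i - u ⊎ Q ∣ (+ 3) ^ i + u) → ∃[ j ] (Q ∣ (+ 3) ^ j - v ⊎ Q ∣ (+ 3) ^ j + v) →
          W u u' ∷ W 1ℤ 1ℤ ⁻¹ ∷ W v v' ∷ [] ≋ W (u * v) (u' * v') ∷ []
        from-gen (i , inj₁ d) (j , inj₁ e) = at [] (W-pos u u' S i d) ⟫ at (_ ∷ _ ∷ []) (W-pos v v' T j e) ⟫ w-mult σ≋ε i j
          ⟫ flip (W-pos (u * v) (u' * v') UV (i ℕ.+ j) (by ((+ 3) ^ j ⊛ d ⊕ u ⊛ e) (≡.trans (≡.cong (_- u * v) (3^+ i j)) (pp ((+ 3) ^ i) ((+ 3) ^ j)))))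
        from-gen (i , inj₂ d) (j , inj₁ e) = at [] (W-opp u u' S i d ⟫ w⁻¹ i) ⟫ at (_ ∷ _ ∷ _ ∷ []) (W-pos v v' T j e) ⟫ at (_ ∷ []) (w-mult σ≋ε i j)
          ⟫ flip (W-opp (u * v) (u' * v') UV (i ℕ.+ j) (by ((+ 3) ^ j ⊛ d ⊕ (- u) ⊛ e) (≡.trans (≡.cong (_+ u * v) (3^+ i j)) (np ((+ 3) ^ i) ((+ 3) ^ j)))) ⟫ w⁻¹ (i ℕ.+ j))
        from-gen (i , inj₁ d) (j , inj₂ e) = at [] (W-pos u u' S i d) ⟫ at (_ ∷ _ ∷ []) (W-opp v v' T j e ⟫ w⁻¹ j) ⟫ at (_ ∷ []) (flip s-w₀⁻¹) ⟫ at [] (flip (s-w i))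
          ⟫ at (_ ∷ []) (w-mult σ≋ε i j)
          ⟫ flip (W-opp (u * v) (u' * v') UV (i ℕ.+ j) (by ((+ 3) ^ j ⊛ d ⊕ u ⊛ e) (≡.trans (≡.cong (_+ u * v) (3^+ i j)) (pn ((+ 3) ^ i) ((+ 3) ^ j)))) ⟫ w⁻¹ (i ℕ.+ j))
        from-gen (i , inj₂ d) (j , inj₂ e) = at [] (W-opp u u' S i d ⟫ w⁻¹ i) ⟫ at (_ ∷ _ ∷ _ ∷ []) (W-opp v v' T j e ⟫ w⁻¹ j) ⟫ at (_ ∷ _ ∷ []) (flip s-w₀⁻¹)
          ⟫ at (_ ∷ []) (flip (s-w i)) ⟫ at [] ss ⟫ w-mult σ≋ε i j
          ⟫ flip (W-pos (u * v) (u' * v') UV (i ℕ.+ j) (by ((+ 3) ^ j ⊛ d ⊕ (- u) ⊛ e) (≡.trans (≡.cong (_- u * v) (3^+ i j)) (nn ((+ 3) ^ i) ((+ 3) ^ j)))))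

module PrimePowers where
  open ElementaryRelations using (_⊛_; _⊕_; by)
  open NormalForms using (LocalRing)
  open import Data.List using ([]; _∷_)
  open import Data.Nat as ℕ using (ℕ; zero; suc; NonZero)
  import Data.Nat.Properties as ℕP
  import Data.Nat.Divisibility as ℕD
  open import Data.Nat.Primality using (Prime; euclidsLemma; prime⇒nonZero; prime⇒nonTrivial)
  open import Data.Nat.Coprimality using (Coprime; prime⇒coprime)
  open import Data.Nat.GCD using (module Bézout; GCD)
  open import Data.Integer as ℤ using (ℤ; +_; _+_; _*_; _-_; -_; _^_; 0ℤ; 1ℤ)
  import Data.Integer.Properties as ℤP
  open import Data.Integer.DivMod using (_%ℕ_; _/ℕ_; a≡a%ℕn+[a/ℕn]*n; n%ℕd<d)
  open import Data.Integer.Divisibility.Signed using (_∣_; divides; ∣⇒∣ᵤ; ∣ᵤ⇒∣; ∣-trans; _∣?_)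
  open import Data.Integer.Tactic.RingSolver using (solve)
  open import Data.Product using (_×_; _,_; proj₁; proj₂; ∃-syntax)
  open import Data.Sum using (_⊎_; inj₁; inj₂; [_,_]′)
  open import Data.Empty using (⊥; ⊥-elim)
  open import Relation.Nullary using (¬_; yes; no; contradiction)
  open import Relation.Binary.PropositionalEquality using (_≡_; refl; sym; trans; cong; cong₂; subst)

  pos-eq : ∀ s t a b → 1 ℕ.+ t ℕ.* b ≡ s ℕ.* a → + s * + a ≡ 1ℤ + + t * + b
  pos-eq s t a b e = trans (sym (ℤP.pos-* s a)) (trans (cong +_ (sym e)) (cong (λ z → 1ℤ + z) (ℤP.pos-* t b)))

  bézout : ∀ a b → Coprime a b → ∃[ u ] ∃[ v ] u * + a + v * + b ≡ 1ℤ
  bézout a b c = from (Bézout.lemma a b)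
    where
    l₁ : ∀ t b → 1ℤ + t * b + - t * b ≡ 1ℤ
    l₁ t b = solve (t ∷ b ∷ [])
    l₂ : ∀ t b → - t * b + (1ℤ + t * b) ≡ 1ℤ
    l₂ t b = solve (t ∷ b ∷ [])
    go : ∀ {d} → d ≡ 1 → Bézout.Identity d a b → ∃[ u ] ∃[ v ] u * + a + v * + b ≡ 1ℤ
    go refl (Bézout.+- s t e) = + s , - (+ t) , trans (cong (λ m → m + - (+ t) * + b) (pos-eq s t a b e)) (l₁ (+ t) (+ b))
    go refl (Bézout.-+ s t e) = - (+ s) , + t , trans (cong (λ m → - (+ s) * + a + m) (pos-eq t s b a e)) (l₂ (+ s) (+ a))
    from : Bézout.Lemma a b → ∃[ u ] ∃[ v ] u * + a + v * + b ≡ 1ℤ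
    from (Bézout.result d g i) = go (c (GCD.commonDivisor g)) i

  power-one : ∀ {Q} a → Q ∣ a - 1ℤ → ∀ i → Q ∣ a ^ i - 1ℤ
  power-one {Q} a d zero = divides 0ℤ refl
  power-one {Q} a d (suc i) = by (a ^ i ⊛ d ⊕ power-one a d i) (lemma a (a ^ i))
    where
    lemma : ∀ a p → a * p - 1ℤ ≡ p * (a - 1ℤ) + (p - 1ℤ)
    lemma a p = solve (a ∷ p ∷ [])

  power-cong : ∀ {Q} a b → Q ∣ a - b → ∀ i → Q ∣ a ^ i - b ^ i
  power-cong a b d zero = divides 0ℤ refl
  power-cong a b d (suc i) = by (a ^ i ⊛ d ⊕ b ⊛ power-cong a b d i) (lemma a b (a ^ i) (b ^ i))
    where
    lemma : ∀ a b p q → a * p - b * q ≡ p * (a - b) + b * (p - q)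
    lemma a b p q = solve (a ∷ b ∷ p ∷ q ∷ [])

  triangle : ℕ → ℕ
  triangle zero = zero
  triangle (suc m) = triangle m ℕ.+ m

  -- (1 + x)^m up to third order, with the binomial coefficient m(m-1)/2 as a triangular number.
  binomial₃ : ∀ x m → ∃[ c ] (1ℤ + x) ^ m ≡ 1ℤ + + m * x + + triangle m * (x * x) + c * (x * x * x)
  binomial₃ x zero = 0ℤ , solve (x ∷ [])
  binomial₃ x (suc m) with binomial₃ x m
  ... | c , e = + triangle m + c + c * x , trans (cong ((1ℤ + x) *_) e) (trans (lemma x (+ m) (+ triangle m) c)
      (cong (λ q → 1ℤ + + suc m * x + q * (x * x) + (+ triangle m + c + c * x) * (x * x * x)) (sym (ℤP.pos-+ (triangle m) m))))
    where
    lemma : ∀ x m t c → (1ℤ + x) * (1ℤ + m * x + t * (x * x) + c * (x * x * x))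
      ≡ 1ℤ + (1ℤ + m) * x + (t + m) * (x * x) + (t + c + c * x) * (x * x * x)
    lemma x m t c = solve (x ∷ m ∷ t ∷ c ∷ [])

  2triangle : ∀ m → + 2 * + triangle m ≡ + m * (+ m - 1ℤ)
  2triangle zero = refl
  2triangle (suc m) = trans (cong (+ 2 *_) (ℤP.pos-+ (triangle m) m)) (trans (lemma (+ triangle m) (+ m)) (trans (cong (_+ + 2 * + m) (2triangle m)) (lemma′ (+ m))))
    where
    lemma : ∀ t m → + 2 * (t + m) ≡ + 2 * t + + 2 * m
    lemma t m = solve (t ∷ m ∷ [])
    lemma′ : ∀ m → m * (m - 1ℤ) + + 2 * m ≡ (1ℤ + m) * (1ℤ + m - 1ℤ)
    lemma′ m = solve (m ∷ [])

  module PrimeModulus {p : ℕ} (prime : Prime p) where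
    P : ℤ
    P = + p

    instance
      p-nonZero : NonZero p
      p-nonZero = prime⇒nonZero prime

    euclid : ∀ a b → P ∣ a * b → P ∣ a ⊎ P ∣ b
    euclid a b d = [ (λ e → inj₁ (∣ᵤ⇒∣ e)) , (λ e → inj₂ (∣ᵤ⇒∣ e)) ]′
      (euclidsLemma ℤ.∣ a ∣ ℤ.∣ b ∣ prime (subst (p ℕD.∣_) (ℤP.abs-* a b) (∣⇒∣ᵤ d)))

    P∤1 : ¬ P ∣ 1ℤ
    P∤1 d = contradiction (ℕD.∣1⇒≡1 (∣⇒∣ᵤ d)) (ℕP.>⇒≢ (ℕ.nonTrivial⇒n>1 p {{prime⇒nonTrivial prime}}))

    invert₁ : ∀ a → ¬ P ∣ a → ∃[ a' ] P ∣ a * a' - 1ℤ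
    invert₁ a P∤a = from (bézout p (a %ℕ p) (prime⇒coprime prime {{ℕ.≢-nonZero r≢0}} (n%ℕd<d a p)))
      where
      r≢0 : a %ℕ p ≡ 0 → ⊥
      r≢0 e = P∤a (divides (a /ℕ p) (trans (a≡a%ℕn+[a/ℕn]*n a p) (trans (cong (λ s → + s + a /ℕ p * P) e) (ℤP.+-identityˡ _))))
      lemma : ∀ r t u v P → (r + t * P) * v - 1ℤ ≡ (t * v - u) * P + (u * P + v * r - 1ℤ)
      lemma r t u v P = solve (r ∷ t ∷ u ∷ v ∷ P ∷ [])
      from : ∃[ u ] ∃[ v ] u * P + v * + (a %ℕ p) ≡ 1ℤ → ∃[ a' ] P ∣ a * a' - 1ℤ
      from (u , v , e) = v , divides (a /ℕ p * v - u) (trans (cong (λ b → b * v - 1ℤ) (a≡a%ℕn+[a/ℕn]*n a p))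
        (trans (lemma (+ (a %ℕ p)) (a /ℕ p) u v P) (trans (cong (λ z → (a /ℕ p * v - u) * P + (z - 1ℤ)) e) (ℤP.+-identityʳ _))))

    invert : ∀ k a → ¬ P ∣ a → ∃[ a' ] P ^ k ∣ a * a' - 1ℤ
    invert zero a P∤a = 1ℤ , divides (a * 1ℤ - 1ℤ) (sym (ℤP.*-identityʳ _))
    invert (suc k) a P∤a = from (invert₁ a P∤a) (invert k a P∤a)
      where
      lemma : ∀ a b c → a * (b + c - a * b * c) - 1ℤ ≡ - ((a * b - 1ℤ) * (a * c - 1ℤ))
      lemma a b c = solve (a ∷ b ∷ c ∷ [])
      lemma′ : ∀ q r P R → - (q * P * (r * R)) ≡ - (q * r) * (P * R)
      lemma′ q r P R = solve (q ∷ r ∷ P ∷ R ∷ [])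
      from : ∃[ b ] P ∣ a * b - 1ℤ → ∃[ c ] P ^ k ∣ a * c - 1ℤ → ∃[ d ] P ^ suc k ∣ a * d - 1ℤ
      from (b , divides q e) (c , divides r f) = b + c - a * b * c
        , divides (- (q * r)) (trans (lemma a b c) (trans (cong₂ (λ x y → - (x * y)) e f) (lemma′ q r P (P ^ k))))

    P∣P* : ∀ z → P ∣ P * z
    P∣P* z = divides z (ℤP.*-comm P z)

    P∣P^ : ∀ k → P ∣ P ^ suc k
    P∣P^ k = divides (P ^ k) (ℤP.*-comm P (P ^ k))

    P^-mono : ∀ {k l} → k ℕ.≤ l → P ^ k ∣ P ^ l
    P^-mono {k} {l} k≤l = divides (P ^ (l ℕ.∸ k)) (trans (cong (P ^_) (sym (ℕP.m∸n+n≡m k≤l))) (ℤP.^-distribˡ-+-* P (l ℕ.∸ k) k))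

    unit⇒∤ : ∀ k a a' → P ^ suc k ∣ a * a' - 1ℤ → ¬ P ∣ a
    unit⇒∤ k a a' d f = P∤1 (by (a' ⊛ f ⊕ - 1ℤ ⊛ ∣-trans (P∣P^ k) d) (solve (a ∷ a' ∷ [])))

    localRing : ∀ k → LocalRing (P ^ suc k)
    localRing k = record
      { decide = decide
      ; nonunit = λ a b ¬A ¬B r s → λ { (c , C) → unit⇒∤ k (r * a + s * b) c C (r ⊛ divisible a ¬A ⊕ s ⊛ divisible b ¬B) }
      ; nontrivial = λ d → P∤1 (∣-trans (P∣P^ k) d) }
      where
      decide : ∀ a → (∃[ a' ] P ^ suc k ∣ a * a' - 1ℤ) ⊎ ¬ (∃[ a' ] P ^ suc k ∣ a * a' - 1ℤ)
      decide a with P ∣? a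
      ... | yes d = inj₂ λ { (a' , A) → unit⇒∤ k a a' A d }
      ... | no P∤a = inj₁ (invert (suc k) a P∤a)
      divisible : ∀ a → ¬ (∃[ a' ] P ^ suc k ∣ a * a' - 1ℤ) → P ∣ a
      divisible a ¬A with P ∣? a
      ... | yes d = d
      ... | no P∤a = ⊥-elim (¬A (invert (suc k) a P∤a))

    ∤-* : ∀ a b → ¬ P ∣ a → ¬ P ∣ b → ¬ P ∣ a * b
    ∤-* a b P∤a P∤b d = [ P∤a , P∤b ]′ (euclid a b d)

    ∤-^ : ∀ a → ¬ P ∣ a → ∀ i → ¬ P ∣ a ^ i
    ∤-^ a P∤a zero = P∤1
    ∤-^ a P∤a (suc i) = ∤-* a (a ^ i) P∤a (∤-^ a P∤a i)

    ∤-shift : ∀ a b → ¬ P ∣ a → P ∣ b → ¬ P ∣ a + b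
    ∤-shift a b P∤a d f = P∤a (by (f ⊕ - 1ℤ ⊛ d) (solve (a ∷ b ∷ [])))

    natural-residue : ∀ a → ∃[ s ] P ∣ + s - a
    natural-residue a = a %ℕ p , divides (- (a /ℕ p)) (trans (cong (λ z → + (a %ℕ p) - z) (a≡a%ℕn+[a/ℕn]*n a p)) (lemma (+ (a %ℕ p)) (a /ℕ p) P))
      where
      lemma : ∀ r t P → r - (r + t * P) ≡ - t * P
      lemma r t P = solve (r ∷ t ∷ P ∷ [])

    -- The p-th power of 1 + p^m c raises m by exactly one; for p = 2 this needs m ≥ 2.
    p-power : ∀ m c → ¬ P ∣ c → P ∣ + triangle p ⊎ (∃[ m' ] m ≡ suc m') →
      ∃[ c' ] ¬ P ∣ c' × (1ℤ + P ^ suc m * c) ^ p ≡ 1ℤ + P ^ suc (suc m) * c'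
    p-power m c P∤c cond with binomial₃ (P ^ suc m * c) p
    p-power m c P∤c (inj₁ (divides t e)) | d , f = c + P * (t * (c * c) * R + d * (c * c * c) * (R * R))
        , ∤-shift c _ P∤c (P∣P* (t * (c * c) * R + d * (c * c * c) * (R * R)))
        , trans f (trans (cong (λ z → 1ℤ + P * (P * R * c) + z * (P * R * c * (P * R * c)) + d * (P * R * c * (P * R * c) * (P * R * c))) e) (lemma P R c t d))
      where
      R = P ^ m
      lemma : ∀ P R c t d → 1ℤ + P * (P * R * c) + t * P * (P * R * c * (P * R * c)) + d * (P * R * c * (P * R * c) * (P * R * c))
        ≡ 1ℤ + P * (P * R) * (c + P * (t * (c * c) * R + d * (c * c * c) * (R * R)))
      lemma P R c t d = solve (P ∷ R ∷ c ∷ t ∷ d ∷ [])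
    p-power m c P∤c (inj₂ (m' , refl)) | d , f = c + P * (+ triangle p * (R * (c * c)) + d * (P * P * (R * R) * (c * c * c)))
        , ∤-shift c _ P∤c (P∣P* (+ triangle p * (R * (c * c)) + d * (P * P * (R * R) * (c * c * c))))
        , trans f (lemma P R c (+ triangle p) d)
      where
      R = P ^ m'
      lemma : ∀ P R c t d → 1ℤ + P * (P * (P * R) * c) + t * (P * (P * R) * c * (P * (P * R) * c)) + d * (P * (P * R) * c * (P * (P * R) * c) * (P * (P * R) * c))
        ≡ 1ℤ + P * (P * (P * R)) * (c + P * (t * (R * (c * c)) + d * (P * P * (R * R) * (c * c * c))))
      lemma P R c t d = solve (P ∷ R ∷ c ∷ t ∷ d ∷ [])

    module Principal (e : ℕ) (c : ℤ) (P∤c : ¬ P ∣ c) (cond : P ∣ + triangle p ⊎ (∃[ e' ] e ≡ suc e')) where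
      γ : ℤ
      γ = 1ℤ + P ^ suc e * c

      γ-power : ∀ j → ∃[ c' ] ¬ P ∣ c' × γ ^ (p ℕ.^ j) ≡ 1ℤ + P ^ suc (e ℕ.+ j) * c'
      γ-power zero = c , P∤c , trans (ℤP.*-identityʳ γ) (cong (λ n → 1ℤ + P ^ suc n * c) (sym (ℕP.+-identityʳ e)))
      γ-power (suc j) = step (γ-power j)
        where
        step : ∃[ c' ] ¬ P ∣ c' × γ ^ (p ℕ.^ j) ≡ 1ℤ + P ^ suc (e ℕ.+ j) * c' → ∃[ c' ] ¬ P ∣ c' × γ ^ (p ℕ.^ suc j) ≡ 1ℤ + P ^ suc (e ℕ.+ suc j) * c'
        step (c' , P∤c' , f) = c″ , P∤c″ , trans (cong (γ ^_) (ℕP.*-comm p (p ℕ.^ j))) (trans (sym (ℤP.^-*-assoc γ (p ℕ.^ j) p))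
            (trans (cong (_^ p) f) (trans h (cong (λ n → 1ℤ + P ^ suc n * c″) (sym (ℕP.+-suc e j))))))
          where
          next = p-power (e ℕ.+ j) c' P∤c' ([ inj₁ , (λ { (e' , refl) → inj₂ (e' ℕ.+ j , refl) }) ]′ cond)
          c″ = proj₁ next
          P∤c″ = proj₁ (proj₂ next)
          h = proj₂ (proj₂ next)

      P∤γ : ¬ P ∣ γ
      P∤γ = ∤-shift 1ℤ (P ^ suc e * c) P∤1 (divides (P ^ e * c) (lemma P (P ^ e) c))
        where
        lemma : ∀ P R c → P * R * c ≡ R * c * P
        lemma P R c = solve (P ∷ R ∷ c ∷ [])

      approximate : ∀ u → P ^ suc e ∣ u - 1ℤ → ∀ j → ∃[ i ] P ^ suc (e ℕ.+ j) ∣ γ ^ i - u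
      approximate u d zero = 0 , subst (λ n → P ^ suc n ∣ 1ℤ - u) (sym (ℕP.+-identityʳ e)) (by (- 1ℤ ⊛ d) (solve (u ∷ [])))
      approximate u d (suc j) = step (approximate u d j) (γ-power j)
        where
        R = P ^ (e ℕ.+ j)
        X = P * R
        identity : ∀ G s t w δ u c X → G - u ≡ δ * X → G * (1ℤ + s * (X * c) + t * (X * c * (X * c)) + w * (X * c * (X * c) * (X * c))) - u
          ≡ X * (δ + G * c * s) + G * c * c * (t + w * (X * c)) * (X * X)
        identity G s t w δ u c X q = trans (lemma G s t w u c X) (trans (cong (λ z → z + X * (G * c * s) + G * c * c * (t + w * (X * c)) * (X * X)) q) (lemma′ G s t w δ c X))
          where
          lemma : ∀ G s t w u c X → G * (1ℤ + s * (X * c) + t * (X * c * (X * c)) + w * (X * c * (X * c) * (X * c))) - u ≡ (G - u) + X * (G * c * s) + G * c * c * (t + w * (X * c)) * (X * X)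
          lemma G s t w u c X = solve (G ∷ s ∷ t ∷ w ∷ u ∷ c ∷ X ∷ [])
          lemma′ : ∀ G s t w δ c X → δ * X + X * (G * c * s) + G * c * c * (t + w * (X * c)) * (X * X) ≡ X * (δ + G * c * s) + G * c * c * (t + w * (X * c)) * (X * X)
          lemma′ G s t w δ c X = solve (G ∷ s ∷ t ∷ w ∷ δ ∷ c ∷ X ∷ [])
        times-X : ∀ {z} → P ∣ z → P * X ∣ X * z
        times-X {z} (divides r refl) = divides r (lemma X r P)
          where
          lemma : ∀ X r P → X * (r * P) ≡ r * (P * X)
          lemma X r P = solve (X ∷ r ∷ P ∷ [])
        lemma : ∀ δ g s v → δ + g * s ≡ g * (s - - δ * v) + - δ * (g * v - 1ℤ)
        lemma δ g s v = solve (δ ∷ g ∷ s ∷ v ∷ [])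
        step : ∃[ i ] X ∣ γ ^ i - u → ∃[ c' ] ¬ P ∣ c' × γ ^ (p ℕ.^ j) ≡ 1ℤ + X * c' → ∃[ i ] P ^ suc (e ℕ.+ suc j) ∣ γ ^ i - u
        step (i , divides δ f) (c' , P∤c' , h) = with-inverse (invert₁ (G * c') (∤-* G c' (∤-^ γ P∤γ i) P∤c'))
          where
          G = γ ^ i
          with-inverse : ∃[ v ] P ∣ G * c' * v - 1ℤ → ∃[ i ] P ^ suc (e ℕ.+ suc j) ∣ γ ^ i - u
          with-inverse (v , V) = with-residue (natural-residue (- δ * v))
            where
            with-residue : ∃[ s ] P ∣ + s - - δ * v → ∃[ i ] P ^ suc (e ℕ.+ suc j) ∣ γ ^ i - u
            with-residue (s , S) = with-expansion (binomial₃ (X * c') s)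
              where
              with-expansion : ∃[ w ] (1ℤ + X * c') ^ s ≡ 1ℤ + + s * (X * c') + + triangle s * (X * c' * (X * c')) + w * (X * c' * (X * c') * (X * c')) →
                ∃[ i ] P ^ suc (e ℕ.+ suc j) ∣ γ ^ i - u
              with-expansion (w , b) = i ℕ.+ p ℕ.^ j ℕ.* s , subst (λ n → P ^ suc n ∣ γ ^ (i ℕ.+ p ℕ.^ j ℕ.* s) - u) (sym (ℕP.+-suc e j))
                  (by (times-X linear ⊕ (G * c' * c' * (+ triangle s + w * (X * c'))) ⊛ times-X (divides R (ℤP.*-comm P R)))
                    (trans (cong (_- u) expand) (identity G (+ s) (+ triangle s) w δ u c' X f)))
                where
                expand : γ ^ (i ℕ.+ p ℕ.^ j ℕ.* s) ≡ G * (1ℤ + + s * (X * c') + + triangle s * (X * c' * (X * c')) + w * (X * c' * (X * c') * (X * c')))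
                expand = trans (ℤP.^-distribˡ-+-* γ i (p ℕ.^ j ℕ.* s)) (cong (G *_) (trans (sym (ℤP.^-*-assoc γ (p ℕ.^ j) s)) (trans (cong (_^ s) h) b)))
                linear : P ∣ δ + G * c' * + s
                linear = by ((G * c') ⊛ S ⊕ (- δ) ⊛ V) (lemma δ (G * c') (+ s) v)

      principal : ∀ u → P ^ suc e ∣ u - 1ℤ → ∀ k → ∃[ i ] P ^ k ∣ γ ^ i - u
      principal u d k = proj₁ (approximate u d k) , ∣-trans (P^-mono (ℕP.≤-trans (ℕP.m≤n+m k e) (ℕP.n≤1+n _))) (proj₂ (approximate u d k))

module PrimitiveRoots where
  open ElementaryRelations using (_⊛_; _⊕_; by)
  open PrimePowers
  open import Data.List using (List; []; _∷_; length; replicate)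
  open import Data.List.Properties using (length-replicate)
  open import Data.List.Relation.Unary.All as All using (All)
  open import Data.Nat as ℕ using (ℕ; zero; suc; z≤n; s≤s; _≤_; _<_)
  import Data.Nat.Properties as ℕP
  import Data.Nat.Divisibility as ℕD
  open import Data.Nat.Induction using (<-rec)
  open import Data.Nat.Primality using (Prime; prime⇒nonZero; prime⇒nonTrivial; prime⇒irreducible)
  open import Data.Nat.Primality.Factorisation using (factorise; PrimeFactorisation)
  open import Data.Nat.Coprimality as Cop using (Coprime; coprime-divisor)
  open import Data.Nat.GCD using (module Bézout; GCD)
  open import Data.Integer using (ℤ; +_; _+_; _*_; _-_; -_; _^_; 0ℤ; 1ℤ)
  import Data.Integer.Properties as ℤP
  open import Data.Integer.Divisibility.Signed using (_∣_; divides; ∣⇒∣ᵤ; ∣-trans; _∣?_)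
  open import Data.Integer.Tactic.RingSolver using (solve)
  open import Data.Product using (_×_; _,_; proj₁; proj₂; ∃-syntax)
  open import Data.Sum using (_⊎_; inj₁; inj₂; [_,_]′)
  open import Data.Empty using (⊥; ⊥-elim)
  open import Relation.Nullary using (¬_; yes; no; contradiction)
  open import Relation.Binary.PropositionalEquality using (_≡_; refl; sym; trans; cong; cong₂; subst)

  binomial : ℕ → ℕ → ℤ
  binomial n zero = 1ℤ
  binomial zero (suc k) = 0ℤ
  binomial (suc n) (suc k) = binomial n k + binomial n (suc k)

  absorption : ∀ n k → + suc k * binomial (suc n) (suc k) ≡ + suc n * binomial n k
  absorption zero zero = refl
  absorption zero (suc k) = trans (ℤP.*-zeroʳ (+ suc (suc k))) (sym (ℤP.*-zeroʳ (+ 1)))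
  absorption (suc n) zero = trans (lemma (binomial n 0 + binomial n 1)) (trans (cong (λ z → 1ℤ + z) (absorption n zero)) (lemma′ (+ n)))
    where
    lemma : ∀ b → + 1 * (1ℤ + b) ≡ 1ℤ + + 1 * b
    lemma b = solve (b ∷ [])
    lemma′ : ∀ n → 1ℤ + (1ℤ + n) * 1ℤ ≡ (1ℤ + (1ℤ + n)) * 1ℤ
    lemma′ n = solve (n ∷ [])
  absorption (suc n) (suc k) = trans (lemma (+ suc k) (binomial (suc n) (suc k)) (binomial (suc n) (suc (suc k))))
      (trans (cong₂ (λ p q → p + binomial (suc n) (suc k) + q) (absorption n k) (absorption n (suc k)))
        (lemma′ (+ suc n) (binomial n k) (binomial n (suc k))))
    where
    lemma : ∀ k a b → (1ℤ + k) * (a + b) ≡ k * a + a + (1ℤ + k) * b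
    lemma k a b = solve (k ∷ a ∷ b ∷ [])
    lemma′ : ∀ n a b → n * a + (a + b) + n * b ≡ (1ℤ + n) * (a + b)
    lemma′ n a b = solve (n ∷ a ∷ b ∷ [])

  binomial-zero : ∀ n k → n < k → binomial n k ≡ 0ℤ
  binomial-zero zero (suc k) _ = refl
  binomial-zero (suc n) (suc k) (s≤s n<k) = cong₂ _+_ (binomial-zero n k n<k) (binomial-zero n (suc k) (ℕP.m≤n⇒m≤1+n n<k))

  binomial-diagonal : ∀ n → binomial n n ≡ 1ℤ
  binomial-diagonal zero = refl
  binomial-diagonal (suc n) = cong₂ _+_ (binomial-diagonal n) (binomial-zero n (suc n) ℕP.≤-refl)

  series : (ℕ → ℤ) → ℕ → ℤ → ℤ
  series c zero a = c 0
  series c (suc n) a = series c n a + c (suc n) * a ^ suc n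

  pascal : ∀ n m a → series (binomial (suc n)) (suc m) a ≡ series (binomial n) (suc m) a + a * series (binomial n) m a
  pascal n zero a = lemma (binomial n 1) a
    where
    lemma : ∀ b a → 1ℤ + (1ℤ + b) * (a * 1ℤ) ≡ 1ℤ + b * (a * 1ℤ) + a * 1ℤ
    lemma b a = solve (b ∷ a ∷ [])
  pascal n (suc m) a = trans (cong (_+ binomial (suc n) (suc (suc m)) * a ^ suc (suc m)) (pascal n m a))
      (lemma (series (binomial n) (suc m) a) (series (binomial n) m a) (binomial n (suc m)) (binomial n (suc (suc m))) a (a ^ suc m))
    where
    lemma : ∀ S S' b c a p → S + a * S' + (b + c) * (a * p) ≡ S + c * (a * p) + a * (S' + b * p)
    lemma S S' b c a p = solve (S ∷ S' ∷ b ∷ c ∷ a ∷ p ∷ [])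

  binomial-theorem : ∀ n a → series (binomial n) n a ≡ (1ℤ + a) ^ n
  binomial-theorem zero a = refl
  binomial-theorem (suc n) a = trans (pascal n n a) (trans (cong (λ b → series (binomial n) n a + b * a ^ suc n + a * series (binomial n) n a) (binomial-zero n (suc n) ℕP.≤-refl))
      (trans (lemma (series (binomial n) n a) a (a ^ suc n)) (cong ((1ℤ + a) *_) (binomial-theorem n a))))
    where
    lemma : ∀ s a p → s + 0ℤ * p + a * s ≡ (1ℤ + a) * s
    lemma s a p = solve (s ∷ a ∷ p ∷ [])

  -- Monic polynomials by their lower coefficients.
  monic : List ℤ → ℤ → ℤ
  monic [] x = 1ℤ
  monic (c ∷ cs) x = c + x * monic cs x

  quotient : List ℤ → ℤ → List ℤ
  quotient [] a = []
  quotient (c ∷ []) a = []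
  quotient (c ∷ c' ∷ cs) a = monic (c' ∷ cs) a ∷ quotient (c' ∷ cs) a

  quotient-length : ∀ c cs a → length (quotient (c ∷ cs) a) ≡ length cs
  quotient-length c [] a = refl
  quotient-length c (c' ∷ cs) a = cong suc (quotient-length c' cs a)

  quotient-correct : ∀ c cs a x → monic (c ∷ cs) x - monic (c ∷ cs) a ≡ (x - a) * monic (quotient (c ∷ cs) a) x
  quotient-correct c [] a x = lemma c a x
    where
    lemma : ∀ c a x → c + x * 1ℤ - (c + a * 1ℤ) ≡ (x - a) * 1ℤ
    lemma c a x = solve (c ∷ a ∷ x ∷ [])
  quotient-correct c (c' ∷ cs) a x = trans (lemma c x a (monic (c' ∷ cs) x) (monic (c' ∷ cs) a)) (trans (cong (λ z → x * z + (x - a) * monic (c' ∷ cs) a) (quotient-correct c' cs a x))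
      (lemma′ x a (monic (quotient (c' ∷ cs) a) x) (monic (c' ∷ cs) a)))
    where
    lemma : ∀ c x a m n → c + x * m - (c + a * n) ≡ x * (m - n) + (x - a) * n
    lemma c x a m n = solve (c ∷ x ∷ a ∷ m ∷ n ∷ [])
    lemma′ : ∀ x a q n → x * ((x - a) * q) + (x - a) * n ≡ (x - a) * (n + x * q)
    lemma′ x a q n = solve (x ∷ a ∷ q ∷ n ∷ [])

  monic-zeros : ∀ e x → monic (replicate e 0ℤ) x ≡ x ^ e
  monic-zeros zero x = refl
  monic-zeros (suc e) x = trans (ℤP.+-identityˡ _) (cong (x *_) (monic-zeros e x))

  prime-divisor : ∀ n → 1 < n → ∃[ r ] Prime r × r ℕD.∣ n
  prime-divisor (suc n) 1<n = from (factorise (suc n))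
    where
    from : PrimeFactorisation (suc n) → ∃[ r ] Prime r × r ℕD.∣ suc n
    from record { factors = [] ; isFactorisation = e } = contradiction e (ℕP.>⇒≢ 1<n)
    from record { factors = r ∷ rs ; isFactorisation = e ; factorsPrime = pr All.∷ _ } = r , pr , subst (r ℕD.∣_) (sym e) (ℕD.m∣m*n _)

  coprime-prime : ∀ {r h} → Prime r → ¬ r ℕD.∣ h → Coprime h r
  coprime-prime pr r∤h (d∣h , d∣r) with prime⇒irreducible pr d∣r
  ... | inj₁ d≡1 = d≡1
  ... | inj₂ refl = contradiction d∣h r∤h

  coprime-power : ∀ {h r} → Coprime h r → ∀ n → Coprime h (r ℕ.^ n)
  coprime-power c zero (d∣h , d∣1) = ℕD.∣1⇒≡1 d∣1
  coprime-power {h} {r} c (suc n) {d} (d∣h , d∣rrⁿ) = coprime-power c n (d∣h , coprime-divisor (λ { (e∣d , e∣r) → c (ℕD.∣-trans e∣d d∣h , e∣r) }) d∣rrⁿ)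

  strip : ∀ {r} → Prime r → ∀ d → 0 < d → ∃[ f ] ∃[ d' ] d ≡ r ℕ.^ f ℕ.* d' × ¬ r ℕD.∣ d'
  strip {r} pr = <-rec _ go
    where
    go : ∀ d → (∀ {d₁} → d₁ < d → 0 < d₁ → ∃[ f ] ∃[ d' ] d₁ ≡ r ℕ.^ f ℕ.* d' × ¬ r ℕD.∣ d') → 0 < d → ∃[ f ] ∃[ d' ] d ≡ r ℕ.^ f ℕ.* d' × ¬ r ℕD.∣ d'
    go d rec 0<d with r ℕD.∣? d
    ... | no r∤d = 0 , d , sym (ℕP.+-identityʳ d) , r∤d
    ... | yes (ℕD.divides zero e) = contradiction e (ℕP.>⇒≢ 0<d)
    ... | yes (ℕD.divides (suc d₁) e) = from (rec smaller (s≤s z≤n))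
      where
      smaller : suc d₁ < d
      smaller = subst (suc d₁ <_) (sym e) (ℕP.m<m*n (suc d₁) r (ℕ.nonTrivial⇒n>1 r {{prime⇒nonTrivial pr}}))
      from : ∃[ f ] ∃[ d' ] suc d₁ ≡ r ℕ.^ f ℕ.* d' × ¬ r ℕD.∣ d' → ∃[ f ] ∃[ d' ] d ≡ r ℕ.^ f ℕ.* d' × ¬ r ℕD.∣ d'
      from (f , d' , q , n) = suc f , d' , trans e (trans (ℕP.*-comm (suc d₁) r) (trans (cong (r ℕ.*_) q) (sym (ℕP.*-assoc r (r ℕ.^ f) d')))) , n

  divisor-of-power : ∀ {r} → Prime r → ∀ f g → g ℕD.∣ r ℕ.^ suc f → g ℕD.∣ r ℕ.^ f ⊎ r ℕ.^ suc f ℕD.∣ g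
  divisor-of-power {r} pr f g (ℕD.divides h e) with r ℕD.∣? h
  ... | yes (ℕD.divides h' q) = inj₁ (ℕD.divides h' (ℕP.*-cancelˡ-≡ _ _ r {{prime⇒nonZero pr}} (trans e (trans (cong (ℕ._* g) (trans q (ℕP.*-comm h' r))) (ℕP.*-assoc r h' g)))))
  ... | no r∤h = inj₂ (ℕD.∣-reflexive (trans e (trans (cong (ℕ._* g) h≡1) (ℕP.*-identityˡ g))))
    where
    h≡1 : h ≡ 1
    h≡1 = coprime-power (coprime-prime pr r∤h) (suc f) (ℕD.∣-refl , ℕD.divides g (trans e (ℕP.*-comm h g)))

  module PrimitiveRoot {p : ℕ} (prime : Prime p) where
    open PrimeModulus prime

    small-∤ : ∀ n → suc n < p → ¬ P ∣ + suc n
    small-∤ n n<p d = ℕP.<⇒≱ n<p (ℕD.∣⇒≤ (∣⇒∣ᵤ d))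

    p₁ : ℕ
    p₁ = ℕ.pred p

    p≡suc : p ≡ suc p₁
    p≡suc = sym (ℕP.suc-pred p)

    binomial-divisible : ∀ m → suc m < p → P ∣ binomial p (suc m)
    binomial-divisible m m<p = [ (λ d → ⊥-elim (small-∤ m m<p d)) , (λ d → d) ]′
      (euclid (+ suc m) (binomial p (suc m)) (divides (binomial p₁ m)
        (trans (cong (λ n → + suc m * binomial n (suc m)) p≡suc) (trans (absorption p₁ m) (trans (cong (λ n → + n * binomial p₁ m) (sym p≡suc)) (ℤP.*-comm P _))))))

    partial : ∀ a m → m < p → P ∣ series (binomial p) m a - 1ℤ
    partial a zero _ = divides 0ℤ refl
    partial a (suc m) m<p = by (partial a m (ℕP.<-trans (ℕP.n<1+n m) m<p) ⊕ a ^ suc m ⊛ binomial-divisible m m<p)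
        (lemma (series (binomial p) m a) (binomial p (suc m)) (a ^ suc m))
      where
      lemma : ∀ s b c → s + b * c - 1ℤ ≡ s - 1ℤ + c * b
      lemma s b c = solve (s ∷ b ∷ c ∷ [])

    frobenius : ∀ a → P ∣ (1ℤ + a) ^ p - (1ℤ + a ^ p)
    frobenius a = by (partial a p₁ (subst (p₁ <_) (sym p≡suc) ℕP.≤-refl)) (trans (cong (_- (1ℤ + a ^ p)) split) (lemma (series (binomial p) p₁ a) (a ^ p)))
      where
      split : (1ℤ + a) ^ p ≡ series (binomial p) p₁ a + 1ℤ * a ^ p
      split = trans (sym (binomial-theorem p a)) (trans (cong (λ n → series (binomial p) n a) p≡suc)
        (cong₂ (λ b n → series (binomial p) p₁ a + b * a ^ n) (trans (cong (binomial p) (sym p≡suc)) (binomial-diagonal p)) (sym p≡suc)))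
      lemma : ∀ s b → s + 1ℤ * b - (1ℤ + b) ≡ s - 1ℤ
      lemma s b = solve (s ∷ b ∷ [])

    fermat-ℕ : ∀ n → P ∣ (+ n) ^ p - + n
    fermat-ℕ zero = subst (λ q → P ∣ 0ℤ ^ q - 0ℤ) (sym p≡suc) (divides 0ℤ refl)
    fermat-ℕ (suc n) = by (frobenius (+ n) ⊕ fermat-ℕ n) (lemma ((1ℤ + + n) ^ p) ((+ n) ^ p) (+ n))
      where
      lemma : ∀ a b n → a - (1ℤ + n) ≡ a - (1ℤ + b) + (b - n)
      lemma a b n = solve (a ∷ b ∷ n ∷ [])

    fermat : ∀ a → ¬ P ∣ a → P ∣ a ^ p₁ - 1ℤ
    fermat a P∤a = [ (λ d → ⊥-elim (P∤a d)) , (λ d → d) ]′ (euclid a (a ^ p₁ - 1ℤ) (by aᵖ (trans (lemma a (a ^ p₁)) (cong (λ n → a ^ n - a) (sym p≡suc)))))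
      where
      s = proj₁ (natural-residue a)
      S = proj₂ (natural-residue a)
      lemma : ∀ a b → a * (b - 1ℤ) ≡ a * b - a
      lemma a b = solve (a ∷ b ∷ [])
      lemma′ : ∀ a s A S → A - a ≡ - 1ℤ * (S - A) + (S - s) + (s - a)
      lemma′ a s A S = solve (a ∷ s ∷ A ∷ S ∷ [])
      aᵖ : P ∣ a ^ p - a
      aᵖ = by (- 1ℤ ⊛ power-cong (+ s) a S p ⊕ fermat-ℕ s ⊕ S) (lemma′ a (+ s) (a ^ p) ((+ s) ^ p))

    no-roots : ∀ n cs s → length cs ≡ n → n < p → (∀ i → i ≤ n → P ∣ monic cs (+ (s ℕ.+ i))) → ⊥
    no-roots zero [] s refl n<p roots = P∤1 (roots 0 z≤n)
    no-roots (suc n) (c ∷ cs) s l n<p roots = no-roots n (quotient (c ∷ cs) (+ s)) (suc s) (trans (quotient-length c cs (+ s)) (ℕP.suc-injective l))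
        (ℕP.<-trans (ℕP.n<1+n n) n<p) next
      where
      root : ∀ i → i ≤ suc n → P ∣ monic (c ∷ cs) (+ (s ℕ.+ i))
      root = roots
      next : ∀ i → i ≤ n → P ∣ monic (quotient (c ∷ cs) (+ s)) (+ (suc s ℕ.+ i))
      next i i≤n = [ (λ d → ⊥-elim (small-∤ i (ℕP.≤-<-trans (s≤s i≤n) n<p) d)) , (λ d → d) ]′ (euclid (+ suc i) _
          (by (subst (λ j → P ∣ monic (c ∷ cs) (+ j)) (ℕP.+-suc s i) (root (suc i) (s≤s i≤n)) ⊕ - 1ℤ ⊛ subst (λ j → P ∣ monic (c ∷ cs) (+ j)) (ℕP.+-identityʳ s) (root 0 z≤n))
            (trans (cong (_* monic (quotient (c ∷ cs) (+ s)) (+ (suc s ℕ.+ i))) (shift i)) (trans (sym (quotient-correct c cs (+ s) (+ (suc s ℕ.+ i))))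
              (lemma (monic (c ∷ cs) (+ (suc s ℕ.+ i))) (monic (c ∷ cs) (+ s)))))))
        where
        lemma : ∀ a b → a - b ≡ a + - 1ℤ * b
        lemma a b = solve (a ∷ b ∷ [])
        shift : ∀ i → + suc i ≡ + (suc s ℕ.+ i) - + s
        shift i = trans (lemma′ (+ s) (+ i)) (cong (λ z → 1ℤ + z - + s) (sym (ℤP.pos-+ s i)))
          where
          lemma′ : ∀ s i → 1ℤ + i ≡ 1ℤ + (s + i) - s
          lemma′ s i = solve (s ∷ i ∷ [])

    non-root : ∀ e → suc (suc e) < p → ∃[ b ] ¬ P ∣ b × ¬ P ∣ b ^ suc e - 1ℤ
    non-root e e<p = from (search (suc (suc e)))
      where
      Root : ℕ → Set
      Root i = P ∣ (+ suc i) ^ suc e - 1ℤ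
      search : ∀ n → (∃[ i ] i < n × ¬ Root i) ⊎ (∀ i → i < n → Root i)
      search zero = inj₂ λ i ()
      search (suc n) with P ∣? ((+ suc n) ^ suc e - 1ℤ) | search n
      ... | no ¬r | _ = inj₁ (n , ℕP.≤-refl , ¬r)
      ... | yes r | inj₁ (i , i<n , ¬r) = inj₁ (i , ℕP.m≤n⇒m≤1+n i<n , ¬r)
      ... | yes r | inj₂ all = inj₂ λ i i<1+n → [ all i , (λ { refl → r }) ]′ (ℕP.m≤n⇒m<n∨m≡n (ℕP.≤-pred i<1+n))
      from : (∃[ i ] i < suc (suc e) × ¬ Root i) ⊎ (∀ i → i < suc (suc e) → Root i) → ∃[ b ] ¬ P ∣ b × ¬ P ∣ b ^ suc e - 1ℤ
      from (inj₁ (i , i<n , ¬r)) = + suc i , small-∤ i (ℕP.<-≤-trans (s≤s i<n) e<p) , ¬r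
      from (inj₂ all) = ⊥-elim (no-roots (suc e) (- 1ℤ ∷ replicate e 0ℤ) 1 (cong suc (length-replicate e)) (ℕP.<-trans (ℕP.n<1+n _) e<p)
          λ i i≤e → by (all i (s≤s i≤e)) (trans (cong (λ z → - 1ℤ + + suc i * z) (monic-zeros e (+ suc i))) (ℤP.+-comm (- 1ℤ) ((+ suc i) ^ suc e))))

    Order : ℤ → ℕ → Set
    Order a m = P ∣ a ^ m - 1ℤ × (∀ i → P ∣ a ^ i - 1ℤ → m ℕD.∣ i)

    power-multiple : ∀ a m → P ∣ a ^ m - 1ℤ → ∀ k → P ∣ a ^ (k ℕ.* m) - 1ℤ
    power-multiple a m d k = subst (λ z → P ∣ z - 1ℤ) (trans (ℤP.^-*-assoc a m k) (cong (a ^_) (ℕP.*-comm m k))) (power-one (a ^ m) d k)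

    power-gcd : ∀ a → ¬ P ∣ a → ∀ i j → P ∣ a ^ i - 1ℤ → P ∣ a ^ j - 1ℤ → ∃[ g ] g ℕD.∣ i × g ℕD.∣ j × P ∣ a ^ g - 1ℤ
    power-gcd a P∤a i j I J = from (Bézout.lemma i j)
      where
      step : ∀ d m n → d ℕ.+ m ≡ n → P ∣ a ^ m - 1ℤ → P ∣ a ^ n - 1ℤ → P ∣ a ^ d - 1ℤ
      step d m n refl M N = by (- (a ^ d) ⊛ M ⊕ N) (trans (lemma (a ^ d) (a ^ m)) (cong (λ z → - (a ^ d) * (a ^ m - 1ℤ) + (z - 1ℤ)) (sym (ℤP.^-distribˡ-+-* a d m))))
        where
        lemma : ∀ x y → x - 1ℤ ≡ - x * (y - 1ℤ) + (x * y - 1ℤ)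
        lemma x y = solve (x ∷ y ∷ [])
      from : Bézout.Lemma i j → ∃[ g ] g ℕD.∣ i × g ℕD.∣ j × P ∣ a ^ g - 1ℤ
      from (Bézout.result d g (Bézout.+- x y e)) = d , proj₁ (GCD.commonDivisor g) , proj₂ (GCD.commonDivisor g) , step d (y ℕ.* j) (x ℕ.* i) e (power-multiple a j J y) (power-multiple a i I x)
      from (Bézout.result d g (Bézout.-+ x y e)) = d , proj₁ (GCD.commonDivisor g) , proj₂ (GCD.commonDivisor g) , step d (x ℕ.* i) (y ℕ.* j) e (power-multiple a i I x) (power-multiple a j J y)

    order-prime-power : ∀ {r} → Prime r → ∀ f c → ¬ P ∣ c → P ∣ c ^ (r ℕ.^ suc f) - 1ℤ → ¬ P ∣ c ^ (r ℕ.^ f) - 1ℤ → Order c (r ℕ.^ suc f)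
    order-prime-power {r} pr f c P∤c one ¬one = one , λ i I → from i (power-gcd c P∤c i (r ℕ.^ suc f) I one)
      where
      from : ∀ i → ∃[ g ] g ℕD.∣ i × g ℕD.∣ r ℕ.^ suc f × P ∣ c ^ g - 1ℤ → r ℕ.^ suc f ℕD.∣ i
      from i (g , g∣i , g∣rᶠ , G) = [ (λ { (ℕD.divides h e) → ⊥-elim (¬one (subst (λ n → P ∣ c ^ n - 1ℤ) (sym e) (power-multiple c g G h))) })
        , (λ d → ℕD.∣-trans d g∣i) ]′ (divisor-of-power pr f g g∣rᶠ)

    order-product : ∀ a b m n → Coprime m n → Order a m → Order b n → Order (a * b) (m ℕ.* n)
    order-product a b m n c (A , A') (B , B') = one , λ i I → coprime-lcm (left i I) (right i I)
      where
      pow-* : ∀ i → (a * b) ^ i ≡ a ^ i * b ^ i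
      pow-* zero = refl
      pow-* (suc i) = trans (cong (a * b *_) (pow-* i)) (lemma a b (a ^ i) (b ^ i))
        where
        lemma : ∀ a b p q → a * b * (p * q) ≡ a * p * (b * q)
        lemma a b p q = solve (a ∷ b ∷ p ∷ q ∷ [])
      lemma₁ : ∀ x y → x * y - 1ℤ ≡ y * (x - 1ℤ) + (y - 1ℤ)
      lemma₁ x y = solve (x ∷ y ∷ [])
      lemma₂ : ∀ x y → x - 1ℤ ≡ (x * y - 1ℤ) + - x * (y - 1ℤ)
      lemma₂ x y = solve (x ∷ y ∷ [])
      one : P ∣ (a * b) ^ (m ℕ.* n) - 1ℤ
      one = by (b ^ (m ℕ.* n) ⊛ subst (λ k → P ∣ a ^ k - 1ℤ) (ℕP.*-comm n m) (power-multiple a m A n) ⊕ power-multiple b n B m)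
        (trans (cong (_- 1ℤ) (pow-* (m ℕ.* n))) (lemma₁ (a ^ (m ℕ.* n)) (b ^ (m ℕ.* n))))
      product : ∀ i k → P ∣ (a * b) ^ i - 1ℤ → P ∣ a ^ (k ℕ.* i) * b ^ (k ℕ.* i) - 1ℤ
      product i k I = subst (λ z → P ∣ z - 1ℤ) (pow-* (k ℕ.* i)) (power-multiple (a * b) i I k)
      left : ∀ i → P ∣ (a * b) ^ i - 1ℤ → m ℕD.∣ i
      left i I = coprime-divisor c (A' (n ℕ.* i) (by (product i n I ⊕ - (a ^ (n ℕ.* i)) ⊛ subst (λ k → P ∣ b ^ k - 1ℤ) (ℕP.*-comm i n) (power-multiple b n B i))
        (lemma₂ (a ^ (n ℕ.* i)) (b ^ (n ℕ.* i)))))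
      right : ∀ i → P ∣ (a * b) ^ i - 1ℤ → n ℕD.∣ i
      right i I = coprime-divisor (Cop.sym c) (B' (m ℕ.* i) (by (product i m I ⊕ - (b ^ (m ℕ.* i)) ⊛ subst (λ k → P ∣ a ^ k - 1ℤ) (ℕP.*-comm i m) (power-multiple a m A i))
        (lemma₃ (a ^ (m ℕ.* i)) (b ^ (m ℕ.* i)))))
        where
        lemma₃ : ∀ x y → y - 1ℤ ≡ (x * y - 1ℤ) + - y * (x - 1ℤ)
        lemma₃ x y = solve (x ∷ y ∷ [])
      coprime-lcm : ∀ {i} → m ℕD.∣ i → n ℕD.∣ i → m ℕ.* n ℕD.∣ i
      coprime-lcm (ℕD.divides k refl) n∣i with coprime-divisor (Cop.sym c) (subst (n ℕD.∣_) (ℕP.*-comm k m) n∣i)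
      ... | ℕD.divides l refl = ℕD.divides l (trans (ℕP.*-assoc l n m) (cong (l ℕ.*_) (ℕP.*-comm n m)))

    order-exists : ∀ d → 0 < d → d ℕD.∣ p₁ → ∃[ a ] ¬ P ∣ a × Order a d
    order-exists = <-rec _ go
      where
      Goal : ℕ → Set
      Goal d = 0 < d → d ℕD.∣ p₁ → ∃[ a ] ¬ P ∣ a × Order a d
      go : ∀ d → (∀ {d'} → d' < d → Goal d') → Goal d
      go (suc zero) rec _ _ = 1ℤ , P∤1 , divides 0ℤ refl , λ i _ → ℕD.1∣ i
      go d@(suc (suc _)) rec 0<d d∣p₁ = split (prime-divisor d (s≤s (s≤s z≤n)))
        where
        split : ∃[ r ] Prime r × r ℕD.∣ d → ∃[ a ] ¬ P ∣ a × Order a d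
        split (r , pr , r∣d) = combine (strip pr d 0<d)
          where
          combine : ∃[ f ] ∃[ d' ] d ≡ r ℕ.^ f ℕ.* d' × ¬ r ℕD.∣ d' → ∃[ a ] ¬ P ∣ a × Order a d
          combine (zero , d' , e , r∤d') = contradiction (subst (r ℕD.∣_) (trans e (ℕP.*-identityˡ d')) r∣d) r∤d'
          combine (suc f , zero , e , r∤d') = contradiction (r ℕD.∣0) r∤d'
          combine (suc f , d'@(suc _) , e , r∤d') = finish (rec d'<d (s≤s z≤n) (ℕD.∣-trans (ℕD.divides (r ℕ.^ suc f) e) d∣p₁)) (cofactor d∣p₁)
            where
            1<r : 1 < r
            1<r = ℕ.nonTrivial⇒n>1 r {{prime⇒nonTrivial pr}}
            d'<d : d' < d
            d'<d = subst (d' <_) (sym (trans e (ℕP.*-comm (r ℕ.^ suc f) d'))) (ℕP.m<m*n d' (r ℕ.^ suc f) (ℕP.<-≤-trans 1<r (ℕP.m≤m*n r (r ℕ.^ f) {{ℕP.m^n≢0 r f {{prime⇒nonZero pr}}}})))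
            -- p - 1 = r^(f+1) h, and b is chosen with b^((p-1)/r) ≠ 1.
            cofactor : d ℕD.∣ p₁ → ∃[ c ] ¬ P ∣ c × Order c (r ℕ.^ suc f)
            cofactor (ℕD.divides k q) = from-non-root (non-root′ _ refl)
              where
              h = k ℕ.* d'
              p₁≡ : p₁ ≡ h ℕ.* r ℕ.^ suc f
              p₁≡ = trans q (trans (cong (k ℕ.*_) (trans e (ℕP.*-comm (r ℕ.^ suc f) d'))) (sym (ℕP.*-assoc k d' _)))
              n = h ℕ.* r ℕ.^ f
              p₁≡′ : p₁ ≡ n ℕ.* r
              p₁≡′ = trans p₁≡ (trans (cong (h ℕ.*_) (ℕP.*-comm r (r ℕ.^ f))) (sym (ℕP.*-assoc h (r ℕ.^ f) r)))
              non-root′ : ∀ n' → n' ≡ n → ∃[ b ] ¬ P ∣ b × ¬ P ∣ b ^ n - 1ℤ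
              non-root′ zero z = contradiction (trans p≡suc (cong suc (trans p₁≡′ (cong (ℕ._* r) (sym z))))) (ℕP.>⇒≢ (ℕ.nonTrivial⇒n>1 p {{prime⇒nonTrivial prime}}))
              non-root′ (suc e') z = subst (λ m → ∃[ b ] ¬ P ∣ b × ¬ P ∣ b ^ m - 1ℤ) z (non-root e' (subst (suc (suc e') <_) (sym p≡suc)
                (s≤s (subst (suc (suc e') ≤_) (sym p₁≡′) (subst (λ m → suc (suc e') ≤ m ℕ.* r) z (ℕP.m<m*n (suc e') r 1<r))))))
              from-non-root : ∃[ b ] ¬ P ∣ b × ¬ P ∣ b ^ n - 1ℤ → ∃[ c ] ¬ P ∣ c × Order c (r ℕ.^ suc f)
              from-non-root (b , P∤b , ¬B) = b ^ h , ∤-^ b P∤b h , order-prime-power pr f (b ^ h) (∤-^ b P∤b h)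
                (subst (λ z → P ∣ z - 1ℤ) (trans (cong (b ^_) p₁≡) (sym (ℤP.^-*-assoc b h (r ℕ.^ suc f)))) (fermat b P∤b))
                (λ B → ¬B (subst (λ z → P ∣ z - 1ℤ) (ℤP.^-*-assoc b h (r ℕ.^ f)) B))
            finish : ∃[ a ] ¬ P ∣ a × Order a d' → ∃[ c ] ¬ P ∣ c × Order c (r ℕ.^ suc f) → ∃[ a ] ¬ P ∣ a × Order a d
            finish (a , P∤a , A) (c , P∤c , C) = c * a , ∤-* c a P∤c P∤a , subst (Order (c * a)) (sym e)
              (order-product c a (r ℕ.^ suc f) d' (Cop.sym (coprime-power (coprime-prime pr r∤d') (suc f))) C A)

module UnitGroups where
  open GroupWords
  open ElementaryRelations
  open WeylPowers using (double)
  open NormalForms using (Torus)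
  open Tori using (module Units)
  open PrimePowers
  open PrimitiveRoots
  open import Algebra.Bundles using (Group)
  open import Level using (0ℓ)
  open import Data.List using ([]; _∷_)
  open import Data.Fin as Fin using (Fin; toℕ; fromℕ<)
  import Data.Fin.Properties as FinP
  open import Data.Nat as ℕ using (ℕ; zero; suc; z≤n; s≤s; _≤_; _<_)
  import Data.Nat.Properties as ℕP
  import Data.Nat.Divisibility as ℕD
  open import Data.Nat.Primality using (Prime; prime⇒nonTrivial; prime⇒irreducible; prime[2])
  open import Data.Integer using (ℤ; +_; _+_; _*_; _-_; -_; _^_; 0ℤ; 1ℤ)
  import Data.Integer.Properties as ℤP
  open import Data.Integer.DivMod using (_%ℕ_; _/ℕ_; a≡a%ℕn+[a/ℕn]*n; n%ℕd<d)
  open import Data.Integer.Divisibility.Signed using (_∣_; divides; ∣⇒∣ᵤ; ∣-trans; _∣?_)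
  open import Data.Integer.Tactic.RingSolver using (solve)
  open import Data.Product using (_×_; _,_; proj₁; proj₂; ∃-syntax)
  open import Data.Sum using (_⊎_; inj₁; inj₂; [_,_]′)
  open import Data.Empty using (⊥-elim)
  open import Relation.Nullary using (¬_; yes; no)
  open import Relation.Nullary.Decidable using (toWitnessFalse)
  open import Relation.Binary.PropositionalEquality using (_≡_; refl; sym; trans; cong; cong₂; subst)

  double-+ : ∀ a b → double (a ℕ.+ b) ≡ double a ℕ.+ double b
  double-+ zero b = refl
  double-+ (suc a) b = cong (λ n → suc (suc n)) (double-+ a b)

  double-* : ∀ a b → double (a ℕ.* b) ≡ a ℕ.* double b
  double-* zero b = refl
  double-* (suc a) b = trans (double-+ b (a ℕ.* b)) (cong (double b ℕ.+_) (double-* a b))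

  double-*ʳ : ∀ a b → double (a ℕ.* b) ≡ double a ℕ.* b
  double-*ʳ a b = trans (cong double (ℕP.*-comm a b)) (trans (double-* b a) (ℕP.*-comm b (double a)))

  parity : ∀ n → (∃[ j ] n ≡ double j) ⊎ (∃[ j ] n ≡ suc (double j))
  parity zero = inj₁ (0 , refl)
  parity (suc n) = [ (λ { (j , e) → inj₂ (j , cong suc e) }) , (λ { (j , e) → inj₁ (suc j , cong suc e) }) ]′ (parity n)

  double-even : ∀ j → 2 ℕD.∣ double j
  double-even zero = 2 ℕD.∣0
  double-even (suc j) = ℕD.∣m∣n⇒∣m+n (ℕD.∣-refl {2}) (double-even j)

  module OddPrime {p : ℕ} (prime : Prime p) (p≢2 : ¬ p ≡ 2) where
    open PrimeModulus prime
    open PrimitiveRoot prime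

    p₁-even : ∃[ m ] p₁ ≡ double m
    p₁-even = [ (λ e → e) , (λ { (j , e) → ⊥-elim (impossible (subst (2 ℕD.∣_) (trans (cong suc (sym e)) (sym p≡suc)) (double-even (suc j)))) }) ]′ (parity p₁)
      where
      impossible : ¬ 2 ℕD.∣ p
      impossible 2∣p with prime⇒irreducible prime 2∣p
      ... | inj₁ ()
      ... | inj₂ e = p≢2 (sym e)

    1<p : 1 < p
    1<p = ℕ.nonTrivial⇒n>1 p {{prime⇒nonTrivial prime}}

    2<p : 2 < p
    2<p = ℕP.≤∧≢⇒< 1<p (λ e → p≢2 (sym e))

    P∤2 : ¬ P ∣ + 2
    P∤2 = small-∤ 1 2<p

    P∣triangle : P ∣ + triangle p
    P∣triangle = [ (λ d → ⊥-elim (P∤2 d)) , (λ d → d) ]′ (euclid (+ 2) (+ triangle p) (divides (P - 1ℤ) (trans (2triangle p) (ℤP.*-comm P _))))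

    residue-equal : ∀ a b → a %ℕ p ≡ b %ℕ p → P ∣ a - b
    residue-equal a b e = divides (a /ℕ p - b /ℕ p) (trans (cong₂ _-_ (a≡a%ℕn+[a/ℕn]*n a p) (trans (a≡a%ℕn+[a/ℕn]*n b p) (cong (λ r → + r + b /ℕ p * P) (sym e))))
        (lemma (+ (a %ℕ p)) (a /ℕ p) (b /ℕ p) P))
      where
      lemma : ∀ r s t P → r + s * P - (r + t * P) ≡ (s - t) * P
      lemma r s t P = solve (r ∷ s ∷ t ∷ P ∷ [])

    residue-positive : ∀ a → ¬ P ∣ a → 0 < a %ℕ p
    residue-positive a P∤a = ℕP.n≢0⇒n>0 λ e → P∤a (divides (a /ℕ p) (trans (a≡a%ℕn+[a/ℕn]*n a p) (trans (cong (λ s → + s + a /ℕ p * P) e) (ℤP.+-identityˡ _))))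

    index : ∀ a → ¬ P ∣ a → Fin p₁
    index a P∤a = fromℕ< (ℕP.pred-mono-< {{ℕ.>-nonZero (residue-positive a P∤a)}} (n%ℕd<d a p))

    index-injective : ∀ a b A B → index a A ≡ index b B → P ∣ a - b
    index-injective a b A B e = residue-equal a b (ℕP.pred-injective {{ℕ.>-nonZero (residue-positive a A)}} {{ℕ.>-nonZero (residue-positive b B)}}
      (trans (sym (FinP.toℕ-fromℕ< _)) (trans (cong toℕ e) (FinP.toℕ-fromℕ< _))))

    logarithm₁ : ∀ g → ¬ P ∣ g → Order g p₁ → ∀ u → ¬ P ∣ u → ∃[ i ] P ∣ g ^ i - u
    logarithm₁ g P∤g (_ , minimal) u P∤u = collide (FinP.pigeonhole (ℕP.n<1+n p₁) f)
      where
      f : Fin (suc p₁) → Fin p₁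
      f Fin.zero = index u P∤u
      f (Fin.suc j) = index (g ^ toℕ j) (∤-^ g P∤g (toℕ j))
      collide : (∃[ i ] ∃[ j ] i Fin.< j × f i ≡ f j) → ∃[ i ] P ∣ g ^ i - u
      collide (Fin.zero , Fin.suc j , _ , e) = toℕ j , index-injective (g ^ toℕ j) u (∤-^ g P∤g (toℕ j)) P∤u (sym e)
      collide (Fin.suc i , Fin.suc j , s≤s i<j , e) = ⊥-elim (ℕP.<⇒≱ (ℕP.≤-<-trans (ℕP.m∸n≤m (toℕ j) (toℕ i)) (FinP.toℕ<n j))
          (ℕD.∣⇒≤ {{ℕ.>-nonZero (ℕP.m<n⇒0<n∸m i<j)}} (minimal (toℕ j ℕ.∸ toℕ i) one)))
        where
        d = toℕ j ℕ.∸ toℕ i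
        G = g ^ toℕ i
        split : g ^ toℕ j ≡ G * g ^ d
        split = trans (cong (g ^_) (sym (ℕP.m+[n∸m]≡n (ℕP.<⇒≤ i<j)))) (ℤP.^-distribˡ-+-* g (toℕ i) d)
        lemma : ∀ G D → G * (D - 1ℤ) ≡ - 1ℤ * (G - G * D)
        lemma G D = solve (G ∷ D ∷ [])
        one : P ∣ g ^ d - 1ℤ
        one = [ (λ q → ⊥-elim (∤-^ g P∤g (toℕ i) q)) , (λ q → q) ]′ (euclid G (g ^ d - 1ℤ)
          (by (- 1ℤ ⊛ subst (λ z → P ∣ G - z) split (index-injective G (g ^ toℕ j) (∤-^ g P∤g (toℕ i)) (∤-^ g P∤g (toℕ j)) e)) (lemma G (g ^ d))))

    0<p₁ : 0 < p₁
    0<p₁ = ℕP.≤-pred (subst (1 <_) p≡suc 1<p)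

    Generator : Set
    Generator = ∃[ g ] ∃[ c ] ¬ P ∣ g × ¬ P ∣ c × Order g p₁ × g ^ p₁ ≡ 1ℤ + P ^ 1 * c

    generator : Generator
    generator = from (order-exists p₁ 0<p₁ ℕD.∣-refl)
      where
      from : ∃[ g ] ¬ P ∣ g × Order g p₁ → Generator
      from (g , P∤g , O@(divides c e , minimal)) = choose (P ∣? c)
        where
        lemma : ∀ z c P → z - 1ℤ ≡ c * P → z ≡ 1ℤ + P * 1ℤ * c
        lemma z c P q = trans (l₁ z) (trans (cong (λ y → 1ℤ + y) q) (l₂ c P))
          where
          l₁ : ∀ z → z ≡ 1ℤ + (z - 1ℤ)
          l₁ z = solve (z ∷ [])
          l₂ : ∀ c P → 1ℤ + c * P ≡ 1ℤ + P * 1ℤ * c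
          l₂ c P = solve (c ∷ P ∷ [])
        choose : _ → Generator
        choose (no P∤c) = g , c , P∤g , P∤c , O , lemma (g ^ p₁) c P e
        choose (yes P∣c) = adjust (binomial₃ P p₁)
          where
          h = g * (1ℤ + P)
          h≡g : P ∣ h - g
          h≡g = divides g (l g P)
            where
            l : ∀ g P → g * (1ℤ + P) - g ≡ g * P
            l g P = solve (g ∷ P ∷ [])
          swap-g : ∀ i → P ∣ h ^ i - 1ℤ → P ∣ g ^ i - 1ℤ
          swap-g i I = by (I ⊕ - 1ℤ ⊛ power-cong h g h≡g i) (l (h ^ i) (g ^ i))
            where
            l : ∀ a b → b - 1ℤ ≡ a - 1ℤ + - 1ℤ * (a - b)
            l a b = solve (a ∷ b ∷ [])
          pow-* : ∀ a b i → (a * b) ^ i ≡ a ^ i * b ^ i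
          pow-* a b zero = refl
          pow-* a b (suc i) = trans (cong (a * b *_) (pow-* a b i)) (l a b (a ^ i) (b ^ i))
            where
            l : ∀ a b p q → a * b * (p * q) ≡ a * p * (b * q)
            l a b p q = solve (a ∷ b ∷ p ∷ q ∷ [])
          adjust : ∃[ w ] (1ℤ + P) ^ p₁ ≡ 1ℤ + + p₁ * P + + triangle p₁ * (P * P) + w * (P * P * P) → Generator
          adjust (w , b) = h , c' , (λ d → P∤g (by (d ⊕ - 1ℤ ⊛ h≡g) (l h g))) , P∤c' , (by ((1ℤ * c') ⊛ divides 1ℤ (sym (ℤP.*-identityˡ P)) ) (trans (cong (_- 1ℤ) power) (l₃ P c')) , λ i I → minimal i (swap-g i I)) , power
            where
            l : ∀ h g → g ≡ h + - 1ℤ * (h - g)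
            l h g = solve (h ∷ g ∷ [])
            l₃ : ∀ P c → 1ℤ + P * 1ℤ * c - 1ℤ ≡ 1ℤ * c * P
            l₃ P c = solve (P ∷ c ∷ [])
            rest = c * + p₁ + + triangle p₁ + c * (+ triangle p₁ * P) + w * P + c * (w * (P * P))
            c' = + p₁ + (c + P * rest)
            P∤p₁ : ¬ P ∣ + p₁
            P∤p₁ d = ℕP.<⇒≱ (subst (p₁ <_) (sym p≡suc) ℕP.≤-refl) (ℕD.∣⇒≤ {{ℕ.>-nonZero 0<p₁}} (∣⇒∣ᵤ d))
            P∤c' : ¬ P ∣ c'
            P∤c' = ∤-shift (+ p₁) (c + P * rest) P∤p₁ (P∣c ⊕ P∣P* rest)
            power : h ^ p₁ ≡ 1ℤ + P ^ 1 * c'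
            power = trans (pow-* g (1ℤ + P) p₁) (trans (cong₂ _*_ (lemma (g ^ p₁) c P e) b) (l₄ P c (+ p₁) (+ triangle p₁) w))
              where
              l₄ : ∀ P c q t w → (1ℤ + P * 1ℤ * c) * (1ℤ + q * P + t * (P * P) + w * (P * P * P))
                ≡ 1ℤ + P * 1ℤ * (q + (c + P * (c * q + t + c * (t * P) + w * P + c * (w * (P * P)))))
              l₄ P c q t w = solve (P ∷ c ∷ q ∷ t ∷ w ∷ [])

    module _ (gen : Generator) (k : ℕ) where
      private
        g = proj₁ gen
        c = proj₁ (proj₂ gen)
        P∤g = proj₁ (proj₂ (proj₂ gen))
        P∤c = proj₁ (proj₂ (proj₂ (proj₂ gen)))
        order-g = proj₁ (proj₂ (proj₂ (proj₂ (proj₂ gen))))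
        g^p₁ = proj₂ (proj₂ (proj₂ (proj₂ (proj₂ gen))))
        Q = P ^ suc k
        open Principal 0 c P∤c (inj₁ P∣triangle)

        -- u ≡ g^i modulo p implies u ≡ g^(p₁ s + i) modulo Q.
        refine : ∀ u i → P ∣ g ^ i - u → ∃[ s ] Q ∣ g ^ (p₁ ℕ.* s ℕ.+ i) - u
        refine u i I = from (invert (suc k) (g ^ i) (∤-^ g P∤g i))
          where
          from : ∃[ v ] Q ∣ g ^ i * v - 1ℤ → ∃[ s ] Q ∣ g ^ (p₁ ℕ.* s ℕ.+ i) - u
          from (v , V) = s , by (g ^ i ⊛ S ⊕ u ⊛ V) (trans (cong (_- u) power) (lemma (γ ^ s) (g ^ i) u v))
            where
            near-one : P ^ 1 ∣ u * v - 1ℤ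
            near-one = subst (_∣ u * v - 1ℤ) (sym (ℤP.*-identityʳ P)) (by (∣-trans (P∣P^ k) V ⊕ - v ⊛ I) (l u v (g ^ i)))
              where
              l : ∀ u v G → u * v - 1ℤ ≡ G * v - 1ℤ + - v * (G - u)
              l u v G = solve (u ∷ v ∷ G ∷ [])
            s = proj₁ (principal (u * v) near-one (suc k))
            S = proj₂ (principal (u * v) near-one (suc k))
            power : g ^ (p₁ ℕ.* s ℕ.+ i) ≡ γ ^ s * g ^ i
            power = trans (ℤP.^-distribˡ-+-* g (p₁ ℕ.* s) i) (cong (_* g ^ i) (trans (sym (ℤP.^-*-assoc g p₁ s)) (cong (_^ s) g^p₁)))
            lemma : ∀ γ G u v → γ * G - u ≡ G * (γ - u * v) + u * (G * v - 1ℤ)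
            lemma γ G u v = solve (γ ∷ G ∷ u ∷ v ∷ [])

      logarithm : ∀ u → ¬ P ∣ u → ∃[ i ] Q ∣ g ^ i - u
      logarithm u P∤u = from (logarithm₁ g P∤g order-g u P∤u)
        where
        from : ∃[ i ] P ∣ g ^ i - u → ∃[ i ] Q ∣ g ^ i - u
        from (i , I) = p₁ ℕ.* proj₁ (refine u i I) ℕ.+ i , proj₂ (refine u i I)

      private
        Even Odd : ℕ → Set
        Even n = ∃[ j ] Q ∣ g ^ double j - + n
        Odd n = ∃[ j ] Q ∣ g ^ suc (double j) - + n

        classify : ∀ n → suc n < p → Even (suc n) ⊎ Odd (suc n)
        classify n n<p = from (logarithm (+ suc n) (small-∤ n n<p))
          where
          from : ∃[ i ] Q ∣ g ^ i - + suc n → Even (suc n) ⊎ Odd (suc n)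
          from (i , I) = [ (λ { (j , refl) → inj₁ (j , I) }) , (λ { (j , refl) → inj₂ (j , I) }) ]′ (parity i)

        n₀ = proj₁ (natural-residue g)

        n₀-odd : Odd n₀
        n₀-odd = m ℕ.* s , subst (λ e → Q ∣ g ^ e - + n₀) exponent (proj₂ (refine (+ n₀) 1 start))
          where
          m = proj₁ p₁-even
          start : P ∣ g ^ 1 - + n₀
          start = by (- 1ℤ ⊛ proj₂ (natural-residue g)) (l g (+ n₀))
            where
            l : ∀ g n → g * 1ℤ - n ≡ - 1ℤ * (n - g)
            l g n = solve (g ∷ n ∷ [])
          s = proj₁ (refine (+ n₀) 1 start)
          exponent : p₁ ℕ.* s ℕ.+ 1 ≡ suc (double (m ℕ.* s))
          exponent = trans (ℕP.+-comm (p₁ ℕ.* s) 1) (cong suc (trans (cong (ℕ._* s) (proj₂ p₁-even)) (sym (double-*ʳ m s))))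

        n₀<p : n₀ < p
        n₀<p = n%ℕd<d g p

        1<n₀ : 1 < n₀
        1<n₀ = ℕP.≤∧≢⇒< (residue-positive g P∤g) λ e → impossible (by (- 1ℤ ⊛ proj₂ (natural-residue g)) (trans (l g) (cong (λ n → - 1ℤ * (+ n - g)) e)))
          where
          l : ∀ g → g - 1ℤ ≡ - 1ℤ * (+ 1 - g)
          l g = solve (g ∷ [])
          impossible : ¬ P ∣ g - 1ℤ
          impossible d = ℕP.<⇒≱ 2<p (subst (_≤ 2) (sym p≡suc) (s≤s (ℕD.∣⇒≤ (proj₂ order-g 1 (by d (l′ g))))))
            where
            l′ : ∀ g → g * 1ℤ - 1ℤ ≡ g - 1ℤ
            l′ g = solve (g ∷ [])

        walk : ∀ d n → suc n ℕ.+ suc d ≡ n₀ → Even (suc n) → ∃[ m ] Even m × Odd (suc m)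
        walk zero n e E = suc n , E , subst Odd (trans (sym e) (trans (ℕP.+-suc (suc n) 0) (cong suc (ℕP.+-identityʳ (suc n))))) n₀-odd
        walk (suc d) n e E = [ (λ E' → walk d (suc n) (trans (sym (ℕP.+-suc (suc n) (suc d))) e) E') , (λ O → suc n , E , O) ]′
          (classify (suc n) (ℕP.<-trans (subst (suc (suc n) <_) (trans (sym (ℕP.+-suc (suc n) (suc d))) e) (ℕP.m<m+n (suc (suc n)) (s≤s z≤n))) n₀<p))

        step-found : ∃[ m ] Even m × Odd (suc m)
        step-found = walk (n₀ ℕ.∸ 2) 0 (trans (cong suc (trans (sym (ℕP.+-∸-assoc 1 1<n₀)) refl)) (ℕP.m+[n∸m]≡n {1} (ℕP.<⇒≤ 1<n₀))) (0 , divides 0ℤ refl)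

      decompose : ∃[ a ] ∃[ b ] Q ∣ g ^ double a + g ^ suc (suc (double b)) - g
      decompose = from step-found (invert (suc k) g P∤g)
        where
        from : ∃[ m ] Even m × Odd (suc m) → ∃[ g' ] Q ∣ g * g' - 1ℤ → ∃[ a ] ∃[ b ] Q ∣ g ^ double a + g ^ suc (suc (double b)) - g
        from (n , (j , J) , (l , L)) (g' , U) = from-log (logarithm g' (unit⇒∤ k g' g (by U (l₁ g g'))))
          where
          l₁ : ∀ g g' → g' * g - 1ℤ ≡ g * g' - 1ℤ
          l₁ g g' = solve (g ∷ g' ∷ [])
          from-log : ∃[ m ] Q ∣ g ^ m - g' → ∃[ a ] ∃[ b ] Q ∣ g ^ double a + g ^ suc (suc (double b)) - g
          from-log (m , M) = a , b , by (G ⊛ sum ⊕ g ⊛ GL ⊕ (g ^ double j * G) ⊛ one₂)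
              (trans (cong (λ z → G + z - g) power-b) (l₂ G (g ^ double j) (g ^ double (suc m)) (g ^ double l) g))
            where
            a = l ℕ.* m
            b = j ℕ.+ (l ℕ.* m ℕ.+ m)
            G = g ^ double a
            one : Q ∣ g ^ suc m - 1ℤ
            one = by (g ⊛ M ⊕ U) (l₃ g (g ^ m) g')
              where
              l₃ : ∀ g h g' → g * h - 1ℤ ≡ g * (h - g') + (g * g' - 1ℤ)
              l₃ g h g' = solve (g ∷ h ∷ g' ∷ [])
            multiples : ∀ n → Q ∣ g ^ (suc m ℕ.* n) - 1ℤ
            multiples n = subst (λ z → Q ∣ z - 1ℤ) (ℤP.^-*-assoc g (suc m) n) (power-one (g ^ suc m) one n)
            one₂ : Q ∣ g ^ double (suc m) - 1ℤ
            one₂ = subst (λ n → Q ∣ g ^ n - 1ℤ) (trans (sym (double-* (suc m) 1)) (cong double (ℕP.*-identityʳ (suc m)))) (multiples 2)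
            GL : Q ∣ G * g ^ double l - 1ℤ
            GL = subst (λ z → Q ∣ z - 1ℤ) (trans (cong (g ^_) (trans (ℕP.+-comm (double l) (m ℕ.* double l)) (cong (ℕ._+ double l) (trans (sym (double-* m l)) (cong double (ℕP.*-comm m l)))))) (ℤP.^-distribˡ-+-* g (double a) (double l)))
              (multiples (double l))
            sum : Q ∣ 1ℤ + g ^ double j - g * g ^ double l
            sum = by (J ⊕ - 1ℤ ⊛ L) (l₄ (g ^ double j) (g * g ^ double l) (+ n))
              where
              l₄ : ∀ J L n → 1ℤ + J - L ≡ J - n + - 1ℤ * (L - (1ℤ + n))
              l₄ J L n = solve (J ∷ L ∷ n ∷ [])
            power-b : g ^ suc (suc (double b)) ≡ g ^ double j * G * g ^ double (suc m)
            power-b = trans (cong (g ^_) (trans (cong double (trans (sym (ℕP.+-suc j _)) (trans (cong (j ℕ.+_) (sym (ℕP.+-suc (l ℕ.* m) m))) (sym (ℕP.+-assoc j (l ℕ.* m) (suc m))))))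
                (trans (double-+ (j ℕ.+ l ℕ.* m) (suc m)) (cong (ℕ._+ double (suc m)) (double-+ j (l ℕ.* m))))))
              (trans (ℤP.^-distribˡ-+-* g (double j ℕ.+ double a) (double (suc m))) (cong (_* g ^ double (suc m)) (ℤP.^-distribˡ-+-* g (double j) (double a))))
            l₂ : ∀ G J M L g → G + J * G * M - g ≡ G * (1ℤ + J - g * L) + g * (G * L - 1ℤ) + J * G * (M - 1ℤ)
            l₂ G J M L g = solve (G ∷ J ∷ M ∷ L ∷ g ∷ [])

    cover : ∀ k u → ¬ P ∣ u → ∃[ i ] ∃[ n ] suc n < p × P ^ suc k ∣ ((1ℤ + P) * (1ℤ + P)) ^ i * + suc n - u
    cover k u P∤u = from (u %ℕ p) refl
      where
      open Principal 0 (+ 2 + P) (∤-shift (+ 2) P P∤2 (divides 1ℤ (sym (ℤP.*-identityˡ P)))) (inj₁ P∣triangle)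
      h = 1ℤ + P
      γ≡ : γ ≡ h * h
      γ≡ = l P
        where
        l : ∀ P → 1ℤ + P * 1ℤ * (+ 2 + P) ≡ (1ℤ + P) * (1ℤ + P)
        l P = solve (P ∷ [])
      from : ∀ r → u %ℕ p ≡ r → ∃[ i ] ∃[ n ] suc n < p × P ^ suc k ∣ (h * h) ^ i * + suc n - u
      from zero e = ⊥-elim (ℕP.>⇒≢ (residue-positive u P∤u) e)
      from (suc n) e = from-inverse (invert (suc k) (+ suc n) (small-∤ n n<p))
        where
        n<p : suc n < p
        n<p = subst (_< p) e (n%ℕd<d u p)
        close : P ∣ + suc n - u
        close = subst (λ r → P ∣ + r - u) e (proj₂ (natural-residue u))
        from-inverse : ∃[ v ] P ^ suc k ∣ + suc n * v - 1ℤ → ∃[ i ] ∃[ n ] suc n < p × P ^ suc k ∣ (h * h) ^ i * + suc n - u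
        from-inverse (v , V) = s , n , n<p , subst (λ z → P ^ suc k ∣ z ^ s * + suc n - u) γ≡ (by (+ suc n ⊛ S ⊕ u ⊛ V) (lemma (γ ^ s) (+ suc n) u v))
          where
          near-one : P ^ 1 ∣ u * v - 1ℤ
          near-one = subst (_∣ u * v - 1ℤ) (sym (ℤP.*-identityʳ P)) (by (∣-trans (P∣P^ k) V ⊕ - v ⊛ close) (l u v (+ suc n)))
            where
            l : ∀ u v G → u * v - 1ℤ ≡ G * v - 1ℤ + - v * (G - u)
            l u v G = solve (u ∷ v ∷ G ∷ [])
          s = proj₁ (principal (u * v) near-one (suc k))
          S = proj₂ (principal (u * v) near-one (suc k))
          lemma : ∀ γ G u v → γ * G - u ≡ G * (γ - u * v) + u * (G * v - 1ℤ)
          lemma γ G u v = solve (γ ∷ G ∷ u ∷ v ∷ [])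

    odd-torus : ∀ k {𝔾 : Group 0ℓ 0ℓ} {x y : ℤ → Group.Carrier 𝔾} (el : Elementary (P ^ suc k) 𝔾 x y) →
      (∀ v → ¬ P ∣ + v → v ≤ suc p → ∃[ v' ] P ^ suc k ∣ + v * v' - 1ℤ × Weyl.Good 𝔾 x y (+ v) v') → Torus el
    odd-torus k el small = from (small (suc p) P∤h ℕP.≤-refl) (invert (suc k) g P∤g) (decompose generator k)
      where
      open Local el using (Unit; Good)
      open Units el
      P∤h : ¬ P ∣ + suc p
      P∤h = ∤-shift 1ℤ P P∤1 (divides 1ℤ (sym (ℤP.*-identityˡ P)))
      g = proj₁ generator
      P∤g = proj₁ (proj₂ (proj₂ generator))
      from : ∃[ h' ] P ^ suc k ∣ + suc p * h' - 1ℤ × Good (+ suc p) h' → ∃[ g' ] P ^ suc k ∣ g * g' - 1ℤ →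
        ∃[ a ] ∃[ b ] P ^ suc k ∣ g ^ double a + g ^ suc (suc (double b)) - g → Torus el
      from (h' , H , GH) (g' , U) (a , b , split) = cyclic-torus (+ suc p) h' H GH covering g g' U (λ u u' V → logarithm generator k u (unit⇒∤ k u u' V)) a b split
        where
        covering : ∀ u u' → Unit u u' → ∃[ i ] ∃[ r ] ∃[ r' ] Unit r r' × Good r r' × P ^ suc k ∣ (+ suc p * + suc p) ^ i * r - u
        covering u u' V = from-cover (cover k u (unit⇒∤ k u u' V))
          where
          from-cover : ∃[ i ] ∃[ n ] suc n < p × P ^ suc k ∣ (+ suc p * + suc p) ^ i * + suc n - u →
            ∃[ i ] ∃[ r ] ∃[ r' ] Unit r r' × Good r r' × P ^ suc k ∣ (+ suc p * + suc p) ^ i * r - u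
          from-cover (i , n , n<p , d) = from-small (small (suc n) (small-∤ n n<p) (ℕP.<⇒≤ (ℕP.m<n⇒m<1+n n<p)))
            where
            from-small : ∃[ v' ] P ^ suc k ∣ + suc n * v' - 1ℤ × Good (+ suc n) v' → _
            from-small (v' , V' , G) = i , + suc n , v' , V' , G , d

  module Dyadic where
    open PrimeModulus prime[2]

    private
      eight : ∀ {a} → + 8 ∣ + 3 * a → + 8 ∣ a
      eight {a} d = by (+ 3 ⊛ d ⊕ - a ⊛ divides 1ℤ refl) (solve (a ∷ []))

      eight′ : ∀ {a} → + 8 ∣ + 5 * a → + 8 ∣ a
      eight′ {a} d = by (+ 5 ⊛ d ⊕ (- (+ 3 * a)) ⊛ divides 1ℤ refl) (solve (a ∷ []))

    residue₈ : ∀ u → ¬ P ∣ u → (+ 8 ∣ u - 1ℤ ⊎ + 8 ∣ u - + 3) ⊎ (+ 8 ∣ u + 1ℤ ⊎ + 8 ∣ u + + 3)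
    residue₈ u odd = cases (u %ℕ 8) (n%ℕd<d u 8) (a≡a%ℕn+[a/ℕn]*n u 8)
      where
      q = u /ℕ 8
      even : ∀ t → u ≡ + 2 * t + q * + 8 → P ∣ u
      even t e = divides (t + q * + 4) (trans e (l t q))
        where
        l : ∀ t q → + 2 * t + q * + 8 ≡ (t + q * + 4) * + 2
        l t q = solve (t ∷ q ∷ [])
      minus : ∀ r → u ≡ r + q * + 8 → + 8 ∣ u - r
      minus r e = divides q (trans (cong (_- r) e) (l r q))
        where
        l : ∀ r q → r + q * + 8 - r ≡ q * + 8
        l r q = solve (r ∷ q ∷ [])
      plus : ∀ r s → r + s ≡ + 8 → u ≡ r + q * + 8 → + 8 ∣ u + s
      plus r s f e = divides (1ℤ + q) (trans (cong (_+ s) e) (trans (l r s q) (trans (cong (_+ q * + 8) f) (l′ q))))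
        where
        l : ∀ r s q → r + q * + 8 + s ≡ r + s + q * + 8
        l r s q = solve (r ∷ s ∷ q ∷ [])
        l′ : ∀ q → + 8 + q * + 8 ≡ (1ℤ + q) * + 8
        l′ q = solve (q ∷ [])
      cases : ∀ r → r < 8 → u ≡ + r + q * + 8 → (+ 8 ∣ u - 1ℤ ⊎ + 8 ∣ u - + 3) ⊎ (+ 8 ∣ u + 1ℤ ⊎ + 8 ∣ u + + 3)
      cases 0 _ e = ⊥-elim (odd (even 0ℤ e))
      cases 1 _ e = inj₁ (inj₁ (minus 1ℤ e))
      cases 2 _ e = ⊥-elim (odd (even 1ℤ e))
      cases 3 _ e = inj₁ (inj₂ (minus (+ 3) e))
      cases 4 _ e = ⊥-elim (odd (even (+ 2) e))
      cases 5 _ e = inj₂ (inj₂ (plus (+ 5) (+ 3) refl e))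
      cases 6 _ e = ⊥-elim (odd (even (+ 3) e))
      cases 7 _ e = inj₂ (inj₁ (plus (+ 7) 1ℤ refl e))
      cases (suc (suc (suc (suc (suc (suc (suc (suc r)))))))) (s≤s (s≤s (s≤s (s≤s (s≤s (s≤s (s≤s (s≤s ())))))))) e

    open Principal 2 1ℤ P∤1 (inj₂ (1 , refl))

    power-9 : ∀ i → (+ 3) ^ double i ≡ γ ^ i
    power-9 zero = refl
    power-9 (suc i) = trans (l ((+ 3) ^ double i)) (cong (+ 9 *_) (power-9 i))
      where
      l : ∀ a → + 3 * (+ 3 * a) ≡ + 9 * a
      l a = solve (a ∷ [])

    square : ∀ k u → + 8 ∣ u - 1ℤ → ∃[ i ] P ^ k ∣ (+ 3) ^ double i - u
    square k u d = proj₁ (principal u d k) , subst (λ z → P ^ k ∣ z - u) (sym (power-9 (proj₁ (principal u d k)))) (proj₂ (principal u d k))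

    module _ (Q : ℤ) (8∣Q : + 8 ∣ Q) (squares : ∀ u → + 8 ∣ u - 1ℤ → ∃[ i ] Q ∣ (+ 3) ^ double i - u)
        (odd-units : ∀ u u' → Q ∣ u * u' - 1ℤ → ¬ P ∣ u) (i₅ : ℤ) (U₅ : Q ∣ + 5 * i₅ - 1ℤ) where
      dyadic-logarithm : ∀ i₃ → Q ∣ + 3 * i₃ - 1ℤ → ∀ u → ¬ P ∣ u → ∃[ i ] (Q ∣ (+ 3) ^ i - u ⊎ Q ∣ (+ 3) ^ i + u)
      dyadic-logarithm i₃ U₃ u odd = [ [ (λ d → pos (one u d)) , (λ d → pos (three u d)) ]′
          , [ (λ d → neg (one (- u) (opposite 1ℤ d))) , (λ d → neg (three (- u) (opposite (+ 3) d))) ]′ ]′ (residue₈ u odd)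
        where
        opposite : ∀ r → + 8 ∣ u + r → + 8 ∣ - u - r
        opposite r d = by (- 1ℤ ⊛ d) (solve (u ∷ r ∷ []))
        one : ∀ u → + 8 ∣ u - 1ℤ → ∃[ i ] Q ∣ (+ 3) ^ i - u
        one u d = double (proj₁ (squares u d)) , proj₂ (squares u d)
        three : ∀ u → + 8 ∣ u - + 3 → ∃[ i ] Q ∣ (+ 3) ^ i - u
        three u d = from (squares (u * i₃) (eight (by (u ⊛ ∣-trans 8∣Q U₃ ⊕ d) (solve (u ∷ i₃ ∷ [])))))
          where
          l : ∀ a u i → + 3 * a - u ≡ + 3 * (a - u * i) + u * (+ 3 * i - 1ℤ)
          l a u i = solve (a ∷ u ∷ i ∷ [])
          from : ∃[ i ] Q ∣ (+ 3) ^ double i - u * i₃ → ∃[ i ] Q ∣ (+ 3) ^ i - u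
          from (i , I) = suc (double i) , by (+ 3 ⊛ I ⊕ u ⊛ U₃) (l ((+ 3) ^ double i) u i₃)
        pos : ∃[ i ] Q ∣ (+ 3) ^ i - u → ∃[ i ] (Q ∣ (+ 3) ^ i - u ⊎ Q ∣ (+ 3) ^ i + u)
        pos (i , I) = i , inj₁ I
        neg : ∃[ i ] Q ∣ (+ 3) ^ i - - u → ∃[ i ] (Q ∣ (+ 3) ^ i - u ⊎ Q ∣ (+ 3) ^ i + u)
        neg (i , I) = i , inj₂ (by I (l ((+ 3) ^ i) u))
          where
          l : ∀ a u → a + u ≡ a - - u
          l a u = solve (a ∷ u ∷ [])

      two-torus′ : ∀ {𝔾 : Group 0ℓ 0ℓ} {x y : ℤ → Group.Carrier 𝔾} (el : Elementary Q 𝔾 x y) →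
        (∃[ v' ] Q ∣ + 3 * v' - 1ℤ × Weyl.Good 𝔾 x y (+ 3) v') →
        (let w = Weyl.W 𝔾 x y 1ℤ 1ℤ in Rewriting._≋_ 𝔾 (w ∷ w ∷ w ∷ w ∷ []) []) → Torus el
      two-torus′ el (i₃ , U₃ , G₃) w⁴ = from-square (squares (- (+ 3 * i₅)) (eight′ (by ((- + 3) ⊛ ∣-trans 8∣Q U₅ ⊕ (- 1ℤ) ⊛ divides 1ℤ refl) (solve (i₅ ∷ [])))))
        where
        from-square : ∃[ f ] Q ∣ (+ 3) ^ double f - - (+ 3 * i₅) → Torus el
        from-square (f , F) = Units.dyadic-torus el i₃ U₃ G₃ (λ u u' V → dyadic-logarithm i₃ U₃ u (odd-units u u' V)) i₅ U₅ f (by F (l ((+ 3) ^ double f) i₅)) w⁴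
          where
          l : ∀ a i → a + + 3 * i ≡ a - - (+ 3 * i)
          l a i = solve (a ∷ i ∷ [])

    two-torus : ∀ k {𝔾 : Group 0ℓ 0ℓ} {x y : ℤ → Group.Carrier 𝔾} (el : Elementary (P ^ (3 ℕ.+ k)) 𝔾 x y) →
      (∃[ v' ] P ^ (3 ℕ.+ k) ∣ + 3 * v' - 1ℤ × Weyl.Good 𝔾 x y (+ 3) v') →
      (let w = Weyl.W 𝔾 x y 1ℤ 1ℤ in Rewriting._≋_ 𝔾 (w ∷ w ∷ w ∷ w ∷ []) []) → Torus el
    two-torus k = two-torus′ (P ^ (3 ℕ.+ k)) (P^-mono {3} (ℕP.m≤m+n 3 k)) (square (3 ℕ.+ k)) (unit⇒∤ (2 ℕ.+ k)) (proj₁ inverse) (proj₂ inverse)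
      where
      5-odd : ¬ P ∣ + 5
      5-odd d = toWitnessFalse {a? = 2 ℕD.∣? 5} _ (∣⇒∣ᵤ d)
      inverse = invert (3 ℕ.+ k) (+ 5) 5-odd

module CongruenceKernel where
  open GroupWords
  open ElementaryRelations
  open NormalForms
  open PrimePowers
  open PrimitiveRoots
  open UnitGroups
  open import Algebra.Bundles using (Group)
  open import Level using (0ℓ)
  open import Data.List using ([]; _∷_; _++_)
  open import Data.Nat as ℕ using (ℕ; zero; suc; z≤n; s≤s; _≤_; _<_)
  import Data.Nat.Properties as ℕP
  import Data.Nat.Divisibility as ℕD
  open import Data.Nat.Induction using (<-rec)
  open import Data.Nat.Primality using (Prime; prime⇒nonTrivial; prime⇒nonZero; prime[2]; euclidsLemma)
  open import Relation.Nullary.Decidable using (toWitnessFalse)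
  open import Data.Nat.Coprimality as Cop using (Coprime)
  open import Data.Integer using (ℤ; +_; _+_; _*_; _-_; -_; _^_; 0ℤ; 1ℤ)
  import Data.Integer.Properties as ℤP
  open import Data.Integer.Divisibility.Signed using (_∣_; divides; ∣⇒∣ᵤ; ∣-trans)
  open import Data.Integer.Tactic.RingSolver using (solve)
  open import Data.Product using (_×_; _,_; Σ; ∃-syntax)
  open import Data.Sum using ([_,_]′)
  open import Data.Empty using (⊥-elim)
  open import Relation.Nullary using (¬_)
  open import Relation.Binary.PropositionalEquality as ≡ using (_≡_)

  pos-^ : ∀ p k → (+ p) ^ k ≡ + (p ℕ.^ k)
  pos-^ p zero = ≡.refl
  pos-^ p (suc k) = ≡.trans (≡.cong (+ p *_) (pos-^ p k)) (≡.sym (ℤP.pos-* p (p ℕ.^ k)))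

  coprime-∣ : ∀ {r s} → Coprime r s → ∀ {a} → + r ∣ a → + s ∣ a → + r * + s ∣ a
  coprime-∣ {r} {s} co {a} ra sa = from (bézout r s co) ra sa
    where
    from : ∃[ u ] ∃[ v ] u * + r + v * + s ≡ 1ℤ → + r ∣ a → + s ∣ a → + r * + s ∣ a
    from (u , v , b) (divides i e) (divides j f) = divides (u * j + v * i)
      (≡.trans (≡.sym (ℤP.*-identityˡ a)) (≡.trans (≡.cong (_* a) (≡.sym b)) (≡.trans (ℤP.*-distribʳ-+ a (u * + r) (v * + s))
        (≡.trans (≡.cong₂ (λ z w → u * + r * z + v * + s * w) f e) (l u v i j (+ r) (+ s))))))
      where
      l : ∀ u v i j r s → u * r * (j * s) + v * s * (i * r) ≡ (u * j + v * i) * (r * s)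
      l u v i j r s = solve (u ∷ v ∷ i ∷ j ∷ r ∷ s ∷ [])

  -- What is known about the images of e₁₂(a), e₂₁(a) in a quotient by a subgroup containing E(q).
  record CongruenceData (𝔾 : Group 0ℓ 0ℓ) (x y : ℤ → Group.Carrier 𝔾) (q : ℕ) : Set where
    open Rewriting 𝔾
    open Weyl 𝔾 x y
    field
      x-homo : ∀ a b → x (a + b) ≈ x a ∙ x b
      y-homo : ∀ a b → y (a + b) ≈ y a ∙ y b
      x-level : ∀ {a} → + q ∣ a → x a ≈ ε
      y-level : ∀ {a} → + q ∣ a → y a ≈ ε
      good₁ : Good 1ℤ 1ℤ
      w₀⁴ : W 1ℤ 1ℤ ∷ W 1ℤ 1ℤ ∷ W 1ℤ 1ℤ ∷ W 1ℤ 1ℤ ∷ [] ≋ []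
      commute : ∀ {a b} → + q ∣ a * b → x a ∷ y b ∷ [] ≋ y b ∷ x a ∷ []
      small : ∀ {p} → Prime p → ∀ k q' → q ≡ p ℕ.^ suc k ℕ.* q' → ¬ p ℕD.∣ q' → ∀ v → ¬ + p ∣ + v → v ≤ suc p →
        ∃[ v' ] (+ p) ^ suc k ∣ + v * v' - 1ℤ
          × (∀ a → W (+ v) v' ∷ x (+ q' * a) ∷ [] ≋ y (- (v' * v' * (+ q' * a))) ∷ W (+ v) v' ∷ [])
          × (∀ a → W (+ v) v' ∷ y (+ q' * a) ∷ [] ≋ x (- (+ v * + v * (+ q' * a))) ∷ W (+ v) v' ∷ [])
      even-part : ∃[ k ] ∃[ q₀ ] q ≡ 2 ℕ.^ (3 ℕ.+ k) ℕ.* q₀ × ¬ 2 ℕD.∣ q₀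

  module CongruenceSubgroup {𝔾 : Group 0ℓ 0ℓ} {x y : ℤ → Group.Carrier 𝔾} {q : ℕ} (data′ : CongruenceData 𝔾 x y q) where
    open CongruenceData data′
    open Rewriting 𝔾
    open Weyl 𝔾 x y
    open Evaluate 𝔾

    difference : ∀ a b → a ≡ a - b + b
    difference a b = solve (a ∷ b ∷ [])

    x-cong : ∀ {a b} → + q ∣ a - b → x a ≈ x b
    x-cong {a} {b} d = trans (reflexive (≡.cong x (difference a b))) (trans (x-homo (a - b) b) (trans (∙-congʳ (x-level d)) (identityˡ _)))

    y-cong : ∀ {a b} → + q ∣ a - b → y a ≈ y b
    y-cong {a} {b} d = trans (reflexive (≡.cong y (difference a b))) (trans (y-homo (a - b) b) (trans (∙-congʳ (y-level d)) (identityˡ _)))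

    _⋆_ : (ℤ → Carrier) → ℤ → ℤ → Carrier
    (z ⋆ π) a = z (π * a)

    evalₚ : ℤ → Word → Carrier
    evalₚ π = eval (x ⋆ π) (y ⋆ π)

    module Split (π π' : ℤ) (orth : + q ∣ π * π') where
      orth′ : ∀ a b → + q ∣ π * a * (π' * b)
      orth′ a b = by ((a * b) ⊛ orth) (solve (π ∷ π' ∷ a ∷ b ∷ []))

      orth″ : ∀ a b → + q ∣ π' * b * (π * a)
      orth″ a b = by ((a * b) ⊛ orth) (solve (π ∷ π' ∷ a ∷ b ∷ []))

      xx-commute : ∀ a b → x a ∷ x b ∷ [] ≋ x b ∷ x a ∷ []
      xx-commute a b = eq (trans (∙-congˡ (identityʳ _)) (trans (sym (x-homo a b)) (trans (reflexive (≡.cong x (ℤP.+-comm a b))) (trans (x-homo b a) (∙-congˡ (sym (identityʳ _)))))))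

      yy-commute : ∀ a b → y a ∷ y b ∷ [] ≋ y b ∷ y a ∷ []
      yy-commute a b = eq (trans (∙-congˡ (identityʳ _)) (trans (sym (y-homo a b)) (trans (reflexive (≡.cong y (ℤP.+-comm a b))) (trans (y-homo b a) (∙-congˡ (sym (identityʳ _)))))))

      letter-commute : ∀ l m → Evaluate.⟪_⟫ 𝔾 (x ⋆ π) (y ⋆ π) l ∷ Evaluate.⟪_⟫ 𝔾 (x ⋆ π') (y ⋆ π') m ∷ []
        ≋ Evaluate.⟪_⟫ 𝔾 (x ⋆ π') (y ⋆ π') m ∷ Evaluate.⟪_⟫ 𝔾 (x ⋆ π) (y ⋆ π) l ∷ []
      letter-commute (𝕩 a) (𝕩 b) = xx-commute _ _
      letter-commute (𝕩 a) (𝕪 b) = commute (orth′ a b)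
      letter-commute (𝕪 a) (𝕩 b) = flip (commute (orth″ a b))
      letter-commute (𝕪 a) (𝕪 b) = yy-commute _ _

      word-commute : ∀ ω m → evalₚ π ω ∷ Evaluate.⟪_⟫ 𝔾 (x ⋆ π') (y ⋆ π') m ∷ [] ≋ Evaluate.⟪_⟫ 𝔾 (x ⋆ π') (y ⋆ π') m ∷ evalₚ π ω ∷ []
      word-commute [] m = eq (trans (identityˡ _) (∙-congˡ (sym (identityʳ _))))
      word-commute (l ∷ ω) m = at [] (split l ω) ⟫ at (_ ∷ []) (word-commute ω m) ⟫ at [] (letter-commute l m) ⟫ at (_ ∷ []) (flip (split l ω))
        where
        split : ∀ l ω → evalₚ π (l ∷ ω) ∷ [] ≋ Evaluate.⟪_⟫ 𝔾 (x ⋆ π) (y ⋆ π) l ∷ evalₚ π ω ∷ []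
        split l ω = eq (assoc _ _ _)

      letter-split : ∀ l → Evaluate.⟪_⟫ 𝔾 (x ⋆ (π + π')) (y ⋆ (π + π')) l ≈ Evaluate.⟪_⟫ 𝔾 (x ⋆ π) (y ⋆ π) l ∙ Evaluate.⟪_⟫ 𝔾 (x ⋆ π') (y ⋆ π') l
      letter-split (𝕩 a) = trans (reflexive (≡.cong x (ℤP.*-distribʳ-+ a π π'))) (x-homo _ _)
      letter-split (𝕪 a) = trans (reflexive (≡.cong y (ℤP.*-distribʳ-+ a π π'))) (y-homo _ _)

      eval-split : ∀ ω → evalₚ (π + π') ω ≈ evalₚ π ω ∙ evalₚ π' ω
      eval-split [] = sym (identityˡ _)
      eval-split (l ∷ ω) = unletter (eq (assoc _ _ _) ⟫ at [] (letter (letter-split l)) ⟫ at (_ ∷ []) (letter (eval-split ω))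
        ⟫ regroup ⟫ at (_ ∷ []) (flip (word-commute ω l)) ⟫ eq shuffle)
        where
        regroup : ∀ {a b c d} → a ∙ b ∷ c ∙ d ∷ [] ≋ a ∷ b ∷ c ∷ d ∷ []
        regroup = eq (trans (assoc _ _ _) (∙-congˡ (∙-congˡ (assoc _ _ _))))
        shuffle : ∀ {a b c d} → a ∙ (b ∙ (c ∙ (d ∙ ε))) ≈ (a ∙ b) ∙ (c ∙ d) ∙ ε
        shuffle = trans (sym (assoc _ _ _)) (trans (∙-congˡ (∙-congˡ (identityʳ _))) (sym (identityʳ _)))

    eval-one : ∀ {π} → + q ∣ π - 1ℤ → ∀ ω → evalₚ π ω ≈ eval x y ω
    eval-one d [] = refl
    eval-one {π} d (𝕩 a ∷ ω) = ∙-cong (x-cong {π * a} {a} (by (a ⊛ d) (solve (π ∷ a ∷ [])))) (eval-one {π} d ω)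
    eval-one {π} d (𝕪 a ∷ ω) = ∙-cong (y-cong {π * a} {a} (by (a ⊛ d) (solve (π ∷ a ∷ [])))) (eval-one {π} d ω)

    eval-zero : ∀ {π} → + q ∣ π → ∀ ω → evalₚ π ω ≈ ε
    eval-zero d [] = refl
    eval-zero {π} d (𝕩 a ∷ ω) = trans (∙-cong (x-level {π * a} (by (a ⊛ d) (solve (π ∷ a ∷ [])))) (eval-zero {π} d ω)) (identityˡ _)
    eval-zero {π} d (𝕪 a ∷ ω) = trans (∙-cong (y-level {π * a} (by (a ⊛ d) (solve (π ∷ a ∷ [])))) (eval-zero {π} d ω)) (identityˡ _)

    weyl : ℤ → ℤ → Word
    weyl v v' = 𝕩 v ∷ 𝕪 (- v') ∷ 𝕩 v ∷ []

    -- A Weyl element acts on the π-component through its own π-component.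
    component-good : ∀ {π} → + q ∣ π * (1ℤ - π) → ∀ v v' →
      (∀ a → W v v' ∷ x (π * a) ∷ [] ≋ y (- (v' * v' * (π * a))) ∷ W v v' ∷ []) →
      (∀ a → W v v' ∷ y (π * a) ∷ [] ≋ x (- (v * v * (π * a))) ∷ W v v' ∷ []) →
      Weyl.Good 𝔾 (x ⋆ π) (y ⋆ π) v v'
    component-good {π} orth v v' gx gy = record
      { good-x = λ a → cancelʳ _ _ (W′ ∷ []) (at (_ ∷ []) (flip (commutes (𝕩 a))) ⟫ at [] (flip full) ⟫ gx a ⟫ at [] (letter (reflexive (≡.cong y (scalar π (v' * v') a)))) ⟫ at (_ ∷ []) full)
      ; good-y = λ a → cancelʳ _ _ (W′ ∷ []) (at (_ ∷ []) (flip (commutes (𝕪 a))) ⟫ at [] (flip full) ⟫ gy a ⟫ at [] (letter (reflexive (≡.cong x (scalar π (v * v) a)))) ⟫ at (_ ∷ []) full) }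
      where
      scalar : ∀ π s a → - (s * (π * a)) ≡ π * - (s * a)
      scalar π s a = solve (π ∷ s ∷ a ∷ [])
      W′ = evalₚ (1ℤ - π) (weyl v v')
      full : W v v' ∷ [] ≋ evalₚ π (weyl v v') ∷ W′ ∷ []
      full = eq (trans (∙-congʳ (trans (sym (eval-one {π + (1ℤ - π)} (divides 0ℤ (one π)) (weyl v v'))) (Split.eval-split π (1ℤ - π) orth (weyl v v')))) (assoc _ _ _))
        where
        one : ∀ π → π + (1ℤ - π) - 1ℤ ≡ 0ℤ
        one π = solve (π ∷ [])
      commutes : ∀ l → W′ ∷ Evaluate.⟪_⟫ 𝔾 (x ⋆ π) (y ⋆ π) l ∷ [] ≋ Evaluate.⟪_⟫ 𝔾 (x ⋆ π) (y ⋆ π) l ∷ W′ ∷ []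
      commutes l = Split.word-commute (1ℤ - π) π (by orth (ℤP.*-comm (1ℤ - π) π)) (weyl v v') l

    record Idempotent (r d : ℤ) : Set where
      field
        π : ℤ
        π≡1 : r ∣ π - 1ℤ
        π≡0 : d ∣ π
        level : r * d ≡ + q

      product : ∀ {a b} → r ∣ a → d ∣ b → + q ∣ a * b
      product (divides s ≡.refl) (divides t ≡.refl) = divides (s * t) (≡.trans (l s r t d) (≡.cong (s * t *_) level))
        where
        l : ∀ s r t d → s * r * (t * d) ≡ s * t * (r * d)
        l s r t d = solve (s ∷ r ∷ t ∷ d ∷ [])

      orthogonal : + q ∣ π * (1ℤ - π)
      orthogonal = by (- 1ℤ ⊛ product π≡1 π≡0) (l π)
        where
        l : ∀ π → π * (1ℤ - π) ≡ - 1ℤ * ((π - 1ℤ) * π)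
        l π = solve (π ∷ [])

      restrict : ∀ a b → r ∣ a - b → + q ∣ π * a - π * b
      restrict a b δ = by (product δ π≡0) (l a b π)
        where
        l : ∀ a b π → π * a - π * b ≡ (a - b) * π
        l a b π = solve (a ∷ b ∷ π ∷ [])

      elementary : Elementary r 𝔾 (x ⋆ π) (y ⋆ π)
      elementary = record
        { x-cong = λ {a} {b} δ → x-cong (restrict a b δ)
        ; y-cong = λ {a} {b} δ → y-cong (restrict a b δ)
        ; x-homo = λ a b → trans (reflexive (≡.cong x (ℤP.*-distribˡ-+ π a b))) (x-homo (π * a) (π * b))
        ; y-homo = λ a b → trans (reflexive (≡.cong y (ℤP.*-distribˡ-+ π a b))) (y-homo (π * a) (π * b))
        ; good₁ = component-good {π} orthogonal 1ℤ 1ℤ (λ a → good-x good₁ (π * a)) (λ a → good-y good₁ (π * a)) }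

      Unique : Set
      Unique = ∀ ω₁ ω₂ → Congruent r (matrix ω₁) (matrix ω₂) → evalₚ π ω₁ ≈ evalₚ π ω₂

      small-good : ∀ v v' →
        (∀ a → W v v' ∷ x (d * a) ∷ [] ≋ y (- (v' * v' * (d * a))) ∷ W v v' ∷ []) →
        (∀ a → W v v' ∷ y (d * a) ∷ [] ≋ x (- (v * v * (d * a))) ∷ W v v' ∷ []) →
        Weyl.Good 𝔾 (x ⋆ π) (y ⋆ π) v v'
      small-good v v' gx gy = from π≡0
        where
        from : d ∣ π → Weyl.Good 𝔾 (x ⋆ π) (y ⋆ π) v v'
        from (divides t e) = component-good {π} orthogonal v v'
          (λ a → ≡.subst (λ z → W v v' ∷ x z ∷ [] ≋ y (- (v' * v' * z)) ∷ W v v' ∷ []) (l a) (gx (t * a)))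
          (λ a → ≡.subst (λ z → W v v' ∷ y z ∷ [] ≋ x (- (v * v * z)) ∷ W v v' ∷ []) (l a) (gy (t * a)))
          where
          l : ∀ a → d * (t * a) ≡ π * a
          l a = ≡.trans (m d t a) (≡.cong (_* a) (≡.sym e))
            where
            m : ∀ d t a → d * (t * a) ≡ t * d * a
            m d t a = solve (d ∷ t ∷ a ∷ [])
    open Idempotent

    Component : ℤ → ℤ → Set
    Component r d = Σ (Idempotent r d) Unique

    idempotent : ∀ r d → Coprime r d → q ≡ r ℕ.* d → Idempotent (+ r) (+ d)
    idempotent r d co e = from (bézout r d co)
      where
      from : ∃[ u ] ∃[ v ] u * + r + v * + d ≡ 1ℤ → Idempotent (+ r) (+ d)
      from (u , v , b) = record { π = v * + d ; π≡1 = divides (- u) (≡.trans (≡.cong (λ z → v * + d - z) (≡.sym b)) (l u (+ r) (v * + d)))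
        ; π≡0 = divides v ≡.refl ; level = ≡.trans (≡.sym (ℤP.pos-* r d)) (≡.cong +_ (≡.sym e)) }
        where
        l : ∀ u r s → s - (u * r + s) ≡ - u * r
        l u r s = solve (u ∷ r ∷ s ∷ [])

    prime-component : ∀ {p} → Prime p → ¬ p ≡ 2 → ∀ k d → q ≡ p ℕ.^ suc k ℕ.* d → ¬ p ℕD.∣ d → Component (+ (p ℕ.^ suc k)) (+ d)
    prime-component {p} pr p≢2 k d e p∤d = id₁ , unique
      where
      id₁ : Idempotent (+ (p ℕ.^ suc k)) (+ d)
      id₁ = idempotent (p ℕ.^ suc k) d (Cop.sym (coprime-power (coprime-prime pr p∤d) (suc k))) e
      id₂ : Idempotent ((+ p) ^ suc k) (+ d)
      id₂ = ≡.subst (λ r → Idempotent r (+ d)) (≡.sym (pos-^ p (suc k))) id₁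
      unique₂ : Unique id₂
      unique₂ = NormalForm.eval-unique (OddPrime.odd-torus pr p≢2 k (elementary id₂) goods) (PrimeModulus.localRing pr k)
        where
        goods : ∀ v → ¬ + p ∣ + v → v ≤ suc p → ∃[ v' ] (+ p) ^ suc k ∣ + v * v' - 1ℤ × Weyl.Good 𝔾 (x ⋆ π id₂) (y ⋆ π id₂) (+ v) v'
        goods v p∤v v≤ = from (small pr k d e p∤d v p∤v v≤)
          where
          from : ∃[ v' ] (+ p) ^ suc k ∣ + v * v' - 1ℤ
              × (∀ a → W (+ v) v' ∷ x (+ d * a) ∷ [] ≋ y (- (v' * v' * (+ d * a))) ∷ W (+ v) v' ∷ [])
              × (∀ a → W (+ v) v' ∷ y (+ d * a) ∷ [] ≋ x (- (+ v * + v * (+ d * a))) ∷ W (+ v) v' ∷ []) →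
            ∃[ v' ] (+ p) ^ suc k ∣ + v * v' - 1ℤ × Weyl.Good 𝔾 (x ⋆ π id₂) (y ⋆ π id₂) (+ v) v'
          from (v' , V , gx , gy) = v' , V , small-good id₂ (+ v) v' gx gy
      transport : ∀ {r r'} (e : r ≡ r') (I : Idempotent r (+ d)) → Unique (≡.subst (λ r → Idempotent r (+ d)) e I) → Unique I
      transport ≡.refl I U = U
      unique : Unique id₁
      unique = transport (≡.sym (pos-^ p (suc k))) id₁ unique₂

    congruent-∣ : ∀ {Q R} → Q ∣ R → ∀ m n → Congruent R m n → Congruent Q m n
    congruent-∣ d (matℤ _ _ _ _) (matℤ _ _ _ _) (da , db , dc , dd) = ∣-trans d da , ∣-trans d db , ∣-trans d dc , ∣-trans d dd

    combine : ∀ {r s d} → Coprime r s → + r * + s * + d ≡ + q → Component (+ r) (+ s * + d) → Component (+ s) (+ r * + d) → Component (+ r * + s) (+ d)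
    combine {r} {s} {d} co e (I , U) (J , V) = K , unique
      where
      K : Idempotent (+ r * + s) (+ d)
      K = record
        { π = π I + π J
        ; π≡1 = coprime-∣ co (by (π≡1 I ⊕ ∣-trans (divides (+ d) (ℤP.*-comm (+ r) (+ d))) (π≡0 J)) (l (π I) (π J)))
            (by (π≡1 J ⊕ ∣-trans (divides (+ d) (ℤP.*-comm (+ s) (+ d))) (π≡0 I)) (l′ (π I) (π J)))
        ; π≡0 = ∣-trans (divides (+ s) ≡.refl) (π≡0 I) ⊕ ∣-trans (divides (+ r) ≡.refl) (π≡0 J)
        ; level = e }
        where
        l : ∀ a b → a + b - 1ℤ ≡ a - 1ℤ + b
        l a b = solve (a ∷ b ∷ [])
        l′ : ∀ a b → a + b - 1ℤ ≡ b - 1ℤ + a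
        l′ a b = solve (a ∷ b ∷ [])
      orth : + q ∣ π I * π J
      orth = go (π≡0 I) (π≡0 J)
        where
        go : ∀ {a b} → + s * + d ∣ a → + r * + d ∣ b → + q ∣ a * b
        go (divides t ≡.refl) (divides t' ≡.refl) = divides (t * t' * + d) (≡.trans (l t t' (+ r) (+ s) (+ d)) (≡.cong (λ z → t * t' * + d * z) e))
          where
          l : ∀ t t' r s d → t * (s * d) * (t' * (r * d)) ≡ t * t' * d * (r * s * d)
          l t t' r s d = solve (t ∷ t' ∷ r ∷ s ∷ d ∷ [])
      unique : Unique K
      unique ω₁ ω₂ c = trans (S.eval-split ω₁) (trans (∙-cong
          (U ω₁ ω₂ (congruent-∣ (divides (+ s) (ℤP.*-comm (+ r) (+ s))) (matrix ω₁) (matrix ω₂) c))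
          (V ω₁ ω₂ (congruent-∣ (divides (+ r) ≡.refl) (matrix ω₁) (matrix ω₂) c))) (sym (S.eval-split ω₂)))
        where module S = Split (π I) (π J) orth

    trivial-component : ∀ d → q ≡ 1 ℕ.* d → Component (+ 1) (+ d)
    trivial-component d e = I , λ ω₁ ω₂ _ → trans (eval-zero {0ℤ} z ω₁) (sym (eval-zero {0ℤ} z ω₂))
      where
      z : + q ∣ 0ℤ
      z = divides 0ℤ ≡.refl
      I : Idempotent (+ 1) (+ d)
      I = record { π = 0ℤ ; π≡1 = divides (- 1ℤ) ≡.refl ; π≡0 = divides 0ℤ ≡.refl ; level = ≡.trans (≡.sym (ℤP.pos-* 1 d)) (≡.cong +_ (≡.sym e)) }

    odd-component : ∀ r d → q ≡ r ℕ.* d → Coprime r d → ¬ 2 ℕD.∣ r → Component (+ r) (+ d)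
    odd-component = <-rec _ go
      where
      go : ∀ r → (∀ {r'} → r' < r → ∀ d → q ≡ r' ℕ.* d → Coprime r' d → ¬ 2 ℕD.∣ r' → Component (+ r') (+ d)) →
        ∀ d → q ≡ r ℕ.* d → Coprime r d → ¬ 2 ℕD.∣ r → Component (+ r) (+ d)
      go 0 rec d e co odd = ⊥-elim (odd (ℕD.divides 0 ≡.refl))
      go 1 rec d e co odd = trivial-component d e
      go r@(suc (suc _)) rec d e co odd = from (prime-divisor r (s≤s (s≤s z≤n)))
        where
        from : ∃[ p ] Prime p × p ℕD.∣ r → Component (+ r) (+ d)
        from (p , pr , p∣r) = from′ (strip pr r (s≤s z≤n))
          where
          1<p : 1 < p
          1<p = ℕ.nonTrivial⇒n>1 p ⦃ prime⇒nonTrivial pr ⦄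
          from′ : ∃[ f ] ∃[ r' ] r ≡ p ℕ.^ f ℕ.* r' × ¬ p ℕD.∣ r' → Component (+ r) (+ d)
          from′ (zero , r' , e' , p∤r') = ⊥-elim (p∤r' (≡.subst (p ℕD.∣_) (≡.trans e' (ℕP.+-identityʳ r')) p∣r))
          from′ (suc f , r' , e' , p∤r') = ≡.subst (λ z → Component z (+ d)) (≡.trans (≡.sym (ℤP.pos-* (p ℕ.^ suc f) r')) (≡.cong +_ (≡.sym e')))
              (combine (Cop.sym (coprime-power (coprime-prime pr p∤r') (suc f))) level′
                (≡.subst (Component (+ (p ℕ.^ suc f))) (ℤP.pos-* r' d)
                  (prime-component pr (λ { ≡.refl → odd p∣r }) f (r' ℕ.* d) e₁ p∤r'd))
                (≡.subst (Component (+ r')) (ℤP.pos-* (p ℕ.^ suc f) d)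
                  (rec r'<r (p ℕ.^ suc f ℕ.* d) e₂ co₂ (λ t → odd (ℕD.∣-trans t r'∣r)))))
            where
            r'∣r : r' ℕD.∣ r
            r'∣r = ℕD.divides (p ℕ.^ suc f) e'
            e₁ : q ≡ p ℕ.^ suc f ℕ.* (r' ℕ.* d)
            e₁ = ≡.trans e (≡.trans (≡.cong (ℕ._* d) e') (ℕP.*-assoc (p ℕ.^ suc f) r' d))
            e₂ : q ≡ r' ℕ.* (p ℕ.^ suc f ℕ.* d)
            e₂ = ≡.trans e (≡.trans (≡.cong (ℕ._* d) (≡.trans e' (ℕP.*-comm (p ℕ.^ suc f) r'))) (ℕP.*-assoc r' (p ℕ.^ suc f) d))
            level′ : + (p ℕ.^ suc f) * + r' * + d ≡ + q
            level′ = ≡.trans (≡.cong (λ z → z * + d) (≡.sym (ℤP.pos-* (p ℕ.^ suc f) r'))) (≡.trans (≡.sym (ℤP.pos-* (p ℕ.^ suc f ℕ.* r') d))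
              (≡.cong +_ (≡.sym (≡.trans e (≡.cong (ℕ._* d) e')))))
            p∤r'd : ¬ p ℕD.∣ r' ℕ.* d
            p∤r'd t = [ p∤r' , (λ p∣d → ℕP.<⇒≢ 1<p (≡.sym (co (p∣r , p∣d)))) ]′ (euclidsLemma r' d pr t)
            co₂ : Coprime r' (p ℕ.^ suc f ℕ.* d)
            co₂ {i} (i∣r' , i∣) = co (ℕD.∣-trans i∣r' r'∣r , Cop.coprime-divisor (λ (j∣i , j∣p) → coprime-power (coprime-prime pr p∤r') (suc f) (ℕD.∣-trans j∣i i∣r' , j∣p)) i∣)
            r'<r : r' < r
            r'<r = ≡.subst (r' <_) (≡.sym e') (ℕP.<-≤-trans (≡.subst (r' <_) (ℕP.*-comm r' p) (ℕP.m<m*n r' p ⦃ ℕ.>-nonZero 0<r' ⦄ 1<p)) (ℕP.*-monoˡ-≤ r' p≤))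
              where
              0<r' : 0 < r'
              0<r' = ℕP.n≢0⇒n>0 λ { ≡.refl → p∤r' (ℕD._∣0 p) }
              p≤ : p ≤ p ℕ.^ suc f
              p≤ = ℕP.m≤m*n p (p ℕ.^ f) ⦃ ℕP.m^n≢0 p f ⦃ prime⇒nonZero pr ⦄ ⦄

    private
      w₀-word = weyl 1ℤ 1ℤ ++ weyl 1ℤ 1ℤ ++ weyl 1ℤ 1ℤ ++ weyl 1ℤ 1ℤ

      spell : ∀ x y → (let w = Weyl.W 𝔾 x y 1ℤ 1ℤ in w ∷ w ∷ w ∷ w ∷ [] ≋ eval x y w₀-word ∷ [])
      spell x y = at [] (flip (pack ls)) ⟫ at ls (flip (pack ls)) ⟫ at (ls ++ ls) (flip (pack ls)) ⟫ at (ls ++ ls ++ ls) (flip (pack ls)) ⟫ pack (ls ++ ls ++ ls ++ ls)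
        where
        ls = x 1ℤ ∷ y (- 1ℤ) ∷ x 1ℤ ∷ []

    eval-unique : ∀ ω₁ ω₂ → Congruent (+ q) (matrix ω₁) (matrix ω₂) → eval x y ω₁ ≈ eval x y ω₂
    eval-unique = from even-part
      where
      from : ∃[ k ] ∃[ q₀ ] q ≡ 2 ℕ.^ (3 ℕ.+ k) ℕ.* q₀ × ¬ 2 ℕD.∣ q₀ → ∀ ω₁ ω₂ → Congruent (+ q) (matrix ω₁) (matrix ω₂) → eval x y ω₁ ≈ eval x y ω₂
      from (k , q₀ , e , odd) = finish (odd-component q₀ (2 ℕ.^ (3 ℕ.+ k)) (≡.trans e (ℕP.*-comm (2 ℕ.^ (3 ℕ.+ k)) q₀)) (coprime-power (coprime-prime prime[2] odd) (3 ℕ.+ k)) odd)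
        where
        finish : Component (+ q₀) (+ (2 ℕ.^ (3 ℕ.+ k))) → ∀ ω₁ ω₂ → Congruent (+ q) (matrix ω₁) (matrix ω₂) → eval x y ω₁ ≈ eval x y ω₂
        finish (I , U) ω₁ ω₂ c = trans (total ω₁) (trans (∙-cong (U ω₁ ω₂ (congruent-∣ q₀∣q (matrix ω₁) (matrix ω₂) c)) (V ω₁ ω₂ (congruent-∣ 2∣q (matrix ω₁) (matrix ω₂) c))) (sym (total ω₂)))
          where
          2ᵏ≡ : (+ 2) ^ (3 ℕ.+ k) ≡ + (2 ℕ.^ (3 ℕ.+ k))
          2ᵏ≡ = pos-^ 2 (3 ℕ.+ k)
          q₀∣q : + q₀ ∣ + q
          q₀∣q = divides (+ (2 ℕ.^ (3 ℕ.+ k))) (≡.trans (≡.cong +_ e) (ℤP.pos-* (2 ℕ.^ (3 ℕ.+ k)) q₀))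
          2∣q : (+ 2) ^ (3 ℕ.+ k) ∣ + q
          2∣q = divides (+ q₀) (≡.trans (≡.sym (level I)) (≡.cong (λ z → + q₀ * z) (≡.sym 2ᵏ≡)))
          module S = Split (π I) (1ℤ - π I) (orthogonal I)
          total : ∀ ω → eval x y ω ≈ evalₚ (π I) ω ∙ evalₚ (1ℤ - π I) ω
          total ω = trans (sym (eval-one {π I + (1ℤ - π I)} (divides 0ℤ (one (π I))) ω)) (S.eval-split ω)
            where
            one : ∀ π → π + (1ℤ - π) - 1ℤ ≡ 0ℤ
            one π = solve (π ∷ [])
          J : Idempotent ((+ 2) ^ (3 ℕ.+ k)) (+ q₀)
          J = record { π = 1ℤ - π I
            ; π≡1 = ≡.subst (_∣ 1ℤ - π I - 1ℤ) (≡.sym 2ᵏ≡) (by (- 1ℤ ⊛ π≡0 I) (l (π I))) ; π≡0 = by (- 1ℤ ⊛ π≡1 I) (l′ (π I))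
            ; level = ≡.trans (ℤP.*-comm _ (+ q₀)) (≡.trans (≡.cong (λ z → + q₀ * z) 2ᵏ≡) (level I)) }
            where
            l : ∀ a → 1ℤ - a - 1ℤ ≡ - 1ℤ * a
            l a = solve (a ∷ [])
            l′ : ∀ a → 1ℤ - a ≡ - 1ℤ * (a - 1ℤ)
            l′ a = solve (a ∷ [])
          -- The central element w₀⁴ is trivial in 𝔾 and in the odd part, hence in the 2-part.
          w⁴ : let w = Weyl.W 𝔾 (x ⋆ π J) (y ⋆ π J) 1ℤ 1ℤ in w ∷ w ∷ w ∷ w ∷ [] ≋ []
          w⁴ = spell (x ⋆ π J) (y ⋆ π J) ⟫ eq (trans (identityʳ _) (trans (sym (identityˡ _)) (trans (∙-congʳ (sym (U w₀-word [] (zero∣ , zero∣ , zero∣ , zero∣))))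
              (trans (sym (total w₀-word)) (trans (sym (identityʳ _)) (value (flip (spell x y) ⟫ w₀⁴)))))))
            where
            zero∣ : + q₀ ∣ 0ℤ
            zero∣ = divides 0ℤ ≡.refl
          V : Unique J
          V = NormalForm.eval-unique (Dyadic.two-torus k (elementary J) (three (small prime[2] (2 ℕ.+ k) q₀ e odd 3 (λ d → three-odd (∣⇒∣ᵤ d)) ℕP.≤-refl)) w⁴) (PrimeModulus.localRing prime[2] (2 ℕ.+ k))
            where
            three-odd : ¬ 2 ℕD.∣ 3
            three-odd = toWitnessFalse {a? = 2 ℕD.∣? 3} _
            three : ∃[ v' ] (+ 2) ^ (3 ℕ.+ k) ∣ + 3 * v' - 1ℤ
                × (∀ a → W (+ 3) v' ∷ x (+ q₀ * a) ∷ [] ≋ y (- (v' * v' * (+ q₀ * a))) ∷ W (+ 3) v' ∷ [])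
                × (∀ a → W (+ 3) v' ∷ y (+ q₀ * a) ∷ [] ≋ x (- (+ 3 * + 3 * (+ q₀ * a))) ∷ W (+ 3) v' ∷ []) →
              ∃[ v' ] (+ 2) ^ (3 ℕ.+ k) ∣ + 3 * v' - 1ℤ × Weyl.Good 𝔾 (x ⋆ π J) (y ⋆ π J) (+ 3) v'
            three (v' , V , gx , gy) = v' , V , small-good J (+ 3) v' gx gy

module Levels where
  open ElementaryRelations using (_⊛_; _⊕_; by)
  open PrimePowers
  open PrimitiveRoots
  open CongruenceKernel using (pos-^)
  open import Data.List using ([]; _∷_)
  open import Data.Fin using (Fin; toℕ; fromℕ<)
  import Data.Fin.Properties as FinP
  open import Data.Nat as ℕ using (ℕ; zero; suc; NonZero; z≤n; s≤s; _≤_; _<_)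
  import Data.Nat.Properties as ℕP
  import Data.Nat.Divisibility as ℕD
  import Data.Nat.DivMod as ℕM
  import Data.Nat.Solver
  open import Data.Nat.Induction using (<-rec)
  open import Data.Nat.Primality using (Prime; prime⇒nonTrivial; prime⇒nonZero; prime[2]; euclidsLemma; prime⇒irreducible)
  open import Data.Nat.Coprimality as Cop using (Coprime)
  open import Data.Integer as ℤ using (ℤ; +_; _+_; _*_; _-_; -_; _^_; 0ℤ; 1ℤ)
  import Data.Integer.Properties as ℤP
  open import Data.Integer.Divisibility.Signed using (_∣_; divides; ∣⇒∣ᵤ; ∣ᵤ⇒∣; ∣-trans; *-cancelˡ-∣; *-monoʳ-∣; *-monoˡ-∣)
  open import Data.Integer.DivMod using (_%ℕ_; _/ℕ_; a≡a%ℕn+[a/ℕn]*n; n%ℕd<d)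
  open import Data.Integer.Tactic.RingSolver using (solve)
  open import Data.Product using (_×_; _,_; proj₁; proj₂; ∃-syntax)
  open import Data.Sum using (_⊎_; inj₁; inj₂; [_,_]′)
  open import Data.Empty using (⊥; ⊥-elim)
  open import Relation.Nullary using (¬_; yes; no)
  open import Relation.Binary.PropositionalEquality using (_≡_; refl; sym; trans; cong; cong₂; subst)

  prime>1 : ∀ {p} → Prime p → 1 < p
  prime>1 {p} pr = ℕ.nonTrivial⇒n>1 p ⦃ prime⇒nonTrivial pr ⦄

  valuation-unique : ∀ {p} → Prime p → ∀ e f r s → p ℕ.^ e ℕ.* r ≡ p ℕ.^ f ℕ.* s → ¬ p ℕD.∣ r → ¬ p ℕD.∣ s → e ≡ f
  valuation-unique pr zero zero r s _ _ _ = refl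
  valuation-unique {p} pr zero (suc f) r s e p∤r _ =
    ⊥-elim (p∤r (ℕD.divides (p ℕ.^ f ℕ.* s) (trans (sym (ℕP.+-identityʳ r)) (trans e (trans (ℕP.*-assoc p _ s) (ℕP.*-comm p _))))))
  valuation-unique {p} pr (suc e) zero r s q _ p∤s =
    ⊥-elim (p∤s (ℕD.divides (p ℕ.^ e ℕ.* r) (trans (sym (ℕP.+-identityʳ s)) (trans (sym q) (trans (ℕP.*-assoc p _ r) (ℕP.*-comm p _))))))
  valuation-unique {p} pr (suc e) (suc f) r s q p∤r p∤s = cong suc (valuation-unique pr e f r s
    (ℕP.*-cancelˡ-≡ _ _ p ⦃ prime⇒nonZero pr ⦄ (trans (sym (ℕP.*-assoc p _ r)) (trans q (ℕP.*-assoc p _ s)))) p∤r p∤s)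

  prime-∣^ : ∀ {p} → Prime p → ∀ a n → p ℕD.∣ a ℕ.^ n → p ℕD.∣ a
  prime-∣^ pr a zero d = ⊥-elim (ℕP.<⇒≢ (prime>1 pr) (sym (ℕD.∣1⇒≡1 d)))
  prime-∣^ pr a (suc n) d = [ (λ z → z) , prime-∣^ pr a n ]′ (euclidsLemma a (a ℕ.^ n) pr d)

  prime-divides-prime : ∀ {p r} → Prime p → Prime r → p ℕD.∣ r → p ≡ r
  prime-divides-prime {p} pp pr d = [ (λ e → ⊥-elim (ℕP.<⇒≢ (prime>1 pp) (sym e))) , (λ e → e) ]′ (prime⇒irreducible pr d)

  finite-order : ∀ R ℓ → 0 < R → Prime ℓ → ¬ ℓ ℕD.∣ R → ∃[ a ] ∃[ M ] ℓ ℕ.^ suc a ≡ suc M × R ℕD.∣ M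
  finite-order R ℓ 0<R pr ℓ∤R = from (FinP.pigeonhole (ℕP.n<1+n R) residue)
    where
    instance
      _ = ℕ.>-nonZero 0<R
      _ = prime⇒nonZero pr
    residue : Fin (suc R) → Fin R
    residue i = fromℕ< (ℕM.m%n<n (ℓ ℕ.^ toℕ i) R)
    from : ∃[ i ] ∃[ j ] toℕ i < toℕ j × residue i ≡ residue j → ∃[ a ] ∃[ M ] ℓ ℕ.^ suc a ≡ suc M × R ℕD.∣ M
    from (i , j , i<j , e) = d , ℕ.pred (ℓ ℕ.^ suc d) , power , Cop.coprime-divisor (coprime-power (coprime-prime pr ℓ∤R) (toℕ i)) (∣⇒∣ᵤ divisible)
      where
      d = ℕ.pred (toℕ j ℕ.∸ toℕ i)
      1+d : suc d ≡ toℕ j ℕ.∸ toℕ i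
      1+d = ℕP.suc-pred (toℕ j ℕ.∸ toℕ i) ⦃ ℕ.>-nonZero (ℕP.m<n⇒0<n∸m i<j) ⦄
      power : ℓ ℕ.^ suc d ≡ suc (ℕ.pred (ℓ ℕ.^ suc d))
      power = sym (ℕP.suc-pred (ℓ ℕ.^ suc d) ⦃ ℕP.m^n≢0 ℓ (suc d) ⦄)
      X = ℓ ℕ.^ toℕ i
      M = ℕ.pred (ℓ ℕ.^ suc d)
      sum : ℓ ℕ.^ toℕ j ≡ X ℕ.* suc M
      sum = trans (cong (ℓ ℕ.^_) (sym (trans (cong (toℕ i ℕ.+_) 1+d) (ℕP.m+[n∸m]≡n (ℕP.<⇒≤ i<j))))) (trans (ℕP.^-distribˡ-+-* ℓ (toℕ i) (suc d)) (cong (X ℕ.*_) power))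
      rem : ℓ ℕ.^ toℕ i ℕ.% R ≡ ℓ ℕ.^ toℕ j ℕ.% R
      rem = trans (sym (FinP.toℕ-fromℕ< _)) (trans (cong toℕ e) (FinP.toℕ-fromℕ< _))
      decompose : ∀ n → + n ≡ + (n ℕ.% R) + + (n ℕ./ R) * + R
      decompose n = trans (cong +_ (ℕM.m≡m%n+[m/n]*n n R)) (trans (ℤP.pos-+ (n ℕ.% R) _) (cong (λ z → + (n ℕ.% R) + z) (ℤP.pos-* (n ℕ./ R) R)))
      divisible : + R ∣ + (X ℕ.* M)
      divisible = divides (+ (ℓ ℕ.^ toℕ j ℕ./ R) - + (X ℕ./ R))
        (trans (shift (+ X) (+ M) (+ (X ℕ.* M)) (ℤP.pos-* X M)) (trans (cong₂ _-_ (trans (sym (trans (cong +_ sum) (ℤP.pos-* X (suc M)))) (decompose (ℓ ℕ.^ toℕ j))) (trans (decompose X) (cong (λ r → + r + + (X ℕ./ R) * + R) rem)))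
          (l (+ (ℓ ℕ.^ toℕ j ℕ.% R)) (+ (ℓ ℕ.^ toℕ j ℕ./ R)) (+ (X ℕ./ R)) (+ R))))
        where
        shift : ∀ x m y → y ≡ x * m → y ≡ x * (1ℤ + m) - x
        shift x m y refl = solve (x ∷ m ∷ [])
        l : ∀ r a b R → r + a * R - (r + b * R) ≡ (a - b) * R
        l r a b R = solve (r ∷ a ∷ b ∷ R ∷ [])

  invertible : ∀ a r → 0 < r → (∀ p → Prime p → p ℕD.∣ r → ¬ + p ∣ a) → ∃[ a' ] + r ∣ a * a' - 1ℤ
  invertible a r 0<r h = from (bézout ℤ.∣ a ∣ r coprime) (ℤP.+∣i∣≡i⊎+∣i∣≡-i a)
    where
    coprime : Coprime ℤ.∣ a ∣ r
    coprime {0} (_ , d) = ⊥-elim (ℕP.<⇒≢ 0<r (sym (ℕD.0∣⇒≡0 d)))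
    coprime {1} _ = refl
    coprime {suc (suc i)} (d , d') = from′ (prime-divisor (suc (suc i)) (s≤s (s≤s z≤n)))
      where
      from′ : ∃[ p ] Prime p × p ℕD.∣ suc (suc i) → suc (suc i) ≡ 1
      from′ (p , pr , p∣) = ⊥-elim (h p pr (ℕD.∣-trans p∣ d') (∣ᵤ⇒∣ (ℕD.∣-trans p∣ d)))
    from : ∃[ u ] ∃[ w ] u * + ℤ.∣ a ∣ + w * + r ≡ 1ℤ → + ℤ.∣ a ∣ ≡ a ⊎ + ℤ.∣ a ∣ ≡ - a → ∃[ a' ] + r ∣ a * a' - 1ℤ
    from (u , w , e) (inj₁ f) = u , divides (- w) (trans (cong (λ z → a * u - z) (trans (sym e) (cong (λ z → u * z + w * + r) f))) (l a u w (+ r)))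
      where
      l : ∀ m u w q → m * u - (u * m + w * q) ≡ - w * q
      l m u w q = solve (m ∷ u ∷ w ∷ q ∷ [])
    from (u , w , e) (inj₂ f) = - u , divides (- w) (trans (cong (λ z → a * - u - z) (trans (sym e) (cong (λ z → u * z + w * + r) f))) (l a u w (+ r)))
      where
      l : ∀ m u w q → m * - u - (u * - m + w * q) ≡ - w * q
      l m u w q = solve (m ∷ u ∷ w ∷ q ∷ [])

  2n+2≤2^n+2 : ∀ n → 2 ℕ.* suc n ≤ 2 ℕ.^ (n ℕ.+ 2)
  2n+2≤2^n+2 zero = s≤s (s≤s z≤n)
  2n+2≤2^n+2 (suc n) = ℕP.*-monoʳ-≤ 2 (ℕP.≤-trans (s≤s (ℕP.m≤m+n (suc n) _)) (ℕP.≤-trans (ℕP.≤-reflexive (l n)) (2n+2≤2^n+2 n)))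
    where
    open Data.Nat.Solver.+-*-Solver renaming (solve to solveℕ)
    l : ∀ n → suc (suc n ℕ.+ n) ≡ 2 ℕ.* suc n
    l = solveℕ 1 (λ n → con 1 :+ (con 1 :+ n :+ n) := con 2 :* (con 1 :+ n)) refl

  module Level {ℓ : ℕ} (ℓ-prime : Prime ℓ) (a M : ℕ) (ℓᵃ : ℓ ℕ.^ a ≡ suc M) (4∣M : 4 ℕD.∣ M) (0<M : 0 < M) where
    E q n : ℕ
    E = M ℕ.+ 3
    q = M ℕ.^ suc E
    n = a ℕ.* M ℕ.^ E
    L : ℤ
    L = (+ ℓ) ^ n

    PrimeTo : ℤ → Set
    PrimeTo m = ∀ {p} → Prime p → p ℕD.∣ M → ¬ + p ∣ m

    p∣triangle : ∀ {p} → Prime p → p ℕD.∣ M → + p ∣ + triangle M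
    p∣triangle {p} pr p∣M with p ℕ.≟ 2
    ... | no p≢2 = [ (λ d → ⊥-elim (p≢2 (prime-divides-prime pr prime[2] (∣⇒∣ᵤ d)))) , (λ d → d) ]′
        (PrimeModulus.euclid pr (+ 2) (+ triangle M) (subst (+ p ∣_) (sym (2triangle M)) (by ((+ M - 1ℤ) ⊛ ∣ᵤ⇒∣ p∣M) (ℤP.*-comm (+ M) (+ M - 1ℤ)))))
    ... | yes refl = *-cancelˡ-∣ (+ 2) (subst (+ 4 ∣_) (sym (2triangle M)) (by ((+ M - 1ℤ) ⊛ ∣ᵤ⇒∣ 4∣M) (ℤP.*-comm (+ M) (+ M - 1ℤ))))

    tower : ∀ i → ∃[ m ] (1ℤ + + M) ^ (M ℕ.^ i) ≡ 1ℤ + (+ M) ^ suc i * m × PrimeTo m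
    tower zero = 1ℤ , l (+ M) , λ pr _ → PrimeModulus.P∤1 pr
      where
      l : ∀ M → (1ℤ + M) * 1ℤ ≡ 1ℤ + M * 1ℤ * 1ℤ
      l M = solve (M ∷ [])
    tower (suc i) = from (tower i)
      where
      from : ∃[ m ] (1ℤ + + M) ^ (M ℕ.^ i) ≡ 1ℤ + (+ M) ^ suc i * m × PrimeTo m → ∃[ m ] (1ℤ + + M) ^ (M ℕ.^ suc i) ≡ 1ℤ + (+ M) ^ suc (suc i) * m × PrimeTo m
      from (m , e , pt) = from′ (binomial₃ ((+ M) ^ suc i * m) M)
        where
        from′ : ∃[ c ] (1ℤ + (+ M) ^ suc i * m) ^ M ≡ 1ℤ + + M * ((+ M) ^ suc i * m) + + triangle M * ((+ M) ^ suc i * m * ((+ M) ^ suc i * m)) + c * ((+ M) ^ suc i * m * ((+ M) ^ suc i * m) * ((+ M) ^ suc i * m)) →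
          ∃[ m ] (1ℤ + + M) ^ (M ℕ.^ suc i) ≡ 1ℤ + (+ M) ^ suc (suc i) * m × PrimeTo m
        from′ (c , f) = m + + triangle M * (X * m * m) + c * (X * X * + M * m * m * m)
          , trans (cong ((1ℤ + + M) ^_) (ℕP.*-comm M (M ℕ.^ i))) (trans (sym (ℤP.^-*-assoc (1ℤ + + M) (M ℕ.^ i) M)) (trans (cong (_^ M) e) (trans f (l (+ M) X m (+ triangle M) c))))
          , λ {p} pr p∣M d → pt pr p∣M (by (d ⊕ (- (X * m * m)) ⊛ p∣triangle pr p∣M ⊕ (- (c * X * X * m * m * m)) ⊛ ∣ᵤ⇒∣ p∣M) (l′ X m (+ triangle M) c (+ M)))
          where
          X = (+ M) ^ i
          l : ∀ M X m t c → 1ℤ + M * (M * X * m) + t * (M * X * m * (M * X * m)) + c * (M * X * m * (M * X * m) * (M * X * m))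
            ≡ 1ℤ + M * (M * X) * (m + t * (X * m * m) + c * (X * X * M * m * m * m))
          l M X m t c = solve (M ∷ X ∷ m ∷ t ∷ c ∷ [])
          l′ : ∀ X m t c M → m ≡ m + t * (X * m * m) + c * (X * X * M * m * m * m) + - (X * m * m) * t + - (c * X * X * m * m * m) * M
          l′ X m t c M = solve (X ∷ m ∷ t ∷ c ∷ M ∷ [])

    m : ℤ
    m = proj₁ (tower E)

    m-prime : PrimeTo m
    m-prime = proj₂ (proj₂ (tower E))

    L≡ : L ≡ 1ℤ + + q * m
    L≡ = trans (sym (ℤP.^-*-assoc (+ ℓ) a (M ℕ.^ E))) (trans (cong (_^ (M ℕ.^ E)) (trans (pos-^ ℓ a) (cong +_ ℓᵃ)))
      (trans (proj₁ (proj₂ (tower E))) (cong (λ z → 1ℤ + z * m) (pos-^ M (suc E)))))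

    geometric : ∀ x i → x - 1ℤ ∣ x ^ i - 1ℤ
    geometric x i = power-one x (divides 1ℤ (sym (ℤP.*-identityˡ _))) i

    geometric-* : ∀ {r} x → + r ∣ x - 1ℤ → (x - 1ℤ) * + r ∣ x ^ r - 1ℤ
    geometric-* {r} x (divides g e) = from (binomial₃ (x - 1ℤ) r)
      where
      from : ∃[ c ] (1ℤ + (x - 1ℤ)) ^ r ≡ 1ℤ + + r * (x - 1ℤ) + + triangle r * ((x - 1ℤ) * (x - 1ℤ)) + c * ((x - 1ℤ) * (x - 1ℤ) * (x - 1ℤ)) → (x - 1ℤ) * + r ∣ x ^ r - 1ℤ
      from (c , f) = divides (1ℤ + + triangle r * g + c * g * (x - 1ℤ)) (trans (cong (_- 1ℤ) (trans (cong (_^ r) (l x)) f)) (l′ (x - 1ℤ) (+ r) (+ triangle r) g c e))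
        where
        l : ∀ x → x ≡ 1ℤ + (x - 1ℤ)
        l x = solve (x ∷ [])
        l′ : ∀ y r t g c → y ≡ g * r → 1ℤ + r * y + t * (y * y) + c * (y * y * y) - 1ℤ ≡ (1ℤ + t * g + c * g * y) * (y * r)
        l′ .(g * r) r t g c refl = solve (r ∷ t ∷ g ∷ c ∷ [])

    module _ {p : ℕ} (p-prime : Prime p) where
      Tame : ℕ → Set
      Tame r = r ≡ ℓ ⊎ (∃[ j ] ¬ p ℕD.∣ j × ℕ.pred r ℕD.∣ n ℕ.* j)

      -- The order of ℓ^n modulo y, and with it the exponent J, stays prime to p.
      absorb : ∀ y → 0 < y → ¬ p ℕD.∣ y → (∀ r → Prime r → r ℕD.∣ y → Tame r) →
        ∃[ s ] ∃[ J ] ¬ p ℕD.∣ J × + q * + y ∣ (+ ℓ) ^ s * (L ^ J - 1ℤ)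
      absorb = <-rec _ go
        where
        Goal : ℕ → Set
        Goal y = ∃[ s ] ∃[ J ] ¬ p ℕD.∣ J × + q * + y ∣ (+ ℓ) ^ s * (L ^ J - 1ℤ)
        go : ∀ y → (∀ {y'} → y' < y → 0 < y' → ¬ p ℕD.∣ y' → (∀ r → Prime r → r ℕD.∣ y' → Tame r) → Goal y') →
          0 < y → ¬ p ℕD.∣ y → (∀ r → Prime r → r ℕD.∣ y → Tame r) → Goal y
        go 1 rec _ p∤1 tame = 0 , 1 , p∤1 , divides m (trans (cong (λ z → 1ℤ * (z * 1ℤ - 1ℤ)) L≡) (l (+ q) m))
          where
          l : ∀ q m → 1ℤ * ((1ℤ + q * m) * 1ℤ - 1ℤ) ≡ m * (q * + 1)
          l q m = solve (q ∷ m ∷ [])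
        go y@(suc (suc _)) rec 0<y p∤y tame = from (prime-divisor y (s≤s (s≤s z≤n)))
          where
          from : ∃[ r ] Prime r × r ℕD.∣ y → Goal y
          from (r , pr , r∣y@(ℕD.divides zero ()))
          from (r , pr , r∣y@(ℕD.divides y'@(suc _) e)) = step (tame r pr r∣y) (rec smaller (s≤s z≤n) (λ d → p∤y (ℕD.∣-trans d y'∣y)) (λ t pt d → tame t pt (ℕD.∣-trans d y'∣y)))
            where
            y'∣y : y' ℕD.∣ y
            y'∣y = ℕD.divides r (trans e (ℕP.*-comm y' r))
            smaller : y' < y
            smaller = subst (y' <_) (sym e) (ℕP.m<m*n y' r (prime>1 pr))
            +y : + q * + y ≡ + r * (+ q * + y')
            +y = trans (cong (λ z → + q * + z) e) (trans (cong (λ z → + q * z) (ℤP.pos-* y' r)) (l (+ q) (+ y') (+ r)))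
              where
              l : ∀ q y r → q * (y * r) ≡ r * (q * y)
              l q y r = solve (q ∷ y ∷ r ∷ [])
            p∤r : ¬ p ℕD.∣ r
            p∤r d = p∤y (ℕD.∣-trans d r∣y)
            by-ℓ : r ≡ ℓ → Goal y' → Goal y
            by-ℓ r≡ℓ (s , J , p∤J , d) = suc s , J , p∤J , subst (_∣ (+ ℓ) ^ suc s * (L ^ J - 1ℤ)) (sym +y)
              (subst (+ r * (+ q * + y') ∣_) (trans (cong (λ z → + z * ((+ ℓ) ^ s * (L ^ J - 1ℤ))) r≡ℓ) (sym (ℤP.*-assoc (+ ℓ) ((+ ℓ) ^ s) _))) (*-monoʳ-∣ (+ r) d))
            by-order : ¬ r ≡ ℓ → ∀ j → ¬ p ℕD.∣ j → ℕ.pred r ℕD.∣ n ℕ.* j → Goal y' → Goal y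
            by-order r≢ℓ j p∤j (ℕD.divides i f) (s , J , p∤J , d) = s , J ℕ.* j ℕ.* r , p∤Jjr , subst (_∣ (+ ℓ) ^ s * (L ^ (J ℕ.* j ℕ.* r) - 1ℤ)) (sym +y) (∣-trans (*-monoʳ-∣ (+ r) d) last)
              where
              p∤Jjr : ¬ p ℕD.∣ J ℕ.* j ℕ.* r
              p∤Jjr t = [ (λ t′ → [ p∤J , p∤j ]′ (euclidsLemma J j p-prime t′)) , p∤r ]′ (euclidsLemma (J ℕ.* j) r p-prime t)
              x = L ^ (J ℕ.* j)
              r∤ℓ : ¬ + r ∣ + ℓ
              r∤ℓ t = r≢ℓ (prime-divides-prime pr ℓ-prime (∣⇒∣ᵤ t))
              r∣x-1 : + r ∣ x - 1ℤ
              r∣x-1 = subst (λ z → + r ∣ z - 1ℤ) exponent (power-one _ (PrimitiveRoot.fermat pr (+ ℓ) r∤ℓ) (i ℕ.* J))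
                where
                exponent : ((+ ℓ) ^ ℕ.pred r) ^ (i ℕ.* J) ≡ x
                exponent = trans (ℤP.^-*-assoc (+ ℓ) (ℕ.pred r) (i ℕ.* J)) (trans (cong ((+ ℓ) ^_)
                  (trans (sym (ℕP.*-assoc (ℕ.pred r) i J)) (trans (cong (ℕ._* J) (trans (ℕP.*-comm (ℕ.pred r) i) (sym f))) (trans (ℕP.*-assoc n j J) (cong (n ℕ.*_) (ℕP.*-comm j J))))))
                  (sym (ℤP.^-*-assoc (+ ℓ) n (J ℕ.* j))))
              chain : (L ^ J - 1ℤ) * + r ∣ L ^ (J ℕ.* j ℕ.* r) - 1ℤ
              chain = ∣-trans (*-monoˡ-∣ (+ r) (subst (λ z → L ^ J - 1ℤ ∣ z - 1ℤ) (ℤP.^-*-assoc L J j) (geometric (L ^ J) j)))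
                (subst (λ z → (x - 1ℤ) * + r ∣ z - 1ℤ) (ℤP.^-*-assoc L (J ℕ.* j) r) (geometric-* x r∣x-1))
              last : + r * ((+ ℓ) ^ s * (L ^ J - 1ℤ)) ∣ (+ ℓ) ^ s * (L ^ (J ℕ.* j ℕ.* r) - 1ℤ)
              last = subst (_∣ (+ ℓ) ^ s * (L ^ (J ℕ.* j ℕ.* r) - 1ℤ)) (l ((+ ℓ) ^ s) (L ^ J - 1ℤ) (+ r)) (*-monoʳ-∣ ((+ ℓ) ^ s) chain)
                where
                l : ∀ a b c → a * (b * c) ≡ c * (a * b)
                l a b c = solve (a ∷ b ∷ c ∷ [])
            step : Tame r → Goal y' → Goal y
            step (inj₁ r≡ℓ) G = by-ℓ r≡ℓ G
            step (inj₂ (j , p∤j , f)) G with r ℕ.≟ ℓ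
            ... | yes r≡ℓ = by-ℓ r≡ℓ G
            ... | no r≢ℓ = by-order r≢ℓ j p∤j f G

      p∤ℓ : p ℕD.∣ M → ¬ + p ∣ + ℓ
      p∤ℓ p∣M d = PrimeModulus.P∤1 p-prime (∣ᵤ⇒∣ (ℕD.∣m+n∣m⇒∣n (subst (p ℕD.∣_) (trans ℓᵃ (ℕP.+-comm 1 M)) p∣ℓᵃ) p∣M))
        where
        a>0 : ∀ a → ℓ ℕ.^ a ≡ suc M → p ℕD.∣ ℓ ℕ.^ a
        a>0 zero e = ⊥-elim (ℕP.<⇒≢ 0<M (ℕP.suc-injective e))
        a>0 (suc a) e = ℕD.∣m⇒∣m*n (ℓ ℕ.^ a) (∣⇒∣ᵤ d)
        p∣ℓᵃ = a>0 a ℓᵃ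

      cofactor : p ℕD.∣ M → ∀ y s J x → ¬ p ℕD.∣ J → + q * y * x ≡ (+ ℓ) ^ s * (L ^ J - 1ℤ) → ¬ + p ∣ x
      cofactor p∣M y s J x p∤J e p∣x = from (binomial₃ (+ q * m) J)
        where
        module PM = PrimeModulus p-prime
        instance
          _ : ℤ.NonZero (+ q)
          _ = ℕP.m^n≢0 M (suc E) ⦃ ℕ.>-nonZero 0<M ⦄
        from : ∃[ c ] (1ℤ + + q * m) ^ J ≡ 1ℤ + + J * (+ q * m) + + triangle J * (+ q * m * (+ q * m)) + c * (+ q * m * (+ q * m) * (+ q * m)) → ⊥
        from (c , f) = [ PM.∤-^ (+ ℓ) (p∤ℓ p∣M) s , (λ d → [ (λ t → p∤J (∣⇒∣ᵤ t)) , m-prime p-prime p∣M ]′ (PM.euclid (+ J) m (clear d))) ]′ (PM.euclid ((+ ℓ) ^ s) rest p∣)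
          where
          rest = + J * m + + triangle J * (+ q * m * m) + c * (+ q * + q * m * m * m)
          p∣q : + p ∣ + q
          p∣q = ∣ᵤ⇒∣ (ℕD.∣m⇒∣m*n (M ℕ.^ E) p∣M)
          expand : + q * (y * x) ≡ + q * ((+ ℓ) ^ s * rest)
          expand = trans (sym (ℤP.*-assoc (+ q) y x)) (trans e (trans (cong (λ z → (+ ℓ) ^ s * (z ^ J - 1ℤ)) L≡) (trans (cong (λ z → (+ ℓ) ^ s * (z - 1ℤ)) f) (l ((+ ℓ) ^ s) (+ q) m (+ J) (+ triangle J) c))))
            where
            l : ∀ s q m J t c → s * (1ℤ + J * (q * m) + t * (q * m * (q * m)) + c * (q * m * (q * m) * (q * m)) - 1ℤ) ≡ q * (s * (J * m + t * (q * m * m) + c * (q * q * m * m * m)))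
            l s q m J t c = solve (s ∷ q ∷ m ∷ J ∷ t ∷ c ∷ [])
          p∣ : + p ∣ (+ ℓ) ^ s * rest
          p∣ = subst (+ p ∣_) (ℤP.*-cancelˡ-≡ (+ q) _ _ expand) (y ⊛ p∣x)
          clear : + p ∣ rest → + p ∣ + J * m
          clear d = by (d ⊕ (- (+ triangle J * m * m + c * + q * m * m * m)) ⊛ p∣q) (l (+ q) m (+ J) (+ triangle J) c)
            where
            l : ∀ q m J t c → J * m ≡ J * m + t * (q * m * m) + c * (q * q * m * m * m) + - (t * m * m + c * q * m * m * m) * q
            l q m J t c = solve (q ∷ m ∷ J ∷ t ∷ c ∷ [])

      private
        ^-* : ∀ b c e → (b ℕ.* c) ℕ.^ e ≡ b ℕ.^ e ℕ.* c ℕ.^ e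
        ^-* b c zero = refl
        ^-* b c (suc e) = trans (cong (b ℕ.* c ℕ.*_) (^-* b c e)) (l b c (b ℕ.^ e) (c ℕ.^ e))
          where
          open Data.Nat.Solver.+-*-Solver renaming (solve to solveℕ)
          l : ∀ b c x y → b ℕ.* c ℕ.* (x ℕ.* y) ≡ b ℕ.* x ℕ.* (c ℕ.* y)
          l = solveℕ 4 (λ b c x y → b :* c :* (x :* y) := b :* x :* (c :* y)) refl

        instance
          p≢0 : NonZero p
          p≢0 = prime⇒nonZero p-prime

        1<p = prime>1 p-prime

      -- A prime factor r of z v' with p^(μE+1) ∣ r - 1 would be too large for v v' = 1 + p^κ z with z < 2v.
      module Bounds (μ M' : ℕ) (M≡ : M ≡ p ℕ.^ μ ℕ.* M') (0<μ : 0 < μ) (p≤M : p ≤ M) (v : ℕ) (2≤v : 2 ≤ v) (v≤ : v ≤ suc p)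
          (z v' : ℕ) (z< : z < 2 ℕ.* v) (vv' : suc (p ℕ.^ (μ ℕ.* suc E) ℕ.* z) ≡ v' ℕ.* v) (0<z : 0 < z) where
        F = p ℕ.^ suc (μ ℕ.* E)

        size : 2 ℕ.* v ≤ p ℕ.^ (μ ℕ.* (M ℕ.+ 2))
        size = begin
          2 ℕ.* v                  ≤⟨ ℕP.*-monoʳ-≤ 2 v≤ ⟩
          2 ℕ.* suc p              ≤⟨ 2n+2≤2^n+2 p ⟩
          2 ℕ.^ (p ℕ.+ 2)          ≤⟨ ℕP.^-monoˡ-≤ (p ℕ.+ 2) 1<p ⟩
          p ℕ.^ (p ℕ.+ 2)          ≤⟨ ℕP.^-monoʳ-≤ p (ℕP.≤-trans (ℕP.+-monoˡ-≤ 2 p≤M) (ℕP.m≤n*m (M ℕ.+ 2) μ ⦃ ℕ.>-nonZero 0<μ ⦄)) ⟩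
          p ℕ.^ (μ ℕ.* (M ℕ.+ 2)) ∎
          where open ℕP.≤-Reasoning

        z≤F : p ℕ.^ (μ ℕ.* (M ℕ.+ 2)) ≤ F
        z≤F = ℕP.^-monoʳ-≤ p (ℕP.≤-trans (ℕP.*-monoʳ-≤ μ (ℕP.+-monoʳ-≤ M (s≤s (s≤s z≤n)))) (ℕP.n≤1+n (μ ℕ.* E)))

        wild-z : ∀ r → Prime r → F ≤ ℕ.pred r → ¬ r ℕD.∣ z
        wild-z r pr F≤ r∣z = ℕP.<-irrefl refl (begin-strict
          r         ≤⟨ ℕD.∣⇒≤ ⦃ ℕ.>-nonZero 0<z ⦄ r∣z ⟩
          z         <⟨ z< ⟩
          2 ℕ.* v   ≤⟨ size ⟩
          _         ≤⟨ z≤F ⟩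
          F         ≤⟨ F≤ ⟩
          ℕ.pred r  ≤⟨ ℕP.pred[n]≤n ⟩
          r ∎)
          where open ℕP.≤-Reasoning

        wild-v' : ∀ r → Prime r → F ℕD.∣ ℕ.pred r → ¬ r ℕD.∣ v'
        wild-v' r pr F∣ (ℕD.divides w e) = go (w ℕ.* v) refl
          where
          F≤ : F ≤ ℕ.pred r
          F≤ = ℕD.∣⇒≤ ⦃ ℕ.>-nonZero (ℕP.pred-mono-≤ (prime>1 pr)) ⦄ F∣
          go : ∀ t → w ℕ.* v ≡ t → ⊥
          go 0 f = ℕP.1+n≢0 (trans vv' (trans (cong (ℕ._* v) e) (trans (l w r v) (trans (cong (r ℕ.*_) f) (ℕP.*-zeroʳ r)))))
            where
            open Data.Nat.Solver.+-*-Solver renaming (solve to solveℕ)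
            l : ∀ w r v → w ℕ.* r ℕ.* v ≡ r ℕ.* (w ℕ.* v)
            l = solveℕ 3 (λ w r v → w :* r :* v := r :* (w :* v)) refl
          go 1 f = ℕP.<⇒≢ 2≤v (sym (ℕD.∣1⇒≡1 (ℕD.divides w (sym f))))
          go (suc h@(suc _)) f = ℕP.<-irrefl refl (begin-strict
            p ℕ.^ (μ ℕ.* suc E) ℕ.* z                                  ≤⟨ ℕP.*-monoʳ-≤ (p ℕ.^ (μ ℕ.* suc E)) (ℕP.≤-trans (ℕP.<⇒≤ z<) size) ⟩
            p ℕ.^ (μ ℕ.* suc E) ℕ.* p ℕ.^ (μ ℕ.* (M ℕ.+ 2))            ≡⟨ ℕP.^-distribˡ-+-* p (μ ℕ.* suc E) (μ ℕ.* (M ℕ.+ 2)) ⟨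
            p ℕ.^ (μ ℕ.* suc E ℕ.+ μ ℕ.* (M ℕ.+ 2))                    <⟨ ℕP.^-monoʳ-< p 1<p (ℕP.≤-trans (ℕP.≤-reflexive (cong suc (l₁ μ M))) (ℕP.≤-trans (ℕP.n≤1+n _) (ℕP.≤-reflexive (cong suc (sym (ℕP.+-suc (μ ℕ.* E) (μ ℕ.* E))))))) ⟩
            p ℕ.^ (suc (μ ℕ.* E) ℕ.+ suc (μ ℕ.* E))                    ≡⟨ ℕP.^-distribˡ-+-* p (suc (μ ℕ.* E)) (suc (μ ℕ.* E)) ⟩
            F ℕ.* F                                                    ≤⟨ ℕP.*-mono-≤ (ℕP.≤-trans (ℕD.∣⇒≤ F∣h) (ℕP.n≤1+n h)) F≤ ⟩
            suc h ℕ.* ℕ.pred r                                         ≤⟨ ℕP.m≤n+m _ h ⟩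
            h ℕ.+ suc h ℕ.* ℕ.pred r                                   ≡⟨ total ⟨
            p ℕ.^ (μ ℕ.* suc E) ℕ.* z ∎)
            where
            open ℕP.≤-Reasoning
            open Data.Nat.Solver.+-*-Solver renaming (solve to solveℕ)
            l₁ : ∀ μ M → μ ℕ.* suc (M ℕ.+ 3) ℕ.+ μ ℕ.* (M ℕ.+ 2) ≡ μ ℕ.* (M ℕ.+ 3) ℕ.+ μ ℕ.* (M ℕ.+ 3)
            l₁ = solveℕ 2 (λ μ M → μ :* (con 1 :+ (M :+ con 3)) :+ μ :* (M :+ con 2) := μ :* (M :+ con 3) :+ μ :* (M :+ con 3)) refl
            l₂ : ∀ w r v → w ℕ.* suc r ℕ.* v ≡ w ℕ.* v ℕ.* suc r
            l₂ = solveℕ 3 (λ w r v → w :* (con 1 :+ r) :* v := w :* v :* (con 1 :+ r)) refl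
            l₃ : ∀ h r → suc h ℕ.* suc r ≡ suc (h ℕ.+ suc h ℕ.* r)
            l₃ = solveℕ 2 (λ h r → (con 1 :+ h) :* (con 1 :+ r) := con 1 :+ (h :+ (con 1 :+ h) :* r)) refl
            total : p ℕ.^ (μ ℕ.* suc E) ℕ.* z ≡ h ℕ.+ suc h ℕ.* ℕ.pred r
            total = ℕP.suc-injective (trans vv' (trans (cong (λ s → s ℕ.* v) (trans e (cong (w ℕ.*_) (sym (ℕP.suc-pred r ⦃ prime⇒nonZero pr ⦄)))))
              (trans (l₂ w (ℕ.pred r) v) (trans (cong (ℕ._* suc (ℕ.pred r)) f) (l₃ h (ℕ.pred r))))))
            F∣κ : F ℕD.∣ p ℕ.^ (μ ℕ.* suc E)
            F∣κ = ℕD.divides (p ℕ.^ ℕ.pred μ) (trans (cong (p ℕ.^_) (trans (ℕP.*-suc μ E) (trans (cong (ℕ._+ μ ℕ.* E) (sym (ℕP.suc-pred μ ⦃ ℕ.>-nonZero 0<μ ⦄))) (sym (ℕP.+-suc (ℕ.pred μ) (μ ℕ.* E))))))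
              (ℕP.^-distribˡ-+-* p (ℕ.pred μ) (suc (μ ℕ.* E))))
            F∣h : F ℕD.∣ h
            F∣h = ℕD.∣m+n∣m⇒∣n (subst (F ℕD.∣_) (trans total (ℕP.+-comm h _)) (ℕD.∣m⇒∣m*n z F∣κ)) (ℕD.∣n⇒∣m*n (suc h) F∣)

        tame : ∀ r → Prime r → r ℕD.∣ z ℕ.* v' → Tame r
        tame r pr d = from (strip p-prime (ℕ.pred r) (ℕP.pred-mono-≤ (prime>1 pr)))
          where
          from : ∃[ f ] ∃[ j ] ℕ.pred r ≡ p ℕ.^ f ℕ.* j × ¬ p ℕD.∣ j → Tame r
          from (f , j , e , p∤j) with f ℕP.≤? μ ℕ.* E
          ... | yes f≤ = inj₂ (j , p∤j , subst (ℕD._∣ n ℕ.* j) (sym e) (ℕD.*-monoˡ-∣ j (ℕD.∣n⇒∣m*n a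
                (subst (p ℕ.^ f ℕD.∣_) (sym (trans (cong (ℕ._^ E) M≡) (trans (^-* (p ℕ.^ μ) M' E) (cong (ℕ._* M' ℕ.^ E) (ℕP.^-*-assoc p μ E)))))
                  (ℕD.∣m⇒∣m*n (M' ℕ.^ E) (ℕD.divides (p ℕ.^ (μ ℕ.* E ℕ.∸ f)) (trans (cong (p ℕ.^_) (sym (ℕP.m∸n+n≡m f≤))) (ℕP.^-distribˡ-+-* p (μ ℕ.* E ℕ.∸ f) f))))))))
          ... | no f≰ = ⊥-elim ([ wild-z r pr (ℕD.∣⇒≤ ⦃ ℕ.>-nonZero (ℕP.pred-mono-≤ (prime>1 pr)) ⦄ F∣) , wild-v' r pr F∣ ]′ (euclidsLemma z v' pr d))
            where
            F∣ : F ℕD.∣ ℕ.pred r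
            F∣ = subst (F ℕD.∣_) (sym e) (ℕD.∣m⇒∣m*n j (ℕD.divides (p ℕ.^ (f ℕ.∸ suc (μ ℕ.* E)))
              (trans (cong (p ℕ.^_) (sym (ℕP.m∸n+n≡m (ℕP.≰⇒> f≰)))) (ℕP.^-distribˡ-+-* p (f ℕ.∸ suc (μ ℕ.* E)) (suc (μ ℕ.* E))))))

      inverse-choice : ∀ κ v → 2 ≤ v → ¬ p ℕD.∣ v → Coprime v p → ∃[ z ] ¬ p ℕD.∣ z × z < 2 ℕ.* v × v ℕD.∣ suc (p ℕ.^ κ ℕ.* z)
      inverse-choice κ v 2≤v p∤v co = from (bézout v (p ℕ.^ κ) (coprime-power co κ))
        where
        instance
          _ = ℕ.>-nonZero (ℕP.≤-trans (s≤s z≤n) 2≤v)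
        from : ∃[ u ] ∃[ w ] u * + v + w * + (p ℕ.^ κ) ≡ 1ℤ → ∃[ z ] ¬ p ℕD.∣ z × z < 2 ℕ.* v × v ℕD.∣ suc (p ℕ.^ κ ℕ.* z)
        from (u , w , e) = choose ((- w) %ℕ v) (n%ℕd<d (- w) v) root
          where
          t = (- w) /ℕ v
          plus : ∀ z → 1ℤ + + (p ℕ.^ κ) * + z ≡ + suc (p ℕ.^ κ ℕ.* z)
          plus z = cong (λ s → 1ℤ + s) (sym (ℤP.pos-* (p ℕ.^ κ) z))
          root : v ℕD.∣ suc (p ℕ.^ κ ℕ.* ((- w) %ℕ v))
          root = ∣⇒∣ᵤ (subst (+ v ∣_) (plus ((- w) %ℕ v)) (divides (u - + (p ℕ.^ κ) * t) (l u w (+ v) (+ (p ℕ.^ κ)) (+ ((- w) %ℕ v)) t e (a≡a%ℕn+[a/ℕn]*n (- w) v))))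
            where
            l : ∀ u w v k z t → u * v + w * k ≡ 1ℤ → - w ≡ z + t * v → 1ℤ + k * z ≡ (u - k * t) * v
            l u w v k z t e f = trans (cong (λ s → s + k * z) (sym e)) (trans (l₁ u w v k z) (trans (cong (λ s → u * v - k * s + k * z) f) (l₂ u v k z t)))
              where
              l₁ : ∀ u w v k z → u * v + w * k + k * z ≡ u * v - k * - w + k * z
              l₁ u w v k z = solve (u ∷ w ∷ v ∷ k ∷ z ∷ [])
              l₂ : ∀ u v k z t → u * v - k * (z + t * v) + k * z ≡ (u - k * t) * v
              l₂ u v k z t = solve (u ∷ v ∷ k ∷ z ∷ t ∷ [])
          choose : ∀ z → z < v → v ℕD.∣ suc (p ℕ.^ κ ℕ.* z) → ∃[ z ] ¬ p ℕD.∣ z × z < 2 ℕ.* v × v ℕD.∣ suc (p ℕ.^ κ ℕ.* z)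
          choose z z<v d with p ℕD.∣? z
          ... | no p∤z = z , p∤z , ℕP.<-≤-trans z<v (ℕP.m≤m+n v _) , d
          ... | yes p∣z = z ℕ.+ v , (λ t → p∤v (ℕD.∣m+n∣m⇒∣n t p∣z)) , ℕP.<-≤-trans (ℕP.+-monoˡ-< v z<v) (ℕP.≤-reflexive (cong (v ℕ.+_) (sym (ℕP.+-identityʳ v))))
                , subst (v ℕD.∣_) (cong suc (sym (ℕP.*-distribˡ-+ (p ℕ.^ κ) z v))) (ℕD.∣m∣n⇒∣m+n d (ℕD.n∣m*n (p ℕ.^ κ)))

      SmallUnit : ℕ → ℕ → Set
      SmallUnit κ v = ∃[ v' ] ∃[ z ] ∃[ x ] ∃[ s ] ∃[ J ]
        + v * v' ≡ 1ℤ + (+ p) ^ κ * z × + q * (z * v') * x ≡ (+ ℓ) ^ s * (L ^ J - 1ℤ) × ¬ + p ∣ x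

      small-units : ∀ k q' → q ≡ p ℕ.^ suc k ℕ.* q' → ¬ p ℕD.∣ q' → ∀ v → ¬ + p ∣ + v → v ≤ suc p → SmallUnit (suc k) v
      small-units k q' q≡ p∤q' 0 p∤v v≤ = ⊥-elim (p∤v (divides 0ℤ refl))
      small-units k q' q≡ p∤q' 1 p∤v v≤ = 1ℤ , 0ℤ , 1ℤ , 0 , 0 , l ((+ p) ^ suc k) , l′ (+ q) , PrimeModulus.P∤1 p-prime
        where
        l : ∀ Q → + 1 * 1ℤ ≡ 1ℤ + Q * 0ℤ
        l Q = solve (Q ∷ [])
        l′ : ∀ q → q * (0ℤ * 1ℤ) * 1ℤ ≡ 1ℤ * (1ℤ - 1ℤ)
        l′ q = solve (q ∷ [])
      small-units k q' q≡ p∤q' v@(suc (suc _)) p∤v v≤ = from (strip p-prime M 0<M)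
        where
        p∣M : p ℕD.∣ M
        p∣M = prime-∣^ p-prime M (suc E) (subst (p ℕD.∣_) (sym q≡) (ℕD.∣m⇒∣m*n q' (ℕD.m∣m*n (p ℕ.^ k))))
        p∤v′ : ¬ p ℕD.∣ v
        p∤v′ d = p∤v (∣ᵤ⇒∣ d)
        from : ∃[ μ ] ∃[ M' ] M ≡ p ℕ.^ μ ℕ.* M' × ¬ p ℕD.∣ M' → SmallUnit (suc k) v
        from (zero , M' , e , p∤M') = ⊥-elim (p∤M' (subst (p ℕD.∣_) (trans e (ℕP.+-identityʳ M')) p∣M))
        from (μ@(suc μ₁) , M' , e , p∤M') = from′ (inverse-choice (μ ℕ.* suc E) v (s≤s (s≤s z≤n)) p∤v′ (coprime-prime p-prime p∤v′))
          where
          κ≡ : suc k ≡ μ ℕ.* suc E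
          κ≡ = valuation-unique p-prime (suc k) (μ ℕ.* suc E) q' (M' ℕ.^ suc E)
            (trans (sym q≡) (trans (cong (ℕ._^ suc E) e) (trans (^-* (p ℕ.^ μ) M' (suc E)) (cong (ℕ._* M' ℕ.^ suc E) (ℕP.^-*-assoc p μ (suc E))))))
            p∤q' (λ d → p∤M' (prime-∣^ p-prime M' (suc E) d))
          from′ : ∃[ z ] ¬ p ℕD.∣ z × z < 2 ℕ.* v × v ℕD.∣ suc (p ℕ.^ (μ ℕ.* suc E) ℕ.* z) → SmallUnit (suc k) v
          from′ (z , p∤z , z< , ℕD.divides v' f) = from″ (absorb (z ℕ.* v') 0<y p∤y (Bounds.tame μ M' e (s≤s z≤n) (ℕD.∣⇒≤ ⦃ ℕ.>-nonZero 0<M ⦄ p∣M) v (s≤s (s≤s z≤n)) v≤ z v' z< f 0<z))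
            where
            0<z : 0 < z
            0<z = ℕP.n≢0⇒n>0 λ { refl → p∤z (p ℕD.∣0) }
            p∤v' : ¬ p ℕD.∣ v'
            p∤v' d = PrimeModulus.P∤1 p-prime (∣ᵤ⇒∣ (ℕD.∣m+n∣m⇒∣n (subst (p ℕD.∣_) (trans (sym f) (ℕP.+-comm 1 _)) (ℕD.∣m⇒∣m*n v d))
              (ℕD.∣m⇒∣m*n z (ℕD.m∣m*n (p ℕ.^ (E ℕ.+ μ₁ ℕ.* suc E))))))
            p∤y : ¬ p ℕD.∣ z ℕ.* v'
            p∤y d = [ p∤z , p∤v' ]′ (euclidsLemma z v' p-prime d)
            0<y : 0 < z ℕ.* v'
            0<y = ℕP.n≢0⇒n>0 λ y≡0 → p∤y (subst (p ℕD.∣_) (sym y≡0) (p ℕD.∣0))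
            vv' : + v * + v' ≡ 1ℤ + (+ p) ^ suc k * + z
            vv' = trans (sym (ℤP.pos-* v v')) (trans (cong +_ (trans (ℕP.*-comm v v') (sym f))) (cong (λ s → 1ℤ + s) (trans (ℤP.pos-* (p ℕ.^ (μ ℕ.* suc E)) z)
              (cong (λ s → s * + z) (trans (cong (λ e → + (p ℕ.^ e)) (sym κ≡)) (sym (pos-^ p (suc k))))))))
            from″ : ∃[ s ] ∃[ J ] ¬ p ℕD.∣ J × + q * + (z ℕ.* v') ∣ (+ ℓ) ^ s * (L ^ J - 1ℤ) → SmallUnit (suc k) v
            from″ (s , J , p∤J , divides x g) = + v' , + z , x , s , J , vv' , h , cofactor p∣M (+ z * + v') s J x p∤J h
              where
              h : + q * (+ z * + v') * x ≡ (+ ℓ) ^ s * (L ^ J - 1ℤ)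
              h = trans (cong (λ t → + q * t * x) (sym (ℤP.pos-* z v'))) (trans (ℤP.*-comm (+ q * + (z ℕ.* v')) x) (sym g))

module RationalMatrices where
  open import Defs
  open import Data.Nat as ℕ using (ℕ; suc)
  import Data.Nat.Properties as ℕP
  import Data.Nat.Divisibility as ℕD
  import Data.Nat.Coprimality as Cop
  open import Data.Integer as ℤ using (ℤ; +_)
  import Data.Integer.Properties as ℤP
  open import Data.Rational using (ℚ; mkℚ; _+_; _*_; _-_; -_; 0ℚ; 1ℚ; ↥_; ↧_; ↧ₙ_; toℚᵘ)
  import Data.Rational.Properties as ℚP
  open import Data.Rational.Unnormalised as ℚᵘ using (mkℚᵘ; *≡*)
  import Data.Rational.Unnormalised.Properties as ℚᵘP
  open import Data.Maybe using (Maybe; just; nothing)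
  open import Data.Product using (_,_; ∃-syntax)
  open import Relation.Nullary using (yes; no)
  open import Relation.Binary.PropositionalEquality using (_≡_; refl; sym; trans; cong; cong₂; subst)
  open import Tactic.RingSolver using (solve-∀)
  open import Tactic.RingSolver.Core.AlmostCommutativeRing using (AlmostCommutativeRing; fromCommutativeRing)

  ℚ-ring : AlmostCommutativeRing _ _
  ℚ-ring = fromCommutativeRing ℚP.+-*-commutativeRing isZero
    where
    isZero : ∀ x → Maybe (0ℚ ≡ x)
    isZero x with 0ℚ ℚP.≟ x
    ... | yes p = just p
    ... | no _ = nothing

  mat-≡ : ∀ {a b c d a' b' c' d'} → a ≡ a' → b ≡ b' → c ≡ c' → d ≡ d' → mat a b c d ≡ mat a' b' c' d'
  mat-≡ refl refl refl refl = refl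

  private
    entry-assoc : ∀ a b a₁ b₁ c₁ d₁ a₂ c₂ → (a * a₁ + b * c₁) * a₂ + (a * b₁ + b * d₁) * c₂ ≡ a * (a₁ * a₂ + b₁ * c₂) + b * (c₁ * a₂ + d₁ * c₂)
    entry-assoc = solve-∀ ℚ-ring

    unit-row : ∀ a b → 1ℚ * a + 0ℚ * b ≡ a
    unit-row = solve-∀ ℚ-ring

    unit-row′ : ∀ a b → 0ℚ * a + 1ℚ * b ≡ b
    unit-row′ = solve-∀ ℚ-ring

    unit-column : ∀ a b → a * 1ℚ + b * 0ℚ ≡ a
    unit-column = solve-∀ ℚ-ring

    unit-column′ : ∀ a b → a * 0ℚ + b * 1ℚ ≡ b
    unit-column′ = solve-∀ ℚ-ring

    adj₁ : ∀ a b c d → d * a + - b * c ≡ a * d - b * c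
    adj₁ = solve-∀ ℚ-ring

    adj₂ : ∀ b d → d * b + - b * d ≡ 0ℚ
    adj₂ = solve-∀ ℚ-ring

    adj₃ : ∀ a c → - c * a + a * c ≡ 0ℚ
    adj₃ = solve-∀ ℚ-ring

    adj₄ : ∀ a b c d → - c * b + a * d ≡ a * d - b * c
    adj₄ = solve-∀ ℚ-ring

    adj₅ : ∀ a b c d → a * d + b * - c ≡ a * d - b * c
    adj₅ = solve-∀ ℚ-ring

    adj₆ : ∀ a b → a * - b + b * a ≡ 0ℚ
    adj₆ = solve-∀ ℚ-ring

    adj₇ : ∀ c d → c * d + d * - c ≡ 0ℚ
    adj₇ = solve-∀ ℚ-ring

    adj₈ : ∀ a b c d → c * - b + d * a ≡ a * d - b * c
    adj₈ = solve-∀ ℚ-ring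

    anti₁ : ∀ c d b' d' → c * b' + d * d' ≡ d' * d + - b' * - c
    anti₁ = solve-∀ ℚ-ring

    anti₂ : ∀ a b b' d' → - (a * b' + b * d') ≡ d' * - b + - b' * a
    anti₂ = solve-∀ ℚ-ring

    anti₃ : ∀ c d a' c' → - (c * a' + d * c') ≡ - c' * d + a' * - c
    anti₃ = solve-∀ ℚ-ring

    anti₄ : ∀ a b a' c' → a * a' + b * c' ≡ - c' * - b + a' * a
    anti₄ = solve-∀ ℚ-ring

    double-neg : ∀ a → - - a ≡ a
    double-neg = solve-∀ ℚ-ring

    det-lemma : ∀ a b c d a' b' c' d' → (a * a' + b * c') * (c * b' + d * d') - (a * b' + b * d') * (c * a' + d * c') ≡ (a * d - b * c) * (a' * d' - b' * c')
    det-lemma = solve-∀ ℚ-ring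

    det-inv-lemma : ∀ a b c d → d * a - - b * - c ≡ a * d - b * c
    det-inv-lemma = solve-∀ ℚ-ring

  ·-assoc : ∀ g h k → (g · h) · k ≡ g · (h · k)
  ·-assoc (mat a b c d) (mat a₁ b₁ c₁ d₁) (mat a₂ b₂ c₂ d₂) = mat-≡ (entry-assoc a b a₁ b₁ c₁ d₁ a₂ c₂) (entry-assoc a b a₁ b₁ c₁ d₁ b₂ d₂)
    (entry-assoc c d a₁ b₁ c₁ d₁ a₂ c₂) (entry-assoc c d a₁ b₁ c₁ d₁ b₂ d₂)

  ·-identityˡ : ∀ g → I₂ · g ≡ g
  ·-identityˡ (mat a b c d) = mat-≡ (unit-row a c) (unit-row b d) (unit-row′ a c) (unit-row′ b d)

  ·-identityʳ : ∀ g → g · I₂ ≡ g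
  ·-identityʳ (mat a b c d) = mat-≡ (unit-column a b) (unit-column′ a b) (unit-column c d) (unit-column′ c d)

  inv-inverseˡ : ∀ g → det g ≡ 1ℚ → inv g · g ≡ I₂
  inv-inverseˡ (mat a b c d) e = mat-≡ (trans (adj₁ a b c d) e) (adj₂ b d) (adj₃ a c) (trans (adj₄ a b c d) e)

  inv-inverseʳ : ∀ g → det g ≡ 1ℚ → g · inv g ≡ I₂
  inv-inverseʳ (mat a b c d) e = mat-≡ (trans (adj₅ a b c d) e) (adj₆ a b) (adj₇ c d) (trans (adj₈ a b c d) e)

  inv-· : ∀ g h → inv (g · h) ≡ inv h · inv g
  inv-· (mat a b c d) (mat a' b' c' d') = mat-≡ (anti₁ c d b' d') (anti₂ a b b' d') (anti₃ c d a' c') (anti₄ a b a' c')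

  inv-inv : ∀ g → inv (inv g) ≡ g
  inv-inv (mat a b c d) = mat-≡ refl (double-neg b) (double-neg c) refl

  det-· : ∀ g h → det (g · h) ≡ det g * det h
  det-· (mat a b c d) (mat a' b' c' d') = det-lemma a b c d a' b' c' d'

  det-inv : ∀ g → det (inv g) ≡ det g
  det-inv (mat a b c d) = det-inv-lemma a b c d

  private
    ι≃ : ∀ z → toℚᵘ (ℤ→ℚ z) ℚᵘ.≃ mkℚᵘ z 0
    ι≃ z = ℚP.toℚᵘ-fromℚᵘ (mkℚᵘ z 0)

  ι-+ : ∀ a b → ℤ→ℚ (a ℤ.+ b) ≡ ℤ→ℚ a + ℤ→ℚ b
  ι-+ a b = ℚP.toℚᵘ-injective (ℚᵘP.≃-trans (ι≃ (a ℤ.+ b)) (ℚᵘP.≃-trans (*≡* (l a b))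
    (ℚᵘP.≃-sym (ℚᵘP.≃-trans (ℚP.toℚᵘ-homo-+ (ℤ→ℚ a) (ℤ→ℚ b)) (ℚᵘP.+-cong (ι≃ a) (ι≃ b))))))
    where
    l : ∀ a b → (a ℤ.+ b) ℤ.* (+ 1) ≡ (a ℤ.* + 1 ℤ.+ b ℤ.* + 1) ℤ.* + 1
    l a b = cong (ℤ._* + 1) (sym (cong₂ ℤ._+_ (ℤP.*-identityʳ a) (ℤP.*-identityʳ b)))

  ι-* : ∀ a b → ℤ→ℚ (a ℤ.* b) ≡ ℤ→ℚ a * ℤ→ℚ b
  ι-* a b = ℚP.toℚᵘ-injective (ℚᵘP.≃-trans (ι≃ (a ℤ.* b)) (ℚᵘP.≃-sym (ℚᵘP.≃-trans (ℚP.toℚᵘ-homo-* (ℤ→ℚ a) (ℤ→ℚ b)) (ℚᵘP.*-cong (ι≃ a) (ι≃ b)))))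

  ι-neg : ∀ a → ℤ→ℚ (ℤ.- a) ≡ - ℤ→ℚ a
  ι-neg a = ℚP.toℚᵘ-injective (ℚᵘP.≃-trans (ι≃ (ℤ.- a)) (ℚᵘP.≃-sym (ℚᵘP.≃-trans (ℚP.toℚᵘ-homo‿- (ℤ→ℚ a)) (ℚᵘP.-‿cong (ι≃ a)))))

  ι-- : ∀ a b → ℤ→ℚ (a ℤ.- b) ≡ ℤ→ℚ a - ℤ→ℚ b
  ι-- a b = trans (ι-+ a (ℤ.- b)) (cong (λ z → ℤ→ℚ a + z) (ι-neg b))

  ι-injective : ∀ {a b} → ℤ→ℚ a ≡ ℤ→ℚ b → a ≡ b
  ι-injective {a} {b} e = from (ℚᵘP.≃-trans (ℚᵘP.≃-sym (ι≃ a)) (ℚᵘP.≃-trans (ℚᵘP.≃-reflexive (cong toℚᵘ e)) (ι≃ b)))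
    where
    from : mkℚᵘ a 0 ℚᵘ.≃ mkℚᵘ b 0 → a ≡ b
    from (*≡* f) = trans (sym (ℤP.*-identityʳ a)) (trans f (ℤP.*-identityʳ b))

  numerator : ∀ q → q * ℤ→ℚ (↧ q) ≡ ℤ→ℚ (↥ q)
  numerator q@(mkℚ n d-1 _) = ℚP.toℚᵘ-injective (ℚᵘP.≃-trans (ℚP.toℚᵘ-homo-* q (ℤ→ℚ (↧ q))) (ℚᵘP.≃-trans (ℚᵘP.*-cong (ℚᵘP.≃-refl {toℚᵘ q}) (ι≃ (↧ q)))
    (ℚᵘP.≃-trans (*≡* (l n (+ suc d-1))) (ℚᵘP.≃-sym (ι≃ (↥ q))))))
    where
    l : ∀ n d → n ℤ.* d ℤ.* + 1 ≡ n ℤ.* (d ℤ.* + 1)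
    l n d = ℤP.*-assoc n d (+ 1)

  -- q ∈ ℤ[1/ℓ] in the form: some q ℓ^k is an integer.
  Fraction : ℕ → ℚ → Set
  Fraction ℓ q = ∃[ k ] ∃[ z ] q * ℤ→ℚ (+ (ℓ ℕ.^ k)) ≡ ℤ→ℚ z

  module Denominator (ℓ : ℕ) where
    private
      pow : ℕ → ℚ
      pow k = ℤ→ℚ (+ (ℓ ℕ.^ k))

      pow-+ : ∀ j k → pow (j ℕ.+ k) ≡ pow j * pow k
      pow-+ j k = trans (cong (λ n → ℤ→ℚ (+ n)) (ℕP.^-distribˡ-+-* ℓ j k)) (trans (cong ℤ→ℚ (ℤP.pos-* (ℓ ℕ.^ j) (ℓ ℕ.^ k))) (ι-* (+ (ℓ ℕ.^ j)) (+ (ℓ ℕ.^ k))))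

    to-fraction : ∀ q → InD ℓ q → Fraction ℓ q
    to-fraction q (k , ℕD.divides m e) = k , ↥ q ℤ.* + m , trans (cong (λ n → q * ℤ→ℚ (+ n)) (trans e (ℕP.*-comm m (↧ₙ q))))
      (trans (cong (λ z → q * z) (trans (cong ℤ→ℚ (ℤP.pos-* (↧ₙ q) m)) (ι-* (↧ q) (+ m)))) (trans (sym (ℚP.*-assoc q (ℤ→ℚ (↧ q)) (ℤ→ℚ (+ m))))
        (trans (cong (_* ℤ→ℚ (+ m)) (numerator q)) (sym (ι-* (↥ q) (+ m))))))

    from-fraction : ∀ q → Fraction ℓ q → InD ℓ q
    from-fraction q@(mkℚ n d-1 c) (k , z , e) = k , Cop.coprime-divisor (Cop.sym (Cop.recompute c)) (subst (suc d-1 ℕD.∣_) (trans (sym (ℤP.abs-* z (+ suc d-1))) (trans (cong ℤ.∣_∣ (sym cross)) (ℤP.abs-* n (+ (ℓ ℕ.^ k))))) (ℕD.n∣m*n ℤ.∣ z ∣))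
      where
      cross : n ℤ.* + (ℓ ℕ.^ k) ≡ z ℤ.* + suc d-1
      cross = ι-injective (trans (ι-* n (+ (ℓ ℕ.^ k))) (trans (cong (_* pow k) (sym (numerator q))) (trans (swap q (ℤ→ℚ (+ suc d-1)) (pow k)) (trans (cong (_* ℤ→ℚ (+ suc d-1)) e) (sym (ι-* z (+ suc d-1)))))))
        where
        swap : ∀ a b c → a * b * c ≡ a * c * b
        swap = solve-∀ ℚ-ring

    abstract
      D-ι : ∀ z → InD ℓ (ℤ→ℚ z)
      D-ι z = from-fraction (ℤ→ℚ z) (0 , z , ℚP.*-identityʳ (ℤ→ℚ z))

      D-+ : ∀ a b → InD ℓ a → InD ℓ b → InD ℓ (a + b)
      D-+ a b A B = from (to-fraction a A) (to-fraction b B)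
        where
        from : Fraction ℓ a → Fraction ℓ b → InD ℓ (a + b)
        from (j , z , e) (k , w , f) = from-fraction (a + b) (j ℕ.+ k , z ℤ.* + (ℓ ℕ.^ k) ℤ.+ w ℤ.* + (ℓ ℕ.^ j) ,
          trans (cong ((a + b) *_) (pow-+ j k)) (trans (l a b (pow j) (pow k)) (trans (cong₂ (λ s t → s * pow k + t * pow j) e f)
            (sym (trans (ι-+ (z ℤ.* + (ℓ ℕ.^ k)) (w ℤ.* + (ℓ ℕ.^ j))) (cong₂ _+_ (ι-* z (+ (ℓ ℕ.^ k))) (ι-* w (+ (ℓ ℕ.^ j)))))))))
          where
          l : ∀ a b p r → (a + b) * (p * r) ≡ a * p * r + b * r * p
          l = solve-∀ ℚ-ring

      D-* : ∀ a b → InD ℓ a → InD ℓ b → InD ℓ (a * b)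
      D-* a b A B = from (to-fraction a A) (to-fraction b B)
        where
        from : Fraction ℓ a → Fraction ℓ b → InD ℓ (a * b)
        from (j , z , e) (k , w , f) = from-fraction (a * b) (j ℕ.+ k , z ℤ.* w ,
          trans (cong ((a * b) *_) (pow-+ j k)) (trans (l a b (pow j) (pow k)) (trans (cong₂ _*_ e f) (sym (ι-* z w)))))
          where
          l : ∀ a b p r → (a * b) * (p * r) ≡ a * p * (b * r)
          l = solve-∀ ℚ-ring

      D-neg : ∀ a → InD ℓ a → InD ℓ (- a)
      D-neg a A = from (to-fraction a A)
        where
        from : Fraction ℓ a → InD ℓ (- a)
        from (j , z , e) = from-fraction (- a) (j , ℤ.- z , trans (sym (ℚP.neg-distribˡ-* a (pow j))) (trans (cong -_ e) (sym (ι-neg z))))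

      sl-· : ∀ g h → InSL2 ℓ g → InSL2 ℓ h → InSL2 ℓ (g · h)
      sl-· g@(mat a b c d) h@(mat a' b' c' d') (A , B , C , D , e) (A' , B' , C' , D' , e') =
        entry a b a' c' A B A' C' , entry a b b' d' A B B' D' , entry c d a' c' C D A' C' , entry c d b' d' C D B' D' , trans (det-· g h) (cong₂ _*_ e e')
        where
        entry : ∀ a b c d → InD ℓ a → InD ℓ b → InD ℓ c → InD ℓ d → InD ℓ (a * c + b * d)
        entry a b c d A B C D = D-+ (a * c) (b * d) (D-* a c A C) (D-* b d B D)

      sl-inv : ∀ g → InSL2 ℓ g → InSL2 ℓ (inv g)
      sl-inv g@(mat a b c d) (A , B , C , D , e) = D , D-neg b B , D-neg c C , A , trans (det-inv g) e

      sl-I : InSL2 ℓ I₂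
      sl-I = D-ι (+ 1) , D-ι (+ 0) , D-ι (+ 0) , D-ι (+ 1) , refl

module FiniteQuotients where
  open import Defs hiding (a; b; c; d)
  open GroupWords
  open ElementaryRelations using (module Weyl; _⊛_; by)
  open NormalForms using (Congruent; matrix; module Evaluate)
  open PrimePowers
  open PrimitiveRoots
  open Levels
  open CongruenceKernel
  open RationalMatrices
  open import Algebra.Bundles using (Group)
  open import Level using (0ℓ)
  open import Data.Fin using (Fin; toℕ)
  import Data.Fin.Properties as FinP
  open import Data.List using ([]; _∷_; length; lookup)
  open import Data.List.Membership.Propositional using (_∈_)
  open import Data.List.Relation.Unary.Any using (index)
  open import Data.List.Relation.Unary.Any.Properties using (lookup-index)
  open import Data.Nat as ℕ using (ℕ; zero; suc; s≤s; _≤_; _<_; _!)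
  import Data.Nat.Properties as ℕP
  import Data.Nat.Divisibility as ℕD
  open import Data.Nat.GCD using (gcd; gcd[m,n]∣m; gcd[m,n]∣n; c*gcd[m,n]≡gcd[cm,cn])
  open import Data.Nat.Primality using (Prime; prime⇒nonZero; prime[2]; euclidsLemma)
  open import Data.Nat.Coprimality as Cop using (Coprime)
  open import Data.Integer as ℤ using (ℤ; +_; 0ℤ; 1ℤ)
  import Data.Integer.Properties as ℤP
  open import Data.Integer.Tactic.RingSolver using (solve)
  open import Data.Integer.Divisibility.Signed using (_∣_; divides; ∣⇒∣ᵤ; ∣ᵤ⇒∣; ∣-trans)
  open import Data.Rational as ℚ using (ℚ; _+_; _*_; _-_; -_; 0ℚ; 1ℚ)
  import Data.Rational.Properties as ℚP
  open import Data.Product using (_×_; _,_; proj₁; proj₂; ∃-syntax)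
  open import Data.Sum using ([_,_]′)
  open import Data.Empty using (⊥; ⊥-elim)
  open import Relation.Nullary using (¬_; yes; no)
  open import Relation.Binary.PropositionalEquality as ≡ using (_≡_; cong; cong₂; subst)
  open import Tactic.RingSolver using (solve-∀)

  private
    add-row : ∀ t a c → 1ℚ * a + t * c ≡ a + t * c
    add-row = solve-∀ ℚ-ring

    keep-row : ∀ a c → 0ℚ * a + 1ℚ * c ≡ c
    keep-row = solve-∀ ℚ-ring

    keep-row′ : ∀ a c → 1ℚ * a + 0ℚ * c ≡ a
    keep-row′ = solve-∀ ℚ-ring

    add-row′ : ∀ t a c → t * a + 1ℚ * c ≡ c + t * a
    add-row′ = solve-∀ ℚ-ring

  upper lower : ℚ → Mat
  upper t = mat 1ℚ t 0ℚ 1ℚ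
  lower t = mat 1ℚ 0ℚ t 1ℚ

  upper-· : ∀ t a b c d → upper t · mat a b c d ≡ mat (a + t * c) (b + t * d) c d
  upper-· t a b c d = mat-≡ (add-row t a c) (add-row t b d) (keep-row a c) (keep-row b d)

  lower-· : ∀ t a b c d → lower t · mat a b c d ≡ mat a b (c + t * a) (d + t * b)
  lower-· t a b c d = mat-≡ (keep-row′ a c) (keep-row′ b d) (add-row′ t a c) (add-row′ t b d)

  -- diag(u, u⁻¹) enters as e₂₁(u⁻¹ - 1) e₁₂(1) e₂₁(u - 1) e₁₂(- u⁻¹), which is visibly trivial modulo u - 1.
  conjugate : ∀ r b c d x u u' → r * d - b * c ≡ 1ℚ → u ≡ 1ℚ - x * r * c → u * u' ≡ 1ℚ →
    mat r b c d · upper x ≡ lower (- (x * c * c) * u' + (u' - 1ℚ)) · (upper 1ℚ · (lower (u - 1ℚ) · (upper (x * r * r * u' - u') · mat r b c d)))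
  conjugate r b c d x u u' Δ ue uu' = ≡.sym (≡.trans (cong (λ m → lower s · (upper 1ℚ · (lower (u - 1ℚ) · m))) (upper-· t r b c d))
      (≡.trans (cong (λ m → lower s · (upper 1ℚ · m)) (lower-· (u - 1ℚ) (r + t * c) (b + t * d) c d))
      (≡.trans (cong (λ m → lower s · m) (upper-· 1ℚ (r + t * c) (b + t * d) (c + (u - 1ℚ) * (r + t * c)) (d + (u - 1ℚ) * (b + t * d))))
      (≡.trans (lower-· s (r + t * c + 1ℚ * (c + (u - 1ℚ) * (r + t * c))) (b + t * d + 1ℚ * (d + (u - 1ℚ) * (b + t * d))) (c + (u - 1ℚ) * (r + t * c)) (d + (u - 1ℚ) * (b + t * d)))
      (mat-≡ (≡.trans top₁ (≡.sym (unit r b))) (≡.trans top₂ (≡.sym (unit′ x r b)))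
        (≡.trans bottom₁ (≡.sym (unit c d))) (≡.trans bottom₂ (≡.sym (unit′ x c d))))))))
    where
    s = - (x * c * c) * u' + (u' - 1ℚ)
    t = x * r * r * u' - u'
    unit : ∀ r b → r * 1ℚ + b * 0ℚ ≡ r
    unit = solve-∀ ℚ-ring
    unit′ : ∀ x r b → r * x + b * 1ℚ ≡ b + x * r
    unit′ = solve-∀ ℚ-ring
    row : ∀ x r a e u u' → a + (x * r * r * u' - u') * e + 1ℚ * (e + (u - 1ℚ) * (a + (x * r * r * u' - u') * e))
      ≡ u * a + x * r * r * e + (u * u' - 1ℚ) * (x * r * r * e - e)
    row = solve-∀ ℚ-ring
    row′ : ∀ x r c a e u u' → e + (u - 1ℚ) * (a + (x * r * r * u' - u') * e) + (- (x * c * c) * u' + (u' - 1ℚ)) * (u * a + x * r * r * e)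
      ≡ - (x * c * c) * a + u' * (1ℚ - x * r * c * (x * r * c)) * e + (u * u' - 1ℚ) * (a - x * c * c * a + x * r * r * e - e)
    row′ = solve-∀ ℚ-ring
    vanish : ∀ p k k' → k ≡ 1ℚ → p + (k - 1ℚ) * k' ≡ p
    vanish p _ k' ≡.refl = drop p k'
      where
      drop : ∀ p k → p + (1ℚ - 1ℚ) * k ≡ p
      drop = solve-∀ ℚ-ring
    xrc≡ : x * r * c ≡ 1ℚ - u
    xrc≡ = ≡.trans (flip′ (x * r * c)) (cong (λ z → 1ℚ - z) (≡.sym ue))
      where
      flip′ : ∀ w → w ≡ 1ℚ - (1ℚ - w)
      flip′ = solve-∀ ℚ-ring
    top : ∀ a e → a + t * e + 1ℚ * (e + (u - 1ℚ) * (a + t * e)) ≡ (1ℚ - x * r * c) * a + x * r * r * e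
    top a e = ≡.trans (row x r a e u u') (≡.trans (vanish (u * a + x * r * r * e) (u * u') (x * r * r * e - e) uu') (cong (λ z → z * a + x * r * r * e) ue))
    bottom : ∀ a e → e + (u - 1ℚ) * (a + t * e) + s * (a + t * e + 1ℚ * (e + (u - 1ℚ) * (a + t * e))) ≡ - (x * c * c) * a + (1ℚ + x * r * c) * e
    bottom a e = ≡.trans (cong (λ z → e + (u - 1ℚ) * (a + t * e) + s * z) (≡.trans (row x r a e u u') (vanish (u * a + x * r * r * e) (u * u') (x * r * r * e - e) uu')))
      (≡.trans (row′ x r c a e u u') (≡.trans (vanish (- (x * c * c) * a + u' * (1ℚ - x * r * c * (x * r * c)) * e) (u * u') (a - x * c * c * a + x * r * r * e - e) uu')
        (cong (λ z → - (x * c * c) * a + z) (≡.trans (cong (λ w → u' * (1ℚ - w * w) * e) xrc≡) (≡.trans (l u u' e) (≡.trans (cong (λ z → z * (1ℚ + (1ℚ - u)) * e) uu') (≡.trans (l′ (1ℚ + (1ℚ - u)) e) (cong (λ w → (1ℚ + w) * e) (≡.sym xrc≡)))))))))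
      where
      l : ∀ u u' e → u' * (1ℚ - (1ℚ - u) * (1ℚ - u)) * e ≡ u * u' * (1ℚ + (1ℚ - u)) * e
      l = solve-∀ ℚ-ring
      l′ : ∀ u e → 1ℚ * u * e ≡ u * e
      l′ = solve-∀ ℚ-ring
    top₁ = ≡.trans (top r c) (l x r c)
      where
      l : ∀ x r c → (1ℚ - x * r * c) * r + x * r * r * c ≡ r
      l = solve-∀ ℚ-ring
    top₂ = ≡.trans (top b d) (≡.trans (l x r b c d) (≡.trans (cong (λ z → b + x * r * z) Δ) (l′ b (x * r))))
      where
      l : ∀ x r b c d → (1ℚ - x * r * c) * b + x * r * r * d ≡ b + x * r * (r * d - b * c)
      l = solve-∀ ℚ-ring
      l′ : ∀ b y → b + y * 1ℚ ≡ b + y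
      l′ = solve-∀ ℚ-ring
    bottom₁ = ≡.trans (bottom r c) (l x r c)
      where
      l : ∀ x r c → - (x * c * c) * r + (1ℚ + x * r * c) * c ≡ c
      l = solve-∀ ℚ-ring
    bottom₂ = ≡.trans (bottom b d) (≡.trans (l x r b c d) (≡.trans (cong (λ z → d + x * c * z) Δ) (l′ d (x * c))))
      where
      l : ∀ x r b c d → - (x * c * c) * b + (1ℚ + x * r * c) * d ≡ d + x * c * (r * d - b * c)
      l = solve-∀ ℚ-ring
      l′ : ∀ b y → b + y * 1ℚ ≡ b + y
      l′ = solve-∀ ℚ-ring

  conjugate′ : ∀ r b c d x u u' s t w → r * d - b * c ≡ 1ℚ → u ≡ 1ℚ - x * r * c → u * u' ≡ 1ℚ →
    s ≡ - (x * c * c) * u' + (u' - 1ℚ) → t ≡ x * r * r * u' - u' → w ≡ u - 1ℚ →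
    mat r b c d · (upper x · I₂) ≡ lower s · (upper 1ℚ · (lower w · (upper t · (mat r b c d · I₂))))
  conjugate′ r b c d x u u' _ _ _ Δ ue uu' ≡.refl ≡.refl ≡.refl = ≡.trans (cong (mat r b c d ·_) (·-identityʳ (upper x)))
    (≡.trans (conjugate r b c d x u u' Δ ue uu')
      (cong (λ m → lower (- (x * c * c) * u' + (u' - 1ℚ)) · (upper 1ℚ · (lower (u - 1ℚ) · (upper (x * r * r * u' - u') · m)))) (≡.sym (·-identityʳ (mat r b c d)))))

  module Additivity (𝔾 : Group 0ℓ 0ℓ) where
    open Rewriting 𝔾

    Additive : (ℤ → Carrier) → Set
    Additive f = ∀ a b → f a ∷ f b ∷ [] ≋ f (a ℤ.+ b) ∷ []

    module _ {f : ℤ → Carrier} (F : Additive f) where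
      additive-zero : f 0ℤ ∷ [] ≋ []
      additive-zero = cancelˡ (f 0ℤ) (F 0ℤ 0ℤ)

      additive-neg : ∀ k → f (ℤ.- k) ∷ f k ∷ [] ≋ []
      additive-neg k = F (ℤ.- k) k ⟫ letter (reflexive (cong f (ℤP.+-inverseˡ k))) ⟫ additive-zero

      additive-neg′ : ∀ k → f k ∷ f (ℤ.- k) ∷ [] ≋ []
      additive-neg′ k = F k (ℤ.- k) ⟫ letter (reflexive (cong f (ℤP.+-inverseʳ k))) ⟫ additive-zero

      additive-* : ∀ e → Additive (λ k → f (k ℤ.* e))
      additive-* e a b = F (a ℤ.* e) (b ℤ.* e) ⟫ letter (reflexive (cong f (≡.sym (ℤP.*-distribʳ-+ e a b))))

    multiples : ∀ {f g} → Additive f → Additive g → ∀ w → w ∷ f 1ℤ ∷ [] ≋ g 1ℤ ∷ w ∷ [] → ∀ k → w ∷ f k ∷ [] ≋ g k ∷ w ∷ []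
    multiples {f} {g} F G w h = all
      where
      nat : ∀ k → w ∷ f (+ k) ∷ [] ≋ g (+ k) ∷ w ∷ []
      nat zero = at (_ ∷ []) (additive-zero F) ⟫ at [] (flip (additive-zero G))
      nat (suc k) = at (_ ∷ []) (flip (F 1ℤ (+ k))) ⟫ at [] h ⟫ at (_ ∷ []) (nat k) ⟫ at [] (G 1ℤ (+ k))
      all : ∀ k → w ∷ f k ∷ [] ≋ g k ∷ w ∷ []
      all (+ k) = nat k
      all (ℤ.-[1+ k ]) = flip (at [] (additive-neg G (+ suc k)) {w ∷ f (ℤ.-[1+ k ]) ∷ []})
          ⟫ at (g (ℤ.-[1+ k ]) ∷ []) (flip (nat (suc k))) {f (ℤ.-[1+ k ]) ∷ []} ⟫ at (g (ℤ.-[1+ k ]) ∷ w ∷ []) (additive-neg′ F (+ suc k)) {[]}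

    trivial-multiples : ∀ {f} → Additive f → ∀ e → f e ∷ [] ≋ [] → ∀ k → f (k ℤ.* e) ∷ [] ≋ []
    trivial-multiples {f} F e h k = cancelˡ (ε) (multiples {λ k → f (k ℤ.* e)} {λ _ → ε} (additive-* F e) (λ _ _ → eq (identityˡ _)) ε
      (at (_ ∷ []) (letter (reflexive (cong f (ℤP.*-identityˡ e))) ⟫ h) ⟫ eq (sym (identityˡ _))) k ⟫ eq (identityˡ _))


    reduce : ∀ {g ξ s s' a w t r} → g ∷ ξ ∷ [] ≋ s ∷ a ∷ w ∷ t ∷ g ∷ [] → s ∷ [] ≋ s' ∷ [] → w ∷ [] ≋ [] → a ∷ t ∷ [] ≋ r ∷ [] → g ∷ ξ ∷ [] ≋ s' ∷ r ∷ g ∷ []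
    reduce h i j k = h ⟫ at [] i ⟫ at (_ ∷ _ ∷ []) j ⟫ at (_ ∷ []) k

    reduce′ : ∀ {g w ξ s s' r} → w ∷ [] ≋ g ∷ [] → g ∷ ξ ∷ [] ≋ s ∷ r ∷ g ∷ [] → s ∷ [] ≋ s' ∷ [] → r ∷ [] ≋ [] → w ∷ ξ ∷ [] ≋ s' ∷ w ∷ []
    reduce′ e h i j = at [] e ⟫ h ⟫ at [] i ⟫ at (_ ∷ []) j ⟫ at (_ ∷ []) (flip e)

    reduce″ : ∀ {g ξ s r} → g ∷ ξ ∷ [] ≋ s ∷ r ∷ g ∷ [] → s ∷ [] ≋ [] → r ∷ [] ≋ ξ ∷ [] → g ∷ ξ ∷ [] ≋ ξ ∷ g ∷ []
    reduce″ h i j = h ⟫ at [] i ⟫ at [] j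

    swap-letters : ∀ {ξ ξ' η η'} → ξ ∷ [] ≋ ξ' ∷ [] → η ∷ [] ≋ η' ∷ [] → ξ ∷ η ∷ [] ≋ η ∷ ξ ∷ [] → ξ' ∷ η' ∷ [] ≋ η' ∷ ξ' ∷ []
    swap-letters e f h = at [] (flip e) ⟫ at (_ ∷ []) (flip f) ⟫ h ⟫ at [] f ⟫ at (_ ∷ []) e

    pair : ∀ g h → g ∙ h ∷ [] ≋ g ∷ h ∷ []
    pair g h = eq (assoc g h ε)

    unit : [] ≋ ε ∷ []
    unit = eq (sym (identityʳ ε))

    replace : ∀ {w ξ ξ' η η'} → ξ ∷ [] ≋ ξ' ∷ [] → η ∷ [] ≋ η' ∷ [] → w ∷ ξ ∷ [] ≋ η ∷ w ∷ [] → w ∷ ξ' ∷ [] ≋ η' ∷ w ∷ []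
    replace e f h = at (_ ∷ []) (flip e) ⟫ h ⟫ at [] f

  module SpecialLinear (ℓ : ℕ) (ℓ-prime : Prime ℓ) where
    open Denominator ℓ

    data SL : Set where
      sl : (g : Mat) → InSL2 ℓ g → SL

    matrixₛ : SL → Mat
    matrixₛ (sl g _) = g

    inSL : ∀ g → InSL2 ℓ (matrixₛ g)
    inSL (sl _ G) = G

    record D : Set where
      constructor _∶_
      field
        val : ℚ
        isD : InD ℓ val
    open D public

    infixl 6 _⊹_
    infixl 7 _⊠_
    infix 8 ⊖_
    _⊹_ _⊠_ : D → D → D
    (p ∶ P) ⊹ (r ∶ R) = (p + r) ∶ D-+ p r P R
    (p ∶ P) ⊠ (r ∶ R) = (p * r) ∶ D-* p r P R

    ⊖_ : D → D
    ⊖ (p ∶ P) = (- p) ∶ D-neg p P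

    ιᴰ : ℤ → D
    ιᴰ z = ℤ→ℚ z ∶ D-ι z

    private
      pow≢0 : ∀ k → ℚ.NonZero (ℤ→ℚ (+ (ℓ ℕ.^ k)))
      pow≢0 k = ℚ.≢-nonZero λ e → ℕ.≢-nonZero⁻¹ (ℓ ℕ.^ k) ⦃ ℕP.m^n≢0 ℓ k ⦃ prime⇒nonZero ℓ-prime ⦄ ⦄ (ℤP.+-injective (ι-injective {+ (ℓ ℕ.^ k)} {0ℤ} e))

    ℓ⁻ : ℕ → D
    ℓ⁻ k = ((ℚ.1/ ℤ→ℚ (+ (ℓ ℕ.^ k))) ⦃ pow≢0 k ⦄) ∶ from-fraction ((ℚ.1/ ℤ→ℚ (+ (ℓ ℕ.^ k))) ⦃ pow≢0 k ⦄) (k , 1ℤ , ℚP.*-inverseˡ (ℤ→ℚ (+ (ℓ ℕ.^ k))) ⦃ pow≢0 k ⦄)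

    ℓ⁻-inverse : ∀ k → ℤ→ℚ (+ (ℓ ℕ.^ k)) * val (ℓ⁻ k) ≡ 1ℚ
    ℓ⁻-inverse k = ℚP.*-inverseʳ (ℤ→ℚ (+ (ℓ ℕ.^ k))) ⦃ pow≢0 k ⦄

    X Y : D → SL
    X (t ∶ T) = sl (upper t) (D-ι (+ 1) , T , D-ι (+ 0) , D-ι (+ 1) , l t)
      where
      l : ∀ t → 1ℚ * 1ℚ - t * 0ℚ ≡ 1ℚ
      l = solve-∀ ℚ-ring
    Y (t ∶ T) = sl (lower t) (D-ι (+ 1) , D-ι (+ 0) , T , D-ι (+ 1) , l t)
      where
      l : ∀ t → 1ℚ * 1ℚ - 0ℚ * t ≡ 1ℚ
      l = solve-∀ ℚ-ring

    module Quotient (N : Mat → Set) (fin : IsFiniteIndexNormal ℓ N) where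
      open IsFiniteIndexNormal fin

      record _~_ (g h : SL) : Set where
        constructor cls
        field rel : N (inv (matrixₛ g) · matrixₛ h)
      open _~_ public

      private
        detₛ : ∀ g → InSL2 ℓ g → det g ≡ 1ℚ
        detₛ _ (_ , _ , _ , _ , e) = e

        inner : ∀ h k → InSL2 ℓ h → h · (inv h · k) ≡ k
        inner h k H = ≡.trans (≡.sym (·-assoc h (inv h) k)) (≡.trans (cong (_· k) (inv-inverseʳ h (detₛ h H))) (·-identityˡ k))

      sl-≡ : ∀ {g h G H} → g ≡ h → sl g G ~ sl h H
      sl-≡ {g} {h} {G} e = cls (subst N (≡.sym (≡.trans (cong (inv g ·_) (≡.sym e)) (inv-inverseˡ g (detₛ g G)))) has-I)

      sym~ : ∀ {g h} → g ~ h → h ~ g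
      sym~ {sl g _} {sl h _} (cls n) = cls (subst N (≡.trans (inv-· (inv g) h) (cong (inv h ·_) (inv-inv g))) (inv-closed _ n))

      trans~ : ∀ {g h k} → g ~ h → h ~ k → g ~ k
      trans~ {sl g _} {sl h H} {sl k _} (cls n) (cls n') = cls (subst N (≡.trans (·-assoc (inv g) h (inv h · k)) (cong (inv g ·_) (inner h k H))) (·-closed _ _ n n'))

      _∘ₛ_ : SL → SL → SL
      sl g G ∘ₛ sl h H = sl (g · h) (sl-· g h G H)

      _⁻¹ₛ : SL → SL
      sl g G ⁻¹ₛ = sl (inv g) (sl-inv g G)

      cong~ : ∀ {g g' h h'} → g ~ g' → h ~ h' → (g ∘ₛ h) ~ (g' ∘ₛ h')
      cong~ {sl g G} {sl g' _} {sl h H} {sl h' _} (cls n) (cls n') = cls (subst N eq₁ (·-closed _ _ (normal (inv h) (inv g · g') (sl-inv h H) n) n'))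
        where
        eq₁ : ((inv h · (inv g · g')) · inv (inv h)) · (inv h · h') ≡ inv (g · h) · (g' · h')
        eq₁ = ≡.trans (cong (λ z → ((inv h · (inv g · g')) · z) · (inv h · h')) (inv-inv h))
          (≡.trans (·-assoc (inv h · (inv g · g')) h (inv h · h')) (≡.trans (cong ((inv h · (inv g · g')) ·_) (inner h h' H))
          (≡.trans (cong (_· h') (≡.sym (·-assoc (inv h) (inv g) g'))) (≡.trans (·-assoc (inv h · inv g) g' h') (cong (_· (g' · h')) (≡.sym (inv-· g h)))))))

      inv~ : ∀ {g h} → g ~ h → (g ⁻¹ₛ) ~ (h ⁻¹ₛ)
      inv~ {sl g G} {sl h H} (cls n) = cls (subst N eq₁ (normal g _ G (inv-closed _ n)))
        where
        eq₁ : (g · inv (inv g · h)) · inv g ≡ inv (inv g) · inv h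
        eq₁ = ≡.trans (cong (λ z → (g · z) · inv g) (≡.trans (inv-· (inv g) h) (cong (inv h ·_) (inv-inv g))))
          (≡.trans (·-assoc g (inv h · g) (inv g)) (≡.trans (cong (g ·_) (≡.trans (·-assoc (inv h) g (inv g)) (≡.trans (cong (inv h ·_) (inv-inverseʳ g (detₛ g G))) (·-identityʳ (inv h))))) (cong (_· inv h) (≡.sym (inv-inv g)))))

      𝔽 : Group 0ℓ 0ℓ
      𝔽 = record { Carrier = SL ; _≈_ = _~_ ; _∙_ = _∘ₛ_ ; ε = sl I₂ sl-I ; _⁻¹ = _⁻¹ₛ
        ; isGroup = record { isMonoid = record { isSemigroup = record { isMagma = record { isEquivalence = record { refl = refl′ ; sym = sym~ ; trans = trans~ } ; ∙-cong = cong~ }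
            ; assoc = assoc′ } ; identity = identityˡ′ , identityʳ′ } ; inverse = inverseˡ′ , inverseʳ′ ; ⁻¹-cong = inv~ } }
        where
        refl′ : ∀ {g} → g ~ g
        refl′ {sl g _} = sl-≡ ≡.refl
        assoc′ : ∀ g h k → ((g ∘ₛ h) ∘ₛ k) ~ (g ∘ₛ (h ∘ₛ k))
        assoc′ (sl m _) (sl m' _) (sl m″ _) = sl-≡ (·-assoc m m' m″)
        identityˡ′ : ∀ g → (sl I₂ sl-I ∘ₛ g) ~ g
        identityˡ′ (sl m _) = sl-≡ (·-identityˡ m)
        identityʳ′ : ∀ g → (g ∘ₛ sl I₂ sl-I) ~ g
        identityʳ′ (sl m _) = sl-≡ (·-identityʳ m)
        inverseˡ′ : ∀ g → ((g ⁻¹ₛ) ∘ₛ g) ~ sl I₂ sl-I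
        inverseˡ′ (sl m G) = sl-≡ (inv-inverseˡ m (detₛ m G))
        inverseʳ′ : ∀ g → (g ∘ₛ (g ⁻¹ₛ)) ~ sl I₂ sl-I
        inverseʳ′ (sl m G) = sl-≡ (inv-inverseʳ m (detₛ m G))

      open Rewriting 𝔽

      X-≡ : ∀ {d e} → val d ≡ val e → X d ∷ [] ≋ X e ∷ []
      X-≡ {d} {e} p = letter (sl-≡ (cong upper p))

      Y-≡ : ∀ {d e} → val d ≡ val e → Y d ∷ [] ≋ Y e ∷ []
      Y-≡ {d} {e} p = letter (sl-≡ (cong lower p))

      XX : ∀ d e → X d ∷ X e ∷ [] ≋ X (d ⊹ e) ∷ []
      XX d e = eq (sl-≡ (≡.trans (cong (upper (val d) ·_) (·-identityʳ (upper (val e)))) (≡.trans (upper-· (val d) 1ℚ (val e) 0ℚ 1ℚ)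
        (≡.trans (mat-≡ (l₁ (val d)) (l₂ (val d) (val e)) ≡.refl ≡.refl) (≡.sym (·-identityʳ (upper (val d + val e))))))))
        where
        l₁ : ∀ d → 1ℚ + d * 0ℚ ≡ 1ℚ
        l₁ = solve-∀ ℚ-ring
        l₂ : ∀ d e → e + d * 1ℚ ≡ d + e
        l₂ = solve-∀ ℚ-ring

      YY : ∀ d e → Y d ∷ Y e ∷ [] ≋ Y (d ⊹ e) ∷ []
      YY d e = eq (sl-≡ (≡.trans (cong (lower (val d) ·_) (·-identityʳ (lower (val e)))) (≡.trans (lower-· (val d) 1ℚ 0ℚ (val e) 1ℚ)
        (≡.trans (mat-≡ ≡.refl ≡.refl (l₂ (val d) (val e)) (l₁ (val d))) (≡.sym (·-identityʳ (lower (val d + val e))))))))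
        where
        l₁ : ∀ d → 1ℚ + d * 0ℚ ≡ 1ℚ
        l₁ = solve-∀ ℚ-ring
        l₂ : ∀ d e → e + d * 1ℚ ≡ d + e
        l₂ = solve-∀ ℚ-ring

      open Additivity 𝔽

      X-additive : ∀ d → Additive (λ k → X (ιᴰ k ⊠ d))
      X-additive d a b = XX (ιᴰ a ⊠ d) (ιᴰ b ⊠ d) ⟫ X-≡ {(ιᴰ a ⊠ d) ⊹ (ιᴰ b ⊠ d)} {ιᴰ (a ℤ.+ b) ⊠ d} (≡.trans (≡.sym (ℚP.*-distribʳ-+ (val d) (ℤ→ℚ a) (ℤ→ℚ b))) (cong (_* val d) (≡.sym (ι-+ a b))))

      Y-additive : ∀ d → Additive (λ k → Y (ιᴰ k ⊠ d))
      Y-additive d a b = YY (ιᴰ a ⊠ d) (ιᴰ b ⊠ d) ⟫ Y-≡ {(ιᴰ a ⊠ d) ⊹ (ιᴰ b ⊠ d)} {ιᴰ (a ℤ.+ b) ⊠ d} (≡.trans (≡.sym (ℚP.*-distribʳ-+ (val d) (ℤ→ℚ a) (ℤ→ℚ b))) (cong (_* val d) (≡.sym (ι-+ a b))))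

      n₀ : ℕ
      n₀ = length reps

      -- Two of the first n₀ + 1 multiples lie in the same coset.
      finite-exponent : ∀ {f} → Additive f → f (+ (n₀ !)) ∷ [] ≋ []
      finite-exponent {f} F = from (FinP.pigeonhole (ℕP.n<1+n n₀) coset)
        where
        cover : ∀ k → ∃[ g ] (g ∈ reps × N (inv g · matrixₛ (f k)))
        cover k = covers (matrixₛ (f k)) (inSL (f k))
        coset : Fin (suc n₀) → Fin n₀
        coset i = index (proj₁ (proj₂ (cover (+ toℕ i))))
        from : ∃[ i ] ∃[ j ] toℕ i < toℕ j × coset i ≡ coset j → f (+ (n₀ !)) ∷ [] ≋ []
        from (i , j , i<j , e) = from′ (ℕD.∣-trans (k∣k! d (ℕP.m<n⇒0<n∸m i<j)) (ℕD.m≤n⇒m!∣n! (ℕP.≤-trans (ℕP.m∸n≤m (toℕ j) (toℕ i)) (ℕP.≤-pred (FinP.toℕ<n j)))))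
          where
          d = toℕ j ℕ.∸ toℕ i
          k∣k! : ∀ k → 0 < k → k ℕD.∣ k !
          k∣k! (suc k) _ = ℕD.m∣m*n (k !)
          same-rep : proj₁ (cover (+ toℕ i)) ≡ proj₁ (cover (+ toℕ j))
          same-rep = ≡.trans (lookup-index (proj₁ (proj₂ (cover (+ toℕ i))))) (≡.trans (cong (lookup reps) e) (≡.sym (lookup-index (proj₁ (proj₂ (cover (+ toℕ j)))))))
          same : f (+ toℕ i) ~ f (+ toℕ j)
          same = trans~ {h = rep} (sym~ {rep} (cls (proj₂ (proj₂ (cover (+ toℕ i)))))) (cls (subst (λ g → N (inv g · matrixₛ (f (+ toℕ j)))) (≡.sym same-rep) (proj₂ (proj₂ (cover (+ toℕ j))))))
            where
            rep : SL
            rep = sl (proj₁ (cover (+ toℕ i))) (reps⊆G _ (proj₁ (proj₂ (cover (+ toℕ i)))))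
          trivial : f (+ d) ∷ [] ≋ []
          trivial = cancelˡ (f (+ toℕ i)) (F (+ toℕ i) (+ d) ⟫ letter (reflexive (cong (λ k → f (+ k)) (ℕP.m+[n∸m]≡n (ℕP.<⇒≤ i<j)))) ⟫ letter (sym~ same))
          from′ : d ℕD.∣ n₀ ! → f (+ (n₀ !)) ∷ [] ≋ []
          from′ (ℕD.divides t e) = letter (reflexive (cong f (≡.trans (cong +_ e) (ℤP.pos-* t d)))) ⟫ trivial-multiples F (+ d) trivial (+ t)

      x y : ℤ → SL
      x k = X (ιᴰ k)
      y k = Y (ιᴰ k)

      open Weyl 𝔽 x y

      1ᴰ : D
      1ᴰ = 1ℚ ∶ D-ι (+ 1)

      x-additive : Additive x
      x-additive a b = XX (ιᴰ a) (ιᴰ b) ⟫ X-≡ {ιᴰ a ⊹ ιᴰ b} {ιᴰ (a ℤ.+ b)} (≡.sym (ι-+ a b))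

      y-additive : Additive y
      y-additive a b = YY (ιᴰ a) (ιᴰ b) ⟫ Y-≡ {ιᴰ a ⊹ ιᴰ b} {ιᴰ (a ℤ.+ b)} (≡.sym (ι-+ a b))

      W-inverse : ∀ v v' → W v v' ∷ W (ℤ.- v) (ℤ.- v') ∷ [] ≋ []
      W-inverse v v' = at [] (flip (pack (x v ∷ y (ℤ.- v') ∷ x v ∷ []))) ⟫ at (_ ∷ _ ∷ _ ∷ []) (flip (pack (x (ℤ.- v) ∷ y (ℤ.- ℤ.- v') ∷ x (ℤ.- v) ∷ [])))
        ⟫ at (_ ∷ _ ∷ []) (additive-neg′ x-additive v) ⟫ at (_ ∷ []) (additive-neg′ y-additive (ℤ.- v')) ⟫ additive-neg′ x-additive v

      W-inverse′ : ∀ v v' → W (ℤ.- v) (ℤ.- v') ∷ W v v' ∷ [] ≋ []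
      W-inverse′ v v' = at [] (flip (pack (x (ℤ.- v) ∷ y (ℤ.- ℤ.- v') ∷ x (ℤ.- v) ∷ []))) ⟫ at (_ ∷ _ ∷ _ ∷ []) (flip (pack (x v ∷ y (ℤ.- v') ∷ x v ∷ [])))
        ⟫ at (_ ∷ _ ∷ []) (additive-neg x-additive v) ⟫ at (_ ∷ []) (additive-neg y-additive (ℤ.- v')) ⟫ additive-neg x-additive v

      flip-action : ∀ v v' {ξ η} → W (ℤ.- v) (ℤ.- v') ∷ ξ ∷ [] ≋ η ∷ W (ℤ.- v) (ℤ.- v') ∷ [] → W v v' ∷ η ∷ [] ≋ ξ ∷ W v v' ∷ []
      flip-action v v' {ξ} {η} h = flip (at (W v v' ∷ η ∷ []) (W-inverse′ v v') {[]}) ⟫ at (W v v' ∷ []) (flip h) {W v v' ∷ []} ⟫ at [] (W-inverse v v') {ξ ∷ W v v' ∷ []}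

      module WeylMatrix (v v' : ℤ) where
        V V' : ℚ
        V = ℤ→ℚ v
        V' = ℤ→ℚ v'

        rᴰ bᴰ cᴰ : D
        rᴰ = 1ᴰ ⊹ ⊖ (ιᴰ v ⊠ ιᴰ v')
        bᴰ = ιᴰ v ⊹ ιᴰ v ⊠ rᴰ
        cᴰ = ⊖ ιᴰ v'

        Wₘ : Mat
        Wₘ = mat (val rᴰ) (val bᴰ) (val cᴰ) (val rᴰ)

        G : InSL2 ℓ Wₘ
        G = isD rᴰ , isD bᴰ , isD cᴰ , isD rᴰ , l V V'
          where
          l : ∀ V V' → (1ℚ - V * V') * (1ℚ - V * V') - (V + V * (1ℚ - V * V')) * - V' ≡ 1ℚ
          l = solve-∀ ℚ-ring

        private
          l₁ : ∀ V V' → 1ℚ + V * (0ℚ + - V' * 1ℚ) ≡ 1ℚ - V * V'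
          l₁ = solve-∀ ℚ-ring
          l₂ : ∀ V V' → V + V * (1ℚ + - V' * V) ≡ V + V * (1ℚ - V * V')
          l₂ = solve-∀ ℚ-ring
          l₃ : ∀ V' → 0ℚ + - V' * 1ℚ ≡ - V'
          l₃ = solve-∀ ℚ-ring
          l₄ : ∀ V V' → 1ℚ + - V' * V ≡ 1ℚ - V * V'
          l₄ = solve-∀ ℚ-ring

        product : upper V · (lower (ℤ→ℚ (ℤ.- v')) · (upper V · I₂)) ≡ Wₘ
        product = ≡.trans (cong (λ m → upper V · (lower (ℤ→ℚ (ℤ.- v')) · m)) (·-identityʳ (upper V)))
          (≡.trans (cong (λ w → upper V · (lower w · upper V)) (ι-neg v')) (≡.trans (cong (upper V ·_) (lower-· (- V') 1ℚ V 0ℚ 1ℚ))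
          (≡.trans (upper-· V 1ℚ V (0ℚ + - V' * 1ℚ) (1ℚ + - V' * V)) (mat-≡ (l₁ V V') (l₂ V V') (l₃ V') (l₄ V V')))))

        W≋ : W v v' ∷ [] ≋ sl Wₘ G ∷ []
        W≋ = letter (sl-≡ {upper V · (lower (ℤ→ℚ (ℤ.- v')) · (upper V · I₂))} {Wₘ} product)

      module AtLevel (s₀ M₀ a M : ℕ) (n₀! : n₀ ! ≡ ℓ ℕ.^ s₀ ℕ.* M₀) (ℓᵃ : ℓ ℕ.^ suc a ≡ suc M) (R∣M : 4 ℕ.* M₀ ℕD.∣ M) where
        private
          0<M : 0 < M
          0<M = ℕP.≤-pred (ℕP.≤-trans (prime>1 ℓ-prime) (ℕP.≤-trans (ℕP.m≤m*n ℓ (ℓ ℕ.^ a) ⦃ ℕP.m^n≢0 ℓ a ⦃ prime⇒nonZero ℓ-prime ⦄ ⦄) (ℕP.≤-reflexive ℓᵃ)))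
        open Levels.Level ℓ-prime (suc a) M ℓᵃ (ℕD.∣-trans (ℕD.m∣m*n M₀) R∣M) 0<M

        Mᴰ : D
        Mᴰ = ιᴰ (+ M)

        private
          factor : D → D
          factor d = ιᴰ (+ (ℕD.quotient R∣M ℕ.* 4)) ⊠ ℓ⁻ s₀ ⊠ d

          M≡ : ∀ d → val (Mᴰ ⊠ d) ≡ val (ιᴰ (+ (n₀ !)) ⊠ factor d)
          M≡ d = ≡.sym (≡.trans (cong (λ k → ℤ→ℚ (+ k) * (ℤ→ℚ (+ (t ℕ.* 4)) * val (ℓ⁻ s₀) * val d)) n₀!)
            (≡.trans (cong (λ z → z * (ℤ→ℚ (+ (t ℕ.* 4)) * val (ℓ⁻ s₀) * val d)) (≡.trans (cong ℤ→ℚ (ℤP.pos-* (ℓ ℕ.^ s₀) M₀)) (ι-* (+ (ℓ ℕ.^ s₀)) (+ M₀))))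
            (≡.trans (l (ℤ→ℚ (+ (ℓ ℕ.^ s₀))) (ℤ→ℚ (+ M₀)) (ℤ→ℚ (+ (t ℕ.* 4))) (val (ℓ⁻ s₀)) (val d)) (≡.trans (cong (λ z → z * (ℤ→ℚ (+ (t ℕ.* 4)) * ℤ→ℚ (+ M₀)) * val d) (ℓ⁻-inverse s₀))
            (cong (_* val d) (≡.trans (ℚP.*-identityˡ _) (≡.trans (≡.sym (ι-* (+ (t ℕ.* 4)) (+ M₀))) (cong ℤ→ℚ (≡.trans (≡.sym (ℤP.pos-* (t ℕ.* 4) M₀)) (cong +_ (≡.trans (ℕP.*-assoc t 4 M₀) (≡.sym (ℕD._∣_.equality R∣M)))))))))))))
            where
            t = ℕD.quotient R∣M
            l : ∀ p m t λ' d → p * m * (t * λ' * d) ≡ p * λ' * (t * m) * d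
            l = solve-∀ ℚ-ring

        X-level : ∀ d → X (Mᴰ ⊠ d) ∷ [] ≋ []
        X-level d = X-≡ {Mᴰ ⊠ d} {ιᴰ (+ (n₀ !)) ⊠ factor d} (M≡ d) ⟫ finite-exponent {λ k → X (ιᴰ k ⊠ factor d)} (X-additive (factor d))

        Y-level : ∀ d → Y (Mᴰ ⊠ d) ∷ [] ≋ []
        Y-level d = Y-≡ {Mᴰ ⊠ d} {ιᴰ (+ (n₀ !)) ⊠ factor d} (M≡ d) ⟫ finite-exponent {λ k → Y (ιᴰ k ⊠ factor d)} (Y-additive (factor d))

        X-shift : ∀ d e f → val d ≡ val e + ℤ→ℚ (+ M) * val f → X d ∷ [] ≋ X e ∷ []
        X-shift d e f p = X-≡ {d} {e ⊹ Mᴰ ⊠ f} p ⟫ flip (XX e (Mᴰ ⊠ f)) ⟫ at (X e ∷ []) (X-level f) {[]}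

        Y-shift : ∀ d e f → val d ≡ val e + ℤ→ℚ (+ M) * val f → Y d ∷ [] ≋ Y e ∷ []
        Y-shift d e f p = Y-≡ {d} {e ⊹ Mᴰ ⊠ f} p ⟫ flip (YY e (Mᴰ ⊠ f)) ⟫ at (Y e ∷ []) (Y-level f) {[]}

        record Principal (u : ℚ) : Set where
          field
            uᴰ u' e e' : D
            u≡ : val uᴰ ≡ u
            uu' : u * val u' ≡ 1ℚ
            u-1 : u ≡ 1ℚ + ℤ→ℚ (+ M) * val e
            u'-1 : val u' ≡ 1ℚ + ℤ→ℚ (+ M) * val e'

        conj : ∀ r b c d (G : InSL2 ℓ (mat r b c d)) x (R : InD ℓ r) (C : InD ℓ c) → Principal (1ℚ - val x * r * c) →
          sl (mat r b c d) G ∷ X x ∷ [] ≋ Y (⊖ (x ⊠ (c ∶ C) ⊠ (c ∶ C))) ∷ X (x ⊠ (r ∶ R) ⊠ (r ∶ R)) ∷ sl (mat r b c d) G ∷ []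
        conj r b c d G x R C p = reduce first step₁ step₂ step₃
          where
          open Principal p
          U = 1ℚ - val x * r * c
          sᴰ tᴰ wᴰ : D
          sᴰ = (⊖ (x ⊠ (c ∶ C) ⊠ (c ∶ C))) ⊠ u' ⊹ (u' ⊹ ⊖ 1ᴰ)
          tᴰ = x ⊠ (r ∶ R) ⊠ (r ∶ R) ⊠ u' ⊹ ⊖ u'
          wᴰ = uᴰ ⊹ ⊖ 1ᴰ
          det₁ : r * d - b * c ≡ 1ℚ
          det₁ = proj₂ (proj₂ (proj₂ (proj₂ G)))
          first : sl (mat r b c d) G ∷ X x ∷ [] ≋ Y sᴰ ∷ X 1ᴰ ∷ Y wᴰ ∷ X tᴰ ∷ sl (mat r b c d) G ∷ []
          first = eq (sl-≡ (conjugate′ r b c d (val x) U (val u') (val sᴰ) (val tᴰ) (val wᴰ) det₁ ≡.refl uu' ≡.refl ≡.refl (cong (_- 1ℚ) u≡)))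
          step₁ : Y sᴰ ∷ [] ≋ Y (⊖ (x ⊠ (c ∶ C) ⊠ (c ∶ C))) ∷ []
          step₁ = Y-shift sᴰ (⊖ (x ⊠ (c ∶ C) ⊠ (c ∶ C))) ((⊖ (x ⊠ (c ∶ C) ⊠ (c ∶ C))) ⊠ e' ⊹ e') (≡.trans (cong (λ z → - (val x * c * c) * z + (z - 1ℚ)) u'-1) (l (- (val x * c * c)) (ℤ→ℚ (+ M)) (val e')))
            where
            l : ∀ k m e → k * (1ℚ + m * e) + (1ℚ + m * e - 1ℚ) ≡ k + m * (k * e + e)
            l = solve-∀ ℚ-ring
          step₂ : Y wᴰ ∷ [] ≋ []
          step₂ = Y-≡ {wᴰ} {Mᴰ ⊠ e} (≡.trans (cong (_- 1ℚ) (≡.trans u≡ u-1)) (l (ℤ→ℚ (+ M) * val e))) ⟫ Y-level e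
            where
            l : ∀ k → 1ℚ + k - 1ℚ ≡ k
            l = solve-∀ ℚ-ring
          step₃ : X 1ᴰ ∷ X tᴰ ∷ [] ≋ X (x ⊠ (r ∶ R) ⊠ (r ∶ R)) ∷ []
          step₃ = XX 1ᴰ tᴰ ⟫ X-shift (1ᴰ ⊹ tᴰ) (x ⊠ (r ∶ R) ⊠ (r ∶ R)) ((x ⊠ (r ∶ R) ⊠ (r ∶ R)) ⊠ e' ⊹ ⊖ e')
            (≡.trans (cong (λ z → 1ℚ + (val x * r * r * z - z)) u'-1) (l (val x * r * r) (ℤ→ℚ (+ M)) (val e')))
            where
            l : ∀ k m e → 1ℚ + (k * (1ℚ + m * e) - (1ℚ + m * e)) ≡ k + m * (k * e - e)
            l = solve-∀ ℚ-ring

        power-unit : ∀ J → Principal (ℤ→ℚ (L ℤ.^ J))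
        power-unit J = from (geometric L J)
          where
          inverse : ℤ→ℚ (L ℤ.^ J) * val (ℓ⁻ (n ℕ.* J)) ≡ 1ℚ
          inverse = ≡.trans (cong (λ z → ℤ→ℚ z * val (ℓ⁻ (n ℕ.* J))) (≡.trans (ℤP.^-*-assoc (+ ℓ) n J) (pos-^ ℓ (n ℕ.* J)))) (ℓ⁻-inverse (n ℕ.* J))
          from : L ℤ.- 1ℤ ∣ L ℤ.^ J ℤ.- 1ℤ → Principal (ℤ→ℚ (L ℤ.^ J))
          from (divides k f) = record { uᴰ = ιᴰ (L ℤ.^ J) ; u' = ℓ⁻ (n ℕ.* J) ; e = eᴰ ; e' = ⊖ (eᴰ ⊠ ℓ⁻ (n ℕ.* J)) ; u≡ = ≡.refl ; uu' = inverse
            ; u-1 = u-1 ; u'-1 = ≡.sym (≡.trans (l (ℤ→ℚ (+ M)) (val eᴰ) (val (ℓ⁻ (n ℕ.* J)))) (≡.trans (cong (λ z → 1ℚ - (z - 1ℚ) * val (ℓ⁻ (n ℕ.* J))) (≡.sym u-1)) (≡.trans (l′ (ℤ→ℚ (L ℤ.^ J)) (val (ℓ⁻ (n ℕ.* J)))) (≡.trans (cong (λ z → 1ℚ - z + val (ℓ⁻ (n ℕ.* J))) inverse) (l″ (val (ℓ⁻ (n ℕ.* J))))))))  }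
            where
            eᴰ = ιᴰ (k ℤ.* (+ (M ℕ.^ E) ℤ.* m))
            u-1 : ℤ→ℚ (L ℤ.^ J) ≡ 1ℚ + ℤ→ℚ (+ M) * val eᴰ
            u-1 = ≡.trans (cong ℤ→ℚ (≡.trans (shift (L ℤ.^ J)) (cong (λ z → 1ℤ ℤ.+ z) (≡.trans f (≡.trans (cong (λ z → k ℤ.* (z ℤ.- 1ℤ)) L≡)
              (≡.trans (cong (λ z → k ℤ.* (1ℤ ℤ.+ z ℤ.* m ℤ.- 1ℤ)) (ℤP.pos-* M (M ℕ.^ E))) (r k (+ M) (+ (M ℕ.^ E)) m))))))) (≡.trans (ι-+ 1ℤ (+ M ℤ.* (k ℤ.* (+ (M ℕ.^ E) ℤ.* m)))) (cong (λ z → 1ℚ + z) (ι-* (+ M) (k ℤ.* (+ (M ℕ.^ E) ℤ.* m)))))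
              where
              shift : ∀ z → z ≡ 1ℤ ℤ.+ (z ℤ.- 1ℤ)
              shift z = solve (z ∷ [])
              r : ∀ k M E m → k ℤ.* (1ℤ ℤ.+ M ℤ.* E ℤ.* m ℤ.- 1ℤ) ≡ M ℤ.* (k ℤ.* (E ℤ.* m))
              r k M E m = solve (k ∷ M ∷ E ∷ m ∷ [])
            l : ∀ m e u → 1ℚ + m * - (e * u) ≡ 1ℚ - (1ℚ + m * e - 1ℚ) * u
            l = solve-∀ ℚ-ring
            l′ : ∀ u u' → 1ℚ - (u - 1ℚ) * u' ≡ 1ℚ - u * u' + u'
            l′ = solve-∀ ℚ-ring
            l″ : ∀ u' → 1ℚ - 1ℚ + u' ≡ u'
            l″ = solve-∀ ℚ-ring

        weyl-x : ∀ v v' ξ f → let open WeylMatrix v v' in Principal (1ℚ - val ξ * val rᴰ * val cᴰ) → val ξ * val rᴰ * val rᴰ ≡ ℤ→ℚ (+ M) * val f →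
          W v v' ∷ X ξ ∷ [] ≋ Y (⊖ (ξ ⊠ ιᴰ v' ⊠ ιᴰ v')) ∷ W v v' ∷ []
        weyl-x v v' ξ f p h = reduce′ W≋ (conj (val rᴰ) (val bᴰ) (val cᴰ) (val rᴰ) G ξ (isD rᴰ) (isD cᴰ) p)
            (Y-≡ {⊖ (ξ ⊠ cᴰ ⊠ cᴰ)} {⊖ (ξ ⊠ ιᴰ v' ⊠ ιᴰ v')} (l (val ξ) V')) (X-≡ {ξ ⊠ rᴰ ⊠ rᴰ} {Mᴰ ⊠ f} h ⟫ X-level f)
          where
          open WeylMatrix v v'
          l : ∀ x v → - (x * - v * - v) ≡ - (x * v * v)
          l = solve-∀ ℚ-ring

        principal-≡ : ∀ {u w} → u ≡ w → Principal u → Principal w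
        principal-≡ ≡.refl p = p

        weyl₁ : ∀ ξ → W 1ℤ 1ℤ ∷ X ξ ∷ [] ≋ Y (⊖ (ξ ⊠ ιᴰ 1ℤ ⊠ ιᴰ 1ℤ)) ∷ W 1ℤ 1ℤ ∷ []
        weyl₁ ξ = weyl-x 1ℤ 1ℤ ξ (ιᴰ 0ℤ) (principal-≡ (l (val ξ)) (power-unit 0)) (l′ (val ξ) (ℤ→ℚ (+ M)))
          where
          l : ∀ x → 1ℚ ≡ 1ℚ - x * (1ℚ - 1ℚ * 1ℚ) * - 1ℚ
          l = solve-∀ ℚ-ring
          l′ : ∀ x m → x * (1ℚ - 1ℚ * 1ℚ) * (1ℚ - 1ℚ * 1ℚ) ≡ m * 0ℚ
          l′ = solve-∀ ℚ-ring

        weyl₋₁ : ∀ ξ → W (ℤ.- 1ℤ) (ℤ.- 1ℤ) ∷ X ξ ∷ [] ≋ Y (⊖ (ξ ⊠ ιᴰ (ℤ.- 1ℤ) ⊠ ιᴰ (ℤ.- 1ℤ))) ∷ W (ℤ.- 1ℤ) (ℤ.- 1ℤ) ∷ []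
        weyl₋₁ ξ = weyl-x (ℤ.- 1ℤ) (ℤ.- 1ℤ) ξ (ιᴰ 0ℤ) (principal-≡ (l (val ξ)) (power-unit 0)) (l′ (val ξ) (ℤ→ℚ (+ M)))
          where
          l : ∀ x → 1ℚ ≡ 1ℚ - x * (1ℚ - - 1ℚ * - 1ℚ) * - - 1ℚ
          l = solve-∀ ℚ-ring
          l′ : ∀ x m → x * (1ℚ - - 1ℚ * - 1ℚ) * (1ℚ - - 1ℚ * - 1ℚ) ≡ m * 0ℚ
          l′ = solve-∀ ℚ-ring

        weyl-good₁ : Good 1ℤ 1ℤ
        weyl-good₁ = record
          { good-x = λ k → replace rfl (Y-≡ {⊖ (ιᴰ k ⊠ ιᴰ 1ℤ ⊠ ιᴰ 1ℤ)} {ιᴰ (ℤ.- (1ℤ ℤ.* 1ℤ ℤ.* k))} (≡.trans (l (ℤ→ℚ k)) (≡.sym (≡.trans (ι-neg (1ℤ ℤ.* 1ℤ ℤ.* k)) (cong (λ z → - ℤ→ℚ z) (ℤP.*-identityˡ k)))))) (weyl₁ (ιᴰ k))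
          ; good-y = λ k → flip-action 1ℤ 1ℤ (replace (X-≡ {⊖ ιᴰ k} {ιᴰ (ℤ.- (1ℤ ℤ.* 1ℤ ℤ.* k))} (≡.sym (≡.trans (ι-neg (1ℤ ℤ.* 1ℤ ℤ.* k)) (cong (λ z → - ℤ→ℚ z) (ℤP.*-identityˡ k)))))
              (Y-≡ {⊖ (⊖ ιᴰ k ⊠ ιᴰ (ℤ.- 1ℤ) ⊠ ιᴰ (ℤ.- 1ℤ))} {ιᴰ k} (l′ (ℤ→ℚ k))) (weyl₋₁ (⊖ ιᴰ k))) }
          where
          l : ∀ x → - (x * 1ℚ * 1ℚ) ≡ - x
          l = solve-∀ ℚ-ring
          l′ : ∀ x → - (- x * - 1ℚ * - 1ℚ) ≡ x
          l′ = solve-∀ ℚ-ring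

        x-congruent : ∀ k k' → + q ∣ k ℤ.- k' → x k ∷ [] ≋ x k' ∷ []
        y-congruent : ∀ k k' → + q ∣ k ℤ.- k' → y k ∷ [] ≋ y k' ∷ []
        private
          shift-by-q : ∀ k k' → (d : + q ∣ k ℤ.- k') → ℤ→ℚ k ≡ ℤ→ℚ k' + ℤ→ℚ (+ M) * ℤ→ℚ (+ (M ℕ.^ E) ℤ.* _∣_.quotient d)
          shift-by-q k k' (divides t e) = ≡.trans (cong ℤ→ℚ (≡.trans (l k k') (cong (λ z → k' ℤ.+ z) (≡.trans e (≡.trans (cong (λ z → t ℤ.* z) (ℤP.pos-* M (M ℕ.^ E))) (l′ t (+ M) (+ (M ℕ.^ E))))))))
            (≡.trans (ι-+ k' (+ M ℤ.* (+ (M ℕ.^ E) ℤ.* t))) (cong (λ z → ℤ→ℚ k' + z) (ι-* (+ M) (+ (M ℕ.^ E) ℤ.* t))))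
            where
            l : ∀ k k' → k ≡ k' ℤ.+ (k ℤ.- k')
            l k k' = solve (k ∷ k' ∷ [])
            l′ : ∀ t M E → t ℤ.* (M ℤ.* E) ≡ M ℤ.* (E ℤ.* t)
            l′ t M E = solve (t ∷ M ∷ E ∷ [])
        x-congruent k k' d = X-shift (ιᴰ k) (ιᴰ k') (ιᴰ (+ (M ℕ.^ E) ℤ.* _∣_.quotient d)) (shift-by-q k k' d)
        y-congruent k k' d = Y-shift (ιᴰ k) (ιᴰ k') (ιᴰ (+ (M ℕ.^ E) ℤ.* _∣_.quotient d)) (shift-by-q k k' d)

        base-commute : ∀ g₀ b₀ → g₀ ℤ.* b₀ ≡ ℤ.- (+ q ℤ.* m) → y b₀ ∷ x g₀ ∷ [] ≋ x g₀ ∷ y b₀ ∷ []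
        base-commute g₀ b₀ h = reduce″ (conj 1ℚ 0ℚ (ℤ→ℚ b₀) 1ℚ (inSL (y b₀)) (ιᴰ g₀) (D-ι (+ 1)) (D-ι b₀) (principal-≡ u≡ (power-unit 1)))
            (Y-≡ {⊖ (ιᴰ g₀ ⊠ ιᴰ b₀ ⊠ ιᴰ b₀)} {Mᴰ ⊠ ιᴰ (+ (M ℕ.^ E) ℤ.* (m ℤ.* b₀))} s≡ ⟫ Y-level (ιᴰ (+ (M ℕ.^ E) ℤ.* (m ℤ.* b₀)))) (X-≡ {ιᴰ g₀ ⊠ 1ᴰ ⊠ 1ᴰ} {ιᴰ g₀} (l (ℤ→ℚ g₀)))
          where
          l : ∀ g → g * 1ℚ * 1ℚ ≡ g
          l = solve-∀ ℚ-ring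
          u≡ : ℤ→ℚ (L ℤ.^ 1) ≡ 1ℚ - ℤ→ℚ g₀ * 1ℚ * ℤ→ℚ b₀
          u≡ = ≡.trans (cong ℤ→ℚ (≡.trans (ℤP.*-identityʳ L) (≡.trans L≡ (≡.trans (l₁ (+ q ℤ.* m)) (cong (λ z → 1ℤ ℤ.- z) (≡.sym h)))))) (≡.trans (ι-- 1ℤ (g₀ ℤ.* b₀)) (≡.trans (cong (λ z → 1ℚ - z) (ι-* g₀ b₀)) (l₂ (ℤ→ℚ g₀) (ℤ→ℚ b₀))))
            where
            l₁ : ∀ z → 1ℤ ℤ.+ z ≡ 1ℤ ℤ.- ℤ.- z
            l₁ z = solve (z ∷ [])
            l₂ : ∀ g b → 1ℚ - g * b ≡ 1ℚ - g * 1ℚ * b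
            l₂ = solve-∀ ℚ-ring
          s≡ : - (ℤ→ℚ g₀ * ℤ→ℚ b₀ * ℤ→ℚ b₀) ≡ ℤ→ℚ (+ M) * ℤ→ℚ (+ (M ℕ.^ E) ℤ.* (m ℤ.* b₀))
          s≡ = ≡.trans (cong (λ z → - (z * ℤ→ℚ b₀)) (≡.trans (≡.sym (ι-* g₀ b₀)) (cong ℤ→ℚ h))) (≡.trans (cong -_ (≡.sym (ι-* (ℤ.- (+ q ℤ.* m)) b₀))) (≡.trans (≡.sym (ι-neg (ℤ.- (+ q ℤ.* m) ℤ.* b₀)))
            (≡.trans (cong ℤ→ℚ (≡.trans (cong (λ z → ℤ.- (ℤ.- (z ℤ.* m) ℤ.* b₀)) (ℤP.pos-* M (M ℕ.^ E))) (l₁ (+ M) (+ (M ℕ.^ E)) m b₀))) (ι-* (+ M) (+ (M ℕ.^ E) ℤ.* (m ℤ.* b₀))))))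
            where
            l₁ : ∀ M E m b → ℤ.- (ℤ.- (M ℤ.* E ℤ.* m) ℤ.* b) ≡ M ℤ.* (E ℤ.* (m ℤ.* b))
            l₁ M E m b = solve (M ∷ E ∷ m ∷ b ∷ [])

        multiples-commute : ∀ g₀ b₀ → g₀ ℤ.* b₀ ≡ ℤ.- (+ q ℤ.* m) → ∀ j k → x (k ℤ.* g₀) ∷ y (j ℤ.* b₀) ∷ [] ≋ y (j ℤ.* b₀) ∷ x (k ℤ.* g₀) ∷ []
        multiples-commute g₀ b₀ h j k = multiples {λ j → y (j ℤ.* b₀)} {λ j → y (j ℤ.* b₀)} (additive-* y-additive b₀) (additive-* y-additive b₀) (x (k ℤ.* g₀))
            (replace one one (flip (multiples {λ k → x (k ℤ.* g₀)} {λ k → x (k ℤ.* g₀)} (additive-* x-additive g₀) (additive-* x-additive g₀) (y b₀) (replace one′ one′ (base-commute g₀ b₀ h)) k))) j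
          where
          one : y b₀ ∷ [] ≋ y (1ℤ ℤ.* b₀) ∷ []
          one = letter (reflexive (cong y (≡.sym (ℤP.*-identityˡ b₀))))
          one′ : x g₀ ∷ [] ≋ x (1ℤ ℤ.* g₀) ∷ []
          one′ = letter (reflexive (cong x (≡.sym (ℤP.*-identityˡ g₀))))

        private
          q≢0 : ℕ.NonZero q
          q≢0 = ℕP.m^n≢0 M (suc E) ⦃ ℕ.>-nonZero 0<M ⦄

        m-inverse : ∃[ m' ] + q ∣ m ℤ.* m' ℤ.- 1ℤ
        m-inverse = invertible m q (ℕ.>-nonZero⁻¹ q ⦃ q≢0 ⦄) (λ p pr d → m-prime pr (prime-∣^ pr M (suc E) d))

        split-level : ∀ a b → + q ∣ a ℤ.* b → ∃[ g₀ ] ∃[ q₂ ] g₀ ℤ.* q₂ ≡ + q × g₀ ∣ a × q₂ ∣ b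
        split-level a b d = from (gcd[m,n]∣m ℤ.∣ a ∣ q) (gcd[m,n]∣n ℤ.∣ a ∣ q)
          where
          g = gcd ℤ.∣ a ∣ q
          from : g ℕD.∣ ℤ.∣ a ∣ → g ℕD.∣ q → ∃[ g₀ ] ∃[ q₂ ] g₀ ℤ.* q₂ ≡ + q × g₀ ∣ a × q₂ ∣ b
          from g∣a@(ℕD.divides a' e) (ℕD.divides q₂ f) = + g , + q₂ , ≡.trans (≡.sym (ℤP.pos-* g q₂)) (cong +_ (≡.trans (ℕP.*-comm g q₂) (≡.sym f))) , ∣ᵤ⇒∣ g∣a , ∣ᵤ⇒∣ (Cop.coprime-divisor co q₂∣)
            where
            g≢0 : ℕ.NonZero g
            g≢0 = ℕ.≢-nonZero λ g≡0 → ℕ.≢-nonZero⁻¹ q ⦃ q≢0 ⦄ (≡.trans f (≡.trans (cong (q₂ ℕ.*_) g≡0) (ℕP.*-zeroʳ q₂)))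
            co : Coprime q₂ a'
            co = Cop.sym (Cop.gcd≡1⇒coprime (ℕP.*-cancelˡ-≡ _ _ g ⦃ g≢0 ⦄ (≡.trans (c*gcd[m,n]≡gcd[cm,cn] g a' q₂)
              (≡.trans (cong₂ gcd (≡.trans (ℕP.*-comm g a') (≡.sym e)) (≡.trans (ℕP.*-comm g q₂) (≡.sym f))) (≡.sym (ℕP.*-identityʳ g))))))
            q₂∣ : q₂ ℕD.∣ a' ℕ.* ℤ.∣ b ∣
            q₂∣ = ℕD.*-cancelˡ-∣ g ⦃ g≢0 ⦄ (≡.subst₂ ℕD._∣_ (≡.trans f (ℕP.*-comm q₂ g)) (≡.trans (ℤP.abs-* a b) (≡.trans (cong (ℕ._* ℤ.∣ b ∣) (≡.trans e (ℕP.*-comm a' g))) (ℕP.*-assoc g a' ℤ.∣ b ∣))) (∣⇒∣ᵤ d))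

        commuting : ∀ {a b} → + q ∣ a ℤ.* b → x a ∷ y b ∷ [] ≋ y b ∷ x a ∷ []
        commuting {a} {b} d = from (split-level a b d) m-inverse
          where
          from : ∃[ g₀ ] ∃[ q₂ ] g₀ ℤ.* q₂ ≡ + q × g₀ ∣ a × q₂ ∣ b → ∃[ m' ] + q ∣ m ℤ.* m' ℤ.- 1ℤ → x a ∷ y b ∷ [] ≋ y b ∷ x a ∷ []
          from (g₀ , q₂ , e , divides α f , divides β h) (m' , i) = swap-letters (letter (reflexive (cong x (≡.sym f)))) (y-congruent (j ℤ.* b₀) b (by ((β ℤ.* q₂) ⊛ i) (≡.trans (cong (λ z → j ℤ.* b₀ ℤ.- z) h) (l β q₂ m m'))))
              (multiples-commute g₀ b₀ (≡.trans (l′ g₀ q₂ m) (cong (λ z → ℤ.- (z ℤ.* m)) e)) j α)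
            where
            b₀ j : ℤ
            b₀ = ℤ.- (q₂ ℤ.* m)
            j = ℤ.- (m' ℤ.* β)
            l : ∀ β q₂ m m' → ℤ.- (m' ℤ.* β) ℤ.* ℤ.- (q₂ ℤ.* m) ℤ.- β ℤ.* q₂ ≡ β ℤ.* q₂ ℤ.* (m ℤ.* m' ℤ.- 1ℤ)
            l β q₂ m m' = solve (β ∷ q₂ ∷ m ∷ m' ∷ [])
            l′ : ∀ g q m → g ℤ.* ℤ.- (q ℤ.* m) ≡ ℤ.- (g ℤ.* q ℤ.* m)
            l′ g q m = solve (g ∷ q ∷ m ∷ [])

        module SmallWeyl (P q' v v' z x₃ : ℤ) (s J : ℕ) (Pq' : P ℤ.* q' ≡ + q) (vv' : v ℤ.* v' ≡ 1ℤ ℤ.+ P ℤ.* z)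
            (rel : + q ℤ.* (z ℤ.* v') ℤ.* x₃ ≡ (+ ℓ) ℤ.^ s ℤ.* (L ℤ.^ J ℤ.- 1ℤ)) where
          open WeylMatrix v v' using (rᴰ; cᴰ)
          private
            S λ' : ℚ
            S = ℤ→ℚ (+ (ℓ ℕ.^ s))
            λ' = val (ℓ⁻ s)

          ξ : D
          ξ = ιᴰ (ℤ.- (q' ℤ.* x₃)) ⊠ ℓ⁻ s

          r≡ : val rᴰ ≡ ℤ→ℚ (ℤ.- (P ℤ.* z))
          r≡ = ≡.trans (cong (λ t → 1ℚ - t) (≡.trans (≡.sym (ι-* v v')) (cong ℤ→ℚ vv'))) (≡.trans (≡.sym (ι-- 1ℤ (1ℤ ℤ.+ P ℤ.* z))) (cong ℤ→ℚ (l (P ℤ.* z))))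
            where
            l : ∀ z → 1ℤ ℤ.- (1ℤ ℤ.+ z) ≡ ℤ.- z
            l z = solve (z ∷ [])

          collect : ∀ a b c → ℤ→ℚ a * λ' * ℤ→ℚ b * ℤ→ℚ c ≡ ℤ→ℚ (a ℤ.* b ℤ.* c) * λ'
          collect a b c = ≡.trans (l (ℤ→ℚ a) λ' (ℤ→ℚ b) (ℤ→ℚ c)) (cong (_* λ') (≡.trans (cong (_* ℤ→ℚ c) (≡.sym (ι-* a b))) (≡.sym (ι-* (a ℤ.* b) c))))
            where
            l : ∀ a l b c → a * l * b * c ≡ a * b * c * l
            l = solve-∀ ℚ-ring

          cancel-pow : ∀ z → ℤ→ℚ ((+ ℓ) ℤ.^ s ℤ.* z) * λ' ≡ ℤ→ℚ z
          cancel-pow z = ≡.trans (cong (_* λ') (≡.trans (cong (λ t → ℤ→ℚ (t ℤ.* z)) (pos-^ ℓ s)) (ι-* (+ (ℓ ℕ.^ s)) z))) (≡.trans (l S (ℤ→ℚ z) λ') (≡.trans (cong (_* ℤ→ℚ z) (ℓ⁻-inverse s)) (ℚP.*-identityˡ (ℤ→ℚ z))))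
            where
            l : ∀ s z l → s * z * l ≡ s * l * z
            l = solve-∀ ℚ-ring

          principal : Principal (1ℚ - val ξ * val rᴰ * val cᴰ)
          principal = principal-≡ (≡.sym (≡.trans (cong₂ (λ t c → 1ℚ - val ξ * t * c) r≡ (≡.sym (ι-neg v'))) (≡.trans (cong (λ t → 1ℚ - t) (≡.trans (collect (ℤ.- (q' ℤ.* x₃)) (ℤ.- (P ℤ.* z)) (ℤ.- v'))
              (≡.trans (cong (λ t → ℤ→ℚ t * λ') integer) (cancel-pow (ℤ.- (L ℤ.^ J ℤ.- 1ℤ)))))) (≡.trans (≡.sym (ι-- 1ℤ (ℤ.- (L ℤ.^ J ℤ.- 1ℤ)))) (cong ℤ→ℚ (l (L ℤ.^ J))))))) (power-unit J)
            where
            l : ∀ z → 1ℤ ℤ.- ℤ.- (z ℤ.- 1ℤ) ≡ z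
            l z = solve (z ∷ [])
            l₁ : ∀ q' x₃ P z v' → ℤ.- (q' ℤ.* x₃) ℤ.* ℤ.- (P ℤ.* z) ℤ.* ℤ.- v' ≡ ℤ.- (P ℤ.* q' ℤ.* (z ℤ.* v') ℤ.* x₃)
            l₁ q' x₃ P z v' = solve (q' ∷ x₃ ∷ P ∷ z ∷ v' ∷ [])
            l₂ : ∀ s t → ℤ.- (s ℤ.* t) ≡ s ℤ.* ℤ.- t
            l₂ s t = solve (s ∷ t ∷ [])
            integer : ℤ.- (q' ℤ.* x₃) ℤ.* ℤ.- (P ℤ.* z) ℤ.* ℤ.- v' ≡ (+ ℓ) ℤ.^ s ℤ.* ℤ.- (L ℤ.^ J ℤ.- 1ℤ)
            integer = ≡.trans (l₁ q' x₃ P z v') (≡.trans (cong (λ t → ℤ.- (t ℤ.* (z ℤ.* v') ℤ.* x₃)) Pq') (≡.trans (cong ℤ.-_ rel) (l₂ ((+ ℓ) ℤ.^ s) (L ℤ.^ J ℤ.- 1ℤ))))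

          base : W v v' ∷ X ξ ∷ [] ≋ Y (⊖ (ξ ⊠ ιᴰ v' ⊠ ιᴰ v')) ∷ W v v' ∷ []
          base = weyl-x v v' ξ (ιᴰ c₀ ⊠ ℓ⁻ s) principal (≡.trans (cong (λ t → val ξ * t * t) r≡) (≡.trans (collect (ℤ.- (q' ℤ.* x₃)) (ℤ.- (P ℤ.* z)) (ℤ.- (P ℤ.* z)))
              (≡.trans (cong (_* λ') (≡.trans (cong ℤ→ℚ integer) (ι-* (+ M) c₀))) (ℚP.*-assoc (ℤ→ℚ (+ M)) (ℤ→ℚ c₀) λ'))))
            where
            c₀ : ℤ
            c₀ = + (M ℕ.^ E) ℤ.* ℤ.- (x₃ ℤ.* P ℤ.* z ℤ.* z)
            l₁ : ∀ q' x₃ P z → ℤ.- (q' ℤ.* x₃) ℤ.* ℤ.- (P ℤ.* z) ℤ.* ℤ.- (P ℤ.* z) ≡ P ℤ.* q' ℤ.* ℤ.- (x₃ ℤ.* P ℤ.* z ℤ.* z)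
            l₁ q' x₃ P z = solve (q' ∷ x₃ ∷ P ∷ z ∷ [])
            integer : ℤ.- (q' ℤ.* x₃) ℤ.* ℤ.- (P ℤ.* z) ℤ.* ℤ.- (P ℤ.* z) ≡ + M ℤ.* c₀
            integer = ≡.trans (l₁ q' x₃ P z) (≡.trans (cong (λ t → t ℤ.* ℤ.- (x₃ ℤ.* P ℤ.* z ℤ.* z)) (≡.trans Pq' (ℤP.pos-* M (M ℕ.^ E)))) (ℤP.*-assoc (+ M) (+ (M ℕ.^ E)) _))

          action : ∀ x₃' → P ∣ x₃ ℤ.* x₃' ℤ.- 1ℤ → ∀ a → W v v' ∷ x (q' ℤ.* a) ∷ [] ≋ y (ℤ.- (v' ℤ.* v' ℤ.* (q' ℤ.* a))) ∷ W v v' ∷ []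
          action x₃' (divides h e) a = replace X≋ Y≋ (multiples {λ k → X (ιᴰ k ⊠ ξ)} {λ k → Y (ιᴰ k ⊠ η)} (X-additive ξ) (Y-additive η) (W v v') (replace X₁ Y₁ base) k)
            where
            η : D
            η = ⊖ (ξ ⊠ ιᴰ v' ⊠ ιᴰ v')
            k t : ℤ
            k = ℤ.- ((+ ℓ) ℤ.^ s ℤ.* (x₃' ℤ.* a))
            t = q' ℤ.* (x₃ ℤ.* x₃') ℤ.* a
            X₁ : X ξ ∷ [] ≋ X (ιᴰ 1ℤ ⊠ ξ) ∷ []
            X₁ = X-≡ {ξ} {ιᴰ 1ℤ ⊠ ξ} (≡.sym (ℚP.*-identityˡ (val ξ)))
            Y₁ : Y η ∷ [] ≋ Y (ιᴰ 1ℤ ⊠ η) ∷ []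
            Y₁ = Y-≡ {η} {ιᴰ 1ℤ ⊠ η} (≡.sym (ℚP.*-identityˡ (val η)))
            kξ : ℤ→ℚ k * val ξ ≡ ℤ→ℚ t
            kξ = ≡.trans (≡.sym (ℚP.*-assoc (ℤ→ℚ k) (ℤ→ℚ (ℤ.- (q' ℤ.* x₃))) λ')) (≡.trans (cong (_* λ') (≡.trans (≡.sym (ι-* k (ℤ.- (q' ℤ.* x₃)))) (cong ℤ→ℚ (l ((+ ℓ) ℤ.^ s) x₃' a q' x₃)))) (cancel-pow t))
              where
              l : ∀ s x₃' a q' x₃ → ℤ.- (s ℤ.* (x₃' ℤ.* a)) ℤ.* ℤ.- (q' ℤ.* x₃) ≡ s ℤ.* (q' ℤ.* (x₃ ℤ.* x₃') ℤ.* a)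
              l s x₃' a q' x₃ = solve (s ∷ x₃' ∷ a ∷ q' ∷ x₃ ∷ [])
            t≡ : + q ∣ t ℤ.- q' ℤ.* a
            t≡ = divides (h ℤ.* a) (≡.trans (l q' x₃ x₃' a) (≡.trans (cong (λ w → w ℤ.* (q' ℤ.* a)) e) (≡.trans (l′ h P q' a) (cong (λ w → h ℤ.* a ℤ.* w) Pq'))))
              where
              l : ∀ q' x₃ x₃' a → q' ℤ.* (x₃ ℤ.* x₃') ℤ.* a ℤ.- q' ℤ.* a ≡ (x₃ ℤ.* x₃' ℤ.- 1ℤ) ℤ.* (q' ℤ.* a)
              l q' x₃ x₃' a = solve (q' ∷ x₃ ∷ x₃' ∷ a ∷ [])
              l′ : ∀ h P q' a → h ℤ.* P ℤ.* (q' ℤ.* a) ≡ h ℤ.* a ℤ.* (P ℤ.* q')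
              l′ h P q' a = solve (h ∷ P ∷ q' ∷ a ∷ [])
            X≋ : X (ιᴰ k ⊠ ξ) ∷ [] ≋ x (q' ℤ.* a) ∷ []
            X≋ = X-≡ {ιᴰ k ⊠ ξ} {ιᴰ t} kξ ⟫ x-congruent t (q' ℤ.* a) t≡
            Y≋ : Y (ιᴰ k ⊠ η) ∷ [] ≋ y (ℤ.- (v' ℤ.* v' ℤ.* (q' ℤ.* a))) ∷ []
            Y≋ = Y-≡ {ιᴰ k ⊠ η} {ιᴰ (ℤ.- (t ℤ.* v' ℤ.* v'))} (≡.trans (l (ℤ→ℚ k) (val ξ) (ℤ→ℚ v')) (≡.trans (cong (λ w → - (w * ℤ→ℚ v' * ℤ→ℚ v')) kξ)
                (≡.sym (≡.trans (ι-neg (t ℤ.* v' ℤ.* v')) (cong -_ (≡.trans (ι-* (t ℤ.* v') v') (cong (_* ℤ→ℚ v') (ι-* t v'))))))))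
                ⟫ y-congruent (ℤ.- (t ℤ.* v' ℤ.* v')) (ℤ.- (v' ℤ.* v' ℤ.* (q' ℤ.* a))) (by ((ℤ.- (v' ℤ.* v')) ⊛ t≡) (l′ t v' (q' ℤ.* a)))
              where
              l : ∀ k x v → k * - (x * v * v) ≡ - (k * x * v * v)
              l = solve-∀ ℚ-ring
              l′ : ∀ t v b → ℤ.- (t ℤ.* v ℤ.* v) ℤ.- ℤ.- (v ℤ.* v ℤ.* b) ≡ ℤ.- (v ℤ.* v) ℤ.* (t ℤ.- b)
              l′ t v b = solve (t ∷ v ∷ b ∷ [])

        small-weyl : ∀ {p} → Prime p → ∀ k q' → q ≡ p ℕ.^ suc k ℕ.* q' → ¬ p ℕD.∣ q' → ∀ v → ¬ + p ∣ + v → v ≤ suc p →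
          ∃[ v' ] (+ p) ℤ.^ suc k ∣ + v ℤ.* v' ℤ.- 1ℤ
            × (∀ a → W (+ v) v' ∷ x (+ q' ℤ.* a) ∷ [] ≋ y (ℤ.- (v' ℤ.* v' ℤ.* (+ q' ℤ.* a))) ∷ W (+ v) v' ∷ [])
            × (∀ a → W (+ v) v' ∷ y (+ q' ℤ.* a) ∷ [] ≋ x (ℤ.- (+ v ℤ.* + v ℤ.* (+ q' ℤ.* a))) ∷ W (+ v) v' ∷ [])
        small-weyl {p} pr k q' q≡ p∤q' v p∤v v≤ = from (small-units pr k q' q≡ p∤q' v p∤v v≤)
          where
          P : ℤ
          P = (+ p) ℤ.^ suc k
          Pq' : P ℤ.* + q' ≡ + q
          Pq' = ≡.trans (cong (λ w → w ℤ.* + q') (pos-^ p (suc k))) (≡.trans (≡.sym (ℤP.pos-* (p ℕ.^ suc k) q')) (cong +_ (≡.sym q≡)))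
          from : SmallUnit pr (suc k) v → ∃[ v' ] P ∣ + v ℤ.* v' ℤ.- 1ℤ
            × (∀ a → W (+ v) v' ∷ x (+ q' ℤ.* a) ∷ [] ≋ y (ℤ.- (v' ℤ.* v' ℤ.* (+ q' ℤ.* a))) ∷ W (+ v) v' ∷ [])
            × (∀ a → W (+ v) v' ∷ y (+ q' ℤ.* a) ∷ [] ≋ x (ℤ.- (+ v ℤ.* + v ℤ.* (+ q' ℤ.* a))) ∷ W (+ v) v' ∷ [])
          from (v' , z , x₃ , s , J , vv' , rel , p∤x₃) = finish (PrimeModulus.invert pr (suc k) x₃ p∤x₃)
            where
            finish : ∃[ x₃' ] P ∣ x₃ ℤ.* x₃' ℤ.- 1ℤ → _
            finish (x₃' , i) = v' , divides z (≡.trans (cong (ℤ._- 1ℤ) vv') (l z P)) , SmallWeyl.action P (+ q') (+ v) v' z x₃ s J Pq' vv' rel x₃' i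
                , λ a → flip-action (+ v) v' (replace (letter (reflexive (cong x (l₃ (+ q') (+ v) a)))) (y-congruent (ℤ.- (ℤ.- v' ℤ.* ℤ.- v' ℤ.* (+ q' ℤ.* (ℤ.- (+ v ℤ.* + v ℤ.* a))))) (+ q' ℤ.* a) (unit² a)) (opposite (ℤ.- (+ v ℤ.* + v ℤ.* a))))
              where
              l : ∀ z P → 1ℤ ℤ.+ P ℤ.* z ℤ.- 1ℤ ≡ z ℤ.* P
              l z P = solve (z ∷ P ∷ [])
              l₁ : ∀ v v' → ℤ.- v ℤ.* ℤ.- v' ≡ v ℤ.* v'
              l₁ v v' = solve (v ∷ v' ∷ [])
              l₂ : ∀ q z v' x₃ → q ℤ.* (z ℤ.* ℤ.- v') ℤ.* ℤ.- x₃ ≡ q ℤ.* (z ℤ.* v') ℤ.* x₃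
              l₂ q z v' x₃ = solve (q ∷ z ∷ v' ∷ x₃ ∷ [])
              l₃ : ∀ q' v a → q' ℤ.* ℤ.- (v ℤ.* v ℤ.* a) ≡ ℤ.- (v ℤ.* v ℤ.* (q' ℤ.* a))
              l₃ q' v a = solve (q' ∷ v ∷ a ∷ [])
              opposite : ∀ a → W (ℤ.- + v) (ℤ.- v') ∷ x (+ q' ℤ.* a) ∷ [] ≋ y (ℤ.- (ℤ.- v' ℤ.* ℤ.- v' ℤ.* (+ q' ℤ.* a))) ∷ W (ℤ.- + v) (ℤ.- v') ∷ []
              opposite = SmallWeyl.action P (+ q') (ℤ.- + v) (ℤ.- v') z (ℤ.- x₃) s J Pq' (≡.trans (l₁ (+ v) v') vv') (≡.trans (l₂ (+ q) z v' x₃) rel) (ℤ.- x₃') (by i (l₄ x₃ x₃'))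
                where
                l₄ : ∀ x x' → ℤ.- x ℤ.* ℤ.- x' ℤ.- 1ℤ ≡ x ℤ.* x' ℤ.- 1ℤ
                l₄ x x' = solve (x ∷ x' ∷ [])
              unit² : ∀ a → + q ∣ ℤ.- (ℤ.- v' ℤ.* ℤ.- v' ℤ.* (+ q' ℤ.* (ℤ.- (+ v ℤ.* + v ℤ.* a)))) ℤ.- + q' ℤ.* a
              unit² a = divides (z ℤ.* (+ v ℤ.* v' ℤ.+ 1ℤ) ℤ.* a) (≡.trans (l₅ v' (+ q') (+ v) a) (≡.trans (cong (λ w → (w ℤ.- 1ℤ) ℤ.* (+ v ℤ.* v' ℤ.+ 1ℤ) ℤ.* (+ q' ℤ.* a)) vv') (≡.trans (l₆ P z (+ v ℤ.* v' ℤ.+ 1ℤ) (+ q') a) (cong (λ w → z ℤ.* (+ v ℤ.* v' ℤ.+ 1ℤ) ℤ.* a ℤ.* w) Pq'))))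
                where
                l₅ : ∀ v' q' v a → ℤ.- (ℤ.- v' ℤ.* ℤ.- v' ℤ.* (q' ℤ.* (ℤ.- (v ℤ.* v ℤ.* a)))) ℤ.- q' ℤ.* a ≡ (v ℤ.* v' ℤ.- 1ℤ) ℤ.* (v ℤ.* v' ℤ.+ 1ℤ) ℤ.* (q' ℤ.* a)
                l₅ v' q' v a = solve (v' ∷ q' ∷ v ∷ a ∷ [])
                l₆ : ∀ P z w q' a → (1ℤ ℤ.+ P ℤ.* z ℤ.- 1ℤ) ℤ.* w ℤ.* (q' ℤ.* a) ≡ z ℤ.* w ℤ.* a ℤ.* (P ℤ.* q')
                l₆ P z w q' a = solve (P ∷ z ∷ w ∷ q' ∷ a ∷ [])

        congruence-data : CongruenceData 𝔽 x y q
        congruence-data = record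
          { x-homo = λ a b → sym (unletter (pair (x a) (x b) ⟫ x-additive a b))
          ; y-homo = λ a b → sym (unletter (pair (y a) (y b) ⟫ y-additive a b))
          ; x-level = λ {a} d → unletter (x-congruent a 0ℤ (by d (ℤP.+-identityʳ a)) ⟫ additive-zero x-additive ⟫ unit)
          ; y-level = λ {a} d → unletter (y-congruent a 0ℤ (by d (ℤP.+-identityʳ a)) ⟫ additive-zero y-additive ⟫ unit)
          ; good₁ = weyl-good₁
          ; w₀⁴ = eq (sl-≡ ≡.refl)
          ; commute = commuting
          ; small = small-weyl
          ; even-part = from (strip prime[2] q (ℕ.>-nonZero⁻¹ q ⦃ q≢0 ⦄)) }
          where
          2³∣q : 2 ℕ.^ 3 ℕD.∣ q
          2³∣q = cube (ℕD.∣-trans (ℕD.divides 2 ≡.refl) (ℕD.∣-trans (ℕD.m∣m*n M₀) R∣M))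
            where
            cube : 2 ℕD.∣ M → 2 ℕ.^ 3 ℕD.∣ q
            cube d = ℕD.∣-trans (ℕD.*-pres-∣ d (ℕD.*-pres-∣ d (ℕD.*-pres-∣ d (ℕD.∣-refl {1})))) (subst (M ℕ.* (M ℕ.* (M ℕ.* 1)) ℕD.∣_)
              (≡.trans (≡.sym (ℕP.^-distribˡ-+-* M 3 (suc M))) (cong (M ℕ.^_) (cong suc (ℕP.+-comm 3 M)))) (ℕD.m∣m*n (M ℕ.^ suc M)))
          from : ∃[ f ] ∃[ q₀ ] q ≡ 2 ℕ.^ f ℕ.* q₀ × ¬ 2 ℕD.∣ q₀ → ∃[ k ] ∃[ q₀ ] q ≡ 2 ℕ.^ (3 ℕ.+ k) ℕ.* q₀ × ¬ 2 ℕD.∣ q₀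
          from (f , q₀ , e , odd) with 3 ℕP.≤? f
          ... | yes 3≤f = f ℕ.∸ 3 , q₀ , ≡.trans e (cong (λ t → 2 ℕ.^ t ℕ.* q₀) (≡.sym (ℕP.m+[n∸m]≡n 3≤f))) , odd
          ... | no 3≰f = ⊥-elim (low f (ℕP.≰⇒> 3≰f) e)
            where
            low : ∀ f → f < 3 → q ≡ 2 ℕ.^ f ℕ.* q₀ → ⊥
            low f (s≤s f≤2) e = odd (ℕD.*-cancelˡ-∣ (2 ℕ.^ f) ⦃ ℕP.m^n≢0 2 f ⦄ (ℕD.∣-trans (subst (2 ℕ.^ f ℕ.* 2 ℕD.∣_) (power f f≤2) (ℕD.m∣m*n (2 ℕ.^ (2 ℕ.∸ f)))) (subst (2 ℕ.^ 3 ℕD.∣_) e 2³∣q)))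
              where
              power : ∀ f → f ≤ 2 → 2 ℕ.^ f ℕ.* 2 ℕ.* 2 ℕ.^ (2 ℕ.∸ f) ≡ 2 ℕ.^ 3
              power 0 _ = ≡.refl
              power 1 _ = ≡.refl
              power 2 _ = ≡.refl
              power (suc (suc (suc _))) (s≤s (s≤s ()))

        congruence : ∀ ω₁ ω₂ → Congruent (+ q) (matrix ω₁) (matrix ω₂) → Evaluate.eval 𝔽 x y ω₁ ~ Evaluate.eval 𝔽 x y ω₂
        congruence = CongruenceSubgroup.eval-unique congruence-data

        0<q : 0 < q
        0<q = ℕ.>-nonZero⁻¹ q ⦃ q≢0 ⦄

      congruence-subgroup : ¬ ℓ ≡ 2 → ∃[ q ] 0 < q × (∀ ω₁ ω₂ → Congruent (+ q) (matrix ω₁) (matrix ω₂) → Evaluate.eval 𝔽 x y ω₁ ~ Evaluate.eval 𝔽 x y ω₂)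
      congruence-subgroup ℓ≢2 = from (strip ℓ-prime (n₀ !) (ℕP.1≤n! n₀))
        where
        from : ∃[ f ] ∃[ d' ] n₀ ! ≡ ℓ ℕ.^ f ℕ.* d' × ¬ ℓ ℕD.∣ d' → _
        from (s₀ , M₀ , e , ℓ∤M₀) = from′ (finite-order (4 ℕ.* M₀) ℓ 0<R ℓ-prime ℓ∤R)
          where
          ℓ∤R : ¬ ℓ ℕD.∣ 4 ℕ.* M₀
          ℓ∤R d = [ (λ t → ℓ≢2 (prime-divides-prime ℓ-prime prime[2] (prime-∣^ ℓ-prime 2 2 t))) , ℓ∤M₀ ]′ (euclidsLemma 4 M₀ ℓ-prime d)
          0<R : 0 < 4 ℕ.* M₀
          0<R = ℕP.n≢0⇒n>0 λ z → ℓ∤R (subst (ℓ ℕD.∣_) (≡.sym z) (ℓ ℕD.∣0))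
          from′ : ∃[ a ] ∃[ M ] ℓ ℕ.^ suc a ≡ suc M × 4 ℕ.* M₀ ℕD.∣ M → _
          from′ (a , M , ℓᵃ , R∣M) = _ , AtLevel.0<q s₀ M₀ a M e ℓᵃ R∣M , AtLevel.congruence s₀ M₀ a M e ℓᵃ R∣M

module Commutators where
  open ElementaryRelations using (_⊛_; _⊕_; by)
  open NormalForms
  open PrimePowers
  open PrimitiveRoots
  open CongruenceKernel using (coprime-∣)
  open import Data.List using ([]; _∷_; _++_; map)
  open import Data.Nat using (zero; suc)
  open import Data.Nat.Coprimality using (Coprime)
  open import Data.Integer using (ℤ; +_; _+_; _*_; _-_; -_; _^_; 0ℤ; 1ℤ)
  import Data.Integer.Properties as ℤP
  open import Data.Integer.Divisibility.Signed using (_∣_; divides; ∣-trans)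
  open import Data.Integer.Tactic.RingSolver using (solve)
  open import Data.Product using (_×_; _,_; ∃-syntax)
  open import Data.Sum using ([_,_]′)
  open import Relation.Binary.PropositionalEquality using (_≡_; refl; sym; trans; cong; cong₂)

  matℤ-≡ : ∀ {a b c d a' b' c' d'} → a ≡ a' → b ≡ b' → c ≡ c' → d ≡ d' → matℤ a b c d ≡ matℤ a' b' c' d'
  matℤ-≡ refl refl refl refl = refl

  Iℤ : Matℤ
  Iℤ = matℤ 1ℤ 0ℤ 0ℤ 1ℤ

  ⊡-assoc : ∀ m n k → (m ⊡ n) ⊡ k ≡ m ⊡ (n ⊡ k)
  ⊡-assoc (matℤ a b c d) (matℤ a₁ b₁ c₁ d₁) (matℤ a₂ b₂ c₂ d₂) = matℤ-≡ (l a b a₂ c₂) (l a b b₂ d₂) (l c d a₂ c₂) (l c d b₂ d₂)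
    where
    l : ∀ a b a₂ c₂ → (a * a₁ + b * c₁) * a₂ + (a * b₁ + b * d₁) * c₂ ≡ a * (a₁ * a₂ + b₁ * c₂) + b * (c₁ * a₂ + d₁ * c₂)
    l a b a₂ c₂ = solve (a ∷ b ∷ a₁ ∷ b₁ ∷ c₁ ∷ d₁ ∷ a₂ ∷ c₂ ∷ [])

  ⊡-identityˡ : ∀ m → Iℤ ⊡ m ≡ m
  ⊡-identityˡ (matℤ a b c d) = matℤ-≡ (l a c) (l b d) (l′ a c) (l′ b d)
    where
    l : ∀ a c → 1ℤ * a + 0ℤ * c ≡ a
    l a c = solve (a ∷ c ∷ [])
    l′ : ∀ a c → 0ℤ * a + 1ℤ * c ≡ c
    l′ a c = solve (a ∷ c ∷ [])

  ⊡-identityʳ : ∀ m → m ⊡ Iℤ ≡ m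
  ⊡-identityʳ (matℤ a b c d) = matℤ-≡ (l a b) (l′ a b) (l c d) (l′ c d)
    where
    l : ∀ a c → a * 1ℤ + c * 0ℤ ≡ a
    l a c = solve (a ∷ c ∷ [])
    l′ : ∀ a c → a * 0ℤ + c * 1ℤ ≡ c
    l′ a c = solve (a ∷ c ∷ [])

  𝕐 : ℤ → Matℤ
  𝕐 k = matℤ 1ℤ 0ℤ k 1ℤ

  ⟨_⟩ : Letter → Matℤ
  ⟨ 𝕩 s ⟩ = matℤ 1ℤ s 0ℤ 1ℤ
  ⟨ 𝕪 s ⟩ = 𝕐 s

  act-⊡ : ∀ l m → act l m ≡ ⟨ l ⟩ ⊡ m
  act-⊡ (𝕩 s) (matℤ a b c d) = matℤ-≡ (l a c) (l b d) (l′ a c) (l′ b d)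
    where
    l : ∀ a c → a + s * c ≡ 1ℤ * a + s * c
    l a c = solve (a ∷ c ∷ s ∷ [])
    l′ : ∀ a c → c ≡ 0ℤ * a + 1ℤ * c
    l′ a c = solve (a ∷ c ∷ [])
  act-⊡ (𝕪 s) (matℤ a b c d) = matℤ-≡ (l a c) (l b d) (l′ a c) (l′ b d)
    where
    l : ∀ a c → a ≡ 1ℤ * a + 0ℤ * c
    l a c = solve (a ∷ c ∷ [])
    l′ : ∀ a c → c + s * a ≡ s * a + 1ℤ * c
    l′ a c = solve (a ∷ c ∷ s ∷ [])

  matrix-++ : ∀ ω ω' → matrix (ω ++ ω') ≡ matrix ω ⊡ matrix ω'
  matrix-++ [] ω' = sym (⊡-identityˡ (matrix ω'))
  matrix-++ (l ∷ ω) ω' = trans (cong (act l) (matrix-++ ω ω')) (trans (act-⊡ l (matrix ω ⊡ matrix ω'))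
    (trans (sym (⊡-assoc ⟨ l ⟩ (matrix ω) (matrix ω'))) (cong (_⊡ matrix ω') (sym (act-⊡ l (matrix ω))))))

  infix 4 _≈[_]_
  data _≈[_]_ (m : Matℤ) (Q : ℤ) (n : Matℤ) : Set where
    con : Congruent Q m n → m ≈[ Q ] n

  uncon : ∀ {m Q n} → m ≈[ Q ] n → Congruent Q m n
  uncon (con c) = c

  zero-∣ : ∀ {Q a} → a ≡ 0ℤ → Q ∣ a
  zero-∣ refl = divides 0ℤ refl

  ≈-refl : ∀ {Q m} → m ≈[ Q ] m
  ≈-refl {Q} {matℤ a b c d} = con (l a , l b , l c , l d)
    where
    l : ∀ a → Q ∣ a - a
    l a = zero-∣ (ℤP.+-inverseʳ a)

  ≈-≡ : ∀ {Q m n} → m ≡ n → m ≈[ Q ] n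
  ≈-≡ refl = ≈-refl

  ≈-trans : ∀ {Q m n k} → m ≈[ Q ] n → n ≈[ Q ] k → m ≈[ Q ] k
  ≈-trans {Q} {matℤ a b c d} {matℤ a₁ b₁ c₁ d₁} {matℤ a₂ b₂ c₂ d₂} (con (p , p' , p″ , p‴)) (con (r , r' , r″ , r‴)) =
    con (l a a₁ a₂ p r , l b b₁ b₂ p' r' , l c c₁ c₂ p″ r″ , l d d₁ d₂ p‴ r‴)
    where
    l : ∀ a b c → Q ∣ a - b → Q ∣ b - c → Q ∣ a - c
    l a b c p r = by (p ⊕ r) (solve (a ∷ b ∷ c ∷ []))

  ≈-sym : ∀ {Q m n} → m ≈[ Q ] n → n ≈[ Q ] m
  ≈-sym {Q} {matℤ a b c d} {matℤ a₁ b₁ c₁ d₁} (con (p , p' , p″ , p‴)) = con (l a a₁ p , l b b₁ p' , l c c₁ p″ , l d d₁ p‴)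
    where
    l : ∀ a b → Q ∣ a - b → Q ∣ b - a
    l a b p = by (- 1ℤ ⊛ p) (solve (a ∷ b ∷ []))

  ⊡-cong : ∀ {Q m n m' n'} → m ≈[ Q ] n → m' ≈[ Q ] n' → m ⊡ m' ≈[ Q ] n ⊡ n'
  ⊡-cong {Q} {matℤ a b c d} {matℤ a₁ b₁ c₁ d₁} {matℤ e f g h} {matℤ e₁ f₁ g₁ h₁} (con (p , p' , p″ , p‴)) (con (r , r' , r″ , r‴)) =
    con (l a b e g a₁ b₁ e₁ g₁ p p' r r″ , l a b f h a₁ b₁ f₁ h₁ p p' r' r‴ , l c d e g c₁ d₁ e₁ g₁ p″ p‴ r r″ , l c d f h c₁ d₁ f₁ h₁ p″ p‴ r' r‴)
    where
    l : ∀ a b e g a₁ b₁ e₁ g₁ → Q ∣ a - a₁ → Q ∣ b - b₁ → Q ∣ e - e₁ → Q ∣ g - g₁ → Q ∣ a * e + b * g - (a₁ * e₁ + b₁ * g₁)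
    l a b e g a₁ b₁ e₁ g₁ p p' r r' = by (e ⊛ p ⊕ a₁ ⊛ r ⊕ g ⊛ p' ⊕ b₁ ⊛ r') (solve (a ∷ b ∷ e ∷ g ∷ a₁ ∷ b₁ ∷ e₁ ∷ g₁ ∷ []))

  ≈-coprime : ∀ {r s} → Coprime r s → ∀ {m n} → m ≈[ + r ] n → m ≈[ + s ] n → m ≈[ + r * + s ] n
  ≈-coprime co {matℤ _ _ _ _} {matℤ _ _ _ _} (con (p , p' , p″ , p‴)) (con (r , r' , r″ , r‴)) =
    con (coprime-∣ co p r , coprime-∣ co p' r' , coprime-∣ co p″ r″ , coprime-∣ co p‴ r‴)

  -- Words X, Y with X Y ≡ A Y X, i.e. A is the commutator of X and Y modulo Q.
  record Solution (Q : ℤ) (A : Matℤ) : Set where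
    constructor solution
    field
      ωX ωY : Word
      solves : matrix ωX ⊡ matrix ωY ≈[ Q ] A ⊡ (matrix ωY ⊡ matrix ωX)

  from-matrices : ∀ {Q A MX MY} ωX ωY → matrix ωX ≈[ Q ] MX → matrix ωY ≈[ Q ] MY → MX ⊡ MY ≈[ Q ] A ⊡ (MY ⊡ MX) → Solution Q A
  from-matrices ωX ωY hX hY h = solution ωX ωY (≈-trans (⊡-cong hX hY) (≈-trans h (⊡-cong ≈-refl (⊡-cong (≈-sym hY) (≈-sym hX)))))

  module _ (k : ℤ) where
    private
      u u' : Matℤ
      u = 𝕐 k
      u' = 𝕐 (- k)
      uu' : u ⊡ u' ≡ Iℤ
      uu' = matℤ-≡ refl refl (l k) (l′ k)
        where
        l : ∀ k → k * 1ℤ + 1ℤ * - k ≡ 0ℤ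
        l k = solve (k ∷ [])
        l′ : ∀ k → k * 0ℤ + 1ℤ * 1ℤ ≡ 1ℤ
        l′ k = solve (k ∷ [])
      u'u : u' ⊡ u ≡ Iℤ
      u'u = matℤ-≡ refl refl (l k) (l′ k)
        where
        l : ∀ k → - k * 1ℤ + 1ℤ * k ≡ 0ℤ
        l k = solve (k ∷ [])
        l′ : ∀ k → - k * 0ℤ + 1ℤ * 1ℤ ≡ 1ℤ
        l′ k = solve (k ∷ [])

      cancel : ∀ {v w} → v ⊡ w ≡ Iℤ → ∀ m → v ⊡ (w ⊡ m) ≡ m
      cancel {v} {w} e m = trans (sym (⊡-assoc v w m)) (trans (cong (_⊡ m) e) (⊡-identityˡ m))

      conjugate-word : Word → Word
      conjugate-word ω = 𝕪 (- k) ∷ (ω ++ 𝕪 k ∷ [])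

      conjugate-matrix : ∀ ω → matrix (conjugate-word ω) ≡ u' ⊡ (matrix ω ⊡ u)
      conjugate-matrix ω = trans (act-⊡ (𝕪 (- k)) (matrix (ω ++ 𝕪 k ∷ []))) (cong (u' ⊡_) (trans (matrix-++ ω (𝕪 k ∷ [])) (cong (matrix ω ⊡_) (trans (act-⊡ (𝕪 k) Iℤ) (⊡-identityʳ u)))))

      conjugate-⊡ : ∀ m n → (u' ⊡ (m ⊡ u)) ⊡ (u' ⊡ (n ⊡ u)) ≡ u' ⊡ ((m ⊡ n) ⊡ u)
      conjugate-⊡ m n = trans (⊡-assoc u' (m ⊡ u) _) (cong (u' ⊡_) (trans (⊡-assoc m u _) (trans (cong (m ⊡_) (cancel uu' (n ⊡ u))) (sym (⊡-assoc m n u)))))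

    conjugate-solution : ∀ {Q A B} → u ⊡ A ⊡ u' ≈[ Q ] B → Solution Q B → Solution Q A
    conjugate-solution {Q} {A} {B} h (solution ωX ωY e) = solution (conjugate-word ωX) (conjugate-word ωY)
      (≈-trans (≈-≡ (trans (cong₂ _⊡_ (conjugate-matrix ωX) (conjugate-matrix ωY)) (conjugate-⊡ (matrix ωX) (matrix ωY))))
        (≈-trans (⊡-cong ≈-refl (⊡-cong (≈-trans e (⊡-cong (≈-sym h) ≈-refl)) ≈-refl))
          (≈-≡ (trans (shift (matrix ωY ⊡ matrix ωX)) (cong (A ⊡_) (sym (trans (cong₂ _⊡_ (conjugate-matrix ωY) (conjugate-matrix ωX)) (conjugate-⊡ (matrix ωY) (matrix ωX)))))))))
      where
      shift : ∀ m → u' ⊡ (((u ⊡ A ⊡ u') ⊡ m) ⊡ u) ≡ A ⊡ (u' ⊡ (m ⊡ u))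
      shift m = trans (cong (λ z → u' ⊡ (z ⊡ u)) (trans (⊡-assoc (u ⊡ A) u' m) (⊡-assoc u A (u' ⊡ m)))) (trans (cong (u' ⊡_) (⊡-assoc u (A ⊡ (u' ⊡ m)) u))
        (trans (cancel u'u ((A ⊡ (u' ⊡ m)) ⊡ u)) (trans (⊡-assoc A (u' ⊡ m) u) (cong (A ⊡_) (⊡-assoc u' m u)))))

  lower-conjugate : ∀ k α β γ δ → 𝕐 k ⊡ matℤ α β γ δ ⊡ 𝕐 (- k) ≡ matℤ (α - k * β) β (γ + k * (α - δ) - k * k * β) (δ + k * β)
  lower-conjugate k α β γ δ = matℤ-≡ (l₁ k α β γ δ) (l₂ k α β γ δ) (l₃ k α β γ δ) (l₄ k α β γ δ)
    where
    l₁ : ∀ k α β γ δ → (1ℤ * α + 0ℤ * γ) * 1ℤ + (1ℤ * β + 0ℤ * δ) * - k ≡ α - k * β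
    l₁ k α β γ δ = solve (k ∷ α ∷ β ∷ γ ∷ δ ∷ [])
    l₂ : ∀ k α β γ δ → (1ℤ * α + 0ℤ * γ) * 0ℤ + (1ℤ * β + 0ℤ * δ) * 1ℤ ≡ β
    l₂ k α β γ δ = solve (k ∷ α ∷ β ∷ γ ∷ δ ∷ [])
    l₃ : ∀ k α β γ δ → (k * α + 1ℤ * γ) * 1ℤ + (k * β + 1ℤ * δ) * - k ≡ γ + k * (α - δ) - k * k * β
    l₃ k α β γ δ = solve (k ∷ α ∷ β ∷ γ ∷ δ ∷ [])
    l₄ : ∀ k α β γ δ → (k * α + 1ℤ * γ) * 0ℤ + (k * β + 1ℤ * δ) * 1ℤ ≡ δ + k * β
    l₄ k α β γ δ = solve (k ∷ α ∷ β ∷ γ ∷ δ ∷ [])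

  scale-letter : ℤ → Letter → Letter
  scale-letter π (𝕩 s) = 𝕩 (π * s)
  scale-letter π (𝕪 s) = 𝕪 (π * s)

  scale : ℤ → Word → Word
  scale π = map (scale-letter π)

  scale-one : ∀ {Q π} → Q ∣ π - 1ℤ → ∀ ω → matrix (scale π ω) ≈[ Q ] matrix ω
  scale-one d [] = ≈-refl
  scale-one {Q} {π} d (l ∷ ω) = ≈-trans (≈-≡ (act-⊡ (scale-letter π l) (matrix (scale π ω)))) (≈-trans (⊡-cong (letter l) (scale-one d ω)) (≈-≡ (sym (act-⊡ l (matrix ω)))))
    where
    entry : ∀ s → Q ∣ π * s - s
    entry s = by (s ⊛ d) (solve (π ∷ s ∷ []))
    letter : ∀ l → ⟨ scale-letter π l ⟩ ≈[ Q ] ⟨ l ⟩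
    letter (𝕩 s) = con (zero-∣ refl , entry s , zero-∣ refl , zero-∣ refl)
    letter (𝕪 s) = con (zero-∣ refl , zero-∣ refl , entry s , zero-∣ refl)

  scale-zero : ∀ {Q π} → Q ∣ π → ∀ ω → matrix (scale π ω) ≈[ Q ] Iℤ
  scale-zero d [] = ≈-refl
  scale-zero {Q} {π} d (l ∷ ω) = ≈-trans (≈-≡ (act-⊡ (scale-letter π l) (matrix (scale π ω)))) (≈-trans (⊡-cong (letter l) (scale-zero d ω)) (≈-≡ refl))
    where
    entry : ∀ s → Q ∣ π * s - 0ℤ
    entry s = by (s ⊛ d) (solve (π ∷ s ∷ []))
    letter : ∀ l → ⟨ scale-letter π l ⟩ ≈[ Q ] Iℤ
    letter (𝕩 s) = con (zero-∣ refl , entry s , zero-∣ refl , zero-∣ refl)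
    letter (𝕪 s) = con (zero-∣ refl , zero-∣ refl , entry s , zero-∣ refl)

  combine-solutions : ∀ {r s A} → Coprime r s → Solution (+ r) A → Solution (+ s) A → Solution (+ r * + s) A
  combine-solutions {r} {s} {A} co (solution X₁ Y₁ h₁) (solution X₂ Y₂ h₂) = from (bézout r s co)
    where
    from : ∃[ u ] ∃[ v ] u * + r + v * + s ≡ 1ℤ → Solution (+ r * + s) A
    from (u , v , e) = solution (mix X₁ X₂) (mix Y₁ Y₂) (≈-coprime co
        (≈-trans (⊡-cong (mod-r X₁ X₂) (mod-r Y₁ Y₂)) (≈-trans h₁ (⊡-cong ≈-refl (⊡-cong (≈-sym (mod-r Y₁ Y₂)) (≈-sym (mod-r X₁ X₂))))))
        (≈-trans (⊡-cong (mod-s X₁ X₂) (mod-s Y₁ Y₂)) (≈-trans h₂ (⊡-cong ≈-refl (⊡-cong (≈-sym (mod-s Y₁ Y₂)) (≈-sym (mod-s X₁ X₂)))))))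
      where
      mix : Word → Word → Word
      mix ω ω' = scale (v * + s) ω ++ scale (u * + r) ω'
      one-r : + r ∣ v * + s - 1ℤ
      one-r = divides (- u) (trans (cong (λ z → v * + s - z) (sym e)) (l u (+ r) (v * + s)))
        where
        l : ∀ u r z → z - (u * r + z) ≡ - u * r
        l u r z = solve (u ∷ r ∷ z ∷ [])
      one-s : + s ∣ u * + r - 1ℤ
      one-s = divides (- v) (trans (cong (λ z → u * + r - z) (sym e)) (l v (+ s) (u * + r)))
        where
        l : ∀ v s z → z - (z + v * s) ≡ - v * s
        l v s z = solve (v ∷ s ∷ z ∷ [])
      mod-r : ∀ ω ω' → matrix (mix ω ω') ≈[ + r ] matrix ω
      mod-r ω ω' = ≈-trans (≈-≡ (matrix-++ (scale (v * + s) ω) (scale (u * + r) ω'))) (≈-trans (⊡-cong (scale-one one-r ω) (scale-zero (divides u refl) ω')) (≈-≡ (⊡-identityʳ (matrix ω))))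
      mod-s : ∀ ω ω' → matrix (mix ω ω') ≈[ + s ] matrix ω'
      mod-s ω ω' = ≈-trans (≈-≡ (matrix-++ (scale (v * + s) ω) (scale (u * + r) ω'))) (≈-trans (⊡-cong (scale-zero (divides v refl) ω) (scale-one one-s ω')) (≈-≡ (⊡-identityˡ (matrix ω'))))

  -- If A = e₁₂(α₁) e₂₁(γ) e₁₂(-σ) and h = diag(2, 1/2), then A = [X, Y] for the conjugates by e₁₂(e) of X = h, Y = e₁₂(m) e₂₁(n).
  unit-corner-solution : ∀ Q α β γ δ i h G → Q ∣ + 2 * i - 1ℤ → Q ∣ + 3 * h - 1ℤ → Q ∣ G * γ - 1ℤ → Q ∣ α * δ - β * γ - 1ℤ → Solution Q (matℤ α β γ δ)
  unit-corner-solution Q α β γ δ i h G I H U Δ = build ((α - 1ℤ) * G) ((δ - 1ℤ) * G) {refl} {refl}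
    where
    build : ∀ α₁ δ₁ → {e₁ : α₁ ≡ (α - 1ℤ) * G} {e₂ : δ₁ ≡ (δ - 1ℤ) * G} → Solution Q (matℤ α β γ δ)
    build α₁ δ₁ {e₁} {e₂} = solve-with (α₁ - + 4 * ((α₁ + δ₁) * h)) ((α₁ + δ₁) * h) (- (+ 4 * γ * h))
        (by ((- (+ 4 * γ)) ⊛ H) (l₁ γ h)) (by ((- (δ - 1ℤ)) ⊛ U ⊕ (- (γ * (α₁ + δ₁))) ⊛ H) (l₂ α₁ δ₁ e₂))
        (by ((- (α - 1ℤ)) ⊛ U) (l₃ α₁ δ₁ e₁)) (by ((- β) ⊛ U ⊕ (- G) ⊛ Δ ⊕ (- (α * (α₁ + δ₁))) ⊛ H) (l₄ α₁ δ₁ e₁ e₂))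
      where
      l₁ : ∀ γ h → + 3 * - (+ 4 * γ * h) + + 4 * γ ≡ - (+ 4 * γ) * (+ 3 * h - 1ℤ)
      l₁ γ h = solve (γ ∷ h ∷ [])
      l₂ : ∀ α₁ δ₁ → δ₁ ≡ (δ - 1ℤ) * G → γ * ((α₁ + δ₁) * h + (α₁ - + 4 * ((α₁ + δ₁) * h))) + δ - 1ℤ ≡ - (δ - 1ℤ) * (G * γ - 1ℤ) + - (γ * (α₁ + δ₁)) * (+ 3 * h - 1ℤ)
      l₂ α₁ .((δ - 1ℤ) * G) refl = solve (α₁ ∷ δ ∷ γ ∷ G ∷ h ∷ [])
      l₃ : ∀ α₁ δ₁ → α₁ ≡ (α - 1ℤ) * G → α - 1ℤ - (α₁ - + 4 * ((α₁ + δ₁) * h) + + 4 * ((α₁ + δ₁) * h)) * γ ≡ - (α - 1ℤ) * (G * γ - 1ℤ)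
      l₃ .((α - 1ℤ) * G) δ₁ refl = solve (α ∷ δ₁ ∷ γ ∷ G ∷ h ∷ [])
      l₄ : ∀ α₁ δ₁ → α₁ ≡ (α - 1ℤ) * G → δ₁ ≡ (δ - 1ℤ) * G →
        β - (α₁ - + 4 * ((α₁ + δ₁) * h) + + 4 * ((α₁ + δ₁) * h)) + ((α₁ + δ₁) * h + (α₁ - + 4 * ((α₁ + δ₁) * h))) * α ≡ - β * (G * γ - 1ℤ) + - G * (α * δ - β * γ - 1ℤ) + - (α * (α₁ + δ₁)) * (+ 3 * h - 1ℤ)
      l₄ .((α - 1ℤ) * G) .((δ - 1ℤ) * G) refl refl = solve (α ∷ β ∷ γ ∷ δ ∷ G ∷ h ∷ [])
      solve-with : ∀ e m n → Q ∣ + 3 * n + + 4 * γ → Q ∣ γ * (m + e) + δ - 1ℤ → Q ∣ α - 1ℤ - (e + + 4 * m) * γ → Q ∣ β - (e + + 4 * m) + (m + e) * α → Solution Q (matℤ α β γ δ)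
      solve-with e m n r₃ r₂ rα rβ = from-matrices {Q} {matℤ α β γ δ} {matℤ (+ 2) (e * (i - + 2)) 0ℤ i} {matℤ (1ℤ + n * (m + e)) (m + e - e * (1ℤ + n * (m + e))) n (1ℤ - n * e)}
          (𝕩 e ∷ 𝕩 (+ 2) ∷ 𝕪 (- i) ∷ 𝕩 1ℤ ∷ 𝕪 1ℤ ∷ 𝕩 (- 1ℤ) ∷ 𝕩 (- e) ∷ []) (𝕩 e ∷ 𝕩 m ∷ 𝕪 n ∷ 𝕩 (- e) ∷ [])
          (con (by ((- (e + + 2)) ⊛ I) (solve (e ∷ i ∷ [])) , by (((e + 1ℤ) * (e + 1ℤ)) ⊛ I) (solve (e ∷ i ∷ [])) , by ((- 1ℤ) ⊛ I) (solve (e ∷ i ∷ [])) , by (e ⊛ I) (solve (e ∷ i ∷ []))))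
          (con (zero-∣ (solve (e ∷ m ∷ n ∷ [])) , zero-∣ (solve (e ∷ m ∷ n ∷ [])) , zero-∣ (solve (e ∷ m ∷ n ∷ [])) , zero-∣ (solve (e ∷ m ∷ n ∷ []))))
          (con (by ((- (i * e)) ⊛ r₃ ⊕ (+ 2 * e * (n + γ)) ⊛ I ⊕ (- (+ 2 * m)) ⊛ r₃ ⊕ (- + 2) ⊛ rα ⊕ (- (+ 2 * n)) ⊛ rβ) (solve (e ∷ m ∷ n ∷ i ∷ α ∷ β ∷ γ ∷ []))
            , by ((- (+ 2 * m)) ⊛ I ⊕ (e * e * i + + 2 * e * m) ⊛ r₃ ⊕ (- (+ 2 * e * e * (n + γ))) ⊛ I ⊕ (+ 2 * e) ⊛ rα ⊕ (- (i - + 2 * n * e)) ⊛ rβ) (solve (e ∷ m ∷ n ∷ i ∷ α ∷ β ∷ γ ∷ []))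
            , by ((- i) ⊛ r₃ ⊕ (+ 2 * (n + γ)) ⊛ I ⊕ (- (+ 2 * n)) ⊛ r₂) (solve (e ∷ m ∷ n ∷ i ∷ γ ∷ δ ∷ []))
            , by ((e * i) ⊛ r₃ ⊕ (- (+ 2 * e * (n + γ))) ⊛ I ⊕ (+ 2 * n * e - i) ⊛ r₂) (solve (e ∷ m ∷ n ∷ i ∷ γ ∷ δ ∷ []))))

  -- e₂₁(3) A e₂₁(-3) for ν = 4 + 27 j.
  Aⱼ : ℤ → Matℤ
  Aⱼ j = let ν = + 4 + + 27 * j in matℤ (1ℤ + + 20 * (ν * ν) - + 10 * ν) (+ 12 + + 90 * j) (+ 60 * (ν * ν)) (1ℤ + + 10 * ν)

  -- A is conjugate to e₂₁(x₀ - 8s) diag(1/9, 9) e₁₂(x₀) = [w e₁₂(-s), e₁₂(-x₀) diag(3, 1/3)], where w = e₁₂(1) e₂₁(-1) e₁₂(1).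
  two-solution : ∀ Q j i₃ w → Q ∣ + 3 * i₃ - 1ℤ → Q ∣ w * (+ 54 + + 405 * j) - 1ℤ → Solution Q (Aⱼ j)
  two-solution Q j i₃ w H R = conjugate-solution k {Q} {Aⱼ j} {T}
      (≈-trans (≈-≡ (lower-conjugate k (1ℤ + + 20 * (ν * ν) - + 10 * ν) (+ 12 + + 90 * j) (+ 60 * (ν * ν)) (1ℤ + + 10 * ν)))
        (con (entry-a j i₃ w H R , entry-b j i₃ H , entry-c j i₃ w H R , entry-d j i₃ w H R)))
      (core (+ 30 * ν - + 12) s)
    where
    ν k s : ℤ
    ν = + 4 + + 27 * j
    k = (+ 90 * (ν * ν) - + 45 * ν + + 4) * w
    s = (+ 45 * (ν * ν) - + 45 * ν + + 13) * w
    T′ : ℤ → ℤ → Matℤ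
    T′ x₀ s = matℤ (i₃ * i₃) (i₃ * i₃ * x₀) ((x₀ - + 8 * s) * (i₃ * i₃)) ((x₀ - + 8 * s) * (i₃ * i₃) * x₀ + + 9)
    T = T′ (+ 30 * ν - + 12) s
    entry-a : ∀ j i₃ w → Q ∣ + 3 * i₃ - 1ℤ → Q ∣ w * (+ 54 + + 405 * j) - 1ℤ → let ν = + 4 + + 27 * j in
      Q ∣ 1ℤ + + 20 * (ν * ν) - + 10 * ν - (+ 90 * (ν * ν) - + 45 * ν + + 4) * w * (+ 12 + + 90 * j) - i₃ * i₃
    entry-a j i₃ w H R = by ((- (i₃ * i₃ * (+ 8 + + 180 * ((+ 4 + + 27 * j) * (+ 4 + + 27 * j)) - + 90 * (+ 4 + + 27 * j)))) ⊛ R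
      ⊕ (- ((1ℤ + + 20 * ((+ 4 + + 27 * j) * (+ 4 + + 27 * j)) - + 10 * (+ 4 + + 27 * j) - (+ 90 * ((+ 4 + + 27 * j) * (+ 4 + + 27 * j)) - + 45 * (+ 4 + + 27 * j) + + 4) * w * (+ 12 + + 90 * j)) * (+ 3 * i₃ + 1ℤ))) ⊛ H) (solve (j ∷ i₃ ∷ w ∷ []))
    entry-b : ∀ j i₃ → Q ∣ + 3 * i₃ - 1ℤ → Q ∣ + 12 + + 90 * j - i₃ * i₃ * (+ 30 * (+ 4 + + 27 * j) - + 12)
    entry-b j i₃ H = by ((- ((+ 12 + + 90 * j) * (+ 3 * i₃ + 1ℤ))) ⊛ H) (solve (j ∷ i₃ ∷ []))
    entry-c : ∀ j i₃ w → Q ∣ + 3 * i₃ - 1ℤ → Q ∣ w * (+ 54 + + 405 * j) - 1ℤ → let ν = + 4 + + 27 * j ; N = + 90 * (ν * ν) - + 45 * ν + + 4 in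
      Q ∣ + 60 * (ν * ν) + N * w * (1ℤ + + 20 * (ν * ν) - + 10 * ν - (1ℤ + + 10 * ν)) - N * w * (N * w) * (+ 12 + + 90 * j) - (+ 30 * ν - + 12 - + 8 * ((+ 45 * (ν * ν) - + 45 * ν + + 13) * w)) * (i₃ * i₃)
    entry-c j i₃ w H R = let ν = + 4 + + 27 * j ; N = + 90 * (ν * ν) - + 45 * ν + + 4 in by ((- (i₃ * i₃ * (+ 9 * (+ 60 * (ν * ν)) - (+ 30 * ν - + 12) + + 2 * (N * N) * w))) ⊛ R
      ⊕ (- ((+ 60 * (ν * ν) + N * w * (1ℤ + + 20 * (ν * ν) - + 10 * ν - (1ℤ + + 10 * ν)) - N * w * (N * w) * (+ 12 + + 90 * j)) * (+ 3 * i₃ + 1ℤ))) ⊛ H) (solve (j ∷ i₃ ∷ w ∷ []))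
    entry-d : ∀ j i₃ w → Q ∣ + 3 * i₃ - 1ℤ → Q ∣ w * (+ 54 + + 405 * j) - 1ℤ → let ν = + 4 + + 27 * j ; N = + 90 * (ν * ν) - + 45 * ν + + 4 in
      Q ∣ 1ℤ + + 10 * ν + N * w * (+ 12 + + 90 * j) - ((+ 30 * ν - + 12 - + 8 * ((+ 45 * (ν * ν) - + 45 * ν + + 13) * w)) * (i₃ * i₃) * (+ 30 * ν - + 12) + + 9)
    entry-d j i₃ w H R = let ν = + 4 + + 27 * j ; N = + 90 * (ν * ν) - + 45 * ν + + 4 in by ((i₃ * i₃ * (+ 2 * N + + 16 * (+ 45 * (ν * ν) - + 45 * ν + + 13))) ⊛ R
      ⊕ (- ((1ℤ + + 10 * ν + N * w * (+ 12 + + 90 * j) - + 9) * (+ 3 * i₃ + 1ℤ))) ⊛ H) (solve (j ∷ i₃ ∷ w ∷ []))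
    core : ∀ x₀ s → Solution Q (T′ x₀ s)
    core x₀ s = from-matrices {Q} {T′ x₀ s} {matℤ 0ℤ 1ℤ (- 1ℤ) s} {matℤ (+ 3) (- (x₀ * i₃)) 0ℤ i₃}
      (𝕩 1ℤ ∷ 𝕪 (- 1ℤ) ∷ 𝕩 1ℤ ∷ 𝕩 (- s) ∷ []) (𝕩 (- x₀) ∷ 𝕩 (+ 3) ∷ 𝕪 (- i₃) ∷ 𝕩 (+ 2) ∷ 𝕪 1ℤ ∷ 𝕩 (- 1ℤ) ∷ [])
      (con (zero-∣ (solve (s ∷ [])) , zero-∣ (solve (s ∷ [])) , zero-∣ (solve (s ∷ [])) , zero-∣ (solve (s ∷ []))))
      (con (by ((x₀ - + 3) ⊛ H) (solve (x₀ ∷ i₃ ∷ [])) , by (1ℤ ⊛ H) (solve (x₀ ∷ i₃ ∷ [])) , by ((- 1ℤ) ⊛ H) (solve (x₀ ∷ i₃ ∷ [])) , zero-∣ (solve (x₀ ∷ i₃ ∷ []))))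
      (con (zero-∣ (solve (x₀ ∷ i₃ ∷ s ∷ [])) , by ((- i₃) ⊛ H) (solve (x₀ ∷ i₃ ∷ s ∷ [])) , by (+ 3 ⊛ H) (solve (x₀ ∷ i₃ ∷ s ∷ [])) , by ((- (i₃ * (x₀ - + 8 * s))) ⊛ H) (solve (x₀ ∷ i₃ ∷ s ∷ []))))

  module Triadic where
    K F aA bA aC bC C₁₁ C₂₁ C₂₂ : ℤ → ℤ
    K j = + 36 + + 480 * j + + 1620 * (j * j)
    F a = + 2 * a - a * a - + 12 * (a * a * a) - + 9 * (a * a * a * a)
    aA j = + 94 + + 1350 * j + + 4860 * (j * j)
    bA j = + 4 + + 30 * j
    aC a = - + 2 - + 11 * a + + 36 * (a * a * a) + + 27 * (a * a * a * a)
    bC a = (1ℤ + + 3 * a) * (+ 2 + + 5 * a + + 3 * (a * a))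
    C₁₁ a = - 1ℤ + + 3 * aC a
    C₂₁ a = - + 6 - + 12 * a + + 27 * (a * a) + + 27 * (a * a * a)
    C₂₂ a = + 5 + + 15 * a + + 9 * (a * a)

    -- C is the commutator of X = [3, -1; 1, 0] and Y = [1+3a, 1; ·, 2-3a], twisted by diag(1, τ);
    -- its trace agrees with that of A exactly when F a + K j = 0.
    C : ℤ → ℤ → ℤ → Matℤ
    C a τ τ' = matℤ (C₁₁ a) (τ * (+ 3 * bC a)) (τ' * C₂₁ a) (C₂₂ a)

    core : ∀ Q a τ τ' → Q ∣ τ * τ' - 1ℤ → Solution Q (C a τ τ')
    core Q a τ τ' ρ = from-matrices {Q} {C a τ τ'} {matℤ (+ 3) (- τ) τ' 0ℤ} {matℤ (1ℤ + + 3 * a) τ (τ' * (1ℤ + + 3 * a - + 9 * (a * a))) (+ 2 - + 3 * a)}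
      (𝕩 (+ 2 * τ) ∷ 𝕪 τ' ∷ 𝕩 (- τ) ∷ []) (𝕪 (τ' * (1ℤ - + 3 * a)) ∷ 𝕩 τ ∷ 𝕪 (τ' * (+ 3 * a)) ∷ [])
      (con (by (+ 2 ⊛ ρ) (solve (τ ∷ τ' ∷ [])) , by ((- (+ 2 * τ)) ⊛ ρ) (solve (τ ∷ τ' ∷ [])) , zero-∣ (solve (τ ∷ τ' ∷ [])) , by ((- 1ℤ) ⊛ ρ) (solve (τ ∷ τ' ∷ []))))
      (con (by ((+ 3 * a) ⊛ ρ) (solve (a ∷ τ ∷ τ' ∷ [])) , zero-∣ (solve (a ∷ τ ∷ τ' ∷ [])) , by ((τ' * (1ℤ - + 3 * a) * (+ 3 * a)) ⊛ ρ) (solve (a ∷ τ ∷ τ' ∷ [])) , by ((1ℤ - + 3 * a) ⊛ ρ) (solve (a ∷ τ ∷ τ' ∷ []))))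
      (con (ra a τ τ' ρ , rb a τ τ' ρ , rc a τ τ' ρ , zero-∣ (rd a τ τ')))
      where
      ra : ∀ a τ τ' → Q ∣ τ * τ' - 1ℤ → let r = 1ℤ + + 3 * a - + 9 * (a * a) ; c = - 1ℤ + + 3 * (- + 2 - + 11 * a + + 36 * (a * a * a) + + 27 * (a * a * a * a)) ; b = τ * (+ 3 * ((1ℤ + + 3 * a) * (+ 2 + + 5 * a + + 3 * (a * a)))) in
        Q ∣ + 3 * (1ℤ + + 3 * a) + - τ * (τ' * r) - (c * ((1ℤ + + 3 * a) * + 3 + τ * τ') + b * (τ' * r * + 3 + (+ 2 - + 3 * a) * τ'))
      ra a τ τ' ρ = let r = 1ℤ + + 3 * a - + 9 * (a * a) ; c = - 1ℤ + + 3 * (- + 2 - + 11 * a + + 36 * (a * a * a) + + 27 * (a * a * a * a)) ; b = + 3 * ((1ℤ + + 3 * a) * (+ 2 + + 5 * a + + 3 * (a * a))) in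
        by ((- r - c - b * (+ 3 * r + (+ 2 - + 3 * a))) ⊛ ρ) (solve (a ∷ τ ∷ τ' ∷ []))
      rb : ∀ a τ τ' → Q ∣ τ * τ' - 1ℤ → let r = 1ℤ + + 3 * a - + 9 * (a * a) ; c = - 1ℤ + + 3 * (- + 2 - + 11 * a + + 36 * (a * a * a) + + 27 * (a * a * a * a)) ; b = τ * (+ 3 * ((1ℤ + + 3 * a) * (+ 2 + + 5 * a + + 3 * (a * a)))) in
        Q ∣ + 3 * τ + - τ * (+ 2 - + 3 * a) - (c * ((1ℤ + + 3 * a) * - τ + τ * 0ℤ) + b * (τ' * r * - τ + (+ 2 - + 3 * a) * 0ℤ))
      rb a τ τ' ρ = let r = 1ℤ + + 3 * a - + 9 * (a * a) ; b = + 3 * ((1ℤ + + 3 * a) * (+ 2 + + 5 * a + + 3 * (a * a))) in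
        by ((τ * b * r) ⊛ ρ) (solve (a ∷ τ ∷ τ' ∷ []))
      rc : ∀ a τ τ' → Q ∣ τ * τ' - 1ℤ → let r = 1ℤ + + 3 * a - + 9 * (a * a) ; c = τ' * (- + 6 - + 12 * a + + 27 * (a * a) + + 27 * (a * a * a)) ; d = + 5 + + 15 * a + + 9 * (a * a) in
        Q ∣ τ' * (1ℤ + + 3 * a) + 0ℤ * (τ' * r) - (c * ((1ℤ + + 3 * a) * + 3 + τ * τ') + d * (τ' * r * + 3 + (+ 2 - + 3 * a) * τ'))
      rc a τ τ' ρ = by ((- (τ' * (- + 6 - + 12 * a + + 27 * (a * a) + + 27 * (a * a * a)))) ⊛ ρ) (solve (a ∷ τ ∷ τ' ∷ []))
      rd : ∀ a τ τ' → let r = 1ℤ + + 3 * a - + 9 * (a * a) ; c = τ' * (- + 6 - + 12 * a + + 27 * (a * a) + + 27 * (a * a * a)) ; d = + 5 + + 15 * a + + 9 * (a * a) in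
        τ' * τ + 0ℤ * (+ 2 - + 3 * a) - (c * ((1ℤ + + 3 * a) * - τ + τ * 0ℤ) + d * (τ' * r * - τ + (+ 2 - + 3 * a) * 0ℤ)) ≡ 0ℤ
      rd a τ τ' = solve (a ∷ τ ∷ τ' ∷ [])

    -- From the equality of determinants, using that the upper right entries are 3 bA and 3 bC.
    corner : ∀ j a k → let ν = + 4 + + 27 * j ; c₁ = - 1ℤ + + 3 * (- + 2 - + 11 * a + + 36 * (a * a * a) + + 27 * (a * a * a * a)) ; c₂ = + 5 + + 15 * a + + 9 * (a * a) ; f = + 2 * a - a * a - + 12 * (a * a * a) - + 9 * (a * a * a * a) + (+ 36 + + 480 * j + + 1620 * (j * j)) ; ε = + 94 + + 1350 * j + + 4860 * (j * j) - k * (+ 4 + + 30 * j) - (- + 2 - + 11 * a + + 36 * (a * a * a) + + 27 * (a * a * a * a)) in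
      (+ 4 + + 30 * j) * (+ 60 * (ν * ν) + k * (1ℤ + + 20 * (ν * ν) - + 10 * ν - (1ℤ + + 10 * ν)) - k * k * (+ 12 + + 90 * j)) - (1ℤ + + 3 * a) * (+ 2 + + 5 * a + + 3 * (a * a)) * (- + 6 - + 12 * a + + 27 * (a * a) + + 27 * (a * a * a))
        ≡ (+ 3 * c₁ + + 9 * ε) * f + (c₂ - c₁ - + 3 * ε) * ε
    corner j a k = solve (j ∷ a ∷ k ∷ [])

    three-solution : ∀ Q j a A' C' → Q ∣ bA j * A' - 1ℤ → Q ∣ bC a * C' - 1ℤ → Q ∣ F a + K j → Solution Q (Aⱼ j)
    three-solution Q j a A' C' HA HC HF = conjugate-solution k {Q} {Aⱼ j} {C a (bA j * C') (bC a * A')}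
        (≈-trans (≈-≡ (lower-conjugate k (1ℤ + + 20 * (ν * ν) - + 10 * ν) (+ 12 + + 90 * j) (+ 60 * (ν * ν)) (1ℤ + + 10 * ν))) (con (entry-a , entry-b , entry-c , entry-d)))
        (core Q a (bA j * C') (bC a * A') (by ((bA j * A') ⊛ HC ⊕ HA) (l (bA j) A' (bC a) C')))
      where
      ν k : ℤ
      ν = + 4 + + 27 * j
      k = (aA j - aC a) * A'
      l : ∀ b A c C → b * C * (c * A) - 1ℤ ≡ b * A * (c * C - 1ℤ) + (b * A - 1ℤ)
      l b A c C = solve (b ∷ A ∷ c ∷ C ∷ [])
      ε : Q ∣ aA j - k * bA j - aC a
      ε = by ((- (aA j - aC a)) ⊛ HA) (l₁ (aA j) (aC a) A' (bA j))
        where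
        l₁ : ∀ p r A b → p - (p - r) * A * b - r ≡ - (p - r) * (b * A - 1ℤ)
        l₁ p r A b = solve (p ∷ r ∷ A ∷ b ∷ [])
      entry-a : Q ∣ 1ℤ + + 20 * (ν * ν) - + 10 * ν - k * (+ 12 + + 90 * j) - C₁₁ a
      entry-a = by (+ 3 ⊛ ε) (l₁ j k (aC a))
        where
        l₁ : ∀ j k c → let ν = + 4 + + 27 * j in 1ℤ + + 20 * (ν * ν) - + 10 * ν - k * (+ 12 + + 90 * j) - (- 1ℤ + + 3 * c) ≡ + 3 * (+ 94 + + 1350 * j + + 4860 * (j * j) - k * (+ 4 + + 30 * j) - c)
        l₁ j k c = solve (j ∷ k ∷ c ∷ [])
      entry-b : Q ∣ + 12 + + 90 * j - bA j * C' * (+ 3 * bC a)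
      entry-b = by ((- (+ 3 * bA j)) ⊛ HC) (l₁ j C' (bC a))
        where
        l₁ : ∀ j C b → + 12 + + 90 * j - (+ 4 + + 30 * j) * C * (+ 3 * b) ≡ - (+ 3 * (+ 4 + + 30 * j)) * (b * C - 1ℤ)
        l₁ j C b = solve (j ∷ C ∷ b ∷ [])
      entry-d : Q ∣ 1ℤ + + 10 * ν + k * (+ 12 + + 90 * j) - C₂₂ a
      entry-d = by (+ 9 ⊛ HF ⊕ - + 3 ⊛ ε) (l₁ j k a)
        where
        l₁ : ∀ j k a → let ν = + 4 + + 27 * j in 1ℤ + + 10 * ν + k * (+ 12 + + 90 * j) - (+ 5 + + 15 * a + + 9 * (a * a))
          ≡ + 9 * (+ 2 * a - a * a - + 12 * (a * a * a) - + 9 * (a * a * a * a) + (+ 36 + + 480 * j + + 1620 * (j * j))) + - + 3 * (+ 94 + + 1350 * j + + 4860 * (j * j) - k * (+ 4 + + 30 * j) - (- + 2 - + 11 * a + + 36 * (a * a * a) + + 27 * (a * a * a * a)))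
        l₁ j k a = solve (j ∷ k ∷ a ∷ [])
      M₂₁ : ℤ
      M₂₁ = + 60 * (ν * ν) + k * (1ℤ + + 20 * (ν * ν) - + 10 * ν - (1ℤ + + 10 * ν)) - k * k * (+ 12 + + 90 * j)
      entry-c : Q ∣ M₂₁ - bC a * A' * C₂₁ a
      entry-c = by (A' ⊛ by ((+ 3 * C₁₁ a + + 9 * (aA j - k * bA j - aC a)) ⊛ HF ⊕ (C₂₂ a - C₁₁ a - + 3 * (aA j - k * bA j - aC a)) ⊛ ε) (corner j a k) ⊕ (- M₂₁) ⊛ HA) (l₁ M₂₁ (bA j) A' (bC a) (C₂₁ a))
        where
        l₁ : ∀ M b A c C → M - c * A * C ≡ A * (b * M - c * C) + - M * (b * A - 1ℤ)
        l₁ M b A c C = solve (M ∷ b ∷ A ∷ c ∷ C ∷ [])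

    hensel : ∀ j n → ∃[ a ] + 3 ∣ a × (+ 3) ^ suc n ∣ F a + K j
    hensel j zero = 0ℤ , divides 0ℤ refl , divides (+ 12 + + 160 * j + + 540 * (j * j)) (l j)
      where
      l : ∀ j → 0ℤ + (+ 36 + + 480 * j + + 1620 * (j * j)) ≡ (+ 12 + + 160 * j + + 540 * (j * j)) * + 3
      l j = solve (j ∷ [])
    hensel j (suc n) = from (hensel j n)
      where
      from : ∃[ a ] + 3 ∣ a × (+ 3) ^ suc n ∣ F a + K j → ∃[ a ] + 3 ∣ a × (+ 3) ^ suc (suc n) ∣ F a + K j
      from (a , d , D) = a + f , (d ⊕ 3∣f) , product D (by (1ℤ ⊛ divides {+ 3} {+ 3} 1ℤ refl ⊕ (- + 2) ⊛ d ⊕ (- 1ℤ) ⊛ 3∣f ⊕ (- (+ 4 * R)) ⊛ divides {+ 3} {+ 3} 1ℤ refl ⊕ (- (+ 3 * S)) ⊛ divides {+ 3} {+ 3} 1ℤ refl) (l₁ a f)) (l a (K j))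
        where
        f R S : ℤ
        f = F a + K j
        R = + 3 * (a * a) + + 3 * (a * f) + f * f
        S = + 4 * (a * a * a) + + 6 * (a * a * f) + + 4 * (a * f * f) + f * f * f
        3∣f : + 3 ∣ f
        3∣f = ∣-trans (divides ((+ 3) ^ n) (ℤP.*-comm (+ 3) ((+ 3) ^ n))) D
        l₁ : ∀ a f → let R = + 3 * (a * a) + + 3 * (a * f) + f * f ; S = + 4 * (a * a * a) + + 6 * (a * a * f) + + 4 * (a * f * f) + f * f * f in
          + 3 - (+ 2 * a + f + + 12 * R + + 9 * S) ≡ 1ℤ * + 3 + - + 2 * a + - 1ℤ * f + - (+ 4 * R) * + 3 + - (+ 3 * S) * + 3
        l₁ a f = solve (a ∷ f ∷ [])
        l₂ : ∀ a f → let R = + 3 * (a * a) + + 3 * (a * f) + f * f ; S = + 4 * (a * a * a) + + 6 * (a * a * f) + + 4 * (a * f * f) + f * f * f in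
          + 2 * (a + f) - (a + f) * (a + f) - + 12 * ((a + f) * (a + f) * (a + f)) - + 9 * ((a + f) * (a + f) * (a + f) * (a + f))
            ≡ + 2 * a - a * a - + 12 * (a * a * a) - + 9 * (a * a * a * a) + f * (+ 3 - (+ 2 * a + f + + 12 * R + + 9 * S)) - f
        l₂ a f = solve (a ∷ f ∷ [])
        l₃ : ∀ p z K → p + z - (p + K) + K ≡ z
        l₃ p z K = solve (p ∷ z ∷ K ∷ [])
        l : ∀ a K → let f = F a + K ; R = + 3 * (a * a) + + 3 * (a * f) + f * f ; S = + 4 * (a * a * a) + + 6 * (a * a * f) + + 4 * (a * f * f) + f * f * f in
          F (a + f) + K ≡ f * (+ 3 - (+ 2 * a + f + + 12 * R + + 9 * S))
        l a K = trans (cong (_+ K) (l₂ a (F a + K))) (l₃ (F a) _ K)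
        product : ∀ {u v w} → (+ 3) ^ suc n ∣ u → + 3 ∣ v → w ≡ u * v → (+ 3) ^ suc (suc n) ∣ w
        product (divides g refl) (divides h refl) refl = divides (g * h) (l₄ g h ((+ 3) ^ suc n))
          where
          l₄ : ∀ g h P → g * P * (h * + 3) ≡ g * h * (+ 3 * P)
          l₄ g h P = solve (g ∷ h ∷ P ∷ [])

module LocalSolutions where
  open import Defs hiding (a; b; c; d)
  open ElementaryRelations using (_⊛_; _⊕_; by)
  open NormalForms
  open PrimePowers
  open PrimitiveRoots
  open Levels using (prime>1; prime-divides-prime; invertible)
  open CongruenceKernel using (pos-^)
  open RationalMatrices
  open FiniteQuotients
  open Commutators
  open import Data.List using ([]; _∷_; _++_)
  open import Data.Nat as ℕ using (ℕ; zero; suc; z≤n; s≤s; _<_)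
  import Data.Nat.Properties as ℕP
  import Data.Nat.Divisibility as ℕD
  open import Data.Nat.Induction using (<-rec)
  open import Data.Nat.Primality using (Prime; prime[2]; prime?; euclidsLemma)
  import Data.Nat.Coprimality as Cop
  open import Data.Integer as ℤ using (ℤ; +_; _+_; _*_; _-_; -_; _^_; 0ℤ; 1ℤ)
  import Data.Integer.Properties as ℤP
  open import Data.Integer.Divisibility.Signed using (_∣_; divides; ∣⇒∣ᵤ; ∣ᵤ⇒∣)
  open import Data.Integer.Tactic.RingSolver using (solve)
  import Data.Rational as ℚ
  import Data.Rational.Properties as ℚP
  open import Data.Product using (_×_; _,_; ∃-syntax)
  open import Data.Sum using (_⊎_; inj₁; inj₂; [_,_]′)
  open import Data.Empty using (⊥; ⊥-elim)
  open import Relation.Nullary using (¬_; yes; no)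
  open import Relation.Nullary.Decidable using (toWitness)
  open import Relation.Binary.PropositionalEquality using (_≡_; refl; sym; trans; cong; cong₂; subst)

  prime[3] : Prime 3
  prime[3] = toWitness {a? = prime? 3} _

  prime[5] : Prime 5
  prime[5] = toWitness {a? = prime? 5} _

  prime-to-part : ∀ c r → 0 < r → ∃[ r₁ ] (∀ p → Prime p → p ℕD.∣ r₁ → ¬ p ℕD.∣ c) × (∀ p → Prime p → p ℕD.∣ r → ¬ p ℕD.∣ r₁ → p ℕD.∣ c)
  prime-to-part c = <-rec _ go
    where
    Goal : ℕ → Set
    Goal r = ∃[ r₁ ] (∀ p → Prime p → p ℕD.∣ r₁ → ¬ p ℕD.∣ c) × (∀ p → Prime p → p ℕD.∣ r → ¬ p ℕD.∣ r₁ → p ℕD.∣ c)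
    go : ∀ r → (∀ {r'} → r' < r → 0 < r' → Goal r') → 0 < r → Goal r
    go 1 rec _ = 1 , (λ p pr d → ⊥-elim (ℕP.<⇒≢ (prime>1 pr) (sym (ℕD.∣1⇒≡1 d)))) , λ p pr d → ⊥-elim (ℕP.<⇒≢ (prime>1 pr) (sym (ℕD.∣1⇒≡1 d)))
    go r@(suc (suc _)) rec _ = from (prime-divisor r (s≤s (s≤s z≤n)))
      where
      from : ∃[ P ] Prime P × P ℕD.∣ r → Goal r
      from (P , pP , ℕD.divides zero ())
      from (P , pP , ℕD.divides r'@(suc _) e) = from′ (rec (subst (r' <_) (sym e) (ℕP.m<m*n r' P (prime>1 pP))) (s≤s z≤n))
        where
        split : ∀ p → Prime p → p ℕD.∣ r → p ℕD.∣ r' ⊎ p ≡ P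
        split p pr d = [ inj₁ , (λ t → inj₂ (prime-divides-prime pr pP t)) ]′ (euclidsLemma r' P pr (subst (p ℕD.∣_) e d))
        from′ : Goal r' → Goal r
        from′ (r₁ , h₁ , h₂) with P ℕD.∣? c
        ... | yes P∣c = r₁ , h₁ , λ p pr d n → [ (λ t → h₂ p pr t n) , (λ { refl → P∣c }) ]′ (split p pr d)
        ... | no P∤c = P ℕ.* r₁ , (λ p pr d → [ (λ t → subst (λ z → ¬ z ℕD.∣ c) (sym (prime-divides-prime pr pP t)) P∤c) , h₁ p pr ]′ (euclidsLemma P r₁ pr d))
            , λ p pr d n → [ (λ t → h₂ p pr t (λ u → n (ℕD.∣n⇒∣m*n P u))) , (λ { refl → ⊥-elim (n (ℕD.m∣m*n r₁)) }) ]′ (split p pr d)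

  generic-solution : ∀ j r → 0 < r → ¬ 2 ℕD.∣ r → ¬ 3 ℕD.∣ r → Solution (+ r) (Aⱼ j)
  generic-solution j r 0<r 2∤r 3∤r = from (prime-to-part (5 ℕ.* ℤ.∣ ν ∣) r 0<r) (invertible (+ 2) r 0<r (λ p pr d t → small p pr d prime[2] 2∤r t)) (invertible (+ 3) r 0<r (λ p pr d t → small p pr d prime[3] 3∤r t))
    where
    ν : ℤ
    ν = + 4 + + 27 * j
    small : ∀ p → Prime p → p ℕD.∣ r → ∀ {s} → Prime s → ¬ s ℕD.∣ r → ¬ + p ∣ + s
    small p pr d ps s∤r t = s∤r (subst (ℕD._∣ r) (prime-divides-prime pr ps (∣⇒∣ᵤ t)) d)
    corner : ℤ → ℤ
    corner s = + 60 * (ν * ν) + s * (1ℤ + + 20 * (ν * ν) - + 10 * ν - (1ℤ + + 10 * ν)) - s * s * (+ 12 + + 90 * j)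
    from : ∃[ r₁ ] (∀ p → Prime p → p ℕD.∣ r₁ → ¬ p ℕD.∣ 5 ℕ.* ℤ.∣ ν ∣) × (∀ p → Prime p → p ℕD.∣ r → ¬ p ℕD.∣ r₁ → p ℕD.∣ 5 ℕ.* ℤ.∣ ν ∣) →
      ∃[ i ] + r ∣ + 2 * i - 1ℤ → ∃[ h ] + r ∣ + 3 * h - 1ℤ → Solution (+ r) (Aⱼ j)
    from (r₁ , h₁ , h₂) (i , I) (h , H) = finish (invertible (corner (+ r₁)) r 0<r unit)
      where
      s : ℤ
      s = + r₁
      unit : ∀ p → Prime p → p ℕD.∣ r → ¬ + p ∣ corner s
      unit p pr p∣r d with p ℕD.∣? r₁
      ... | yes p∣r₁ = [ (λ t → [ (λ t → [ two , (λ t → [ two , three ]′ (E.euclid (+ 2) (+ 3) t)) ]′ (E.euclid (+ 2) (+ 6) t)) , (λ t → h₁ p pr p∣r₁ (ℕD.∣m⇒∣m*n ℤ.∣ ν ∣ (∣⇒∣ᵤ t))) ]′ (E.euclid (+ 12) (+ 5) t))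
            , (λ t → h₁ p pr p∣r₁ (ℕD.∣n⇒∣m*n 5 (∣⇒∣ᵤ ([ (λ z → z) , (λ z → z) ]′ (E.euclid ν ν t))))) ]′
            (E.euclid (+ 60) (ν * ν) (by (d ⊕ (- (1ℤ + + 20 * (ν * ν) - + 10 * ν - (1ℤ + + 10 * ν)) + s * (+ 12 + + 90 * j)) ⊛ ∣ᵤ⇒∣ {+ p} {s} p∣r₁) (l ν s j)))
        where
        module E = PrimeModulus pr
        two : + p ∣ + 2 → ⊥
        two = small p pr p∣r prime[2] 2∤r
        three : + p ∣ + 3 → ⊥
        three = small p pr p∣r prime[3] 3∤r
        l : ∀ ν s j → + 60 * (ν * ν) ≡ + 60 * (ν * ν) + s * (1ℤ + + 20 * (ν * ν) - + 10 * ν - (1ℤ + + 10 * ν)) - s * s * (+ 12 + + 90 * j)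
          + (- (1ℤ + + 20 * (ν * ν) - + 10 * ν - (1ℤ + + 10 * ν)) + s * (+ 12 + + 90 * j)) * s
        l ν s j = solve (ν ∷ s ∷ j ∷ [])
      ... | no p∤r₁ = [ (λ t → p∤s ([ (λ z → z) , (λ z → z) ]′ (E.euclid s s t))) , four ]′ (E.euclid (s * s) (+ 12 + + 90 * j) (by ((- 1ℤ) ⊛ d ⊕ (+ 12 * ν + s * (+ 4 * ν - + 4)) ⊛ 5ν) (l ν s j)))
        where
        module E = PrimeModulus pr
        p∤s : ¬ + p ∣ s
        p∤s t = p∤r₁ (∣⇒∣ᵤ t)
        5ν : + p ∣ + 5 * ν
        5ν = ∣ᵤ⇒∣ (subst (p ℕD.∣_) (sym (ℤP.abs-* (+ 5) ν)) (h₂ p pr p∣r p∤r₁))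
        l : ∀ ν s j → s * s * (+ 12 + + 90 * j) ≡ - 1ℤ * (+ 60 * (ν * ν) + s * (1ℤ + + 20 * (ν * ν) - + 10 * ν - (1ℤ + + 10 * ν)) - s * s * (+ 12 + + 90 * j)) + (+ 12 * ν + s * (+ 4 * ν - + 4)) * (+ 5 * ν)
        l ν s j = solve (ν ∷ s ∷ j ∷ [])
        four : + p ∣ + 12 + + 90 * j → ⊥
        four t = [ small p pr p∣r prime[2] 2∤r , small p pr p∣r prime[2] 2∤r ]′ (E.euclid (+ 2) (+ 2) (by (+ 2 ⊛ 5ν ⊕ (- + 3) ⊛ t) (l′ j)))
          where
          l′ : ∀ j → + 2 * + 2 ≡ + 2 * (+ 5 * (+ 4 + + 27 * j)) + - + 3 * (+ 12 + + 90 * j)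
          l′ j = solve (j ∷ [])
      finish : ∃[ G ] + r ∣ corner s * G - 1ℤ → Solution (+ r) (Aⱼ j)
      finish (G , U) = conjugate-solution s (≈-≡ (lower-conjugate s (1ℤ + + 20 * (ν * ν) - + 10 * ν) (+ 12 + + 90 * j) (+ 60 * (ν * ν)) (1ℤ + + 10 * ν)))
        (unit-corner-solution (+ r) (1ℤ + + 20 * (ν * ν) - + 10 * ν - s * (+ 12 + + 90 * j)) (+ 12 + + 90 * j) (corner s) (1ℤ + + 10 * ν + s * (+ 12 + + 90 * j)) i h G I H
          (by U (cong (_- 1ℤ) (ℤP.*-comm G (corner s)))) (zero-∣ (l j s)))
        where
        l : ∀ j s → let ν = + 4 + + 27 * j in (1ℤ + + 20 * (ν * ν) - + 10 * ν - s * (+ 12 + + 90 * j)) * (1ℤ + + 10 * ν + s * (+ 12 + + 90 * j)) - (+ 12 + + 90 * j) * (+ 60 * (ν * ν) + s * (1ℤ + + 20 * (ν * ν) - + 10 * ν - (1ℤ + + 10 * ν)) - s * s * (+ 12 + + 90 * j)) - 1ℤ ≡ 0ℤ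
        l j s = solve (j ∷ s ∷ [])

  solution-^ : ∀ {p A} k → Solution ((+ p) ^ k) A → Solution (+ (p ℕ.^ k)) A
  solution-^ {p} {A} k = subst (λ Q → Solution Q A) (pos-^ p k)

  even-solution : ∀ j → ¬ + 2 ∣ + 4 + + 27 * j → ∀ k → Solution (+ (2 ℕ.^ k)) (Aⱼ j)
  even-solution j odd k = solution-^ k (from (PrimeModulus.invert prime[2] k (+ 3) 2∤3) (PrimeModulus.invert prime[2] k (+ 54 + + 405 * j) 2∤D))
    where
    2∤3 : ¬ + 2 ∣ + 3
    2∤3 t = PrimeModulus.P∤1 prime[2] (by (t ⊕ (- 1ℤ) ⊛ divides 1ℤ refl) refl)
    2∤D : ¬ + 2 ∣ + 54 + + 405 * j
    2∤D t = odd (by (t ⊕ (- (+ 25 + + 189 * j)) ⊛ divides 1ℤ refl) (l j))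
      where
      l : ∀ j → + 4 + + 27 * j ≡ + 54 + + 405 * j + - (+ 25 + + 189 * j) * + 2
      l j = solve (j ∷ [])
    from : ∃[ i ] (+ 2) ^ k ∣ + 3 * i - 1ℤ → ∃[ w ] (+ 2) ^ k ∣ (+ 54 + + 405 * j) * w - 1ℤ → Solution ((+ 2) ^ k) (Aⱼ j)
    from (i , I) (w , W) = two-solution ((+ 2) ^ k) j i w I (by W (cong (_- 1ℤ) (ℤP.*-comm w (+ 54 + + 405 * j))))

  triadic-solution : ∀ j k → Solution (+ (3 ℕ.^ k)) (Aⱼ j)
  triadic-solution j zero = subst (λ Q → Solution Q (Aⱼ j)) refl (generic-solution j 1 (s≤s z≤n) (λ d → ℕP.1+n≢0 (ℕP.suc-injective (ℕD.∣1⇒≡1 d))) (λ d → ℕP.1+n≢0 (ℕP.suc-injective (ℕD.∣1⇒≡1 d))))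
  triadic-solution j (suc k) = solution-^ (suc k) (from (Triadic.hensel j k))
    where
    open Triadic
    module E = PrimeModulus prime[3]
    3∤2 : ¬ + 3 ∣ + 2
    3∤2 t = E.P∤1 (by ((- 1ℤ) ⊛ t ⊕ divides 1ℤ refl) refl)
    3∤bA : ¬ + 3 ∣ bA j
    3∤bA t = E.P∤1 (by (t ⊕ (- (1ℤ + + 10 * j)) ⊛ divides 1ℤ refl) (l j))
      where
      l : ∀ j → 1ℤ ≡ + 4 + + 30 * j + - (1ℤ + + 10 * j) * + 3
      l j = solve (j ∷ [])
    from : ∃[ a ] + 3 ∣ a × (+ 3) ^ suc k ∣ F a + K j → Solution ((+ 3) ^ suc k) (Aⱼ j)
    from (a , d , f) = from′ (E.invert (suc k) (bA j) 3∤bA) (E.invert (suc k) (bC a) 3∤bC)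
      where
      3∤bC : ¬ + 3 ∣ bC a
      3∤bC t = 3∤2 (by (t ⊕ (- (+ 11 + + 18 * a + + 9 * (a * a))) ⊛ d) (l a))
        where
        l : ∀ a → + 2 ≡ (1ℤ + + 3 * a) * (+ 2 + + 5 * a + + 3 * (a * a)) + - (+ 11 + + 18 * a + + 9 * (a * a)) * a
        l a = solve (a ∷ [])
      from′ : ∃[ A' ] (+ 3) ^ suc k ∣ bA j * A' - 1ℤ → ∃[ C' ] (+ 3) ^ suc k ∣ bC a * C' - 1ℤ → Solution ((+ 3) ^ suc k) (Aⱼ j)
      from′ (A' , HA) (C' , HC) = three-solution ((+ 3) ^ suc k) j a A' C' HA HC f

  local-solution : ∀ j → ¬ + 2 ∣ + 4 + + 27 * j → ∀ q → 0 < q → Solution (+ q) (Aⱼ j)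
  local-solution j odd q 0<q = from (strip prime[2] q 0<q)
    where
    positive : ∀ {p q} → ¬ p ℕD.∣ q → 0 < q
    positive {p} h = ℕP.n≢0⇒n>0 λ { refl → h (p ℕD.∣0) }
    join : ∀ r s → + r * + s ≡ + (r ℕ.* s)
    join r s = sym (ℤP.pos-* r s)
    from : ∃[ f ] ∃[ q₁ ] q ≡ 2 ℕ.^ f ℕ.* q₁ × ¬ 2 ℕD.∣ q₁ → Solution (+ q) (Aⱼ j)
    from (f , q₁ , refl , 2∤q₁) = from′ (strip prime[3] q₁ (positive 2∤q₁))
      where
      from′ : ∃[ g ] ∃[ r ] q₁ ≡ 3 ℕ.^ g ℕ.* r × ¬ 3 ℕD.∣ r → Solution (+ (2 ℕ.^ f ℕ.* q₁)) (Aⱼ j)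
      from′ (g , r , refl , 3∤r) = subst (λ Q → Solution Q (Aⱼ j)) (join (2 ℕ.^ f) (3 ℕ.^ g ℕ.* r))
        (combine-solutions {2 ℕ.^ f} {3 ℕ.^ g ℕ.* r} (Cop.sym (coprime-power (coprime-prime prime[2] 2∤q₁) f)) (even-solution j odd f)
          (subst (λ Q → Solution Q (Aⱼ j)) (join (3 ℕ.^ g) r) (combine-solutions {3 ℕ.^ g} {r} (Cop.sym (coprime-power (coprime-prime prime[3] 3∤r) g)) (triadic-solution j g)
            (generic-solution j r (positive 3∤r) (λ t → 2∤q₁ (ℕD.∣n⇒∣m*n (3 ℕ.^ g) t)) 3∤r))))

  Zⱼ : ℤ → Matℤ
  Zⱼ j = let ν = + 4 + + 27 * j in matℤ (+ 20 * (ν * ν) - + 3) (+ 12 + + 90 * j) (+ 30 * ν + + 12) (+ 5)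

  half-turn : Word
  half-turn = 𝕩 1ℤ ∷ 𝕪 (- 1ℤ) ∷ 𝕩 1ℤ ∷ 𝕩 1ℤ ∷ 𝕪 (- 1ℤ) ∷ 𝕩 1ℤ ∷ []

  half-turn-matrix : matrix half-turn ≡ matℤ (- 1ℤ) 0ℤ 0ℤ (- 1ℤ)
  half-turn-matrix = refl

  four-letters : ℤ → ℤ → Word
  four-letters s k = 𝕩 s ∷ 𝕪 (+ 3) ∷ 𝕩 (- + 2) ∷ 𝕪 k ∷ []

  four-letters-matrix : ∀ s k → matrix (four-letters s k) ≡ matℤ (1ℤ - + 2 * k + s * (+ 3 - + 5 * k)) (- + 2 - + 5 * s) (+ 3 - + 5 * k) (- + 5)
  four-letters-matrix s k = matℤ-≡ (l₁ s k) (l₂ s k) (l₃ k) (l₄ k)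
    where
    l₁ : ∀ s k → 1ℤ + - + 2 * (0ℤ + k * 1ℤ) + s * (0ℤ + k * 1ℤ + + 3 * (1ℤ + - + 2 * (0ℤ + k * 1ℤ))) ≡ 1ℤ - + 2 * k + s * (+ 3 - + 5 * k)
    l₁ s k = solve (s ∷ k ∷ [])
    l₂ : ∀ s k → 0ℤ + - + 2 * (1ℤ + k * 0ℤ) + s * (1ℤ + k * 0ℤ + + 3 * (0ℤ + - + 2 * (1ℤ + k * 0ℤ))) ≡ - + 2 - + 5 * s
    l₂ s k = solve (s ∷ k ∷ [])
    l₃ : ∀ k → 0ℤ + k * 1ℤ + + 3 * (1ℤ + - + 2 * (0ℤ + k * 1ℤ)) ≡ + 3 - + 5 * k
    l₃ k = solve (k ∷ [])
    l₄ : ∀ k → 1ℤ + k * 0ℤ + + 3 * (0ℤ + - + 2 * (1ℤ + k * 0ℤ)) ≡ - + 5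
    l₄ k = solve (k ∷ [])

  Z-word : ℤ → Word
  Z-word j = half-turn ++ four-letters (+ 2 + + 18 * j) (+ 6 * (+ 4 + + 27 * j) + + 3)

  Z-word-matrix : ∀ j → matrix (Z-word j) ≡ Zⱼ j
  Z-word-matrix j = trans (matrix-++ half-turn (four-letters s k)) (trans (cong₂ _⊡_ half-turn-matrix (four-letters-matrix s k))
      (matℤ-≡ (trans (negate (1ℤ - + 2 * k + s * (+ 3 - + 5 * k)) (+ 3 - + 5 * k)) (e₁ j)) (trans (negate (- + 2 - + 5 * s) (- + 5)) (e₂ j)) (trans (negate′ (1ℤ - + 2 * k + s * (+ 3 - + 5 * k)) (+ 3 - + 5 * k)) (e₃ j)) (negate′ (- + 2 - + 5 * s) (- + 5))))
    where
    s k : ℤ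
    s = + 2 + + 18 * j
    k = + 6 * (+ 4 + + 27 * j) + + 3
    negate : ∀ a c → - 1ℤ * a + 0ℤ * c ≡ - a
    negate a c = solve (a ∷ c ∷ [])
    negate′ : ∀ a c → 0ℤ * a + - 1ℤ * c ≡ - c
    negate′ a c = solve (a ∷ c ∷ [])
    e₁ : ∀ j → let ν = + 4 + + 27 * j ; k = + 6 * ν + + 3 in - (1ℤ - + 2 * k + (+ 2 + + 18 * j) * (+ 3 - + 5 * k)) ≡ + 20 * (ν * ν) - + 3
    e₁ j = solve (j ∷ [])
    e₂ : ∀ j → - (- + 2 - + 5 * (+ 2 + + 18 * j)) ≡ + 12 + + 90 * j
    e₂ j = solve (j ∷ [])
    e₃ : ∀ j → let ν = + 4 + + 27 * j ; k = + 6 * ν + + 3 in - (+ 3 - + 5 * k) ≡ + 30 * ν + + 12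
    e₃ j = solve (j ∷ [])

  Z-solution : ∀ j → ¬ + 2 ∣ + 4 + + 27 * j → ∀ q → 0 < q → Solution (+ q) (Zⱼ j)
  Z-solution j odd q 0<q = conjugate-solution (+ 3) (≈-≡ (trans (lower-conjugate (+ 3) (+ 20 * (ν * ν) - + 3) (+ 12 + + 90 * j) (+ 30 * ν + + 12) (+ 5)) (matℤ-≡ (l₁ j) refl (l₃ j) (l₄ j)))) (local-solution j odd q 0<q)
    where
    ν : ℤ
    ν = + 4 + + 27 * j
    l₁ : ∀ j → let ν = + 4 + + 27 * j in + 20 * (ν * ν) - + 3 - + 3 * (+ 12 + + 90 * j) ≡ 1ℤ + + 20 * (ν * ν) - + 10 * ν
    l₁ j = solve (j ∷ [])
    l₃ : ∀ j → let ν = + 4 + + 27 * j in + 30 * ν + + 12 + + 3 * (+ 20 * (ν * ν) - + 3 - + 5) - + 3 * + 3 * (+ 12 + + 90 * j) ≡ + 60 * (ν * ν)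
    l₃ j = solve (j ∷ [])
    l₄ : ∀ j → + 5 + + 3 * (+ 12 + + 90 * j) ≡ 1ℤ + + 10 * (+ 4 + + 27 * j)
    l₄ j = solve (j ∷ [])

  ιₘ : Matℤ → Mat
  ιₘ (matℤ a b c d) = mat (ℤ→ℚ a) (ℤ→ℚ b) (ℤ→ℚ c) (ℤ→ℚ d)

  matA-ι : ∀ j → matA (+ 4 + + 27 * j) ≡ ιₘ (Zⱼ j)
  matA-ι j = mat-≡ (cong ℤ→ℚ (l₁ j)) (trans (cong (λ z → (+ 2 ℚ./ 3) ℚ.* ℤ→ℚ z) (l₂ j)) (trans (cong (λ z → (+ 2 ℚ./ 3) ℚ.* z) (ι-* (+ 3) (+ 6 + + 45 * j))) (trans (sym (ℚP.*-assoc (+ 2 ℚ./ 3) (ℤ→ℚ (+ 3)) (ℤ→ℚ (+ 6 + + 45 * j))))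
      (trans (sym (ι-* (+ 2) (+ 6 + + 45 * j))) (cong ℤ→ℚ (l₃ j)))))) (cong ℤ→ℚ (l₄ j)) refl
    where
    l₁ : ∀ j → let ν = + 4 + + 27 * j in + 2 + + 20 * (ν * ν) - + 5 ≡ + 20 * (ν * ν) - + 3
    l₁ j = solve (j ∷ [])
    l₂ : ∀ j → + 5 * (+ 4 + + 27 * j) - + 2 ≡ + 3 * (+ 6 + + 45 * j)
    l₂ j = solve (j ∷ [])
    l₃ : ∀ j → + 2 * (+ 6 + + 45 * j) ≡ + 12 + + 90 * j
    l₃ j = solve (j ∷ [])
    l₄ : ∀ j → + 6 * (+ 5 * (+ 4 + + 27 * j) + + 2) ≡ + 30 * (+ 4 + + 27 * j) + + 12
    l₄ j = solve (j ∷ [])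

  matA-in-SL₂ : ∀ ℓ j → InSL2 ℓ (matA (+ 4 + + 27 * j))
  matA-in-SL₂ ℓ j = subst (InSL2 ℓ) (sym (matA-ι j)) (D-ι A , D-ι B , D-ι C , D-ι (+ 5) , trans (sym (cong₂ ℚ._-_ (ι-* A (+ 5)) (ι-* B C))) (trans (sym (ι-- (A * + 5) (B * C))) (cong ℤ→ℚ (l j))))
    where
    open Denominator ℓ
    A B C : ℤ
    A = let ν = + 4 + + 27 * j in + 20 * (ν * ν) - + 3
    B = + 12 + + 90 * j
    C = + 30 * (+ 4 + + 27 * j) + + 12
    l : ∀ j → let ν = + 4 + + 27 * j in (+ 20 * (ν * ν) - + 3) * + 5 - (+ 12 + + 90 * j) * (+ 30 * ν + + 12) ≡ 1ℤ
    l j = solve (j ∷ [])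

module CommutatorQuotients where
  open import Defs hiding (a; b; c; d)
  open GroupWords using (module Rewriting)
  open NormalForms
  open PrimePowers
  open PrimitiveRoots
  open RationalMatrices
  open FiniteQuotients
  open Commutators
  open LocalSolutions
  open import Data.List using ([]; _∷_; _++_)
  open import Data.Nat using (ℕ; _<_)
  open import Data.Nat.Primality using (Prime)
  open import Data.Integer using (+_; _+_; _*_)
  open import Data.Integer.Divisibility.Signed using (_∣_)
  import Data.Rational as ℚ
  open import Data.Product using (_×_; _,_; ∃-syntax)
  open import Data.Sum using ([_,_]′)
  open import Relation.Nullary using (¬_)
  open import Relation.Binary.PropositionalEquality using (_≡_; refl; sym; trans; cong; cong₂; subst)

  module _ (ℓ : ℕ) (ℓ-prime : Prime ℓ) (N : Mat → Set) (fin : IsFiniteIndexNormal ℓ N) where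
    open SpecialLinear ℓ ℓ-prime
    open Quotient N fin
    open Evaluate 𝔽 x y
    open Rewriting 𝔽 using (_∙_; _⁻¹; ε; assoc; inverseʳ; identityʳ; ∙-congˡ; ∙-congʳ; setoid; identityˡ)

    eval-matrix : ∀ ω → matrixₛ (eval ω) ≡ ιₘ (matrix ω)
    eval-matrix [] = refl
    eval-matrix (l ∷ ω) = go l (eval ω) (matrix ω) (eval-matrix ω)
      where
      go : ∀ l g m → matrixₛ g ≡ ιₘ m → matrixₛ (⟪ l ⟫ ∙ g) ≡ ιₘ (act l m)
      go (𝕩 s) (sl g _) (matℤ a b c d) refl = trans (upper-· (ℤ→ℚ s) (ℤ→ℚ a) (ℤ→ℚ b) (ℤ→ℚ c) (ℤ→ℚ d)) (mat-≡ (linear a s c) (linear b s d) refl refl)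
        where
        linear : ∀ a s c → ℤ→ℚ a ℚ.+ ℤ→ℚ s ℚ.* ℤ→ℚ c ≡ ℤ→ℚ (a + s * c)
        linear a s c = sym (trans (ι-+ a (s * c)) (cong (λ z → ℤ→ℚ a ℚ.+ z) (ι-* s c)))
      go (𝕪 s) (sl g _) (matℤ a b c d) refl = trans (lower-· (ℤ→ℚ s) (ℤ→ℚ a) (ℤ→ℚ b) (ℤ→ℚ c) (ℤ→ℚ d)) (mat-≡ refl refl (linear c s a) (linear d s b))
        where
        linear : ∀ a s c → ℤ→ℚ a ℚ.+ ℤ→ℚ s ℚ.* ℤ→ℚ c ≡ ℤ→ℚ (a + s * c)
        linear a s c = sym (trans (ι-+ a (s * c)) (cong (λ z → ℤ→ℚ a ℚ.+ z) (ι-* s c)))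

    eval-++ : ∀ ω ω' → eval (ω ++ ω') ~ (eval ω ∙ eval ω')
    eval-++ [] ω' = sym~ (identityˡ (eval ω'))
    eval-++ (l ∷ ω) ω' = trans~ (∙-congˡ (eval-++ ω ω')) (sym~ (assoc ⟪ l ⟫ (eval ω) (eval ω')))

    commutator-relation : ∀ g h k → (g ∙ h) ~ (k ∙ (h ∙ g)) → (((g ∙ h) ∙ g ⁻¹) ∙ h ⁻¹) ~ k
    commutator-relation g h k r = begin
      ((g ∙ h) ∙ g ⁻¹) ∙ h ⁻¹        ≈⟨ ∙-congʳ (∙-congʳ r) ⟩
      ((k ∙ (h ∙ g)) ∙ g ⁻¹) ∙ h ⁻¹  ≈⟨ ∙-congʳ (assoc k (h ∙ g) (g ⁻¹)) ⟩
      (k ∙ ((h ∙ g) ∙ g ⁻¹)) ∙ h ⁻¹  ≈⟨ ∙-congʳ (∙-congˡ (assoc h g (g ⁻¹))) ⟩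
      (k ∙ (h ∙ (g ∙ g ⁻¹))) ∙ h ⁻¹  ≈⟨ ∙-congʳ (∙-congˡ (∙-congˡ (inverseʳ g))) ⟩
      (k ∙ (h ∙ ε)) ∙ h ⁻¹           ≈⟨ ∙-congʳ (∙-congˡ (identityʳ h)) ⟩
      (k ∙ h) ∙ h ⁻¹                 ≈⟨ assoc k h (h ⁻¹) ⟩
      k ∙ (h ∙ h ⁻¹)                 ≈⟨ ∙-congˡ (inverseʳ h) ⟩
      k ∙ ε                          ≈⟨ identityʳ k ⟩
      k ∎
      where open import Relation.Binary.Reasoning.Setoid setoid

    commutator-mod : ¬ ℓ ≡ 2 → ∀ j → ¬ + 2 ∣ + 4 + + 27 * j → IsCommutatorMod ℓ N (matA (+ 4 + + 27 * j))
    commutator-mod ℓ≢2 j odd = from (congruence-subgroup ℓ≢2)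
      where
      finish : ∀ g h k → matrixₛ k ≡ matA (+ 4 + + 27 * j) → (((g ∙ h) ∙ g ⁻¹) ∙ h ⁻¹) ~ k → IsCommutatorMod ℓ N (matA (+ 4 + + 27 * j))
      finish (sl g G) (sl h H) (sl k _) e (cls n) = g , h , G , H , subst (λ z → N (inv (comm g h) · z)) e n
      from : ∃[ q ] 0 < q × (∀ ω₁ ω₂ → Congruent (+ q) (matrix ω₁) (matrix ω₂) → eval ω₁ ~ eval ω₂) → IsCommutatorMod ℓ N (matA (+ 4 + + 27 * j))
      from (q , 0<q , h) = from′ (Z-solution j odd q 0<q)
        where
        from′ : Solution (+ q) (Zⱼ j) → IsCommutatorMod ℓ N (matA (+ 4 + + 27 * j))
        from′ (solution ωX ωY r) = finish (eval ωX) (eval ωY) (eval (Z-word j)) (trans (eval-matrix (Z-word j)) (trans (cong ιₘ (Z-word-matrix j)) (sym (matA-ι j))))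
          (commutator-relation (eval ωX) (eval ωY) (eval (Z-word j)) (trans~ (sym~ (eval-++ ωX ωY)) (trans~ (h (ωX ++ ωY) (Z-word j ++ (ωY ++ ωX)) (uncon congruent))
            (trans~ (eval-++ (Z-word j) (ωY ++ ωX)) (∙-congˡ (eval-++ ωY ωX))))))
          where
          congruent : matrix (ωX ++ ωY) ≈[ + q ] matrix (Z-word j ++ (ωY ++ ωX))
          congruent = ≈-trans (≈-≡ (matrix-++ ωX ωY)) (≈-trans r (≈-≡ (sym (trans (matrix-++ (Z-word j) (ωY ++ ωX)) (cong₂ _⊡_ (Z-word-matrix j) (matrix-++ ωY ωX))))))

module FiveResidues where
  open import Defs hiding (a; b; c; d)
  open ElementaryRelations using (_⊛_; _⊕_; by)
  open PrimePowers
  open PrimitiveRoots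
  open Levels using (prime>1; prime-divides-prime)
  open LocalSolutions using (prime[3]; prime[5])
  open RationalMatrices
  open import Data.List using ([]; _∷_)
  open import Data.Fin using (Fin; toℕ; fromℕ<; remQuot; combine)
  import Data.Fin.Properties as FinP
  open import Data.Nat as ℕ using (ℕ; zero; suc; z≤n; s≤s; _≤_; _<_)
  import Data.Nat.Properties as ℕP
  import Data.Nat.Divisibility as ℕD
  import Data.Nat.DivMod as ℕM
  open import Data.Nat.Induction using (<-rec)
  open import Data.Nat.Primality using (Prime; prime[2]; euclidsLemma; prime⇒irreducible; prime⇒nonZero)
  open import Data.Integer as ℤ using (ℤ; +_; _+_; _*_; _-_; -_; _^_; 0ℤ; 1ℤ; -[1+_])
  import Data.Integer.Properties as ℤP
  open import Data.Integer.Divisibility.Signed using (_∣_; divides; ∣⇒∣ᵤ; ∣-trans; _∣?_)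
  open import Data.Integer.Tactic.RingSolver using (solve)
  open import Data.Product using (_×_; _,_; proj₁; proj₂; ∃-syntax)
  open import Data.Sum using (_⊎_; inj₁; inj₂; [_,_]′)
  open import Data.Empty using (⊥; ⊥-elim)
  open import Relation.Nullary using (¬_; yes; no)
  open import Relation.Binary.PropositionalEquality using (_≡_; refl; sym; trans; cong; cong₂; subst)

  integer-sqrt : ∀ p → ∃[ s ] s ℕ.* s ≤ p × p < suc s ℕ.* suc s
  integer-sqrt zero = 0 , z≤n , s≤s z≤n
  integer-sqrt (suc p) = from (integer-sqrt p)
    where
    from : ∃[ s ] s ℕ.* s ≤ p × p < suc s ℕ.* suc s → ∃[ s ] s ℕ.* s ≤ suc p × suc p < suc s ℕ.* suc s
    from (s , lo , hi) with suc p ℕP.<? suc s ℕ.* suc s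
    ... | yes h = s , ℕP.≤-trans lo (ℕP.n≤1+n p) , h
    ... | no h = suc s , ℕP.≮⇒≥ h , ℕP.≤-<-trans hi (ℕP.*-mono-< (ℕP.n<1+n (suc s)) (ℕP.n<1+n (suc s)))

  square-prime : ∀ {p} → Prime p → ∀ s → ¬ s ℕ.* s ≡ p
  square-prime {p} pr s e = [ (λ { refl → ℕP.<⇒≢ (prime>1 pr) e }) , (λ { refl → ℕP.<⇒≢ (ℕP.m<m*n s s ⦃ prime⇒nonZero pr ⦄ (prime>1 pr)) (sym e) }) ]′ (prime⇒irreducible pr (ℕD.divides s (sym e)))

  -- Thue: every residue R is a quotient of two integers of size at most √p.
  thue : ∀ {p} → Prime p → ∀ s → p < suc s ℕ.* suc s → ∀ R → ∃[ m ] ∃[ n ] ¬ (m ≡ 0ℤ × n ≡ 0ℤ) × + p ∣ m + n * + R × ℤ.∣ m ∣ ≤ s × ℤ.∣ n ∣ ≤ s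
  thue {p} pr s p<s² R = from (FinP.pigeonhole p<s² residue)
    where
    instance _ = prime⇒nonZero pr
    fst snd : Fin (suc s ℕ.* suc s) → ℕ
    fst i = toℕ (proj₁ (remQuot {suc s} (suc s) i))
    snd i = toℕ (proj₂ (remQuot {suc s} (suc s) i))
    fst≤ : ∀ i → fst i ≤ s
    fst≤ i = ℕP.≤-pred (FinP.toℕ<n (proj₁ (remQuot {suc s} (suc s) i)))
    snd≤ : ∀ i → snd i ≤ s
    snd≤ i = ℕP.≤-pred (FinP.toℕ<n (proj₂ (remQuot {suc s} (suc s) i)))
    value : Fin (suc s ℕ.* suc s) → ℕ
    value i = fst i ℕ.+ snd i ℕ.* R
    residue : Fin (suc s ℕ.* suc s) → Fin p
    residue i = fromℕ< (ℕM.m%n<n (value i) p)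
    bound : ∀ a b → a ≤ s → b ≤ s → ℤ.∣ + a - + b ∣ ≤ s
    bound a b a≤ b≤ = ℕP.≤-trans (ℕP.≤-reflexive (cong ℤ.∣_∣ (ℤP.m-n≡m⊖n a b))) (ℕP.≤-trans (ℤP.∣m⊝n∣≤m⊔n a b) (ℕP.⊔-lub a≤ b≤))
    diff-zero : ∀ a b → + a - + b ≡ 0ℤ → a ≡ b
    diff-zero a b e = ℤP.+-injective (ℤP.i-j≡0⇒i≡j (+ a) (+ b) e)
    from : ∃[ i ] ∃[ j ] toℕ i < toℕ j × residue i ≡ residue j → ∃[ m ] ∃[ n ] ¬ (m ≡ 0ℤ × n ≡ 0ℤ) × + p ∣ m + n * + R × ℤ.∣ m ∣ ≤ s × ℤ.∣ n ∣ ≤ s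
    from (i , j , i<j , e) = + fst i - + fst j , + snd i - + snd j , distinct , divisible , bound (fst i) (fst j) (fst≤ i) (fst≤ j) , bound (snd i) (snd j) (snd≤ i) (snd≤ j)
      where
      distinct : ¬ (+ fst i - + fst j ≡ 0ℤ × + snd i - + snd j ≡ 0ℤ)
      distinct (f , g) = ℕP.<⇒≢ i<j (cong toℕ (trans (sym (FinP.combine-remQuot {suc s} (suc s) i)) (trans (cong₂ combine (FinP.toℕ-injective (diff-zero (fst i) (fst j) f)) (FinP.toℕ-injective (diff-zero (snd i) (snd j) g))) (FinP.combine-remQuot {suc s} (suc s) j))))
      rem : value i ℕ.% p ≡ value j ℕ.% p
      rem = trans (sym (FinP.toℕ-fromℕ< _)) (trans (cong toℕ e) (FinP.toℕ-fromℕ< _))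
      decompose : ∀ n → + n ≡ + (n ℕ.% p) + + (n ℕ./ p) * + p
      decompose n = trans (cong +_ (ℕM.m≡m%n+[m/n]*n n p)) (trans (ℤP.pos-+ (n ℕ.% p) _) (cong (λ z → + (n ℕ.% p) + z) (ℤP.pos-* (n ℕ./ p) p)))
      expand : ∀ i → + value i ≡ + fst i + + snd i * + R
      expand i = trans (ℤP.pos-+ (fst i) (snd i ℕ.* R)) (cong (λ z → + fst i + z) (ℤP.pos-* (snd i) R))
      divisible : + p ∣ + fst i - + fst j + (+ snd i - + snd j) * + R
      divisible = divides (+ (value i ℕ./ p) - + (value j ℕ./ p)) (trans (l (+ fst i) (+ fst j) (+ snd i) (+ snd j) (+ R)) (trans (cong₂ _-_ (trans (sym (expand i)) (decompose (value i)))
          (trans (sym (expand j)) (trans (decompose (value j)) (cong (λ r → + r + + (value j ℕ./ p) * + p) (sym rem))))) (l′ (+ (value i ℕ.% p)) (+ (value i ℕ./ p)) (+ (value j ℕ./ p)) (+ p))))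
        where
        l : ∀ a a' b b' R → a - a' + (b - b') * R ≡ a + b * R - (a' + b' * R)
        l a a' b b' R = solve (a ∷ a' ∷ b ∷ b' ∷ R ∷ [])
        l′ : ∀ r x y p → r + x * p - (r + y * p) ≡ (x - y) * p
        l′ r x y p = solve (r ∷ x ∷ y ∷ p ∷ [])

  √5-irrational : ∀ b a → a ℕ.* a ≡ 5 ℕ.* (b ℕ.* b) → b ≡ 0
  √5-irrational = <-rec _ go
    where
    go : ∀ b → (∀ {b'} → b' < b → ∀ a → a ℕ.* a ≡ 5 ℕ.* (b' ℕ.* b') → b' ≡ 0) → ∀ a → a ℕ.* a ≡ 5 ℕ.* (b ℕ.* b) → b ≡ 0
    go zero rec a e = refl
    go b@(suc b₁) rec a e = from ([ (λ z → z) , (λ z → z) ]′ (euclidsLemma a a prime[5] (ℕD.divides (b ℕ.* b) (trans e (ℕP.*-comm 5 (b ℕ.* b))))))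
      where
      from : 5 ℕD.∣ a → b ≡ 0
      from (ℕD.divides a' f) = ⊥-elim (ℕP.1+n≢0 (sq (trans e′ (cong (λ z → 5 ℕ.* (z ℕ.* z)) (rec smaller b e′)))))
        where
        e′ : b ℕ.* b ≡ 5 ℕ.* (a' ℕ.* a')
        e′ = ℕP.*-cancelˡ-≡ _ _ 5 (trans (sym e) (trans (cong₂ ℕ._*_ f f) (l a')))
          where
          open import Data.Nat.Solver using (module +-*-Solver)
          open +-*-Solver renaming (solve to solveℕ)
          l : ∀ a → a ℕ.* 5 ℕ.* (a ℕ.* 5) ≡ 5 ℕ.* (5 ℕ.* (a ℕ.* a))
          l = solveℕ 1 (λ a → a :* con 5 :* (a :* con 5) := con 5 :* (con 5 :* (a :* a))) refl
        sq : b ℕ.* b ≡ 0 → b ≡ 0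
        sq ()
        smaller : a' < b
        smaller = ℕP.≰⇒> λ b≤a' → ℕP.<⇒≢ (ℕP.<-≤-trans (subst (b ℕ.* b <_) (ℕP.*-comm (b ℕ.* b) 5) (ℕP.m<m*n (b ℕ.* b) 5 (s≤s (s≤s z≤n)))) (ℕP.*-monoʳ-≤ 5 (ℕP.*-mono-≤ b≤a' b≤a'))) e′

  -- u is 0 or ±1 modulo 5.
  Five : ℤ → Set
  Five u = + 5 ∣ u ⊎ + 5 ∣ u * u - 1ℤ

  five-* : ∀ u v → Five u → Five v → Five (u * v)
  five-* u v (inj₁ d) _ = inj₁ (by (v ⊛ d) (ℤP.*-comm u v))
  five-* u v (inj₂ _) (inj₁ d) = inj₁ (u ⊛ d)
  five-* u v (inj₂ d) (inj₂ d') = inj₂ (by ((v * v) ⊛ d ⊕ d') (l u v))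
    where
    l : ∀ u v → u * v * (u * v) - 1ℤ ≡ v * v * (u * u - 1ℤ) + (v * v - 1ℤ)
    l u v = solve (u ∷ v ∷ [])

  five-residue : ∀ n r → n ℕ.% 5 ≡ r → r ≡ 1 ⊎ r ≡ 4 → + 5 ∣ + n * + n - 1ℤ
  five-residue n r e = from
    where
    q : ℤ
    q = + (n ℕ./ 5)
    n≡ : + n ≡ + r + q * + 5
    n≡ = trans (cong +_ (trans (ℕM.m≡m%n+[m/n]*n n 5) (cong (ℕ._+ n ℕ./ 5 ℕ.* 5) e))) (trans (ℤP.pos-+ r _) (cong (λ z → + r + z) (ℤP.pos-* (n ℕ./ 5) 5)))
    from : r ≡ 1 ⊎ r ≡ 4 → + 5 ∣ + n * + n - 1ℤ
    from (inj₁ refl) = divides (+ 2 * q + + 5 * (q * q)) (trans (cong (λ z → z * z - 1ℤ) n≡) (l q))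
      where
      l : ∀ q → (+ 1 + q * + 5) * (+ 1 + q * + 5) - 1ℤ ≡ (+ 2 * q + + 5 * (q * q)) * + 5
      l q = solve (q ∷ [])
    from (inj₂ refl) = divides (+ 3 + + 8 * q + + 5 * (q * q)) (trans (cong (λ z → z * z - 1ℤ) n≡) (l q))
      where
      l : ∀ q → (+ 4 + q * + 5) * (+ 4 + q * + 5) - 1ℤ ≡ (+ 3 + + 8 * q + + 5 * (q * q)) * + 5
      l q = solve (q ∷ [])

  sum-of-squares₃ : ∀ m n → + 3 ∣ m * m + n * n → + 3 ∣ n
  sum-of-squares₃ m n d with + 3 ∣? n | + 3 ∣? m
  ... | yes h | _ = h
  ... | no 3∤n | yes 3∣m = ⊥-elim (3∤n ([ (λ z → z) , (λ z → z) ]′ (PrimeModulus.euclid prime[3] n n (by (d ⊕ (- m) ⊛ 3∣m) (l m n)))))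
    where
    l : ∀ m n → n * n ≡ m * m + n * n + - m * m
    l m n = solve (m ∷ n ∷ [])
  ... | no 3∤n | no 3∤m = ⊥-elim (PrimeModulus.P∤1 prime[3] (by ((- 1ℤ) ⊛ d ⊕ PrimitiveRoot.fermat prime[3] m 3∤m ⊕ PrimitiveRoot.fermat prime[3] n 3∤n ⊕ divides 1ℤ refl) (l m n)))
    where
    l : ∀ m n → 1ℤ ≡ - 1ℤ * (m * m + n * n) + (m * (m * 1ℤ) - 1ℤ) + (n * (n * 1ℤ) - 1ℤ) + + 3
    l m n = solve (m ∷ n ∷ [])

  module FiveIsSquare {p : ℕ} (pr : Prime p) (p≢2 : ¬ p ≡ 2) where
    private module E = PrimeModulus pr

    norm : ∀ m n c → m * m - + 5 * (n * n) ≡ c * + p → + 5 ∣ c * c - 1ℤ → ¬ + 5 ∣ c → Five (+ p)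
    norm m n c e d 5∤c with + 5 ∣? m
    ... | yes 5∣m = [ (λ t → ⊥-elim (5∤c t)) , inj₁ ]′ (PrimeModulus.euclid prime[5] c (+ p) (by (m ⊛ 5∣m ⊕ (- (n * n)) ⊛ divides 1ℤ refl) (trans (sym e) (l m n))))
      where
      l : ∀ m n → m * m - + 5 * (n * n) ≡ m * m + - (n * n) * + 5
      l m n = solve (m ∷ n ∷ [])
    ... | no 5∤m = inj₂ (by ((- (+ p * + p)) ⊛ d ⊕ PrimitiveRoot.fermat prime[5] m 5∤m ⊕ (- (+ 2 * (m * m) * (n * n)) + + 5 * (n * n * (n * n))) ⊛ divides 1ℤ refl) (l m n c (+ p) e))
      where
      l₁ : ∀ c p X → p * p - 1ℤ ≡ - (p * p) * (c * c - 1ℤ) + (X - 1ℤ) + (c * p * (c * p) - X)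
      l₁ c p X = solve (c ∷ p ∷ X ∷ [])
      l₂ : ∀ m n → (m * m - + 5 * (n * n)) * (m * m - + 5 * (n * n)) - m * (m * (m * (m * 1ℤ))) ≡ (- (+ 2 * (m * m) * (n * n)) + + 5 * (n * n * (n * n))) * + 5
      l₂ m n = solve (m ∷ n ∷ [])
      l : ∀ m n c p → m * m - + 5 * (n * n) ≡ c * p → p * p - 1ℤ ≡ - (p * p) * (c * c - 1ℤ) + (m ^ 4 - 1ℤ) + (- (+ 2 * (m * m) * (n * n)) + + 5 * (n * n * (n * n))) * + 5
      l m n c p e = trans (l₁ c p (m ^ 4)) (cong (λ z → - (p * p) * (c * c - 1ℤ) + (m ^ 4 - 1ℤ) + z) (trans (cong (λ z → z * z - m ^ 4) (sym e)) (l₂ m n)))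

    odd : ¬ + 2 ∣ + p
    odd d = p≢2 (sym (prime-divides-prime prime[2] pr (∣⇒∣ᵤ d)))

    not-2 : ∀ m n → ¬ m * m - + 5 * (n * n) ≡ - + 2 * + p
    not-2 m n e = from ([ (λ z → z) , (λ z → z) ]′ (PrimeModulus.euclid prime[2] (m - n) (m - n) (divides (- + p + + 3 * (n * n) - m * n) (l m n (+ p) e))))
      where
      l : ∀ m n p → m * m - + 5 * (n * n) ≡ - + 2 * p → (m - n) * (m - n) ≡ (- p + + 3 * (n * n) - m * n) * + 2
      l m n p e = trans (l₁ m n) (trans (cong (λ z → z + (+ 3 * (n * n) - m * n) * + 2) e) (l₂ m n p))
        where
        l₁ : ∀ m n → (m - n) * (m - n) ≡ m * m - + 5 * (n * n) + (+ 3 * (n * n) - m * n) * + 2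
        l₁ m n = solve (m ∷ n ∷ [])
        l₂ : ∀ m n p → - + 2 * p + (+ 3 * (n * n) - m * n) * + 2 ≡ (- p + + 3 * (n * n) - m * n) * + 2
        l₂ m n p = solve (m ∷ n ∷ p ∷ [])
      from : + 2 ∣ m - n → ⊥
      from (divides h f) = odd (divides (- (h * h) - h * n + n * n) (ℤP.*-cancelˡ-≡ (- + 2) (+ p) _ (trans (sym e) (l′ m n h f))))
        where
        l₁ : ∀ h n → (h * + 2 + n) * (h * + 2 + n) - + 5 * (n * n) ≡ - + 2 * ((- (h * h) - h * n + n * n) * + 2)
        l₁ h n = solve (h ∷ n ∷ [])
        l₃ : ∀ m n → m ≡ m - n + n
        l₃ m n = solve (m ∷ n ∷ [])
        l′ : ∀ m n h → m - n ≡ h * + 2 → m * m - + 5 * (n * n) ≡ - + 2 * ((- (h * h) - h * n + n * n) * + 2)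
        l′ m n h f = trans (cong (λ z → z * z - + 5 * (n * n)) (trans (l₃ m n) (cong (_+ n) f))) (l₁ h n)

    not-3 : ¬ p ≡ 3 → ∀ m n → ¬ m * m - + 5 * (n * n) ≡ - + 3 * + p
    not-3 p≢3 m n e = from (sum-of-squares₃ n m (by d (ℤP.+-comm (n * n) (m * m)))) (sum-of-squares₃ m n d)
      where
      d : + 3 ∣ m * m + n * n
      d = divides (- + p + + 2 * (n * n)) (trans (l₁ m n) (trans (cong (λ z → z + + 6 * (n * n)) e) (l₂ n (+ p))))
        where
        l₁ : ∀ m n → m * m + n * n ≡ m * m - + 5 * (n * n) + + 6 * (n * n)
        l₁ m n = solve (m ∷ n ∷ [])
        l₂ : ∀ n p → - + 3 * p + + 6 * (n * n) ≡ (- p + + 2 * (n * n)) * + 3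
        l₂ n p = solve (n ∷ p ∷ [])
      from : + 3 ∣ m → + 3 ∣ n → ⊥
      from (divides h f) (divides k g) = p≢3 (sym (prime-divides-prime prime[3] pr (∣⇒∣ᵤ (divides {+ 3} {+ p} (- (h * h) + + 5 * (k * k)) (ℤP.*-cancelˡ-≡ (- + 3) (+ p) _ (trans (sym e) (trans (cong₂ (λ m n → m * m - + 5 * (n * n)) f g) (l h k))))))))
        where
        l : ∀ h k → h * + 3 * (h * + 3) - + 5 * (k * + 3 * (k * + 3)) ≡ - + 3 * ((- (h * h) + + 5 * (k * k)) * + 3)
        l h k = solve (h ∷ k ∷ [])

    square-abs : ∀ m → m * m ≡ + (ℤ.∣ m ∣ ℕ.* ℤ.∣ m ∣)
    square-abs (+ m) = sym (ℤP.pos-* m m)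
    square-abs (-[1+ m ]) = refl

    small-norm : ¬ p ≡ 3 → ∀ s → s ℕ.* s < p → ∀ m n c → ¬ (m ≡ 0ℤ × n ≡ 0ℤ) → ℤ.∣ m ∣ ≤ s → ℤ.∣ n ∣ ≤ s → m * m - + 5 * (n * n) ≡ c * + p → Five (+ p)
    small-norm p≢3 s s²<p m n c nz m≤ n≤ e = cases c e
      where
      A B : ℕ
      A = ℤ.∣ m ∣ ℕ.* ℤ.∣ m ∣
      B = ℤ.∣ n ∣ ℕ.* ℤ.∣ n ∣
      A<p : A < p
      A<p = ℕP.≤-<-trans (ℕP.*-mono-≤ m≤ m≤) s²<p
      B<p : B < p
      B<p = ℕP.≤-<-trans (ℕP.*-mono-≤ n≤ n≤) s²<p
      positive : ∀ k → m * m - + 5 * (n * n) ≡ + k * + p → A ≡ 5 ℕ.* B ℕ.+ k ℕ.* p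
      positive k e = ℤP.+-injective (trans (sym (square-abs m)) (trans (l (m * m) (n * n)) (trans (cong₂ (λ y z → + 5 * y + z) (square-abs n) e) (sym (trans (ℤP.pos-+ (5 ℕ.* B) (k ℕ.* p)) (cong₂ _+_ (ℤP.pos-* 5 B) (ℤP.pos-* k p)))))))
        where
        l : ∀ M N → M ≡ + 5 * N + (M - + 5 * N)
        l M N = solve (M ∷ N ∷ [])
      negative : ∀ k → m * m - + 5 * (n * n) ≡ - + k * + p → A ℕ.+ k ℕ.* p ≡ 5 ℕ.* B
      negative k e = ℤP.+-injective (trans (ℤP.pos-+ A (k ℕ.* p)) (trans (cong₂ _+_ (sym (square-abs m)) (ℤP.pos-* k p)) (trans (l (m * m) (n * n) (+ k) (+ p) e) (trans (cong (λ y → + 5 * y) (square-abs n)) (sym (ℤP.pos-* 5 B))))))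
        where
        l₁ : ∀ M N k p → M + k * p ≡ M - + 5 * N + + 5 * N + k * p
        l₁ M N k p = solve (M ∷ N ∷ k ∷ p ∷ [])
        l₂ : ∀ N k p → - k * p + + 5 * N + k * p ≡ + 5 * N
        l₂ N k p = solve (N ∷ k ∷ p ∷ [])
        l : ∀ M N k p → M - + 5 * N ≡ - k * p → M + k * p ≡ + 5 * N
        l M N k p e = trans (l₁ M N k p) (trans (cong (λ z → z + + 5 * N + k * p) e) (l₂ N k p))
      5∤ : ∀ k → k < 5 → 0 < k → ¬ + 5 ∣ - + k
      5∤ k k<5 0<k d = ℕP.<⇒≱ k<5 (ℕD.∣⇒≤ ⦃ ℕ.>-nonZero 0<k ⦄ (subst (5 ℕD.∣_) (ℤP.∣-i∣≡∣i∣ (+ k)) (∣⇒∣ᵤ d)))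
      cases : ∀ c → m * m - + 5 * (n * n) ≡ c * + p → Five (+ p)
      cases (+ zero) e = ⊥-elim (nz (zero-m , zero-n))
        where
        |n|≡0 : ℤ.∣ n ∣ ≡ 0
        |n|≡0 = √5-irrational ℤ.∣ n ∣ ℤ.∣ m ∣ (trans (positive 0 e) (ℕP.+-identityʳ (5 ℕ.* B)))
        zero-n : n ≡ 0ℤ
        zero-n = ℤP.∣i∣≡0⇒i≡0 |n|≡0
        zero-m : m ≡ 0ℤ
        zero-m = ℤP.∣i∣≡0⇒i≡0 ([ (λ z → z) , (λ z → z) ]′ (ℕP.m*n≡0⇒m≡0∨n≡0 ℤ.∣ m ∣ (trans (positive 0 e) (trans (ℕP.+-identityʳ (5 ℕ.* B)) (cong (λ z → 5 ℕ.* (z ℕ.* z)) |n|≡0)))))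
      cases (+ suc k) e = ⊥-elim (ℕP.<⇒≱ A<p (subst (p ≤_) (sym (positive (suc k) e)) (ℕP.≤-trans (ℕP.m≤m+n p (k ℕ.* p)) (ℕP.m≤n+m _ (5 ℕ.* B)))))
      cases (-[1+ 0 ]) e = norm m n (- + 1) e (divides 0ℤ refl) (5∤ 1 (s≤s (s≤s z≤n)) (s≤s z≤n))
      cases (-[1+ 1 ]) e = ⊥-elim (not-2 m n e)
      cases (-[1+ 2 ]) e = ⊥-elim (not-3 p≢3 m n e)
      cases (-[1+ 3 ]) e = norm m n (- + 4) e (divides (+ 3) refl) (5∤ 4 (s≤s (s≤s (s≤s (s≤s (s≤s z≤n))))) (s≤s z≤n))
      cases (-[1+ suc (suc (suc (suc k))) ]) e = ⊥-elim (ℕP.<⇒≱ (ℕP.*-monoʳ-< 5 B<p) (subst (5 ℕ.* p ≤_) (negative (5 ℕ.+ k) e) (ℕP.≤-trans (ℕP.*-monoˡ-≤ p (ℕP.m≤m+n 5 k)) (ℕP.m≤n+m _ A))))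

    five : ∀ W T → ¬ + p ∣ T → + p ∣ W * W - + 5 * (T * T) → Five (+ p)
    five W T p∤T d with p ℕ.≟ 3
    ... | yes refl = ⊥-elim (p∤T (sum-of-squares₃ W T (by (d ⊕ (+ 2 * (T * T)) ⊛ divides 1ℤ refl) (l W T))))
      where
      l : ∀ W T → W * W + T * T ≡ W * W - + 5 * (T * T) + + 2 * (T * T) * + 3
      l W T = solve (W ∷ T ∷ [])
    ... | no p≢3 = from (E.invert₁ T p∤T) (integer-sqrt p)
      where
      from : ∃[ T' ] + p ∣ T * T' - 1ℤ → ∃[ s ] s ℕ.* s ≤ p × p < suc s ℕ.* suc s → Five (+ p)
      from (T' , h) (s , lo , hi) = from′ (E.natural-residue (W * T'))
        where
        from′ : ∃[ R ] + p ∣ + R - W * T' → Five (+ p)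
        from′ (R , g) = from″ (thue pr s hi R)
          where
          R² : + p ∣ + R * + R - + 5
          R² = by ((+ R + W * T') ⊛ g ⊕ (T' * T') ⊛ d ⊕ (+ 5 * (T * T' + 1ℤ)) ⊛ h) (l (+ R) W T T')
            where
            l : ∀ R W T T' → R * R - + 5 ≡ (R + W * T') * (R - W * T') + T' * T' * (W * W - + 5 * (T * T)) + + 5 * (T * T' + 1ℤ) * (T * T' - 1ℤ)
            l R W T T' = solve (R ∷ W ∷ T ∷ T' ∷ [])
          from″ : ∃[ m ] ∃[ n ] ¬ (m ≡ 0ℤ × n ≡ 0ℤ) × + p ∣ m + n * + R × ℤ.∣ m ∣ ≤ s × ℤ.∣ n ∣ ≤ s → Five (+ p)
          from″ (m , n , nz , k , m≤ , n≤) = last (by ((m - n * + R) ⊛ k ⊕ (n * n) ⊛ R²) (l m n (+ R)))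
            where
            l : ∀ m n R → m * m - + 5 * (n * n) ≡ (m - n * R) * (m + n * R) + n * n * (R * R - + 5)
            l m n R = solve (m ∷ n ∷ R ∷ [])
            last : + p ∣ m * m - + 5 * (n * n) → Five (+ p)
            last (divides c e) = small-norm p≢3 s (ℕP.≤∧≢⇒< lo (square-prime pr s)) m n c nz m≤ n≤ e

  five-product : ∀ u → 0 < u → (∀ r → Prime r → r ℕD.∣ u → Five (+ r)) → Five (+ u)
  five-product = <-rec _ go
    where
    go : ∀ u → (∀ {u'} → u' < u → 0 < u' → (∀ r → Prime r → r ℕD.∣ u' → Five (+ r)) → Five (+ u')) → 0 < u → (∀ r → Prime r → r ℕD.∣ u → Five (+ r)) → Five (+ u)
    go 1 rec _ h = inj₂ (divides 0ℤ refl)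
    go u@(suc (suc _)) rec _ h = from (prime-divisor u (s≤s (s≤s z≤n)))
      where
      from : ∃[ r ] Prime r × r ℕD.∣ u → Five (+ u)
      from (r , pr , ℕD.divides zero ())
      from (r , pr , r∣u@(ℕD.divides u'@(suc _) e)) = subst Five (trans (sym (ℤP.pos-* u' r)) (cong +_ (sym e)))
        (five-* (+ u') (+ r) (rec (subst (u' <_) (sym e) (ℕP.m<m*n u' r (prime>1 pr))) (s≤s z≤n) (λ t pt d → h t pt (ℕD.∣-trans d (ℕD.divides r (trans e (ℕP.*-comm u' r)))))) (h r pr r∣u))

module TraceDescent where
  open import Defs hiding (a; b; c; d)
  open ElementaryRelations using (_⊛_; _⊕_; by)
  open PrimePowers
  open PrimitiveRoots
  open Levels using (prime-∣^; prime-divides-prime)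
  open LocalSolutions using (prime[5])
  open RationalMatrices
  open FiveResidues
  open import Data.List using ([]; _∷_)
  open import Data.Nat as ℕ using (ℕ; zero; suc; s≤s; _<_)
  import Data.Nat.Properties as ℕP
  import Data.Nat.Divisibility as ℕD
  open import Data.Nat.Primality using (Prime; prime[2])
  open import Data.Integer as ℤ using (ℤ; +_; _+_; _*_; _-_; -_; 0ℤ; 1ℤ)
  import Data.Integer.Properties as ℤP
  open import Data.Integer.DivMod using (_%ℕ_; _/ℕ_; a≡a%ℕn+[a/ℕn]*n; n%ℕd<d)
  open import Data.Integer.Divisibility.Signed using (_∣_; divides; ∣⇒∣ᵤ; ∣ᵤ⇒∣; ∣-trans; _∣?_)
  open import Data.Integer.Tactic.RingSolver using (solve)
  open import Data.Product using (_×_; _,_; proj₁; proj₂; ∃-syntax)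
  open import Data.Sum using (_⊎_; inj₁; inj₂; [_,_]′)
  open import Data.Empty using (⊥; ⊥-elim)
  open import Relation.Nullary using (¬_; Dec; yes; no)
  open import Relation.Nullary.Decidable using (toWitnessFalse)
  open import Relation.Binary.PropositionalEquality using (_≡_; refl; sym; trans; cong; cong₂; subst)

  odd-form : ∀ a → ¬ + 2 ∣ a → ∃[ k ] a ≡ 1ℤ + + 2 * k
  odd-form a h = from (a %ℕ 2) (n%ℕd<d a 2) (a≡a%ℕn+[a/ℕn]*n a 2)
    where
    from : ∀ r → r < 2 → a ≡ + r + (a /ℕ 2) * + 2 → ∃[ k ] a ≡ 1ℤ + + 2 * k
    from 0 _ e = ⊥-elim (h (divides (a /ℕ 2) (trans e (ℤP.+-identityˡ _))))
    from 1 _ e = a /ℕ 2 , trans e (cong (λ z → 1ℤ + z) (ℤP.*-comm (a /ℕ 2) (+ 2)))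
    from (suc (suc _)) (s≤s (s≤s ())) e

  odd-square : ∀ a → ¬ + 2 ∣ a → + 8 ∣ a * a - 1ℤ
  odd-square a h = from (odd-form a h)
    where
    from : ∃[ k ] a ≡ 1ℤ + + 2 * k → + 8 ∣ a * a - 1ℤ
    from (k , refl) with + 2 ∣? k
    ... | yes (divides j refl) = divides (j + + 2 * (j * j)) (l j)
      where
      l : ∀ j → (1ℤ + + 2 * (j * + 2)) * (1ℤ + + 2 * (j * + 2)) - 1ℤ ≡ (j + + 2 * (j * j)) * + 8
      l j = solve (j ∷ [])
    ... | no o = from′ (odd-form k o)
      where
      from′ : ∃[ j ] k ≡ 1ℤ + + 2 * j → + 8 ∣ (1ℤ + + 2 * k) * (1ℤ + + 2 * k) - 1ℤ
      from′ (j , refl) = divides (+ 1 + + 3 * j + + 2 * (j * j)) (l j)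
        where
        l : ∀ j → (1ℤ + + 2 * (1ℤ + + 2 * j)) * (1ℤ + + 2 * (1ℤ + + 2 * j)) - 1ℤ ≡ (+ 1 + + 3 * j + + 2 * (j * j)) * + 8
        l j = solve (j ∷ [])

  odd-sum : ∀ a b → ¬ + 2 ∣ a → ¬ + 2 ∣ b → + 2 ∣ a + b
  odd-sum a b ha hb = from (odd-form a ha) (odd-form b hb)
    where
    from : ∃[ k ] a ≡ 1ℤ + + 2 * k → ∃[ k ] b ≡ 1ℤ + + 2 * k → + 2 ∣ a + b
    from (k , refl) (j , refl) = divides (1ℤ + k + j) (l k j)
      where
      l : ∀ k j → 1ℤ + + 2 * k + (1ℤ + + 2 * j) ≡ (1ℤ + k + j) * + 2
      l k j = solve (k ∷ j ∷ [])

  private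
    module T = PrimeModulus prime[2]
    module V = PrimeModulus prime[5]

    idem : ∀ {A : Set} → A ⊎ A → A
    idem = [ (λ z → z) , (λ z → z) ]′

  module Descent (ℓ : ℕ) (ℓ-prime : Prime ℓ) (ℓ≢2 : ¬ ℓ ≡ 2) (ℓ-five : + 5 ∣ + ℓ * + ℓ - 1ℤ)
      (ν : ℤ) (ν-primes : ∀ p → Prime p → p ℕD.∣ ℤ.∣ ν ∣ → ¬ p ≡ 2 × + 5 ∣ + p * + p - 1ℤ) where

    2∤ν : ¬ + 2 ∣ ν
    2∤ν t = proj₁ (ν-primes 2 prime[2] (∣⇒∣ᵤ t)) refl

    private
      5∤24 : ¬ + 5 ∣ + 24
      5∤24 t = toWitnessFalse {a? = 5 ℕD.∣? 24} _ (∣⇒∣ᵤ t)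

    5∤ν : ¬ + 5 ∣ ν
    5∤ν t = 5∤24 (proj₂ (ν-primes 5 prime[5] (∣⇒∣ᵤ t)))

    module _ (s : ℕ) where
      d : ℤ
      d = + (ℓ ℕ.^ s)

      d-five : + 5 ∣ d * d - 1ℤ
      d-five = go s
        where
        go : ∀ s → + 5 ∣ + (ℓ ℕ.^ s) * + (ℓ ℕ.^ s) - 1ℤ
        go zero = divides 0ℤ refl
        go (suc s) = by ((+ (ℓ ℕ.^ s) * + (ℓ ℕ.^ s)) ⊛ ℓ-five ⊕ go s) (trans (cong (λ z → z * z - 1ℤ) (ℤP.pos-* ℓ (ℓ ℕ.^ s))) (l (+ ℓ) (+ (ℓ ℕ.^ s))))
          where
          l : ∀ a b → a * b * (a * b) - 1ℤ ≡ b * b * (a * a - 1ℤ) + (b * b - 1ℤ)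
          l a b = solve (a ∷ b ∷ [])

      prime-∣d : ∀ r → Prime r → + r ∣ d → r ≡ ℓ
      prime-∣d r pr t = prime-divides-prime pr ℓ-prime (prime-∣^ pr ℓ s (∣⇒∣ᵤ t))

      2∤d : ¬ + 2 ∣ d
      2∤d t = ℓ≢2 (sym (prime-∣d 2 prime[2] t))

      5∤d : ¬ + 5 ∣ d
      5∤d t = V.P∤1 (by (d ⊛ t ⊕ (- 1ℤ) ⊛ d-five) (l d))
        where
        l : ∀ d → 1ℤ ≡ d * d + - 1ℤ * (d * d - 1ℤ)
        l d = solve (d ∷ [])

      -- The Fricke relation tr² + tr² + tr² - tr tr tr = 4 + 20 ν² for tr X, tr Y, tr XY, with denominator d cleared.
      Eq : ℤ → ℤ → ℤ → Set
      Eq U V Z = d * (U * U + V * V + Z * Z) - U * V * Z ≡ (+ 4 + + 20 * (ν * ν)) * (d * d * d)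

      Eq-swap : ∀ {U V Z} → Eq U V Z → Eq U Z V
      Eq-swap {U} {V} {Z} e = trans (l d U V Z) e
        where
        l : ∀ d U V Z → d * (U * U + Z * Z + V * V) - U * Z * V ≡ d * (U * U + V * V + Z * Z) - U * V * Z
        l d U V Z = solve (d ∷ U ∷ V ∷ Z ∷ [])

      Eq-rotate : ∀ {U V Z} → Eq U V Z → Eq V Z U
      Eq-rotate {U} {V} {Z} e = trans (l d U V Z) e
        where
        l : ∀ d U V Z → d * (V * V + Z * Z + U * U) - V * Z * U ≡ d * (U * U + V * V + Z * Z) - U * V * Z
        l d U V Z = solve (d ∷ U ∷ V ∷ Z ∷ [])

      Eq-flip : ∀ {U V Z} → Eq U V Z → Eq (- U) V (- Z)
      Eq-flip {U} {V} {Z} e = trans (l d U V Z) e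
        where
        l : ∀ d U V Z → d * (- U * - U + V * V + - Z * - Z) - - U * V * - Z ≡ d * (U * U + V * V + Z * Z) - U * V * Z
        l d U V Z = solve (d ∷ U ∷ V ∷ Z ∷ [])

      product : ∀ U V Z → Eq U V Z → (U * U - + 4 * (d * d)) * (V * V - + 4 * (d * d)) ≡ (+ 2 * d * Z - U * V) * (+ 2 * d * Z - U * V) - + 5 * (+ 4 * (ν * (d * d)) * (+ 4 * (ν * (d * d))))
      product U V Z e = trans (l d U V Z) (trans (cong (λ z → (+ 2 * d * Z - U * V) * (+ 2 * d * Z - U * V) - + 4 * d * z + + 16 * (d * d * d * d)) e) (l′ d ν ((+ 2 * d * Z - U * V) * (+ 2 * d * Z - U * V))))
        where
        l : ∀ d U V Z → (U * U - + 4 * (d * d)) * (V * V - + 4 * (d * d)) ≡ (+ 2 * d * Z - U * V) * (+ 2 * d * Z - U * V) - + 4 * d * (d * (U * U + V * V + Z * Z) - U * V * Z) + + 16 * (d * d * d * d)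
        l d U V Z = solve (d ∷ U ∷ V ∷ Z ∷ [])
        l′ : ∀ d ν W → W - + 4 * d * ((+ 4 + + 20 * (ν * ν)) * (d * d * d)) + + 16 * (d * d * d * d) ≡ W - + 5 * (+ 4 * (ν * (d * d)) * (+ 4 * (ν * (d * d))))
        l′ d ν W = solve (d ∷ ν ∷ W ∷ [])

      five-factor : ∀ U V Z → Eq U V Z → ∀ u w → u * w ≡ U * U - + 4 * (d * d) → ¬ + 2 ∣ u → Five u
      five-factor U V Z e u w uw 2∤u = from (ℤP.+∣i∣≡i⊎+∣i∣≡-i u) (five-product ℤ.∣ u ∣ positive prime-factor)
        where
        from : + ℤ.∣ u ∣ ≡ u ⊎ + ℤ.∣ u ∣ ≡ - u → Five (+ ℤ.∣ u ∣) → Five u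
        from (inj₁ f) h = subst Five f h
        from (inj₂ f) (inj₁ t) = inj₁ (by (- 1ℤ ⊛ t) (trans (l u) (cong (λ z → - 1ℤ * z) (sym f))))
          where
          l : ∀ u → u ≡ - 1ℤ * - u
          l u = solve (u ∷ [])
        from (inj₂ f) (inj₂ t) = inj₂ (by t (trans (l u) (cong (λ z → z * z - 1ℤ) (sym f))))
          where
          l : ∀ u → u * u - 1ℤ ≡ - u * - u - 1ℤ
          l u = solve (u ∷ [])
        positive : 0 < ℤ.∣ u ∣
        positive = ℕP.n≢0⇒n>0 λ z → 2∤u (subst (+ 2 ∣_) (sym (ℤP.∣i∣≡0⇒i≡0 z)) (divides 0ℤ refl))
        W T : ℤ
        W = + 2 * d * Z - U * V
        T = + 4 * (ν * (d * d))
        prime-factor : ∀ r → Prime r → r ℕD.∣ ℤ.∣ u ∣ → Five (+ r)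
        prime-factor r pr r∣u = split (+ r ∣? T)
          where
          module E = PrimeModulus pr
          r≢2 : ¬ r ≡ 2
          r≢2 refl = 2∤u (∣ᵤ⇒∣ r∣u)
          l : ∀ u w v → u * w * v ≡ w * v * u
          l u w v = solve (u ∷ w ∷ v ∷ [])
          split : Dec (+ r ∣ T) → Five (+ r)
          split (no r∤T) = FiveIsSquare.five pr r≢2 W T r∤T (by ((w * (V * V - + 4 * (d * d))) ⊛ ∣ᵤ⇒∣ r∣u) (trans (sym (product U V Z e)) (trans (cong (λ z → z * (V * V - + 4 * (d * d))) (sym uw)) (l u w (V * V - + 4 * (d * d))))))
          split (yes r∣T) = [ (λ t → ⊥-elim (r≢2 (prime-divides-prime pr prime[2] (∣⇒∣ᵤ (idem (E.euclid (+ 2) (+ 2) t)))))) ,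
            (λ t → [ (λ t → inj₂ (proj₂ (ν-primes r pr (∣⇒∣ᵤ t)))) , (λ t → subst (λ z → Five (+ z)) (sym (prime-∣d r pr (idem (E.euclid d d t)))) (inj₂ ℓ-five)) ]′ (E.euclid ν (d * d) t)) ]′ (E.euclid (+ 4) (ν * (d * d)) r∣T)

      square₅ : ∀ U V Z → Eq U V Z → ¬ + 2 ∣ U → + 5 ∣ U - + 2 * d ⊎ + 5 ∣ U + + 2 * d
      square₅ U V Z e odd = combine (five-factor U V Z e (U - + 2 * d) (U + + 2 * d) (l U d) (λ t → odd (by (t ⊕ d ⊛ divides 1ℤ refl) (l₁ U d))))
          (five-factor U V Z e (U + + 2 * d) (U - + 2 * d) (l′ U d) (λ t → odd (by (t ⊕ (- d) ⊛ divides 1ℤ refl) (l₂ U d))))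
        where
        l : ∀ U d → (U - + 2 * d) * (U + + 2 * d) ≡ U * U - + 4 * (d * d)
        l U d = solve (U ∷ d ∷ [])
        l′ : ∀ U d → (U + + 2 * d) * (U - + 2 * d) ≡ U * U - + 4 * (d * d)
        l′ U d = solve (U ∷ d ∷ [])
        l₁ : ∀ U d → U ≡ U - + 2 * d + d * + 2
        l₁ U d = solve (U ∷ d ∷ [])
        l₂ : ∀ U d → U ≡ U + + 2 * d + - d * + 2
        l₂ U d = solve (U ∷ d ∷ [])
        combine : Five (U - + 2 * d) → Five (U + + 2 * d) → + 5 ∣ U - + 2 * d ⊎ + 5 ∣ U + + 2 * d
        combine (inj₁ t) _ = inj₁ t
        combine (inj₂ _) (inj₁ t) = inj₂ t
        combine (inj₂ t) (inj₂ t') = ⊥-elim ([ 5∤8 , (λ h → [ 5∤U , 5∤d ]′ (V.euclid U d h)) ]′ (V.euclid (+ 8) (U * d) (by (t' ⊕ (- 1ℤ) ⊛ t) (l₃ U d))))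
          where
          l₃ : ∀ U d → + 8 * (U * d) ≡ (U + + 2 * d) * (U + + 2 * d) - 1ℤ + - 1ℤ * ((U - + 2 * d) * (U - + 2 * d) - 1ℤ)
          l₃ U d = solve (U ∷ d ∷ [])
          5∤8 : ¬ + 5 ∣ + 8
          5∤8 h = toWitnessFalse {a? = 5 ℕD.∣? 8} _ (∣⇒∣ᵤ h)
          5∤3 : ¬ + 5 ∣ + 3
          5∤3 h = toWitnessFalse {a? = 5 ℕD.∣? 3} _ (∣⇒∣ᵤ h)
          5∤U : ¬ + 5 ∣ U
          5∤U h = 5∤3 (by (t ⊕ (- (U - + 4 * d)) ⊛ h ⊕ (- + 4) ⊛ d-five) (l₄ U d))
            where
            l₄ : ∀ U d → + 3 ≡ (U - + 2 * d) * (U - + 2 * d) - 1ℤ + - (U - + 4 * d) * U + - + 4 * (d * d - 1ℤ)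
            l₄ U d = solve (U ∷ d ∷ [])

      aligned : ∀ U V Z → Eq U V Z → + 5 ∣ U - + 2 * d → + 5 ∣ V - + 2 * d → ⊥
      aligned U V Z e (divides x f) (divides y g) = from (idem (V.euclid ζ ζ ([ (λ t → ⊥-elim (5∤d t)) , (λ t → t) ]′ (V.euclid d (ζ * ζ) square))))
        where
        ζ : ℤ
        ζ = Z - + 2 * d
        expand : ∀ ξ η ζ → U - + 2 * d ≡ ξ → V - + 2 * d ≡ η → Z - + 2 * d ≡ ζ → d * (ξ * ξ + η * η + ζ * ζ) - + 2 * d * (ξ * η + η * ζ + ζ * ξ) - ξ * η * ζ ≡ + 20 * (ν * ν) * (d * d * d)
        expand _ _ _ refl refl refl = trans (l d U V Z) (trans (cong (λ z → z - + 4 * (d * d * d)) e) (l′ d ν))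
          where
          l : ∀ d U V Z → d * ((U - + 2 * d) * (U - + 2 * d) + (V - + 2 * d) * (V - + 2 * d) + (Z - + 2 * d) * (Z - + 2 * d)) - + 2 * d * ((U - + 2 * d) * (V - + 2 * d) + (V - + 2 * d) * (Z - + 2 * d) + (Z - + 2 * d) * (U - + 2 * d)) - (U - + 2 * d) * (V - + 2 * d) * (Z - + 2 * d)
            ≡ d * (U * U + V * V + Z * Z) - U * V * Z - + 4 * (d * d * d)
          l d U V Z = solve (d ∷ U ∷ V ∷ Z ∷ [])
          l′ : ∀ d ν → (+ 4 + + 20 * (ν * ν)) * (d * d * d) - + 4 * (d * d * d) ≡ + 20 * (ν * ν) * (d * d * d)
          l′ d ν = solve (d ∷ ν ∷ [])
        square : + 5 ∣ d * (ζ * ζ)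
        square = divides (+ 4 * (ν * ν) * (d * d * d) - d * (+ 5 * (x * x) + + 5 * (y * y)) + + 2 * d * (+ 5 * (x * y) + y * ζ + ζ * x) + + 5 * (x * y) * ζ)
          (trans (l d x y ζ) (trans (cong (λ z → z - d * (x * + 5 * (x * + 5) + y * + 5 * (y * + 5)) + + 2 * d * (x * + 5 * (y * + 5) + y * + 5 * ζ + ζ * (x * + 5)) + x * + 5 * (y * + 5) * ζ) (expand (x * + 5) (y * + 5) ζ f g refl)) (l′ d x y ζ ν)))
          where
          l : ∀ d x y ζ → d * (ζ * ζ) ≡ d * (x * + 5 * (x * + 5) + y * + 5 * (y * + 5) + ζ * ζ) - + 2 * d * (x * + 5 * (y * + 5) + y * + 5 * ζ + ζ * (x * + 5)) - x * + 5 * (y * + 5) * ζ - d * (x * + 5 * (x * + 5) + y * + 5 * (y * + 5)) + + 2 * d * (x * + 5 * (y * + 5) + y * + 5 * ζ + ζ * (x * + 5)) + x * + 5 * (y * + 5) * ζ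
          l d x y ζ = solve (d ∷ x ∷ y ∷ ζ ∷ [])
          l′ : ∀ d x y ζ ν → + 20 * (ν * ν) * (d * d * d) - d * (x * + 5 * (x * + 5) + y * + 5 * (y * + 5)) + + 2 * d * (x * + 5 * (y * + 5) + y * + 5 * ζ + ζ * (x * + 5)) + x * + 5 * (y * + 5) * ζ
            ≡ (+ 4 * (ν * ν) * (d * d * d) - d * (+ 5 * (x * x) + + 5 * (y * y)) + + 2 * d * (+ 5 * (x * y) + y * ζ + ζ * x) + + 5 * (x * y) * ζ) * + 5
          l′ d x y ζ ν = solve (d ∷ x ∷ y ∷ ζ ∷ ν ∷ [])
        from : + 5 ∣ ζ → ⊥
        from (divides z h) = [ 5∤4 , (λ t → [ (λ t → 5∤ν (idem (V.euclid ν ν t))) , (λ t → [ (λ t → 5∤d (idem (V.euclid d d t))) , 5∤d ]′ (V.euclid (d * d) d t)) ]′ (V.euclid (ν * ν) (d * d * d) t)) ]′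
            (V.euclid (+ 4) (ν * ν * (d * d * d)) (divides (d * (x * x + y * y + z * z) - + 2 * d * (x * y + y * z + z * x) - + 5 * (x * y * z)) (ℤP.*-cancelˡ-≡ (+ 5) _ _ (trans (l ν d) (trans (sym (expand (x * + 5) (y * + 5) (z * + 5) f g h)) (l′ d x y z))))))
          where
          5∤4 : ¬ + 5 ∣ + 4
          5∤4 h = toWitnessFalse {a? = 5 ℕD.∣? 4} _ (∣⇒∣ᵤ h)
          l : ∀ ν d → + 5 * (+ 4 * (ν * ν * (d * d * d))) ≡ + 20 * (ν * ν) * (d * d * d)
          l ν d = solve (ν ∷ d ∷ [])
          l′ : ∀ d x y z → d * (x * + 5 * (x * + 5) + y * + 5 * (y * + 5) + z * + 5 * (z * + 5)) - + 2 * d * (x * + 5 * (y * + 5) + y * + 5 * (z * + 5) + z * + 5 * (x * + 5)) - x * + 5 * (y * + 5) * (z * + 5)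
            ≡ + 5 * ((d * (x * x + y * y + z * z) - + 2 * d * (x * y + y * z + z * x) - + 5 * (x * y * z)) * + 5)
          l′ d x y z = solve (d ∷ x ∷ y ∷ z ∷ [])

      two-odd : ∀ U V Z → Eq U V Z → ¬ + 2 ∣ U → ¬ + 2 ∣ V → ⊥
      two-odd U V Z e oU oV = cases (square₅ U V Z e oU) (square₅ V Z U (Eq-rotate {U} {V} {Z} e) oV)
        where
        opposite : ∀ U → + 5 ∣ U + + 2 * d → + 5 ∣ - U - + 2 * d
        opposite U t = by (- 1ℤ ⊛ t) (l U d)
          where
          l : ∀ U d → - U - + 2 * d ≡ - 1ℤ * (U + + 2 * d)
          l U d = solve (U ∷ d ∷ [])
        cases : + 5 ∣ U - + 2 * d ⊎ + 5 ∣ U + + 2 * d → + 5 ∣ V - + 2 * d ⊎ + 5 ∣ V + + 2 * d → ⊥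
        cases (inj₁ f) (inj₁ g) = aligned U V Z e f g
        cases (inj₂ f) (inj₁ g) = aligned (- U) V (- Z) (Eq-flip {U} {V} {Z} e) (opposite U f) g
        cases (inj₁ f) (inj₂ g) = aligned (- V) U (- Z) (Eq-flip {V} {U} {Z} (Eq-swap {V} {Z} {U} (Eq-rotate {U} {V} {Z} e))) (opposite V g) f
        cases (inj₂ f) (inj₂ g) = aligned (- U) (- V) Z (trans (l d U V Z) e) (opposite U f) (opposite V g)
          where
          l : ∀ d U V Z → d * (- U * - U + - V * - V + Z * Z) - - U * - V * Z ≡ d * (U * U + V * V + Z * Z) - U * V * Z
          l d U V Z = solve (d ∷ U ∷ V ∷ Z ∷ [])

      one-odd : ∀ U V Z → Eq U V Z → ¬ + 2 ∣ U → + 2 ∣ V → + 2 ∣ Z → ⊥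
      one-odd U V Z e oU hV hZ = [ 2∤d , (λ t → oU (idem (T.euclid U U t))) ]′ (T.euclid d (U * U) (by ((- (d * V) + U * Z) ⊛ hV ⊕ (- (d * Z)) ⊛ hZ ⊕ ((+ 2 + + 10 * (ν * ν)) * (d * d * d)) ⊛ divides 1ℤ refl) (l′ e)))
        where
        l₁ : ∀ d U V Z → d * (U * U) ≡ - (d * V) * V + U * Z * V + - (d * Z) * Z + (d * (U * U + V * V + Z * Z) - U * V * Z)
        l₁ d U V Z = solve (d ∷ U ∷ V ∷ Z ∷ [])
        l₂ : ∀ d U V Z ν → - (d * V) * V + U * Z * V + - (d * Z) * Z + (+ 4 + + 20 * (ν * ν)) * (d * d * d) ≡ (- (d * V) + U * Z) * V + - (d * Z) * Z + (+ 2 + + 10 * (ν * ν)) * (d * d * d) * + 2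
        l₂ d U V Z ν = solve (d ∷ U ∷ V ∷ Z ∷ ν ∷ [])
        l′ : Eq U V Z → d * (U * U) ≡ (- (d * V) + U * Z) * V + - (d * Z) * Z + (+ 2 + + 10 * (ν * ν)) * (d * d * d) * + 2
        l′ e = trans (l₁ d U V Z) (trans (cong (λ z → - (d * V) * V + U * Z * V + - (d * Z) * Z + z) e) (l₂ d U V Z ν))

      Half : ℤ → ℤ → ℤ → Set
      Half U V Z = d * (U * U + V * V + Z * Z) - + 2 * (U * V * Z) ≡ (1ℤ + + 5 * (ν * ν)) * (d * d * d)

      private
        2∤d³ : ¬ + 2 ∣ d * d * d
        2∤d³ t = [ (λ t → 2∤d (idem (T.euclid d d t))) , 2∤d ]′ (T.euclid (d * d) d t)

        ν² : + 8 ∣ ν * ν - 1ℤ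
        ν² = odd-square ν 2∤ν

      half-even : ∀ U V Z → ¬ Half (U * + 2) (V * + 2) (Z * + 2)
      half-even U V Z e = 2∤d³ (by (((d * (U * U + V * V + Z * Z) - + 4 * (U * V * Z)) - d * d * d) ⊛ divides {+ 2} {+ 2} 1ℤ refl ⊕ (- (+ 5 * (d * d * d))) ⊛ quarter ν²) (ℤP.*-cancelˡ-≡ (+ 2) _ _ (l′ ν² e)))
        where
        quarter : (t : + 8 ∣ ν * ν - 1ℤ) → + 2 ∣ _∣_.quotient t * + 4
        quarter (divides q _) = divides (q * + 2) (l q)
          where
          l : ∀ q → q * + 4 ≡ q * + 2 * + 2
          l q = solve (q ∷ [])
        l₁ : ∀ D N → + 2 * D ≡ (1ℤ + + 5 * N) * D - + 4 * D - + 5 * (N - 1ℤ) * D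
        l₁ D N = solve (D ∷ N ∷ [])
        l₂ : ∀ d U V Z q D → d * (U * + 2 * (U * + 2) + V * + 2 * (V * + 2) + Z * + 2 * (Z * + 2)) - + 2 * (U * + 2 * (V * + 2) * (Z * + 2)) - + 4 * D - + 5 * (q * + 8) * D
          ≡ + 2 * ((d * (U * U + V * V + Z * Z) - + 4 * (U * V * Z) - D) * + 2 + - (+ 5 * D) * (q * + 4))
        l₂ d U V Z q D = solve (d ∷ U ∷ V ∷ Z ∷ q ∷ D ∷ [])
        l′ : (t : + 8 ∣ ν * ν - 1ℤ) → Half (U * + 2) (V * + 2) (Z * + 2) → + 2 * (d * d * d) ≡ + 2 * (((d * (U * U + V * V + Z * Z) - + 4 * (U * V * Z)) - d * d * d) * + 2 + - (+ 5 * (d * d * d)) * (_∣_.quotient t * + 4))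
        l′ (divides q h) e = trans (l₁ (d * d * d) (ν * ν)) (trans (cong₂ (λ y z → y - + 4 * (d * d * d) - + 5 * z * (d * d * d)) (sym e) h) (l₂ d U V Z q (d * d * d)))

      half-mixed : ∀ U V z → ¬ + 2 ∣ U → ¬ + 2 ∣ V → ¬ Half U V (z * + 2)
      half-mixed U V z oU oV e = from (odd-square U oU) (odd-square V oV) ν² (odd-square d 2∤d)
        where
        parity : + 2 ∣ z * (d * z - U * V) - d → ⊥
        parity t = split (+ 2 ∣? z)
          where
          l₁ : ∀ w → w ≡ - 1ℤ * - w
          l₁ w = solve (w ∷ [])
          l : ∀ d z w → d ≡ - 1ℤ * (z * (d * z - w) - d) + z * (d * z + - w)
          l d z w = solve (d ∷ z ∷ w ∷ [])
          l₀ : ∀ d z w → d ≡ - 1ℤ * (z * (d * z - w) - d) + (d * z - w) * z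
          l₀ d z w = solve (d ∷ z ∷ w ∷ [])
          split : Dec (+ 2 ∣ z) → ⊥
          split (yes h) = 2∤d (by ((- 1ℤ) ⊛ t ⊕ (d * z - U * V) ⊛ h) (l₀ d z (U * V)))
          split (no oz) = 2∤d (by ((- 1ℤ) ⊛ t ⊕ z ⊛ odd-sum (d * z) (- (U * V)) (T.∤-* d z 2∤d oz) (λ h → T.∤-* U V oU oV (by (- 1ℤ ⊛ h) (l₁ (U * V))))) (l d z (U * V)))
        from : + 8 ∣ U * U - 1ℤ → + 8 ∣ V * V - 1ℤ → + 8 ∣ ν * ν - 1ℤ → + 8 ∣ d * d - 1ℤ → ⊥
        from (divides a fa) (divides b fb) (divides c fc) (divides k fd) = parity (divides (- (a * d) - b * d + + 5 * c * (d * d * d) + + 6 * k * d) (ℤP.*-cancelˡ-≡ (+ 4) _ _ (trans (l₁ d z (U * V)) (trans (cong₂ _-_ (trans (l₂ d U V z) refl) refl) (l₅ e)))))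
          where
          -- 4 (z (d z - U V) - d) is the Half relation minus terms divisible by 8.
          l₁ : ∀ d z w → + 4 * (z * (d * z - w) - d) ≡ d * (z * + 2 * (z * + 2)) - + 4 * (w * z) - + 4 * d
          l₁ d z w = solve (d ∷ z ∷ w ∷ [])
          l₂ : ∀ d U V z → d * (z * + 2 * (z * + 2)) - + 4 * (U * V * z) ≡ d * (U * U + V * V + z * + 2 * (z * + 2)) - + 2 * (U * V * (z * + 2)) - d * (U * U - 1ℤ) - d * (V * V - 1ℤ) - + 2 * d
          l₂ d U V z = solve (d ∷ U ∷ V ∷ z ∷ [])
          l₃ : ∀ d ν A B → (1ℤ + + 5 * (ν * ν)) * (d * d * d) - d * A - d * B - + 2 * d - + 4 * d ≡ + 5 * (ν * ν - 1ℤ) * (d * d * d) + + 6 * d * (d * d - 1ℤ) - d * A - d * B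
          l₃ d ν A B = solve (d ∷ ν ∷ A ∷ B ∷ [])
          l₄ : ∀ d a b c k → + 5 * (c * + 8) * (d * d * d) + + 6 * d * (k * + 8) - d * (a * + 8) - d * (b * + 8) ≡ + 4 * ((- (a * d) - b * d + + 5 * c * (d * d * d) + + 6 * k * d) * + 2)
          l₄ d a b c k = solve (d ∷ a ∷ b ∷ c ∷ k ∷ [])
          l₅ : Half U V (z * + 2) → d * (U * U + V * V + z * + 2 * (z * + 2)) - + 2 * (U * V * (z * + 2)) - d * (U * U - 1ℤ) - d * (V * V - 1ℤ) - + 2 * d - + 4 * d ≡ + 4 * ((- (a * d) - b * d + + 5 * c * (d * d * d) + + 6 * k * d) * + 2)
          l₅ e = trans (cong (λ y → y - d * (U * U - 1ℤ) - d * (V * V - 1ℤ) - + 2 * d - + 4 * d) e) (trans (l₃ d ν (U * U - 1ℤ) (V * V - 1ℤ))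
            (trans (cong₂ (λ n k → + 5 * n * (d * d * d) + + 6 * d * k - d * (U * U - 1ℤ) - d * (V * V - 1ℤ)) fc fd) (trans (cong₂ (λ A B → + 5 * (c * + 8) * (d * d * d) + + 6 * d * (k * + 8) - d * A - d * B) fa fb) (l₄ d a b c k))))

      half-sum : ∀ U V Z → Half U V Z → + 2 ∣ U + V + Z
      half-sum U V Z e = idem (T.euclid (U + V + Z) (U + V + Z) ([ (λ t → ⊥-elim (2∤d t)) , (λ t → t) ]′ (T.euclid d ((U + V + Z) * (U + V + Z)) (from ν²))))
        where
        l₁ : ∀ d U V Z → d * ((U + V + Z) * (U + V + Z)) ≡ d * (U * U + V * V + Z * Z) - + 2 * (U * V * Z) + (U * V * Z + d * (U * V + V * Z + Z * U)) * + 2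
        l₁ d U V Z = solve (d ∷ U ∷ V ∷ Z ∷ [])
        l₂ : ∀ D N R → (1ℤ + + 5 * N) * D + R * + 2 ≡ + 5 * D * (N - 1ℤ) + (+ 3 * D + R) * + 2
        l₂ D N R = solve (D ∷ N ∷ R ∷ [])
        from : + 8 ∣ ν * ν - 1ℤ → + 2 ∣ d * ((U + V + Z) * (U + V + Z))
        from t = by ((+ 5 * (d * d * d)) ⊛ ∣-trans (divides (+ 4) refl) t ⊕ (+ 3 * (d * d * d) + (U * V * Z + d * (U * V + V * Z + Z * U))) ⊛ divides 1ℤ refl)
          (trans (l₁ d U V Z) (trans (cong (λ y → y + (U * V * Z + d * (U * V + V * Z + Z * U)) * + 2) e) (l₂ (d * d * d) (ν * ν) (U * V * Z + d * (U * V + V * Z + Z * U)))))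

      not-half : ∀ U V Z → ¬ Half U V Z
      not-half U V Z e = cases U V Z e (half-sum U V Z e) (+ 2 ∣? U) (+ 2 ∣? V) (+ 2 ∣? Z)
        where
        m₁ : ∀ d U V Z → d * (U * U + Z * Z + V * V) - + 2 * (U * Z * V) ≡ d * (U * U + V * V + Z * Z) - + 2 * (U * V * Z)
        m₁ d U V Z = solve (d ∷ U ∷ V ∷ Z ∷ [])
        m₂ : ∀ d U V Z → d * (V * V + Z * Z + U * U) - + 2 * (V * Z * U) ≡ d * (U * U + V * V + Z * Z) - + 2 * (U * V * Z)
        m₂ d U V Z = solve (d ∷ U ∷ V ∷ Z ∷ [])
        l₁ : ∀ U V Z → U ≡ U + V + Z + - 1ℤ * V + - 1ℤ * Z
        l₁ U V Z = solve (U ∷ V ∷ Z ∷ [])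
        l₂ : ∀ U V Z → V ≡ U + V + Z + - 1ℤ * U + - 1ℤ * Z
        l₂ U V Z = solve (U ∷ V ∷ Z ∷ [])
        l₃ : ∀ U V Z → Z ≡ U + V + Z + - 1ℤ * U + - 1ℤ * V
        l₃ U V Z = solve (U ∷ V ∷ Z ∷ [])
        l₄ : ∀ U V Z → Z ≡ U + V + Z + - 1ℤ * (U + V)
        l₄ U V Z = solve (U ∷ V ∷ Z ∷ [])
        even : ∀ {U V Z} → Half U V Z → + 2 ∣ U → + 2 ∣ V → + 2 ∣ Z → ⊥
        even e (divides u refl) (divides v refl) (divides z refl) = half-even u v z e
        mixed : ∀ {U V Z} → Half U V Z → ¬ + 2 ∣ U → ¬ + 2 ∣ V → + 2 ∣ Z → ⊥
        mixed {U} {V} e oU oV (divides z refl) = half-mixed U V z oU oV e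
        cases : ∀ U V Z → Half U V Z → + 2 ∣ U + V + Z → Dec (+ 2 ∣ U) → Dec (+ 2 ∣ V) → Dec (+ 2 ∣ Z) → ⊥
        cases U V Z e t (yes hU) (yes hV) (yes hZ) = even {U} {V} {Z} e hU hV hZ
        cases U V Z e t (no oU) (no oV) (yes hZ) = mixed {U} {V} {Z} e oU oV hZ
        cases U V Z e t (no oU) (yes hV) (no oZ) = mixed {U} {Z} {V} (trans (m₁ d U V Z) e) oU oZ hV
        cases U V Z e t (yes hU) (no oV) (no oZ) = mixed {V} {Z} {U} (trans (m₂ d U V Z) e) oV oZ hU
        cases U V Z e t (no oU) (yes hV) (yes hZ) = oU (by (t ⊕ (- 1ℤ) ⊛ hV ⊕ (- 1ℤ) ⊛ hZ) (l₁ U V Z))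
        cases U V Z e t (yes hU) (no oV) (yes hZ) = oV (by (t ⊕ (- 1ℤ) ⊛ hU ⊕ (- 1ℤ) ⊛ hZ) (l₂ U V Z))
        cases U V Z e t (yes hU) (yes hV) (no oZ) = oZ (by (t ⊕ (- 1ℤ) ⊛ hU ⊕ (- 1ℤ) ⊛ hV) (l₃ U V Z))
        cases U V Z e t (no oU) (no oV) (no oZ) = oZ (by (t ⊕ (- 1ℤ) ⊛ odd-sum U V oU oV) (l₄ U V Z))

      no-solution : ∀ U V Z → ¬ Eq U V Z
      no-solution U V Z e = cases (+ 2 ∣? U) (+ 2 ∣? V) (+ 2 ∣? Z)
        where
        even : ∀ {U V Z} → Eq U V Z → + 2 ∣ U → + 2 ∣ V → + 2 ∣ Z → ⊥
        even e (divides u refl) (divides v refl) (divides z refl) = not-half u v z (ℤP.*-cancelˡ-≡ (+ 4) _ _ (trans (l d u v z) (trans e (l′ d ν))))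
          where
          l : ∀ d u v z → + 4 * (d * (u * u + v * v + z * z) - + 2 * (u * v * z)) ≡ d * (u * + 2 * (u * + 2) + v * + 2 * (v * + 2) + z * + 2 * (z * + 2)) - u * + 2 * (v * + 2) * (z * + 2)
          l d u v z = solve (d ∷ u ∷ v ∷ z ∷ [])
          l′ : ∀ d ν → (+ 4 + + 20 * (ν * ν)) * (d * d * d) ≡ + 4 * ((1ℤ + + 5 * (ν * ν)) * (d * d * d))
          l′ d ν = solve (d ∷ ν ∷ [])
        cases : Dec (+ 2 ∣ U) → Dec (+ 2 ∣ V) → Dec (+ 2 ∣ Z) → ⊥
        cases (no oU) (no oV) _ = two-odd U V Z e oU oV
        cases (no oU) (yes _) (no oZ) = two-odd U Z V (Eq-swap {U} {V} {Z} e) oU oZ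
        cases (yes _) (no oV) (no oZ) = two-odd V Z U (Eq-rotate {U} {V} {Z} e) oV oZ
        cases (no oU) (yes hV) (yes hZ) = one-odd U V Z e oU hV hZ
        cases (yes hU) (no oV) (yes hZ) = one-odd V Z U (Eq-rotate {U} {V} {Z} e) oV hZ hU
        cases (yes hU) (yes hV) (no oZ) = one-odd Z U V (Eq-rotate {V} {Z} {U} (Eq-rotate {U} {V} {Z} e)) oZ hU hV
        cases (yes hU) (yes hV) (yes hZ) = even {U} {V} {Z} e hU hV hZ

module Conclusion where
  open import Defs hiding (a; b; c; d)
  open ElementaryRelations using (_⊛_; _⊕_; by)
  open PrimePowers
  open PrimitiveRoots
  open Levels using (prime>1; prime-∣^; prime-divides-prime)
  open CongruenceKernel using (pos-^)
  open LocalSolutions using (matA-in-SL₂; prime[5])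
  open CommutatorQuotients using (commutator-mod)
  open RationalMatrices
  open FiveResidues
  open TraceDescent
  open import Data.List using ([]; _∷_)
  open import Data.Nat as ℕ using (ℕ; suc; z≤n; s≤s; _≤_; _<_; _!; _%_)
  import Data.Nat.Properties as ℕP
  import Data.Nat.Divisibility as ℕD
  import Data.Nat.DivMod as ℕM
  open import Data.Nat.Primality using (Prime; prime?)
  open import Data.Integer as ℤ using (ℤ; +_; 1ℤ)
  import Data.Integer.Properties as ℤP
  import Data.Integer.Divisibility as ℤD
  open import Data.Integer.Divisibility.Signed using (_∣_; divides; ∣⇒∣ᵤ; ∣ᵤ⇒∣; ∣-trans)
  open import Data.Integer.Tactic.RingSolver using (solve)
  open import Data.Rational using (ℚ; _+_; _*_; _-_; -_; 1ℚ)
  import Data.Rational.Properties as ℚP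
  open import Data.Product using (_×_; _,_; Σ; ∃-syntax)
  open import Data.Sum using (_⊎_; inj₁; inj₂; [_,_]′)
  open import Data.Empty using (⊥-elim)
  open import Function.Definitions using (Injective)
  open import Relation.Binary.Definitions using (tri<; tri≈; tri>)
  open import Relation.Nullary using (¬_)
  open import Relation.Nullary.Decidable using (toWitness)
  open import Relation.Binary.PropositionalEquality using (_≡_; refl; sym; trans; cong; cong₂; subst)
  open import Tactic.RingSolver using (solve-∀)

  trace : Mat → ℚ
  trace (mat a b c d) = a + d

  fricke : ∀ X Y → det X ≡ 1ℚ → det Y ≡ 1ℚ →
    let x = trace X ; y = trace Y ; z = trace (X · Y) in trace (comm X Y) ≡ x * x + y * y + z * z - x * y * z - (1ℚ + 1ℚ)
  fricke (mat a b c d) (mat e f g h) p q = trans (l a b c d e f g h) (trans (cong₂ (λ u v → v * ((a + d) * (a + d)) + u * ((e + h) * (e + h)) + z * z - (a + d) * (e + h) * z - (1ℚ + 1ℚ) * (u * v)) p q)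
      (l′ ((a + d) * (a + d)) ((e + h) * (e + h)) (z * z) ((a + d) * (e + h) * z)))
    where
    z : ℚ
    z = (a * e + b * g) + (c * f + d * h)
    l : ∀ a b c d e f g h → let p = a * e + b * g ; q = a * f + b * h ; r = c * e + d * g ; s = c * f + d * h ; u = a * d - b * c ; v = e * h - f * g in
      ((p * d + q * - c) * h + (p * - b + q * a) * - g) + ((r * d + s * - c) * - f + (r * - b + s * a) * e)
        ≡ v * ((a + d) * (a + d)) + u * ((e + h) * (e + h)) + (p + s) * (p + s) - (a + d) * (e + h) * (p + s) - (1ℚ + 1ℚ) * (u * v)
    l = solve-∀ ℚ-ring
    l′ : ∀ A B C D → 1ℚ * A + 1ℚ * B + C - D - (1ℚ + 1ℚ) * (1ℚ * 1ℚ) ≡ A + B + C - D - (1ℚ + 1ℚ)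
    l′ = solve-∀ ℚ-ring

  module _ (ℓ : ℕ) (ℓ-prime : Prime ℓ) (ℓ≢2 : ¬ ℓ ≡ 2) (ℓ-five : + 5 ∣ + ℓ ℤ.* + ℓ ℤ.- 1ℤ)
      (ν : ℤ) (ν-primes : ∀ p → Prime p → p ℕD.∣ ℤ.∣ ν ∣ → ¬ p ≡ 2 × + 5 ∣ + p ℤ.* + p ℤ.- 1ℤ) where
    open Descent ℓ ℓ-prime ℓ≢2 ℓ-five ν ν-primes
    open Denominator ℓ

    clear-denominators : ∀ x y z → Fraction ℓ x → Fraction ℓ y → Fraction ℓ z → ¬ x * x + y * y + z * z - x * y * z ≡ ℤ→ℚ (+ 4 ℤ.+ + 20 ℤ.* (ν ℤ.* ν))
    clear-denominators x y z (k₁ , z₁ , e₁) (k₂ , z₂ , e₂) (k₃ , z₃ , e₃) h = no-solution s U V Z (ι-injective (trans left (sym right)))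
      where
      n₁ n₂ n₃ U V Z : ℤ
      n₁ = + (ℓ ℕ.^ k₁)
      n₂ = + (ℓ ℕ.^ k₂)
      n₃ = + (ℓ ℕ.^ k₃)
      U = z₁ ℤ.* (n₂ ℤ.* n₃)
      V = z₂ ℤ.* (n₁ ℤ.* n₃)
      Z = z₃ ℤ.* (n₁ ℤ.* n₂)
      s : ℕ
      s = k₁ ℕ.+ (k₂ ℕ.+ k₃)
      D : ℚ
      D = ℤ→ℚ (d s)
      D≡ : D ≡ ℤ→ℚ n₁ * (ℤ→ℚ n₂ * ℤ→ℚ n₃)
      D≡ = trans (cong ℤ→ℚ (trans (cong +_ (trans (ℕP.^-distribˡ-+-* ℓ k₁ (k₂ ℕ.+ k₃)) (cong (ℓ ℕ.^ k₁ ℕ.*_) (ℕP.^-distribˡ-+-* ℓ k₂ k₃)))) (trans (ℤP.pos-* (ℓ ℕ.^ k₁) (ℓ ℕ.^ k₂ ℕ.* ℓ ℕ.^ k₃)) (cong (λ w → n₁ ℤ.* w) (ℤP.pos-* (ℓ ℕ.^ k₂) (ℓ ℕ.^ k₃))))))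
        (trans (ι-* n₁ (n₂ ℤ.* n₃)) (cong (λ w → ℤ→ℚ n₁ * w) (ι-* n₂ n₃)))
      scaled : ∀ x z n m m' → x * ℤ→ℚ n ≡ ℤ→ℚ z → ℤ→ℚ (z ℤ.* (m ℤ.* m')) ≡ x * (ℤ→ℚ n * (ℤ→ℚ m * ℤ→ℚ m'))
      scaled x z n m m' e = trans (ι-* z (m ℤ.* m')) (trans (cong₂ _*_ (sym e) (ι-* m m')) (ℚP.*-assoc x (ℤ→ℚ n) (ℤ→ℚ m * ℤ→ℚ m')))
      U≡ : ℤ→ℚ U ≡ x * D
      U≡ = trans (scaled x z₁ n₁ n₂ n₃ e₁) (cong (λ w → x * w) (sym D≡))
      V≡ : ℤ→ℚ V ≡ y * D
      V≡ = trans (scaled y z₂ n₂ n₁ n₃ e₂) (cong (λ w → y * w) (trans (l (ℤ→ℚ n₁) (ℤ→ℚ n₂) (ℤ→ℚ n₃)) (sym D≡)))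
        where
        l : ∀ p q r → q * (p * r) ≡ p * (q * r)
        l = solve-∀ ℚ-ring
      Z≡ : ℤ→ℚ Z ≡ z * D
      Z≡ = trans (scaled z z₃ n₃ n₁ n₂ e₃) (cong (λ w → z * w) (trans (l (ℤ→ℚ n₁) (ℤ→ℚ n₂) (ℤ→ℚ n₃)) (sym D≡)))
        where
        l : ∀ p q r → r * (p * q) ≡ p * (q * r)
        l = solve-∀ ℚ-ring
      push : ∀ d U V Z → ℤ→ℚ (d ℤ.* (U ℤ.* U ℤ.+ V ℤ.* V ℤ.+ Z ℤ.* Z) ℤ.- U ℤ.* V ℤ.* Z) ≡ ℤ→ℚ d * (ℤ→ℚ U * ℤ→ℚ U + ℤ→ℚ V * ℤ→ℚ V + ℤ→ℚ Z * ℤ→ℚ Z) - ℤ→ℚ U * ℤ→ℚ V * ℤ→ℚ Z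
      push d U V Z = trans (ι-- (d ℤ.* (U ℤ.* U ℤ.+ V ℤ.* V ℤ.+ Z ℤ.* Z)) (U ℤ.* V ℤ.* Z)) (cong₂ _-_
        (trans (ι-* d (U ℤ.* U ℤ.+ V ℤ.* V ℤ.+ Z ℤ.* Z)) (cong (λ w → ℤ→ℚ d * w) (trans (ι-+ (U ℤ.* U ℤ.+ V ℤ.* V) (Z ℤ.* Z)) (cong₂ _+_ (trans (ι-+ (U ℤ.* U) (V ℤ.* V)) (cong₂ _+_ (ι-* U U) (ι-* V V))) (ι-* Z Z)))))
        (trans (ι-* (U ℤ.* V) Z) (cong (_* ℤ→ℚ Z) (ι-* U V))))
      homogeneous : ∀ x y z D → D * (x * D * (x * D) + y * D * (y * D) + z * D * (z * D)) - x * D * (y * D) * (z * D) ≡ (x * x + y * y + z * z - x * y * z) * (D * D * D)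
      homogeneous = solve-∀ ℚ-ring
      S : ℤ
      S = + 4 ℤ.+ + 20 ℤ.* (ν ℤ.* ν)
      right : ℤ→ℚ (S ℤ.* (d s ℤ.* d s ℤ.* d s)) ≡ ℤ→ℚ S * (D * D * D)
      right = trans (ι-* S (d s ℤ.* d s ℤ.* d s)) (cong (λ w → ℤ→ℚ S * w) (trans (ι-* (d s ℤ.* d s) (d s)) (cong (_* D) (ι-* (d s) (d s)))))
      left : ℤ→ℚ (d s ℤ.* (U ℤ.* U ℤ.+ V ℤ.* V ℤ.+ Z ℤ.* Z) ℤ.- U ℤ.* V ℤ.* Z) ≡ ℤ→ℚ S * (D * D * D)
      left = trans (push (d s) U V Z) (trans (cong₂ (λ u v → D * (u * u + v * v + ℤ→ℚ Z * ℤ→ℚ Z) - u * v * ℤ→ℚ Z) U≡ V≡)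
        (trans (cong (λ w → D * (x * D * (x * D) + y * D * (y * D) + w * w) - x * D * (y * D) * w) Z≡) (trans (homogeneous x y z D) (cong (_* (D * D * D)) h))))

    trace-fraction : ∀ X → InSL2 ℓ X → Fraction ℓ (trace X)
    trace-fraction (mat a b c d) (A , _ , _ , D , _) = to-fraction (a + d) (D-+ a d A D)

    not-commutator : ¬ IsCommutator ℓ (matA ν)
    not-commutator (X , Y , GX , GY , e) = clear-denominators (trace X) (trace Y) (trace (X · Y)) (trace-fraction X GX) (trace-fraction Y GY) (trace-fraction (X · Y) (sl-· X Y GX GY))
        (trans (l (trace X * trace X + trace Y * trace Y + trace (X · Y) * trace (X · Y) - trace X * trace Y * trace (X · Y))) (trans (cong (_+ (1ℚ + 1ℚ)) (trans (sym (fricke X Y (determinant X GX) (determinant Y GY))) (trans (cong trace (sym e)) trace-A))) final))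
      where
      determinant : ∀ X → InSL2 ℓ X → det X ≡ 1ℚ
      determinant _ (_ , _ , _ , _ , e) = e
      l : ∀ a → a ≡ a - (1ℚ + 1ℚ) + (1ℚ + 1ℚ)
      l = solve-∀ ℚ-ring
      t : ℤ
      t = + 2 ℤ.+ + 20 ℤ.* (ν ℤ.* ν)
      shift : ∀ t → t ℤ.- + 5 ℤ.+ + 5 ≡ t
      shift t = solve (t ∷ [])
      shift′ : ∀ n → + 2 ℤ.+ n ℤ.+ + 2 ≡ + 4 ℤ.+ n
      shift′ n = solve (n ∷ [])
      trace-A : trace (matA ν) ≡ ℤ→ℚ t
      trace-A = trans (sym (ι-+ (t ℤ.- + 5) (+ 5))) (cong ℤ→ℚ (shift t))
      final : ℤ→ℚ t + (1ℚ + 1ℚ) ≡ ℤ→ℚ (+ 4 ℤ.+ + 20 ℤ.* (ν ℤ.* ν))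
      final = trans (sym (ι-+ t (+ 2))) (cong ℤ→ℚ (shift′ (+ 20 ℤ.* (ν ℤ.* ν))))

    everything : + 27 ∣ ν ℤ.- + 4 → InSL2 ℓ (matA ν) × CommutatorInEveryFiniteQuotient ℓ (matA ν) × ¬ IsCommutator ℓ (matA ν)
    everything (divides j e) = subst (λ n → InSL2 ℓ (matA n)) (sym ν≡) (matA-in-SL₂ ℓ j)
        , subst (λ n → CommutatorInEveryFiniteQuotient ℓ (matA n)) (sym ν≡) (λ N fin → commutator-mod ℓ ℓ-prime N fin ℓ≢2 j (subst (λ n → ¬ + 2 ∣ n) ν≡ 2∤ν))
        , not-commutator
      where
      l : ∀ ν → ν ≡ + 4 ℤ.+ (ν ℤ.- + 4)
      l ν = solve (ν ∷ [])
      ν≡ : ν ≡ + 4 ℤ.+ + 27 ℤ.* j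
      ν≡ = trans (l ν) (cong (λ z → + 4 ℤ.+ z) (trans e (ℤP.*-comm j (+ 27))))

  residue₂₀ : ∀ p → p % 20 ≡ 1 ⊎ p % 20 ≡ 19 → ¬ p ≡ 2 × + 5 ∣ + p ℤ.* + p ℤ.- 1ℤ
  residue₂₀ p h = not-two h , five-residue p (p % 5) refl ([ (λ e → inj₁ (mod e)) , (λ e → inj₂ (mod e)) ]′ h)
    where
    not-two : p % 20 ≡ 1 ⊎ p % 20 ≡ 19 → ¬ p ≡ 2
    not-two (inj₁ ()) refl
    not-two (inj₂ ()) refl
    mod : ∀ {r} → p % 20 ≡ r → p % 5 ≡ r % 5
    mod e = trans (sym (ℕM.m∣n⇒o%n%m≡o%m 5 20 p (ℕD.divides 4 refl))) (cong (_% 5) e)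

  prime[139] : Prime 139
  prime[139] = toWitness {a? = prime? 139} _

  νᵢ : ℕ → ℕ
  νᵢ i = 139 ℕ.^ (1 ℕ.+ 9 ℕ.* i)

  νᵢ-primes : ∀ i p → Prime p → p ℕD.∣ νᵢ i → ¬ p ≡ 2 × + 5 ∣ + p ℤ.* + p ℤ.- 1ℤ
  νᵢ-primes i p pr d = subst (λ p → ¬ p ≡ 2 × + 5 ∣ + p ℤ.* + p ℤ.- 1ℤ) (sym (prime-divides-prime pr prime[139] (prime-∣^ pr 139 (1 ℕ.+ 9 ℕ.* i) d))) ((λ ()) , divides (+ 3864) refl)

  -- 139 ≡ 4 and 139⁹ ≡ 1 modulo 27.
  νᵢ-residue : ∀ i → + 27 ∣ + νᵢ i ℤ.- + 4
  νᵢ-residue i = by (+ 139 ⊛ power-one ((+ 139) ℤ.^ 9) (divides (+ 717413323793482654) refl) i ⊕ (+ 5) ⊛ divides 1ℤ refl) (trans (cong (ℤ._- + 4) νᵢ≡) (l (((+ 139) ℤ.^ 9) ℤ.^ i)))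
    where
    νᵢ≡ : + νᵢ i ≡ + 139 ℤ.* ((+ 139) ℤ.^ 9) ℤ.^ i
    νᵢ≡ = trans (ℤP.pos-* 139 (139 ℕ.^ (9 ℕ.* i))) (cong (λ z → + 139 ℤ.* z) (trans (sym (pos-^ 139 (9 ℕ.* i))) (sym (ℤP.^-*-assoc (+ 139) 9 i))))
    l : ∀ a → + 139 ℤ.* a ℤ.- + 4 ≡ + 139 ℤ.* (a ℤ.- 1ℤ) ℤ.+ + 5 ℤ.* + 27
    l a = solve (a ∷ [])

  νᵢ-injective : ∀ {i k} → νᵢ i ≡ νᵢ k → i ≡ k
  νᵢ-injective {i} {k} e = from (ℕP.<-cmp i k)
    where
    mono : ∀ {i k} → i < k → νᵢ i < νᵢ k
    mono h = ℕP.^-monoʳ-< 139 (s≤s (s≤s z≤n)) (s≤s (ℕP.*-monoʳ-< 9 h))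
    from : _ → i ≡ k
    from (tri< h _ _) = ⊥-elim (ℕP.<⇒≢ (mono h) e)
    from (tri≈ _ h _) = h
    from (tri> _ _ h) = ⊥-elim (ℕP.<⇒≢ (mono h) (sym e))

  matA-injective : ∀ {μ ν} → matA μ ≡ matA ν → μ ≡ ν
  matA-injective {μ} {ν} e = ℤP.*-cancelˡ-≡ (+ 30) μ ν (trans (l μ) (trans (cong (ℤ._- + 12) (ι-injective {+ 6 ℤ.* (+ 5 ℤ.* μ ℤ.+ + 2)} {+ 6 ℤ.* (+ 5 ℤ.* ν ℤ.+ + 2)} (cong Mat.c e))) (sym (l ν))))
    where
    l : ∀ ν → + 30 ℤ.* ν ≡ + 6 ℤ.* (+ 5 ℤ.* ν ℤ.+ + 2) ℤ.- + 12
    l ν = solve (ν ∷ [])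

  -- A prime divisor of 5 y² - 1, for y divisible by all small numbers.
  large-prime : ∀ m → ∃[ ℓ ] Prime ℓ × m < ℓ × ¬ ℓ ≡ 2 × + 5 ∣ + ℓ ℤ.* + ℓ ℤ.- 1ℤ
  large-prime m = from (prime-divisor n 1<n)
    where
    y n : ℕ
    y = (m ℕ.+ 6) !
    n = ℕ.pred (5 ℕ.* (y ℕ.* y))
    0<y² : 0 < y ℕ.* y
    0<y² = ℕP.*-mono-≤ (ℕP.1≤n! (m ℕ.+ 6)) (ℕP.1≤n! (m ℕ.+ 6))
    4≤n : 5 ≤ 5 ℕ.* (y ℕ.* y)
    4≤n = ℕP.*-monoʳ-≤ 5 0<y²
    1<n : 1 < n
    1<n = ℕP.≤-trans (s≤s (s≤s z≤n)) (ℕP.pred-mono-≤ 4≤n)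
    suc-n : suc n ≡ 5 ℕ.* (y ℕ.* y)
    suc-n = ℕP.suc-pred (5 ℕ.* (y ℕ.* y)) ⦃ ℕ.>-nonZero (ℕP.≤-trans (s≤s z≤n) 4≤n) ⦄
    from : ∃[ ℓ ] Prime ℓ × ℓ ℕD.∣ n → ∃[ ℓ ] Prime ℓ × m < ℓ × ¬ ℓ ≡ 2 × + 5 ∣ + ℓ ℤ.* + ℓ ℤ.- 1ℤ
    from (ℓ , pr , d) = ℓ , pr , ℕP.≤-trans (s≤s (ℕP.m≤m+n m 6)) large , ℓ≢2 , [ (λ t → ⊥-elim (ℕP.<⇒≢ (ℕP.≤-trans (s≤s (ℕP.≤-trans (s≤s (s≤s (s≤s (s≤s (s≤s z≤n))))) (ℕP.m≤n+m 6 m))) large) (prime-divides-prime prime[5] pr (∣⇒∣ᵤ t)))) , (λ t → t) ]′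
        (FiveIsSquare.five pr ℓ≢2 (+ 5 ℤ.* + y) 1ℤ (PrimeModulus.P∤1 pr) (by (+ 5 ⊛ ∣ᵤ⇒∣ {+ ℓ} {+ n} d) (trans (l (+ y)) (cong (λ z → + 5 ℤ.* z) (sym n≡)))))
      where
      large : m ℕ.+ 6 < ℓ
      large = ℕP.≰⇒> λ ℓ≤ → PrimeModulus.P∤1 pr (∣ᵤ⇒∣ (ℕD.∣m+n∣m⇒∣n (subst (ℓ ℕD.∣_) (trans (sym suc-n) (ℕP.+-comm 1 n)) (ℕD.∣n⇒∣m*n 5 (ℕD.∣m⇒∣m*n y (ℕD.∣-trans (self ℓ (ℕP.<-trans (s≤s z≤n) (prime>1 pr))) (ℕD.m≤n⇒m!∣n! ℓ≤))))) d))
        where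
        self : ∀ k → 0 < k → k ℕD.∣ k !
        self (suc k) _ = ℕD.m∣m*n (k !)
      ℓ≢2 : ¬ ℓ ≡ 2
      ℓ≢2 e = ℕP.<⇒≢ (ℕP.≤-trans (s≤s (ℕP.≤-trans (s≤s (s≤s z≤n)) (ℕP.m≤n+m 6 m))) large) (sym e)
      n≡ : + n ≡ + 5 ℤ.* (+ y ℤ.* + y) ℤ.- 1ℤ
      n≡ = trans (shift (+ n)) (cong (ℤ._- 1ℤ) (trans (cong +_ suc-n) (trans (ℤP.pos-* 5 (y ℕ.* y)) (cong (λ z → + 5 ℤ.* z) (ℤP.pos-* y y)))))
        where
        shift : ∀ n → n ≡ 1ℤ ℤ.+ n ℤ.- 1ℤ
        shift n = solve (n ∷ [])
      l : ∀ y → + 5 ℤ.* y ℤ.* (+ 5 ℤ.* y) ℤ.- + 5 ℤ.* (1ℤ ℤ.* 1ℤ) ≡ + 5 ℤ.* (+ 5 ℤ.* (y ℤ.* y) ℤ.- 1ℤ)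
      l y = solve (y ∷ [])

  main :
      ((ℓ : ℕ) (ν : ℤ) →
        Prime ℓ → ℓ % 2 ≡ 1 → (ℓ % 5 ≡ 1 ⊎ ℓ % 5 ≡ 4) →
        (+ 27) ℤD.∣ (ν ℤ.- + 4) →
        (∀ p → Prime p → p ℕD.∣ ℤ.∣ ν ∣ → (p % 20 ≡ 1 ⊎ p % 20 ≡ 19)) →
        InSL2 ℓ (matA ν)
          × CommutatorInEveryFiniteQuotient ℓ (matA ν)
          × ¬ IsCommutator ℓ (matA ν))
      ×
      (∀ (m : ℕ) → ∃[ ℓ ] (Prime ℓ × m < ℓ ×
        Σ (ℕ → Mat) (λ f → Injective _≡_ _≡_ f ×
          (∀ i → InSL2 ℓ (f i)
                   × CommutatorInEveryFiniteQuotient ℓ (f i)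
                   × ¬ IsCommutator ℓ (f i)))))
  main = (λ ℓ ν pr odd h₅ h₂₇ h → everything ℓ pr (λ { refl → ℕP.1+n≢0 (sym odd) }) (five-residue ℓ (ℓ % 5) refl h₅) ν (λ p pp d → residue₂₀ p (h p pp d)) (∣ᵤ⇒∣ h₂₇))
    , λ m → from (large-prime m)
    where
    from : ∀ {m} → ∃[ ℓ ] Prime ℓ × m < ℓ × ¬ ℓ ≡ 2 × + 5 ∣ + ℓ ℤ.* + ℓ ℤ.- 1ℤ → ∃[ ℓ ] (Prime ℓ × m < ℓ × Σ (ℕ → Mat) (λ f → Injective _≡_ _≡_ f ×
      (∀ i → InSL2 ℓ (f i) × CommutatorInEveryFiniteQuotient ℓ (f i) × ¬ IsCommutator ℓ (f i))))
    from (ℓ , pr , m<ℓ , ℓ≢2 , h₅) = ℓ , pr , m<ℓ , (λ i → matA (+ νᵢ i)) , (λ e → νᵢ-injective (ℤP.+-injective (matA-injective e)))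
      , λ i → everything ℓ pr ℓ≢2 h₅ (+ νᵢ i) (νᵢ-primes i) (νᵢ-residue i)

open import Defs
open import Data.Nat as ℕ using (ℕ; _%_; _<_)
open import Data.Nat.Primality using (Prime)
open import Data.Integer as ℤ using (ℤ; +_)
open import Data.Integer.Divisibility as ℤD using ()
open import Data.Nat.Divisibility using (_∣_)
open import Data.Product using (Σ; ∃-syntax; _×_)
open import Data.Sum using (_⊎_)
open import Relation.Nullary using (¬_)
open import Relation.Binary.PropositionalEquality using (_≡_)
open import Function.Definitions using (Injective)

theorem5p15 : ((ℓ : ℕ) (ν : ℤ) →
    Prime ℓ → ℓ % 2 ≡ 1 → (ℓ % 5 ≡ 1 ⊎ ℓ % 5 ≡ 4) →
    (+ 27) ℤD.∣ (ν ℤ.- + 4) →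
    (∀ p → Prime p → p ∣ ℤ.∣ ν ∣ → (p % 20 ≡ 1 ⊎ p % 20 ≡ 19)) →
    InSL2 ℓ (matA ν)
    × CommutatorInEveryFiniteQuotient ℓ (matA ν)
    × ¬ IsCommutator ℓ (matA ν))
    ×
    (∀ (m : ℕ) → ∃[ ℓ ] (Prime ℓ × m < ℓ ×
    Σ (ℕ → Mat) (λ f → Injective _≡_ _≡_ f ×
    (∀ i → InSL2 ℓ (f i)
    × CommutatorInEveryFiniteQuotient ℓ (f i)
    × ¬ IsCommutator ℓ (f i)))))
theorem5p15 = Conclusion.main
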